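{- Let $k\ge 2$ be an integer. There is a constant $c=c(k)>0$ such that every $C_{2k}$-free graph $G$ with average degree $r$ contains a minor with average degree at least $c\,r^{\frac{k+1}{2}}$.
   Context: All graphs are finite, simple. $C_{2k}$ is the cycle of length $2k$; $G$ is $C_{2k}$-free if it contains no (not necessarily induced) cycle of length $2k$. The average degree of $G$ is $2|E(G)|/|V(G)|$. A graph $\Gamma$ is a minor of $G$ if there are vertex-disjoint connected subgraphs $G_u\subseteq G$, $u\in V(\Gamma)$, with an edge of $G$ between $G_u$ and $G_{u'}$ whenever $uu'\in E(\Gamma)$. -}

module Defs where

open import Data.Nat using (ℕ; zero; suc)
open import Data.Fin using (Fin; zero; suc; inject₁; fromℕ)
open import Data.Bool using (Bool; true; false; if_then_else_)
open import Data.List using (List; map; allFin)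
open import Data.Nat.ListAction using (sum)
open import Data.Empty using (⊥)
open import Data.Maybe using (Maybe; just)
open import Data.Product using (Σ; _×_; ∃)
open import Data.Integer using (+_)
open import Data.Rational using (ℚ; _/_; _*_; 1ℚ)
open import Relation.Binary.PropositionalEquality using (_≡_)
open import Function.Definitions using (Injective)

record Graph (n : ℕ) : Set where
  field
    adj   : Fin n → Fin n → Bool
    sym   : ∀ i j → adj i j ≡ adj j i
    irrefl : ∀ i → adj i i ≡ false

open Graph public

Adj : ∀ {n} → Graph n → Fin n → Fin n → Set
Adj G i j = adj G i j ≡ true

degree : ∀ {n} → Graph n → Fin n → ℕ
degree {n} G i = sum (map (λ j → if adj G i j then 1 else 0) (allFin n))

degSum : ∀ {n} → Graph n → ℕ
degSum {n} G = sum (map (degree G) (allFin n))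

avgDeg : ∀ {n} → Graph (suc n) → ℚ
avgDeg {n} G = (+ degSum G) / suc n

HasCycle : ∀ {n} → Graph n → ℕ → Set
HasCycle {n} G zero = ⊥
HasCycle {n} G (suc m) =
  Σ (Fin (suc m) → Fin n) λ f →
    Injective _≡_ _≡_ f ×
    ((i : Fin m) → Adj G (f (inject₁ i)) (f (suc i))) ×
    Adj G (f (fromℕ m)) (f zero)

WalkIn : ∀ {n} → Graph n → (Fin n → Set) → Fin n → Fin n → Set
WalkIn {n} G P x y =
  Σ ℕ λ ℓ → Σ (Fin (suc ℓ) → Fin n) λ w →
    w zero ≡ x × w (fromℕ ℓ) ≡ y ×
    ((i : Fin (suc ℓ)) → P (w i)) ×
    ((i : Fin ℓ) → Adj G (w (inject₁ i)) (w (suc i)))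

-- Γ is a minor of G: branch sets G_u = φ⁻¹(just u) are pairwise disjoint (φ is a function),
-- nonempty and connected, and every edge uu' of Γ is realized by an edge of G between G_u and G_u'.
IsMinor : ∀ {m n} → Graph m → Graph n → Set
IsMinor {m} {n} Γ G =
  Σ (Fin n → Maybe (Fin m)) λ φ →
    ((u : Fin m) → ∃ λ x → φ x ≡ just u) ×
    ((u : Fin m) → (x y : Fin n) → φ x ≡ just u → φ y ≡ just u →
        WalkIn G (λ z → φ z ≡ just u) x y) ×
    ((u u' : Fin m) → Adj Γ u u' →
        Σ (Fin n) λ x → Σ (Fin n) λ y → φ x ≡ just u × φ y ≡ just u' × Adj G x y)

_^ℚ_ : ℚ → ℕ → ℚ
q ^ℚ zero = 1ℚ
q ^ℚ suc e = q * (q ^ℚ e)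

{-# OPTIONS --safe #-}
module Submission where

-- Put ρ = σ² for a constant fraction of the average degree, and pass to a subgraph with a digraph in which every vertex has
-- exactly ρ out-arcs (in-degrees stay arbitrary).
--
-- If L is a level of depth < k of a rooted tree and W avoids the tree, a C₂ₖ-free graph has only O(k)(|L| + |W|) edges between
-- L and W: otherwise some subgraph between them has large minimum degree, and a greedy path of the right length in it closes
-- up to a C₂ₖ through the tree.  Hence, up to a 1/ρ fraction, walks of at most k arcs from a fixed root are light: they end at
-- a given vertex a bounded number of times.
--
-- With h = ⌊k/2⌋ consider the configurations a ← ⋯ ← u → ⋯ → a' having h arcs on the left and h + 1 on the right.  At most ρ^h
-- roots are reachable from a vertex within h arcs, so if roots are chosen with probability about ρ^{-h}, a configuration both
-- of whose roots are chosen has, with probability at least 1/2, no vertex that reaches a third chosen root.  The surviving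
-- configurations then give disjoint connected branch sets, adjacent in pairs.
--   For odd k a configuration has k arcs, so almost all pairs (a, a') are different, and the density is about ρ^{h+1} = σ^{k+1}.
--   For even k it has k + 1 arcs; a branch set is then a root with a group of about σ of its in-neighbours, and a random
-- grouping on the right keeps the number of configurations per pair of branch sets bounded.  This requires in-degrees
-- O(σ^{k+1}).  If instead half of the arcs enter vertices of larger in-degree, contracting every other vertex into one of
-- these already yields a minor of density σ^{k+1}.
-- Expectations are sums over all functions between finite sets.

open import Data.Nat hiding (_≟_)
open import Data.Nat.Properties hiding (_≟_)
open import Data.Nat.ListAction using (sum)
open import Data.Bool using (Bool; true; false; if_then_else_; _∧_; _∨_; not)
open import Data.Fin using (Fin; zero; suc; _≟_; inject₁; fromℕ; toℕ; fromℕ<; combine; remQuot)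
open import Data.List using (List; []; _∷_; map; allFin; tabulate; length; _++_; concatMap; lookup; applyUpTo; applyDownFrom; _∷ʳ_; filterᵇ)
open import Data.Bool.ListAction using (any)
open import Data.List.Properties using (map-tabulate; length-tabulate; length-++; length-applyUpTo; length-applyDownFrom; length-map)
open import Data.List.Membership.Propositional using (_∈_; _∉_; find; lose)
open import Data.List.Membership.Propositional.Properties using (∈-allFin; ∈-lookup; ∈-++⁻; ∈-applyUpTo⁻; ∈-applyDownFrom⁻; ∈-concatMap⁻; ∈-map⁻; ∈-concatMap⁺; ∈-map⁺)
open import Data.List.Relation.Unary.Any using (here; there)
open import Data.Product using (Σ; ∃; _×_; _,_; proj₁; proj₂)
open import Data.Sum using (_⊎_; inj₁; inj₂)
open import Data.Empty using (⊥; ⊥-elim)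
open import Relation.Nullary using (¬_; Dec; yes; no; does; contradiction)
open import Relation.Binary.PropositionalEquality hiding ([_])
open import Function using (_∘_; id; Equivalence)
open import Data.Bool.Properties using (T-≡; ∨-comm) renaming (_≟_ to _≟ᵇ_)
open import Data.Fin.Properties using (any?; toℕ<n; toℕ-fromℕ<; toℕ-injective; remQuot-combine; combine-remQuot; combine-injectiveˡ; combine-injective)
open import Relation.Nullary.Decidable using (_×-dec_)
open import Defs hiding (sym)
open import Data.List.Relation.Unary.All as All using (All; []; _∷_)
open import Data.List.Relation.Unary.All.Properties using (¬Any⇒All¬)
open import Data.List.Relation.Unary.AllPairs using ([]; _∷_)
open import Data.List.Relation.Unary.Unique.Propositional using (Unique)
open import Data.List.Relation.Unary.Unique.Propositional.Properties using (applyUpTo⁺₁; applyDownFrom⁺₁) renaming (++⁺ to Unique-++)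
open import Data.Nat.Tactic.RingSolver using (solve-∀)
open import Data.Maybe using (Maybe; just; nothing)
open import Data.Nat.DivMod using (_/_; _%_; m≡m%n+[m/n]*n; m%n<n; m/n*n≤m; /-monoˡ-≤; m*n/n≡m)

-- Finite sums

-- Vertices are coloured at random with 2h+2 colours, and only configurations in which every vertex
-- has the colour of its position are kept; this costs a constant factor. The colours do three jobs:
-- tree levels are disjoint because their colours differ, left and right roots cannot coincide, and
-- the colour of a vertex tells its side and its distance from the root. Trees grow backwards from a
-- root, and with arbitrary in-degrees their levels can be huge. Losses are therefore measured
-- against the size of the level, and only the sum of these sizes over all roots is bounded: it
-- counts pairs (vertex, root reachable from it), at most ρ^g for each vertex. The cycle argument
-- controls walks of at most k arcs seen from the root. For odd k a whole configuration fits. For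
-- even k it is one arc too long, and no bound on the configurations between two roots follows.
-- Splitting the roots into about σ branch sets each, on average, repairs this; the number of branch
-- sets grows by a factor O(σ), exactly the factor by which ρ^(h+1) = σ^(k+2) exceeds the target.

⟦_⟧ : Bool → ℕ
⟦ b ⟧ = if b then 1 else 0

∑ : {A : Set} → List A → (A → ℕ) → ℕ
∑ xs f = sum (map f xs)

∑-mono : {A : Set} (xs : List A) {f g : A → ℕ} → (∀ x → f x ≤ g x) → ∑ xs f ≤ ∑ xs g
∑-mono []       f≤g = z≤n
∑-mono (x ∷ xs) f≤g = +-mono-≤ (f≤g x) (∑-mono xs f≤g)

∑-mono-∈ : {A : Set} (xs : List A) {f g : A → ℕ} → (∀ x → x ∈ xs → f x ≤ g x) → ∑ xs f ≤ ∑ xs g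
∑-mono-∈ []       f≤g = z≤n
∑-mono-∈ (x ∷ xs) f≤g = +-mono-≤ (f≤g x (here refl)) (∑-mono-∈ xs (λ y y∈ → f≤g y (there y∈)))

∑-cong : {A : Set} (xs : List A) {f g : A → ℕ} → (∀ x → f x ≡ g x) → ∑ xs f ≡ ∑ xs g
∑-cong []       f≡g = refl
∑-cong (x ∷ xs) f≡g = cong₂ _+_ (f≡g x) (∑-cong xs f≡g)

interchange : ∀ a b c d → (a + b) + (c + d) ≡ (a + c) + (b + d)
interchange a b c d = begin
  (a + b) + (c + d) ≡⟨ +-assoc a b (c + d) ⟩
  a + (b + (c + d)) ≡⟨ cong (a +_) (trans (sym (+-assoc b c d)) (trans (cong (_+ d) (+-comm b c)) (+-assoc c b d))) ⟩
  a + (c + (b + d)) ≡⟨ sym (+-assoc a c (b + d)) ⟩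
  (a + c) + (b + d) ∎
  where open ≡-Reasoning

∑-+ : {A : Set} (xs : List A) (f g : A → ℕ) → ∑ xs (λ x → f x + g x) ≡ ∑ xs f + ∑ xs g
∑-+ []       f g = refl
∑-+ (x ∷ xs) f g = trans (cong (f x + g x +_) (∑-+ xs f g)) (interchange (f x) (g x) (∑ xs f) (∑ xs g))

∑-*ˡ : {A : Set} (xs : List A) (c : ℕ) (f : A → ℕ) → ∑ xs (λ x → c * f x) ≡ c * ∑ xs f
∑-*ˡ []       c f = sym (*-zeroʳ c)
∑-*ˡ (x ∷ xs) c f = trans (cong (c * f x +_) (∑-*ˡ xs c f)) (sym (*-distribˡ-+ c (f x) (∑ xs f)))

∑-*ʳ : {A : Set} (xs : List A) (f : A → ℕ) (c : ℕ) → ∑ xs (λ x → f x * c) ≡ ∑ xs f * c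
∑-*ʳ xs f c = trans (∑-cong xs (λ x → *-comm (f x) c)) (trans (∑-*ˡ xs c f) (*-comm c (∑ xs f)))

∑-const : {A : Set} (xs : List A) (c : ℕ) → ∑ xs (λ _ → c) ≡ length xs * c
∑-const []       c = refl
∑-const (x ∷ xs) c = cong (c +_) (∑-const xs c)

∑-zero : {A : Set} (xs : List A) → ∑ xs (λ _ → 0) ≡ 0
∑-zero xs = trans (∑-const xs 0) (*-zeroʳ (length xs))

∑-swap : {A B : Set} (xs : List A) (ys : List B) (f : A → B → ℕ) →
         ∑ xs (λ x → ∑ ys (f x)) ≡ ∑ ys (λ y → ∑ xs (λ x → f x y))
∑-swap []       ys f = sym (∑-zero ys)
∑-swap (x ∷ xs) ys f = trans (cong (∑ ys (f x) +_) (∑-swap xs ys f)) (sym (∑-+ ys (f x) (λ y → ∑ xs (λ x → f x y))))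

∑-++ : {A : Set} (xs ys : List A) (f : A → ℕ) → ∑ (xs ++ ys) f ≡ ∑ xs f + ∑ ys f
∑-++ []       ys f = refl
∑-++ (x ∷ xs) ys f = trans (cong (f x +_) (∑-++ xs ys f)) (sym (+-assoc (f x) (∑ xs f) (∑ ys f)))

∑-concatMap : {A B : Set} (g : A → List B) (xs : List A) (f : B → ℕ) → ∑ (concatMap g xs) f ≡ ∑ xs (λ x → ∑ (g x) f)
∑-concatMap g []       f = refl
∑-concatMap g (x ∷ xs) f = trans (∑-++ (g x) (concatMap g xs) f) (cong (∑ (g x) f +_) (∑-concatMap g xs f))

∑-map : {A B : Set} (g : A → B) (xs : List A) (f : B → ℕ) → ∑ (map g xs) f ≡ ∑ xs (f ∘ g)
∑-map g []       f = refl
∑-map g (x ∷ xs) f = cong (f (g x) +_) (∑-map g xs f)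

-- The averaging principle behind the probabilistic existence claims: a strict inequality between
-- totals gives a witness without any division.
∑-<⇒∃ : {A : Set} (xs : List A) (f g : A → ℕ) → ∑ xs f < ∑ xs g → ∃ λ x → f x < g x
∑-<⇒∃ (x ∷ xs) f g lt with f x <? g x
... | yes p = x , p
... | no ¬p = ∑-<⇒∃ xs f g (+-cancelˡ-< (f x) _ _ (≤-trans lt (+-monoˡ-≤ (∑ xs g) (≮⇒≥ ¬p))))

∑-∈ : {A : Set} (xs : List A) (f : A → ℕ) {x : A} → x ∈ xs → f x ≤ ∑ xs f
∑-∈ (x ∷ xs) f (here refl) = m≤m+n (f x) _
∑-∈ (x ∷ xs) f (there x∈) = ≤-trans (∑-∈ xs f x∈) (m≤n+m _ (f x))

∑ᶠ : ∀ {n} → (Fin n → ℕ) → ℕ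
∑ᶠ {n} f = ∑ (allFin n) f

∑-tabulate : ∀ {A : Set} {n} (g : Fin n → A) (f : A → ℕ) → ∑ (tabulate g) f ≡ ∑ᶠ (f ∘ g)
∑-tabulate g f = cong sum (trans (map-tabulate g f) (sym (map-tabulate id (f ∘ g))))

∑ᶠ-suc : ∀ {n} (f : Fin (suc n) → ℕ) → ∑ᶠ f ≡ f zero + ∑ᶠ (f ∘ suc)
∑ᶠ-suc f = cong (f zero +_) (∑-tabulate suc f)

_==_ : ∀ {n} → Fin n → Fin n → Bool
x == y = does (x ≟ y)

==-refl : ∀ {n} (x : Fin n) → (x == x) ≡ true
==-refl x with x ≟ x
... | yes _ = refl
... | no ¬p = contradiction refl ¬p

==⇒≡ : ∀ {n} {x y : Fin n} → (x == y) ≡ true → x ≡ y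
==⇒≡ {x = x} {y} e with x ≟ y
... | yes p = p

≢⇒== : ∀ {n} {x y : Fin n} → x ≢ y → (x == y) ≡ false
≢⇒== {x = x} {y} x≢y with x ≟ y
... | yes p = contradiction p x≢y
... | no _ = refl

==-sym : ∀ {n} (x y : Fin n) → (x == y) ≡ (y == x)
==-sym x y with x ≟ y
... | yes refl = sym (==-refl x)
... | no x≢y = sym (≢⇒== (x≢y ∘ sym))

==-suc : ∀ {n} (x y : Fin n) → (suc x == suc y) ≡ (x == y)
==-suc x y with x ≟ y
... | yes _ = refl
... | no _ = refl

∑ᶠ-δ : ∀ {n} (x : Fin n) (f : Fin n → ℕ) → ∑ᶠ (λ y → ⟦ y == x ⟧ * f y) ≡ f x
∑ᶠ-δ {suc n} zero f = trans (∑ᶠ-suc (λ y → ⟦ y == zero ⟧ * f y))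
  (trans (cong (1 * f zero +_) (∑-zero (allFin n))) (trans (+-identityʳ _) (*-identityˡ (f zero))))
∑ᶠ-δ {suc n} (suc x) f = trans (∑ᶠ-suc (λ y → ⟦ y == suc x ⟧ * f y))
  (trans (∑-cong (allFin n) (λ y → cong (λ b → ⟦ b ⟧ * f (suc y)) (==-suc y x))) (∑ᶠ-δ x (f ∘ suc)))

∑ᶠ-δ₁ : ∀ {n} (x : Fin n) → ∑ᶠ (λ y → ⟦ y == x ⟧) ≡ 1
∑ᶠ-δ₁ x = trans (∑-cong (allFin _) (λ y → sym (*-identityʳ ⟦ y == x ⟧))) (∑ᶠ-δ x (λ _ → 1))

∑ᶠ-≥ : ∀ {n} (f : Fin n → ℕ) (x : Fin n) → f x ≤ ∑ᶠ f
∑ᶠ-≥ f x = subst (_≤ ∑ᶠ f) (∑ᶠ-δ x f) (∑-mono (allFin _) (λ y → le y))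
  where le : ∀ y → ⟦ y == x ⟧ * f y ≤ f y
        le y with y == x
        ... | true = ≤-reflexive (+-identityʳ (f y))
        ... | false = z≤n

⟦⟧≤1 : ∀ b → ⟦ b ⟧ ≤ 1
⟦⟧≤1 true = ≤-refl
⟦⟧≤1 false = z≤n

⟦⟧-mono : ∀ {a b} → (a ≡ true → b ≡ true) → ⟦ a ⟧ ≤ ⟦ b ⟧
⟦⟧-mono {false} h = z≤n
⟦⟧-mono {true} h rewrite h refl = ≤-refl

⟦∧⟧ : ∀ a b → ⟦ a ∧ b ⟧ ≡ ⟦ a ⟧ * ⟦ b ⟧
⟦∧⟧ true b = sym (+-identityʳ _)
⟦∧⟧ false b = refl

⟦∨⟧≤ : ∀ a b → ⟦ a ∨ b ⟧ ≤ ⟦ a ⟧ + ⟦ b ⟧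
⟦∨⟧≤ true b = s≤s z≤n
⟦∨⟧≤ false b = ≤-refl

∧-intro : ∀ {a b} → a ≡ true → b ≡ true → a ∧ b ≡ true
∧-intro refl refl = refl

∧-l : ∀ {a b} → a ∧ b ≡ true → a ≡ true
∧-l {true} e = refl

∧-r : ∀ {a b} → a ∧ b ≡ true → b ≡ true
∧-r {true} e = e

∨-elim : ∀ {a b} → a ∨ b ≡ true → a ≡ true ⊎ b ≡ true
∨-elim {true} e = inj₁ refl
∨-elim {false} e = inj₂ e

∨-introˡ : ∀ {a b} → a ≡ true → a ∨ b ≡ true
∨-introˡ refl = refl

∨-introʳ : ∀ {a b} → b ≡ true → a ∨ b ≡ true
∨-introʳ {true} refl = refl
∨-introʳ {false} refl = refl

≢true⇒≡false : ∀ {b} → b ≢ true → b ≡ false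
≢true⇒≡false {true} h = contradiction refl h
≢true⇒≡false {false} h = refl

⟦⟧-pos : ∀ {b} → 0 < ⟦ b ⟧ → b ≡ true
⟦⟧-pos {true} _ = refl

∃ᵇ : ∀ {n} → (Fin n → Bool) → Bool
∃ᵇ {n} p = any p (allFin n)

any⇒∃ : {A : Set} (p : A → Bool) (xs : List A) → any p xs ≡ true → ∃ λ x → x ∈ xs × p x ≡ true
any⇒∃ p (x ∷ xs) e with p x in eq
... | true = x , here refl , eq
... | false with any⇒∃ p xs e
...   | y , y∈ , py = y , there y∈ , py

∃⇒any : {A : Set} (p : A → Bool) (xs : List A) {x : A} → x ∈ xs → p x ≡ true → any p xs ≡ true
∃⇒any p (x ∷ xs) (here refl) px rewrite px = refl
∃⇒any p (x ∷ xs) (there x∈) px = ∨-introʳ {p x} (∃⇒any p xs x∈ px)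

any≤∑ : {A : Set} (p : A → Bool) (xs : List A) → ⟦ any p xs ⟧ ≤ ∑ xs (λ x → ⟦ p x ⟧)
any≤∑ p [] = z≤n
any≤∑ p (x ∷ xs) = ≤-trans (⟦∨⟧≤ (p x) (any p xs)) (+-monoʳ-≤ ⟦ p x ⟧ (any≤∑ p xs))

∃ᵇ-elim : ∀ {n} {p : Fin n → Bool} → ∃ᵇ p ≡ true → ∃ λ x → p x ≡ true
∃ᵇ-elim {p = p} e with any⇒∃ p (allFin _) e
... | x , _ , px = x , px

∃ᵇ-intro : ∀ {n} {p : Fin n → Bool} (x : Fin n) → p x ≡ true → ∃ᵇ p ≡ true
∃ᵇ-intro {p = p} x px = ∃⇒any p (allFin _) (∈-allFin x) px

∑ᶠ-pos⇒∃ : ∀ {n} (p : Fin n → Bool) → 0 < ∑ᶠ (λ x → ⟦ p x ⟧) → ∃ λ x → p x ≡ true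
∑ᶠ-pos⇒∃ {n} p lt with ∑-<⇒∃ (allFin n) (λ _ → 0) (λ x → ⟦ p x ⟧) (subst (_< ∑ᶠ (λ x → ⟦ p x ⟧)) (sym (∑-zero (allFin n))) lt)
... | x , px = x , ⟦⟧-pos px

-- Averaging over all functions

cons : ∀ {n} {A : Set} → A → (Fin n → A) → Fin (suc n) → A
cons c f zero = c
cons c f (suc i) = f i

funs : (n q : ℕ) → List (Fin n → Fin q)
funs zero    q = (λ ()) ∷ []
funs (suc n) q = concatMap (λ c → map (cons c) (funs n q)) (allFin q)

∑-funs-suc : ∀ n q (F : (Fin (suc n) → Fin q) → ℕ) →
  ∑ (funs (suc n) q) F ≡ ∑ᶠ (λ c → ∑ (funs n q) (λ f → F (cons c f)))
∑-funs-suc n q F = trans (∑-concatMap (λ c → map (cons c) (funs n q)) (allFin q) F)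
  (∑-cong (allFin q) (λ c → ∑-map (cons c) (funs n q) F))

∑ᶠ-const : ∀ n c → ∑ᶠ {n} (λ _ → c) ≡ n * c
∑ᶠ-const n c = trans (∑-const (allFin n) c) (cong (_* c) (length-tabulate {n = n} id))

∑-funs-const : ∀ n q c → ∑ (funs n q) (λ _ → c) ≡ q ^ n * c
∑-funs-const zero q c = refl
∑-funs-const (suc n) q c = begin
  ∑ (funs (suc n) q) (λ _ → c)       ≡⟨ ∑-funs-suc n q (λ _ → c) ⟩
  ∑ᶠ {q} (λ _ → ∑ (funs n q) (λ _ → c)) ≡⟨ ∑ᶠ-const q _ ⟩
  q * ∑ (funs n q) (λ _ → c)         ≡⟨ cong (q *_) (∑-funs-const n q c) ⟩
  q * (q ^ n * c)                    ≡⟨ sym (*-assoc q (q ^ n) c) ⟩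
  q * q ^ n * c ∎
  where open ≡-Reasoning

-- `F` does not look at the value at `x`; this replaces stochastic independence.
Indep : ∀ {n q} → Fin n → ((Fin n → Fin q) → ℕ) → Set
Indep x F = ∀ f g → (∀ y → y ≢ x → f y ≡ g y) → F f ≡ F g


-- The event that `x` takes the value `c` has probability 1/q and is independent of `F`. Here and
-- below probabilities are cleared of denominators by powers of `q`.
∑-funs-fix : ∀ n q (x : Fin n) (c : Fin q) (F : (Fin n → Fin q) → ℕ) → Indep x F →
  q * ∑ (funs n q) (λ f → ⟦ f x == c ⟧ * F f) ≡ ∑ (funs n q) F
∑-funs-fix (suc n) q zero c F ind = begin
  q * ∑ (funs (suc n) q) (λ f → ⟦ f zero == c ⟧ * F f)
    ≡⟨ cong (q *_) (∑-funs-suc n q _) ⟩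
  q * ∑ᶠ (λ d → ∑ (funs n q) (λ f → ⟦ d == c ⟧ * F (cons d f)))
    ≡⟨ cong (q *_) (∑-cong (allFin q) (λ d → ∑-*ˡ (funs n q) ⟦ d == c ⟧ _)) ⟩
  q * ∑ᶠ (λ d → ⟦ d == c ⟧ * ∑ (funs n q) (λ f → F (cons d f)))
    ≡⟨ cong (q *_) (∑ᶠ-δ c _) ⟩
  q * ∑ (funs n q) (λ f → F (cons c f))
    ≡⟨ sym (∑ᶠ-const q _) ⟩
  ∑ᶠ {q} (λ d → ∑ (funs n q) (λ f → F (cons c f)))
    ≡⟨ ∑-cong (allFin q) (λ d → ∑-cong (funs n q) (λ f → ind _ _ (agree d f))) ⟩
  ∑ᶠ {q} (λ d → ∑ (funs n q) (λ f → F (cons d f)))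
    ≡⟨ sym (∑-funs-suc n q F) ⟩
  ∑ (funs (suc n) q) F ∎
  where
  open ≡-Reasoning
  agree : ∀ d f y → y ≢ zero → cons c f y ≡ cons d f y
  agree d f zero y≢0 = contradiction refl y≢0
  agree d f (suc y) _ = refl
∑-funs-fix (suc n) q (suc x) c F ind = begin
  q * ∑ (funs (suc n) q) (λ f → ⟦ f (suc x) == c ⟧ * F f)
    ≡⟨ cong (q *_) (∑-funs-suc n q _) ⟩
  q * ∑ᶠ (λ d → ∑ (funs n q) (λ f → ⟦ f x == c ⟧ * F (cons d f)))
    ≡⟨ sym (∑-*ˡ (allFin q) q _) ⟩
  ∑ᶠ (λ d → q * ∑ (funs n q) (λ f → ⟦ f x == c ⟧ * F (cons d f)))
    ≡⟨ ∑-cong (allFin q) (λ d → ∑-funs-fix n q x c (F ∘ cons d) (λ f g h → ind _ _ (agree d f g h))) ⟩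
  ∑ᶠ (λ d → ∑ (funs n q) (λ f → F (cons d f)))
    ≡⟨ sym (∑-funs-suc n q F) ⟩
  ∑ (funs (suc n) q) F ∎
  where
  open ≡-Reasoning
  agree : ∀ d f g → (∀ y → y ≢ x → f y ≡ g y) → ∀ y → y ≢ suc x → cons d f y ≡ cons d g y
  agree d f g h zero _ = refl
  agree d f g h (suc y) y≢ = h y (λ { refl → y≢ refl })

Indep-at : ∀ {n q} {x y : Fin n} (c : Fin q) → x ≢ y → Indep {n} {q} x (λ f → ⟦ f y == c ⟧)
Indep-at c x≢y f g h = cong (λ z → ⟦ z == c ⟧) (h _ (x≢y ∘ sym))

Indep-* : ∀ {n q} {x : Fin n} {F H : (Fin n → Fin q) → ℕ} → Indep x F → Indep x H → Indep x (λ f → F f * H f)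
Indep-* i j f g h = cong₂ _*_ (i f g h) (j f g h)

∑-funs-1 : ∀ n q (x : Fin n) (c : Fin q) → q * ∑ (funs n q) (λ f → ⟦ f x == c ⟧) ≡ q ^ n
∑-funs-1 n q x c = begin
  q * ∑ (funs n q) (λ f → ⟦ f x == c ⟧) ≡⟨ cong (q *_) (∑-cong (funs n q) (λ f → sym (*-identityʳ _))) ⟩
  q * ∑ (funs n q) (λ f → ⟦ f x == c ⟧ * 1) ≡⟨ ∑-funs-fix n q x c (λ _ → 1) (λ _ _ _ → refl) ⟩
  ∑ (funs n q) (λ _ → 1) ≡⟨ ∑-funs-const n q 1 ⟩
  q ^ n * 1 ≡⟨ *-identityʳ _ ⟩
  q ^ n ∎
  where open ≡-Reasoning

∑-funs-2 : ∀ n q {x y : Fin n} (c d : Fin q) → x ≢ y →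
  q * (q * ∑ (funs n q) (λ f → ⟦ f x == c ⟧ * ⟦ f y == d ⟧)) ≡ q ^ n
∑-funs-2 n q {x} {y} c d x≢y =
  trans (cong (q *_) (∑-funs-fix n q x c _ (Indep-at d x≢y))) (∑-funs-1 n q y d)

∑-funs-3 : ∀ n q {x y z : Fin n} (c d e : Fin q) → x ≢ y → x ≢ z → y ≢ z →
  q * (q * (q * ∑ (funs n q) (λ f → ⟦ f x == c ⟧ * (⟦ f y == d ⟧ * ⟦ f z == e ⟧)))) ≡ q ^ n
∑-funs-3 n q {x} {y} {z} c d e x≢y x≢z y≢z =
  trans (cong (λ s → q * (q * s)) (∑-funs-fix n q x c _ (Indep-* {F = λ f → ⟦ f y == d ⟧} (Indep-at d x≢y) (Indep-at e x≢z))))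
        (∑-funs-2 n q d e y≢z)

-- Split by the common value `c`: prescribing the value at `x` costs a factor q, and summing over
-- the value at `y` gives it back to the full count.
∑-funs-≡ : ∀ n q {x y : Fin n} → x ≢ y → q * ∑ (funs n q) (λ f → ⟦ f x == f y ⟧) ≡ q ^ n
∑-funs-≡ n q {x} {y} x≢y = begin
  q * ∑ (funs n q) (λ f → ⟦ f x == f y ⟧)
    ≡⟨ cong (q *_) (∑-cong (funs n q) (λ f → sym (split f))) ⟩
  q * ∑ (funs n q) (λ f → ∑ᶠ (λ c → ⟦ f x == c ⟧ * ⟦ f y == c ⟧))
    ≡⟨ cong (q *_) (∑-swap (funs n q) (allFin q) _) ⟩
  q * ∑ᶠ (λ c → ∑ (funs n q) (λ f → ⟦ f x == c ⟧ * ⟦ f y == c ⟧))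
    ≡⟨ sym (∑-*ˡ (allFin q) q _) ⟩
  ∑ᶠ (λ c → q * ∑ (funs n q) (λ f → ⟦ f x == c ⟧ * ⟦ f y == c ⟧))
    ≡⟨ ∑-cong (allFin q) (λ c → ∑-funs-fix n q x c _ (Indep-at c x≢y)) ⟩
  ∑ᶠ (λ c → ∑ (funs n q) (λ f → ⟦ f y == c ⟧))
    ≡⟨ ∑-swap (allFin q) (funs n q) _ ⟩
  ∑ (funs n q) (λ f → ∑ᶠ (λ c → ⟦ f y == c ⟧))
    ≡⟨ ∑-cong (funs n q) (λ f → trans (∑-cong (allFin q) (λ c → cong ⟦_⟧ (==-sym (f y) c))) (∑ᶠ-δ₁ (f y))) ⟩
  ∑ (funs n q) (λ _ → 1)
    ≡⟨ trans (∑-funs-const n q 1) (*-identityʳ _) ⟩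
  q ^ n ∎
  where
  open ≡-Reasoning
  split : ∀ f → ∑ᶠ (λ c → ⟦ f x == c ⟧ * ⟦ f y == c ⟧) ≡ ⟦ f x == f y ⟧
  split f = trans (∑-cong (allFin q) (λ c → trans (*-comm ⟦ f x == c ⟧ _) (cong (λ b → ⟦ b ⟧ * ⟦ f x == c ⟧) (==-sym (f y) c)))) (∑ᶠ-δ (f y) (λ c → ⟦ f x == c ⟧))

-- Subgraphs of large minimum degree

card : ∀ {n} → (Fin n → Bool) → ℕ
card U = ∑ᶠ (λ v → ⟦ U v ⟧)

module _ {n : ℕ} (E : Fin n → Fin n → Bool) (E-sym : ∀ v w → E v w ≡ E w v) where

  degIn : (Fin n → Bool) → Fin n → ℕ
  degIn U v = ∑ᶠ (λ w → ⟦ U w ∧ E v w ⟧)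

  -- Ordered pairs, hence twice the number of edges; this is the source of the factor 2 in `core`.
  volIn : (Fin n → Bool) → ℕ
  volIn U = ∑ᶠ (λ v → ∑ᶠ (λ w → ⟦ U v ∧ (U w ∧ E v w) ⟧))

  private
    remove : (Fin n → Bool) → Fin n → Fin n → Bool
    remove U v w = U w ∧ not (w == v)

    remove-≤ : ∀ U v → volIn U ≤ volIn (remove U v) + (degIn U v + degIn U v)
    remove-≤ U v = begin
      volIn U
        ≤⟨ ∑-mono (allFin n) (λ x → ∑-mono (allFin n) (λ y → pt x y)) ⟩
      ∑ᶠ (λ x → ∑ᶠ (λ y → a x y + (b x y + c x y)))
        ≡⟨ ∑-cong (allFin n) (λ x → trans (∑-+ (allFin n) (a x) _) (cong (∑ᶠ (a x) +_) (∑-+ (allFin n) (b x) (c x)))) ⟩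
      ∑ᶠ (λ x → ∑ᶠ (a x) + (∑ᶠ (b x) + ∑ᶠ (c x)))
        ≡⟨ trans (∑-+ (allFin n) (λ x → ∑ᶠ (a x)) _) (cong (volIn (remove U v) +_) (∑-+ (allFin n) (λ x → ∑ᶠ (b x)) (λ x → ∑ᶠ (c x)))) ⟩
      volIn (remove U v) + (∑ᶠ (λ x → ∑ᶠ (b x)) + ∑ᶠ (λ x → ∑ᶠ (c x)))
        ≡⟨ cong (volIn (remove U v) +_) (cong₂ _+_ eqb eqc) ⟩
      volIn (remove U v) + (degIn U v + degIn U v) ∎
      where
      open ≤-Reasoning
      a b c : Fin n → Fin n → ℕ
      a x y = ⟦ remove U v x ∧ (remove U v y ∧ E x y) ⟧
      b x y = ⟦ x == v ⟧ * ⟦ U y ∧ E x y ⟧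
      c x y = ⟦ y == v ⟧ * ⟦ U x ∧ E x y ⟧
      pt : ∀ x y → ⟦ U x ∧ (U y ∧ E x y) ⟧ ≤ a x y + (b x y + c x y)
      pt x y with U x | U y | E x y | x == v | y == v
      ... | false | _ | _ | _ | _ = z≤n
      ... | true | false | _ | _ | _ = z≤n
      ... | true | true | false | _ | _ = z≤n
      ... | true | true | true | true | _ = s≤s z≤n
      ... | true | true | true | false | true = s≤s z≤n
      ... | true | true | true | false | false = s≤s z≤n
      eqb : ∑ᶠ (λ x → ∑ᶠ (b x)) ≡ degIn U v
      eqb = trans (∑-cong (allFin n) (λ x → ∑-*ˡ (allFin n) ⟦ x == v ⟧ _)) (∑ᶠ-δ v (λ x → degIn U x))
      eqc : ∑ᶠ (λ x → ∑ᶠ (c x)) ≡ degIn U v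
      eqc = ∑-cong (allFin n) (λ x → trans (∑ᶠ-δ v (λ y → ⟦ U x ∧ E x y ⟧)) (cong (λ e → ⟦ U x ∧ e ⟧) (E-sym x v)))

    card-remove : ∀ U v → U v ≡ true → card U ≡ suc (card (remove U v))
    card-remove U v Uv = begin
      card U ≡⟨ ∑-cong (allFin n) pt ⟩
      ∑ᶠ (λ x → ⟦ x == v ⟧ + ⟦ remove U v x ⟧) ≡⟨ ∑-+ (allFin n) _ _ ⟩
      ∑ᶠ (λ x → ⟦ x == v ⟧) + card (remove U v) ≡⟨ cong (_+ card (remove U v)) (∑ᶠ-δ₁ v) ⟩
      suc (card (remove U v)) ∎
      where
      open ≡-Reasoning
      pt : ∀ x → ⟦ U x ⟧ ≡ ⟦ x == v ⟧ + ⟦ remove U v x ⟧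
      pt x with x ≟ v
      ... | yes refl rewrite Uv = refl
      ... | no _ with U x
      ...   | true = refl
      ...   | false = refl

  record Core (C : ℕ) (U : Fin n → Bool) : Set where
    field
      V      : Fin n → Bool
      sub    : ∀ v → V v ≡ true → U v ≡ true
      point  : Fin n
      inside : V point ≡ true
      degree> : ∀ v → V v ≡ true → C < degIn V v

  -- Deleting a vertex of degree at most C lowers `volIn` by at most 2C and `card` by one, so the
  -- strict inequality survives every deletion. It fails for the empty set, so the process stops
  -- earlier.
  core : ∀ C U → 2 * C * card U < volIn U → Core C U
  core C U = go (card U) U refl
    where
    go : ∀ m U → card U ≡ m → 2 * C * card U < volIn U → Core C U
    go m U eq lt with any? (λ v → (U v ≟ᵇ true) ×-dec (degIn U v ≤? C))
    ... | no none = record { V = U ; sub = λ _ Uv → Uv ; point = proj₁ pt ; inside = proj₂ pt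
                           ; degree> = λ v Uv → ≰⇒> (λ le → none (v , Uv , le)) }
      where
      pt : ∃ λ v → U v ≡ true
      pt with ∑-<⇒∃ (allFin n) (λ _ → 0) (λ v → ∑ᶠ (λ w → ⟦ U v ∧ (U w ∧ E v w) ⟧)) (subst (_< volIn U) (sym (∑-zero (allFin n))) (≤-trans (s≤s z≤n) lt))
      ... | v , p with ∑ᶠ-pos⇒∃ (λ w → U v ∧ (U w ∧ E v w)) p
      ...   | w , q = v , ∧-l q
    go zero U eq lt | yes (v , Uv , le) = contradiction (trans (sym (card-remove U v Uv)) eq) λ ()
    go (suc m) U eq lt | yes (v , Uv , le) = record { V = Core.V c ; sub = λ x Vx → ∧-l (Core.sub c x Vx) ; point = Core.point c ; inside = Core.inside c ; degree> = Core.degree> c }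
      where
      U' = remove U v
      eq' : card U' ≡ m
      eq' = suc-injective (trans (sym (card-remove U v Uv)) eq)
      open ≤-Reasoning
      step : 2 * C * card U' + (C + C) < volIn U' + (C + C)
      step = begin-strict
        2 * C * card U' + (C + C) ≡⟨ cong (2 * C * card U' +_) (cong (C +_) (sym (+-identityʳ C))) ⟩
        2 * C * card U' + 2 * C ≡⟨ trans (+-comm _ (2 * C)) (sym (*-suc (2 * C) (card U'))) ⟩
        2 * C * suc (card U') ≡⟨ cong (2 * C *_) (sym (card-remove U v Uv)) ⟩
        2 * C * card U <⟨ lt ⟩
        volIn U ≤⟨ remove-≤ U v ⟩
        volIn U' + (degIn U v + degIn U v) ≤⟨ +-monoʳ-≤ (volIn U') (+-mono-≤ le le) ⟩
        volIn U' + (C + C) ∎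
      c : Core C U'
      c = go m U' eq' (+-cancelʳ-< (C + C) _ _ step)

-- Cycles through a rooted tree

pick-avoiding : ∀ {n} (p : Fin n → Bool) (xs : List (Fin n)) → length xs < card p →
                ∃ λ v → p v ≡ true × v ∉ xs
pick-avoiding {n} p xs lt with ∑-<⇒∃ (allFin n) (λ v → ∑ xs (λ x → ⟦ v == x ⟧)) (λ v → ⟦ p v ⟧) (subst (_< card p) (sym eq) lt)
  where
  eq : ∑ᶠ (λ v → ∑ xs (λ x → ⟦ v == x ⟧)) ≡ length xs
  eq = trans (∑-swap (allFin n) xs _) (trans (∑-cong xs (λ x → ∑ᶠ-δ₁ x)) (trans (∑-const xs 1) (*-identityʳ _)))
... | v , q = v , ⟦⟧-pos (≤-trans (s≤s z≤n) q) , λ v∈ → <⇒≱ q (≤-trans (⟦⟧≤1 (p v))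
        (≤-trans (≤-reflexive (cong ⟦_⟧ (sym (==-refl v)))) (∑-∈ xs (λ x → ⟦ v == x ⟧) v∈)))

module _ {n : ℕ} (G : Graph n) where

  data Trail : Fin n → Fin n → List (Fin n) → Set where
    one : ∀ {x} → Trail x x (x ∷ [])
    _∷_ : ∀ {x y z ys} → Adj G x y → Trail y z ys → Trail x z (x ∷ ys)

  join : ∀ {x y y' z xs ys} → Trail x y xs → Adj G y y' → Trail y' z ys → Trail x z (xs ++ ys)
  join one      e t = e ∷ t
  join (e' ∷ s) e t = e' ∷ join s e t

  Adj-sym : ∀ {x y} → Adj G x y → Adj G y x
  Adj-sym {x} {y} e = trans (Graph.sym G y x) e

  trail-up : (f : ℕ → Fin n) (t : ℕ) → (∀ i → i < t → Adj G (f i) (f (suc i))) → Trail (f 0) (f t) (applyUpTo f (suc t))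
  trail-up f zero    h = one
  trail-up f (suc t) h = h 0 (s≤s z≤n) ∷ trail-up (f ∘ suc) t (λ i i<t → h (suc i) (s≤s i<t))

  trail-down : (f : ℕ → Fin n) (t : ℕ) → (∀ i → i < t → Adj G (f (suc i)) (f i)) → Trail (f t) (f 0) (applyDownFrom f (suc t))
  trail-down f zero    h = one
  trail-down f (suc t) h = h t ≤-refl ∷ trail-down f t (λ i i<t → h i (m≤n⇒m≤1+n i<t))

  private
    trail-adj : ∀ {x z y ys} → Trail x z (y ∷ ys) → (i : Fin (length ys)) →
                Adj G (lookup (y ∷ ys) (inject₁ i)) (lookup (y ∷ ys) (suc i))
    trail-adj (e ∷ one)       zero    = e
    trail-adj (e ∷ (e' ∷ t))  zero    = e
    trail-adj (e ∷ (e' ∷ t))  (suc i) = trail-adj (e' ∷ t) i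

    trail-head : ∀ {x z y ys} → Trail x z (y ∷ ys) → y ≡ x
    trail-head one = refl
    trail-head (_ ∷ _) = refl

    trail-last : ∀ {x z y ys} → Trail x z (y ∷ ys) → lookup (y ∷ ys) (fromℕ (length ys)) ≡ z
    trail-last one = refl
    trail-last (e ∷ one) = refl
    trail-last (e ∷ (e' ∷ t)) = trail-last (e' ∷ t)

    lookup-inj : ∀ {xs : List (Fin n)} → Unique xs → ∀ {i j} → lookup xs i ≡ lookup xs j → i ≡ j
    lookup-inj (p ∷ u) {zero} {zero} e = refl
    lookup-inj (p ∷ u) {zero} {suc j} e = contradiction e (All.lookup p (∈-lookup j))
    lookup-inj (p ∷ u) {suc i} {zero} e = contradiction (sym e) (All.lookup p (∈-lookup i))
    lookup-inj (p ∷ u) {suc i} {suc j} e = cong suc (lookup-inj u e)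

  closed-trail⇒cycle : ∀ {x z xs m} → Trail x z xs → Unique xs → length xs ≡ m → Adj G z x → HasCycle G m
  closed-trail⇒cycle {xs = y ∷ ys} t u refl e =
    lookup (y ∷ ys) , lookup-inj u , trail-adj t , subst₂ (Adj G) (sym (trail-last t)) (sym (trail-head t)) e

  module TreeCycle
    (k d : ℕ) (d<k : d < k)
    (lev : ℕ → Fin n → Bool)
    (root : ∀ u v → lev 0 u ≡ true → lev 0 v ≡ true → u ≡ v)
    (par : ∀ j y → lev (suc j) y ≡ true → ∃ λ x → lev j x ≡ true × Adj G y x)
    (disj : ∀ i j v → lev i v ≡ true → lev j v ≡ true → i ≡ j)
    (W : Fin n → Bool)
    (W-off : ∀ j v → j ≤ d → W v ≡ true → lev j v ≡ true → ⊥)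
    (E : Fin n → Fin n → Bool)
    (E-adj : ∀ x y → E x y ≡ true → Adj G x y)
    where

    H : Fin n → Fin n → Bool
    H x y = (lev d x ∧ (W y ∧ E x y)) ∨ (lev d y ∧ (W x ∧ E y x))

    H-sym : ∀ x y → H x y ≡ H y x
    H-sym x y with lev d x ∧ (W y ∧ E x y) | lev d y ∧ (W x ∧ E y x)
    ... | true  | true  = refl
    ... | true  | false = refl
    ... | false | true  = refl
    ... | false | false = refl

    private
      H-adj : ∀ x y → H x y ≡ true → Adj G x y
      H-adj x y e with ∨-elim {lev d x ∧ (W y ∧ E x y)} e
      ... | inj₁ p = E-adj x y (∧-r {W y} (∧-r {lev d x} p))
      ... | inj₂ p = Adj-sym (E-adj y x (∧-r {W x} (∧-r {lev d y} p)))

      H-W : ∀ x y → lev d x ≡ true → H x y ≡ true → W y ≡ true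
      H-W x y lx e with ∨-elim {lev d x ∧ (W y ∧ E x y)} e
      ... | inj₁ p = ∧-l (∧-r {lev d x} p)
      ... | inj₂ p = ⊥-elim (W-off d x ≤-refl (∧-l (∧-r {lev d y} p)) lx)

      H-S : ∀ x y → W x ≡ true → H x y ≡ true → lev d y ≡ true
      H-S x y wx e with ∨-elim {lev d x ∧ (W y ∧ E x y)} e
      ... | inj₁ p = ⊥-elim (W-off d x ≤-refl wx (∧-l p))
      ... | inj₂ p = ∧-l p

      -- The value off level `suc j` is only a default; ancestors are taken from vertices of level
      -- `d`, where `parent-ok` applies.
      parent : ℕ → Fin n → Fin n
      parent j y with lev (suc j) y ≟ᵇ true
      ... | yes p = proj₁ (par j y p)
      ... | no  _ = y

      parent-ok : ∀ j y → lev (suc j) y ≡ true → lev j (parent j y) ≡ true × Adj G y (parent j y)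
      parent-ok j y l with lev (suc j) y ≟ᵇ true
      ... | yes p = proj₂ (par j y p)
      ... | no ¬p = contradiction l ¬p

      A : ℕ → Fin n → Fin n
      A zero    v = v
      A (suc j) v = parent (d ∸ suc j) (A j v)

      ∸-suc' : ∀ j → j < d → d ∸ j ≡ suc (d ∸ suc j)
      ∸-suc' j j<d = +-∸-assoc 1 j<d

      A-lev : ∀ j v → j ≤ d → lev d v ≡ true → lev (d ∸ j) (A j v) ≡ true
      A-step : ∀ j v → j < d → lev d v ≡ true → lev (d ∸ suc j) (A (suc j) v) ≡ true × Adj G (A j v) (A (suc j) v)
      A-lev zero    v _   l = l
      A-lev (suc j) v j<d l = proj₁ (A-step j v j<d l)
      A-step j v j<d l = parent-ok (d ∸ suc j) (A j v)
        (subst (λ i → lev i (A j v) ≡ true) (∸-suc' j j<d) (A-lev j v (<⇒≤ j<d) l))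

      A-merge : ∀ j i x z → A j x ≡ A j z → A (i + j) x ≡ A (i + j) z
      A-merge j zero    x z e = e
      A-merge j (suc i) x z e = cong (parent (d ∸ suc (i + j))) (A-merge j i x z e)

      A-split : ∀ {j t x z} → j ≤ t → A t x ≢ A t z → A j x ≢ A j z
      A-split {j} {t} {x} {z} j≤t ne e = ne (subst (λ i → A i x ≡ A i z) (m∸n+n≡m j≤t) (A-merge j (t ∸ j) x z e))

      A-inj : ∀ {i j x z} → i ≤ d → j ≤ d → lev d x ≡ true → lev d z ≡ true → A i x ≡ A j z → i ≡ j
      A-inj {i} {j} {x} {z} i≤d j≤d lx lz e =
        ∸-cancelˡ-≡ i≤d j≤d (disj _ _ _ (A-lev i x i≤d lx) (subst (λ v → lev (d ∸ j) v ≡ true) (sym e) (A-lev j z j≤d lz)))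

      A-noW : ∀ {j x} → j ≤ d → lev d x ≡ true → W (A j x) ≢ true
      A-noW {j} {x} j≤d lx w = W-off (d ∸ j) _ (m∸n≤m d j) w (A-lev j x j≤d lx)

      S≢W : ∀ {u v} → lev d u ≡ true → W v ≡ true → u ≢ v
      S≢W Su Wv refl = W-off d _ ≤-refl Wv Su

    module _ {U : Fin n → Bool} (core : Core H H-sym (2 * k + 2) U) (free : ¬ HasCycle G (2 * k)) where
      open Core core

      private
        -- Minimum degree above 2k+2 leaves room to avoid a path with fewer than 2k vertices
        -- together with the two vertices reserved for closing it.
        next : ∀ v → V v ≡ true → (xs : List (Fin n)) → length xs ≤ 2 * k + 2 → ∃ λ w → V w ≡ true × H v w ≡ true × w ∉ xs
        next v Vv xs le with pick-avoiding (λ w → V w ∧ H v w) xs (≤-<-trans le (degree> v Vv))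
        ... | w , p , w∉ = w , ∧-l p , ∧-r {V w} p , w∉

        -- All core neighbours of a core vertex of `W` have one common t-th ancestor. This is clear
        -- at height d, where the ancestor is the root, and is pushed down to height 0, where it
        -- says that the vertex has a single neighbour.
        Same : ℕ → Set
        Same t = ∀ w x y → V w ≡ true → W w ≡ true → V x ≡ true → V y ≡ true → H w x ≡ true → H w y ≡ true → A t x ≡ A t y

        same-d : Same d
        same-d w x y _ Ww _ _ hx hy = root _ _ (lv x (H-S w x Ww hx)) (lv y (H-S w y Ww hy))
          where lv : ∀ v → lev d v ≡ true → lev 0 (A d v) ≡ true
                lv v l = subst (λ i → lev i (A d v) ≡ true) (n∸n≡0 d) (A-lev d v ≤-refl l)

        -- A greedy alternating path between level `d` and `W` that ends in `w` and avoids `x` and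
        -- `y`. The field `top` records that its other end `z` still hangs below the same (t+1)-th
        -- ancestor as `x`.
        record Grown (t : ℕ) (w x y : Fin n) (m : ℕ) : Set where
          field
            z     : Fin n
            xs    : List (Fin n)
            trail : Trail z w xs
            len   : length xs ≡ 2 * suc m
            Vz    : V z ≡ true
            Sz    : lev d z ≡ true
            uniq  : Unique xs
            kind  : ∀ v → v ∈ xs → lev d v ≡ true ⊎ W v ≡ true
            x∉    : x ∉ xs
            y∉    : y ∉ xs
            top   : A (suc t) z ≡ A (suc t) x

        ∉⇒All : ∀ {v : Fin n} {xs} → v ∉ xs → All (v ≢_) xs
        ∉⇒All {v} {xs} v∉ = ¬Any⇒All¬ xs v∉

        -- The path grows by two vertices at a time. The new vertex of level `d` and the previous
        -- one are both neighbours of the inserted vertex of `W`, so the hypothesis at height t+1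
        -- carries `top` along.
        grow : ∀ {t w x y} → Same (suc t) → V w ≡ true → W w ≡ true → V x ≡ true → V y ≡ true →
               H w x ≡ true → H w y ≡ true → ∀ m → suc m ≤ k → Grown t w x y m
        grow {t} {w} {x} {y} same Vw Ww Vx Vy hx hy zero m<k = record
            { z = s ; xs = s ∷ w ∷ [] ; trail = H-adj s w (trans (H-sym s w) hs) ∷ one ; len = refl ; Vz = Vs
            ; Sz = H-S w s Ww hs
            ; uniq = ((λ e → s∉ (here e)) ∷ []) ∷ ([] ∷ [])
            ; kind = λ { v (here refl) → inj₁ (H-S w s Ww hs) ; v (there (here refl)) → inj₂ Ww }
            ; x∉ = λ { (here e) → s∉ (there (here (sym e))) ; (there (here e)) → S≢W (H-S w x Ww hx) Ww e }
            ; y∉ = λ { (here e) → s∉ (there (there (here (sym e)))) ; (there (here e)) → S≢W (H-S w y Ww hy) Ww e }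
            ; top = same w s x Vw Ww Vs Vx hs hx }
          where
          nx = next w Vw (w ∷ x ∷ y ∷ []) (≤-trans (s≤s (s≤s (s≤s z≤n))) (+-monoˡ-≤ 2 (*-monoʳ-≤ 2 m<k)))
          s = proj₁ nx
          Vs = proj₁ (proj₂ nx)
          hs = proj₁ (proj₂ (proj₂ nx))
          s∉ = proj₂ (proj₂ (proj₂ nx))
        grow {t} {w} {x} {y} same Vw Ww Vx Vy hx hy (suc m) m<k = record
            { z = s ; xs = s ∷ w' ∷ xs ; trail = H-adj s w' (trans (H-sym s w') hs) ∷ (H-adj w' z (trans (H-sym w' z) hw) ∷ trail)
            ; len = trans (cong (2 +_) len) (sym (*-suc 2 (suc m)))
            ; Vz = Vs ; Sz = Ss
            ; uniq = ∉⇒All (λ { (here e) → S≢W Ss Ww' e ; (there s∈) → s∉ (there (there s∈)) }) ∷ (∉⇒All w'∉ ∷ uniq)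
            ; kind = λ { v (here refl) → inj₁ Ss ; v (there (here refl)) → inj₂ Ww' ; v (there (there v∈)) → kind v v∈ }
            ; x∉ = λ { (here e) → s∉ (here (sym e)) ; (there (here e)) → S≢W (H-S w x Ww hx) Ww' e ; (there (there x∈)) → x∉ x∈ }
            ; y∉ = λ { (here e) → s∉ (there (here (sym e))) ; (there (here e)) → S≢W (H-S w y Ww hy) Ww' e ; (there (there y∈)) → y∉ y∈ }
            ; top = trans (same w' s z Vw' Ww' Vs Vz hs (trans (H-sym w' z) hw)) top }
          where
          open Grown (grow {t} same Vw Ww Vx Vy hx hy m (≤-trans (n≤1+n _) m<k))
          len≤ : 2 + length xs ≤ 2 * k
          len≤ = ≤-trans (≤-reflexive (trans (cong (2 +_) len) (sym (*-suc 2 (suc m))))) (*-monoʳ-≤ 2 m<k)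
          nw = next z Vz xs (≤-trans (m≤n+m _ 2) (≤-trans len≤ (m≤m+n _ 2)))
          w' = proj₁ nw
          Vw' = proj₁ (proj₂ nw)
          hw = proj₁ (proj₂ (proj₂ nw))
          w'∉ = proj₂ (proj₂ (proj₂ nw))
          Ww' = H-W z w' Sz hw
          ns = next w' Vw' (x ∷ y ∷ xs) (≤-trans len≤ (m≤m+n _ 2))
          s = proj₁ ns
          Vs = proj₁ (proj₂ ns)
          hs = proj₁ (proj₂ (proj₂ ns))
          s∉ = proj₂ (proj₂ (proj₂ ns))
          Ss = H-S w' s Ww' hs

        either : ∀ {x y x' : Fin n} (P : Fin n → Set) → x' ≡ x ⊎ x' ≡ y → P x → P y → P x'
        either P (inj₁ refl) px py = px
        either P (inj₂ refl) px py = py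

        -- The cycle climbs down from the common ancestor to z, follows the greedy path to w, and climbs from x back up.
        close : ∀ {t w x y} → t < d → Same (suc t) → V w ≡ true → W w ≡ true → V x ≡ true → V y ≡ true →
                H w x ≡ true → H w y ≡ true → (gr : Grown t w x y (k ∸ suc (suc t))) →
                ∀ x' → (x' ≡ x ⊎ x' ≡ y) → A t (Grown.z gr) ≢ A t x' → ⊥
        close {t} {w} {x} {y} t<d same Vw Ww Vx Vy hx hy gr x' x'≡ ne = free
            (closed-trail⇒cycle (join tz (Adj-sym (proj₂ (A-step 0 z (≤-<-trans z≤n t<d) Sz))) (join trail (H-adj w x' hx') tx))
              (Unique-++ uz (Unique-++ uniq ux dis2) dis1) lenTotal
              (subst (Adj G (A t x')) (sym top') (proj₂ (A-step t x' t<d Sx'))))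
          where
          open Grown gr
          hx' = either (λ v → H w v ≡ true) x'≡ hx hy
          Sx' = H-S w x' Ww hx'
          x'∉ = either (λ v → v ∉ xs) x'≡ x∉ y∉
          top' = either (λ v → A (suc t) z ≡ A (suc t) v) x'≡ top (trans top (same w x y Vw Ww Vx Vy hx hy))
          tz = trail-down (λ j → A (suc j) z) t (λ i i<t → Adj-sym (proj₂ (A-step (suc i) z (≤-<-trans i<t t<d) Sz)))
          tx = trail-up (λ j → A j x') t (λ i i<t → proj₂ (A-step i x' (<-trans i<t t<d) Sx'))
          bd : ∀ {i} → i < suc t → i ≤ d
          bd i<t = ≤-trans (s≤s⁻¹ i<t) (<⇒≤ t<d)
          bd' : ∀ {i} → i < suc t → suc i ≤ d
          bd' i<t = ≤-trans i<t t<d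
          uz : Unique (applyDownFrom (λ j → A (suc j) z) (suc t))
          uz = applyDownFrom⁺₁ _ (suc t) (λ j<i i<t e → <⇒≢ j<i (sym (suc-injective (A-inj (bd' i<t) (bd' (<-trans j<i i<t)) Sz Sz e))))
          ux : Unique (applyUpTo (λ j → A j x') (suc t))
          ux = applyUpTo⁺₁ _ (suc t) (λ i<j j<t e → <⇒≢ i<j (A-inj (bd (<-trans i<j j<t)) (bd j<t) Sx' Sx' e))
          path-anc : ∀ {v j u} → suc j ≤ d → lev d u ≡ true → v ∈ xs → v ≡ A (suc j) u → ⊥
          path-anc {v} {j} {u} j≤d Su v∈ e with kind v v∈
          ... | inj₁ Sv = contradiction (A-inj {0} {suc j} {v} {u} z≤n j≤d Sv Su e) λ ()
          ... | inj₂ Wv = A-noW j≤d Su (subst (λ u → W u ≡ true) e Wv)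
          dis2 : ∀ {v} → v ∈ xs × v ∈ applyUpTo (λ j → A j x') (suc t) → ⊥
          dis2 (v∈ , v∈') with ∈-applyUpTo⁻ (λ j → A j x') v∈'
          ... | zero , _ , refl = x'∉ v∈
          ... | suc j , lt , e = path-anc (≤-trans (<⇒≤ lt) t<d) Sx' v∈ e
          dis1 : ∀ {v} → v ∈ applyDownFrom (λ j → A (suc j) z) (suc t) × v ∈ (xs ++ applyUpTo (λ j → A j x') (suc t)) → ⊥
          dis1 (v∈ , v∈') with ∈-applyDownFrom⁻ (λ j → A (suc j) z) v∈ | ∈-++⁻ xs v∈'
          ... | j , lt , e | inj₁ p = path-anc (bd' lt) Sz p e
          ... | j , lt , e | inj₂ p with ∈-applyUpTo⁻ (λ j → A j x') p
          -- If the two climbs met below the common top, they would meet at equal heights, and then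
          -- the t-th ancestors would agree as well.
          ...   | i , lt' , e' with A-inj (bd' lt) (bd lt') Sz Sx' (trans (sym e) e')
          ...     | refl = A-split (s≤s⁻¹ lt') ne (trans (sym e) e')
          -- There are t+1 proper ancestors of `z`, 2(k-t-1) vertices on the path, and t+1 vertices
          -- from `x'` up to its t-th ancestor: 2k in all.
          lenTotal : length (applyDownFrom (λ j → A (suc j) z) (suc t) ++ (xs ++ applyUpTo (λ j → A j x') (suc t))) ≡ 2 * k
          lenTotal = begin
            length (applyDownFrom (λ j → A (suc j) z) (suc t) ++ (xs ++ applyUpTo (λ j → A j x') (suc t)))
              ≡⟨ trans (length-++ (applyDownFrom (λ j → A (suc j) z) (suc t))) (cong₂ _+_ (length-applyDownFrom (λ j → A (suc j) z) (suc t)) (trans (length-++ xs) (cong₂ _+_ len (length-applyUpTo (λ j → A j x') (suc t))))) ⟩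
            suc t + (2 * suc (k ∸ suc (suc t)) + suc t) ≡⟨ cong (suc t +_) (+-comm _ (suc t)) ⟩
            suc t + (suc t + 2 * suc (k ∸ suc (suc t))) ≡⟨ sym (+-assoc (suc t) (suc t) _) ⟩
            suc t + suc t + 2 * suc (k ∸ suc (suc t)) ≡⟨ cong (_+ 2 * suc (k ∸ suc (suc t))) (cong (suc t +_) (sym (+-identityʳ (suc t)))) ⟩
            2 * suc t + 2 * suc (k ∸ suc (suc t)) ≡⟨ sym (*-distribˡ-+ 2 (suc t) _) ⟩
            2 * (suc t + suc (k ∸ suc (suc t))) ≡⟨ cong (2 *_) (trans (+-suc (suc t) _) (m+[n∸m]≡n (≤-<-trans t<d d<k))) ⟩
            2 * k ∎
            where open ≡-Reasoning

        -- If the t-th ancestors of `x` and `y` differ, that of `z` differs from at least one of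
        -- them, and this one closes the cycle: the two climbs meet exactly at height t+1.
        descend : ∀ t → t < d → Same (suc t) → Same t
        descend t t<d same w x y Vw Ww Vx Vy hx hy with A t x ≟ A t y
        ... | yes e = e
        ... | no ne = ⊥-elim bad
          where
          le : suc (k ∸ suc (suc t)) ≤ k
          le = ≤-trans (≤-reflexive (sym (+-∸-assoc 1 (≤-<-trans t<d d<k)))) (m∸n≤m k (suc t))
          gr = grow {t} same Vw Ww Vx Vy hx hy (k ∸ suc (suc t)) le
          bad : ⊥
          bad with A t (Grown.z gr) ≟ A t x
          ... | no ne' = close t<d same Vw Ww Vx Vy hx hy gr x (inj₁ refl) ne'
          ... | yes e' = close t<d same Vw Ww Vx Vy hx hy gr y (inj₂ refl) (λ e'' → ne (trans (sym e') e''))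

        same-all : ∀ i t → t + i ≡ d → Same t
        same-all zero    t e = subst Same (trans (sym e) (+-identityʳ t)) same-d
        same-all (suc i) t e = descend t (≤-trans (m≤m+n (suc t) i) (≤-reflexive (trans (sym (+-suc t i)) e)))
                                 (same-all i (suc t) (trans (sym (+-suc t i)) e))

      no-core : ⊥
      no-core = fin
        where
        two : 2 ≤ 2 * k + 2
        two = m≤n+m 2 (2 * k)
        contr : ∀ w → V w ≡ true → W w ≡ true → ⊥
        contr w Vw Ww with next w Vw [] z≤n
        ... | x , Vx , hx , _ with next w Vw (x ∷ []) (≤-trans (s≤s z≤n) two)
        ...   | y , Vy , hy , y∉ = y∉ (here (sym (same-all d 0 refl w x y Vw Ww Vx Vy hx hy)))
        fin : ⊥
        fin with next point inside [] z≤n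
        ... | x , Vx , hx , _ with ∨-elim {lev d point ∧ (W x ∧ E point x)} hx
        ...   | inj₁ p = contr x Vx (∧-l (∧-r {lev d point} p))
        ...   | inj₂ p = contr point inside (∧-l (∧-r {lev d x} p))

module Sparse {n : ℕ} (G : Graph n)
    (k d : ℕ) (d<k : d < k)
    (lev : ℕ → Fin n → Bool)
    (root : ∀ u v → lev 0 u ≡ true → lev 0 v ≡ true → u ≡ v)
    (par : ∀ j y → lev (suc j) y ≡ true → ∃ λ x → lev j x ≡ true × Adj G y x)
    (disj : ∀ i j v → lev i v ≡ true → lev j v ≡ true → i ≡ j)
    (W : Fin n → Bool)
    (W-off : ∀ j v → j ≤ d → W v ≡ true → lev j v ≡ true → ⊥)
    (E : Fin n → Fin n → Bool)
    (E-adj : ∀ x y → E x y ≡ true → Adj G x y)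
    (free : ¬ HasCycle G (2 * k))
    where

  open TreeCycle G k d d<k lev root par disj W W-off E E-adj

  private
    C = 2 * k + 2
    S = lev d
    ed : Fin n → Fin n → ℕ
    ed x y = ⟦ S x ∧ (W y ∧ E x y) ⟧
    U : Fin n → Bool
    U v = S v ∨ W v

  edges : ℕ
  edges = ∑ᶠ (λ x → ∑ᶠ (λ y → ⟦ lev d x ∧ (W y ∧ E x y) ⟧))

  private
    card-U : card U ≤ card S + card W
    card-U = ≤-trans (∑-mono (allFin n) (λ v → ⟦∨⟧≤ (S v) (W v))) (≤-reflexive (∑-+ (allFin n) _ _))

    vol-U : edges + edges ≤ volIn H H-sym U
    vol-U = begin
      edges + edges ≡⟨ cong (edges +_) (∑-swap (allFin n) (allFin n) ed) ⟩
      edges + ∑ᶠ (λ y → ∑ᶠ (λ x → ed x y)) ≡⟨ sym (∑-+ (allFin n) _ _) ⟩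
      ∑ᶠ (λ v → ∑ᶠ (ed v) + ∑ᶠ (λ w → ed w v)) ≡⟨ ∑-cong (allFin n) (λ v → sym (∑-+ (allFin n) (ed v) _)) ⟩
      ∑ᶠ (λ v → ∑ᶠ (λ w → ed v w + ed w v)) ≤⟨ ∑-mono (allFin n) (λ v → ∑-mono (allFin n) (λ w → pt v w)) ⟩
      volIn H H-sym U ∎
      where
      open ≤-Reasoning
      pt : ∀ v w → ed v w + ed w v ≤ ⟦ U v ∧ (U w ∧ H v w) ⟧
      pt v w with S v in sv | W v in wv | S w | W w | E v w | E w v
      ... | true  | true  | _ | _ | _ | _ = ⊥-elim (W-off d v ≤-refl wv sv)
      ... | true  | false | true  | true  | true  | _ = ≤-refl
      ... | true  | false | false | true  | true  | _ = ≤-refl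
      ... | true  | false | true  | true  | false | _ = z≤n
      ... | true  | false | false | true  | false | _ = z≤n
      ... | true  | false | true  | false | _     | _ = z≤n
      ... | true  | false | false | false | _     | _ = z≤n
      ... | false | true  | true  | true  | _ | true  = ≤-refl
      ... | false | true  | true  | true  | _ | false = z≤n
      ... | false | true  | true  | false | _ | true  = ≤-refl
      ... | false | true  | true  | false | _ | false = z≤n
      ... | false | true  | false | _ | _ | _ = z≤n
      ... | false | false | true  | _ | _ | _ = z≤n
      ... | false | false | false | _ | _ | _ = z≤n

  -- More edges would give `H` enough volume on level `d` and `W` together for a core, and `no-core`
  -- excludes it.
  sparse : edges ≤ C * (card S + card W)
  sparse with edges ≤? C * (card S + card W)
  ... | yes p = p
  ... | no ¬p = ⊥-elim (no-core (core H H-sym C U big) free)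
    where
    open ≤-Reasoning
    big : 2 * C * card U < volIn H H-sym U
    big = begin-strict
      2 * C * card U ≡⟨ *-assoc 2 C (card U) ⟩
      2 * (C * card U) ≤⟨ *-monoʳ-≤ 2 (*-monoʳ-≤ C card-U) ⟩
      2 * (C * (card S + card W)) <⟨ *-monoʳ-< 2 (≰⇒> ¬p) ⟩
      2 * edges ≡⟨ cong (edges +_) (+-identityʳ edges) ⟩
      edges + edges ≤⟨ vol-U ⟩
      volIn H H-sym U ∎

  -- Then 2C|W| ≤ edges ≤ C|S| + C|W|, so C|W| ≤ C|S|. The bound no longer depends on how many heavy
  -- vertices there are.
  heavy-edges : (∀ y → W y ≡ true → 2 * C ≤ ∑ᶠ (λ x → ⟦ lev d x ∧ E x y ⟧)) → edges ≤ 2 * C * card S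
  heavy-edges heavy = begin
    edges                 ≤⟨ sparse ⟩
    C * (card S + card W) ≡⟨ *-distribˡ-+ C (card S) (card W) ⟩
    C * card S + C * card W ≤⟨ +-monoʳ-≤ (C * card S) W≤S ⟩
    C * card S + C * card S ≡⟨ cong (C * card S +_) (sym (+-identityʳ _)) ⟩
    2 * (C * card S)      ≡⟨ sym (*-assoc 2 C (card S)) ⟩
    2 * C * card S        ∎
    where
    open ≤-Reasoning
    lower : 2 * C * card W ≤ edges
    lower = begin
      2 * C * card W ≡⟨ sym (∑-*ˡ (allFin n) (2 * C) _) ⟩
      ∑ᶠ (λ y → 2 * C * ⟦ W y ⟧) ≤⟨ ∑-mono (allFin n) pt ⟩
      ∑ᶠ (λ y → ∑ᶠ (λ x → ed x y)) ≡⟨ ∑-swap (allFin n) (allFin n) (λ y x → ed x y) ⟩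
      edges ∎
      where
      pt : ∀ y → 2 * C * ⟦ W y ⟧ ≤ ∑ᶠ (λ x → ed x y)
      pt y with W y in wy
      ... | true = ≤-trans (≤-reflexive (*-identityʳ _)) (heavy y wy)
      ... | false = ≤-trans (≤-reflexive (*-zeroʳ (2 * C))) z≤n
    W≤S : C * card W ≤ C * card S
    W≤S = +-cancelʳ-≤ (C * card W) _ _ (begin
      C * card W + C * card W ≡⟨ trans (cong (C * card W +_) (sym (+-identityʳ _))) (sym (*-assoc 2 C (card W))) ⟩
      2 * C * card W ≤⟨ lower ⟩
      edges ≤⟨ sparse ⟩
      C * (card S + card W) ≡⟨ *-distribˡ-+ C (card S) (card W) ⟩
      C * card S + C * card W ∎)

-- Walks and light levels

≡ᵇ-true : ∀ {m n} → (m ≡ᵇ n) ≡ true → m ≡ n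
≡ᵇ-true {m} {n} e = ≡ᵇ⇒≡ m n (Equivalence.from T-≡ e)

true-≡ᵇ : ∀ {m n} → m ≡ n → (m ≡ᵇ n) ≡ true
true-≡ᵇ {m} {n} e = Equivalence.to T-≡ (≡⇒≡ᵇ m n e)

≤ᵇ-true : ∀ {m n} → (m ≤ᵇ n) ≡ true → m ≤ n
≤ᵇ-true {m} {n} e = ≤ᵇ⇒≤ m n (Equivalence.from T-≡ e)

true-≤ᵇ : ∀ {m n} → m ≤ n → (m ≤ᵇ n) ≡ true
true-≤ᵇ le = Equivalence.to T-≡ (≤⇒≤ᵇ le)

<ᵇ-true : ∀ {m n} → (m <ᵇ n) ≡ true → m < n
<ᵇ-true {m} {n} e = <ᵇ⇒< m n (Equivalence.from T-≡ e)

true-<ᵇ : ∀ {m n} → m < n → (m <ᵇ n) ≡ true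
true-<ᵇ lt = Equivalence.to T-≡ (<⇒<ᵇ lt)

<ᵇ-false : ∀ {m n} → n ≤ m → (m <ᵇ n) ≡ false
<ᵇ-false le = ≢true⇒≡false (λ e → <⇒≱ (<ᵇ-true e) le)

⟦⟧*-≤ : ∀ b m → ⟦ b ⟧ * m ≤ m
⟦⟧*-≤ true m = ≤-reflexive (+-identityʳ m)
⟦⟧*-≤ false m = z≤n

⟦⟧*-mono : ∀ b {m m'} → (b ≡ true → m ≤ m') → ⟦ b ⟧ * m ≤ ⟦ b ⟧ * m'
⟦⟧*-mono true h = *-monoʳ-≤ 1 (h refl)
⟦⟧*-mono false h = z≤n

⟦⟧*-bound : ∀ b {m m'} → (b ≡ true → m ≤ m') → ⟦ b ⟧ * m ≤ m'
⟦⟧*-bound true {m} h = ≤-trans (≤-reflexive (*-identityˡ m)) (h refl)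
⟦⟧*-bound false h = z≤n

module _ {n : ℕ} where

  -- The relation depends on the time `c`, which will prescribe the colour of the next vertex. The
  -- list omits the starting vertex.
  data Walk (E : ℕ → Fin n → Fin n → Bool) : ℕ → Fin n → List (Fin n) → Set where
    []  : ∀ {c x} → Walk E c x []
    _∷_ : ∀ {c x y zs} → E c x y ≡ true → Walk E (suc c) y zs → Walk E c x (y ∷ zs)

  wk : (E : ℕ → Fin n → Fin n → Bool) (m c : ℕ) (x : Fin n) → List (List (Fin n))
  wk E zero    c x = [] ∷ []
  wk E (suc m) c x = concatMap (λ y → if E c x y then map (y ∷_) (wk E m (suc c) y) else []) (allFin n)

  ∑-wk-suc : ∀ E m c x (F : List (Fin n) → ℕ) →
    ∑ (wk E (suc m) c x) F ≡ ∑ᶠ (λ y → ⟦ E c x y ⟧ * ∑ (wk E m (suc c) y) (λ zs → F (y ∷ zs)))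
  ∑-wk-suc E m c x F = trans (∑-concatMap _ (allFin n) F) (∑-cong (allFin n) pt)
    where
    pt : ∀ y → ∑ (if E c x y then map (y ∷_) (wk E m (suc c) y) else []) F
             ≡ ⟦ E c x y ⟧ * ∑ (wk E m (suc c) y) (λ zs → F (y ∷ zs))
    pt y with E c x y
    ... | true = trans (∑-map (y ∷_) (wk E m (suc c) y) F) (sym (+-identityʳ _))
    ... | false = refl

  wk-sound : ∀ E m c x {zs} → zs ∈ wk E m c x → Walk E c x zs × length zs ≡ m
  wk-sound E zero c x (here refl) = [] , refl
  wk-sound E (suc m) c x zs∈ with find (∈-concatMap⁻ (λ y → if E c x y then map (y ∷_) (wk E m (suc c) y) else []) {xs = allFin n} zs∈)
  ... | y , _ , p with E c x y in eq
  ...   | true with ∈-map⁻ (y ∷_) p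
  ...     | zs' , q , refl = let w , l = wk-sound E m (suc c) y q in (eq ∷ w) , cong suc l

  end : Fin n → List (Fin n) → Fin n
  end x [] = x
  end x (z ∷ zs) = end z zs

  end-∷ʳ : ∀ x zs y → end x (zs ∷ʳ y) ≡ y
  end-∷ʳ x [] y = refl
  end-∷ʳ x (z ∷ zs) y = end-∷ʳ z zs y

  -- Walks are generated from the front, but the even case has to split off the last arc.
  ∑-wk-snoc : ∀ E m c x (F : List (Fin n) → ℕ) →
    ∑ (wk E (suc m) c x) F ≡ ∑ (wk E m c x) (λ zs → ∑ᶠ (λ y → ⟦ E (m + c) (end x zs) y ⟧ * F (zs ∷ʳ y)))
  ∑-wk-snoc E zero c x F = trans (∑-wk-suc E 0 c x F)
    (trans (∑-cong (allFin n) (λ y → cong (⟦ E c x y ⟧ *_) (+-identityʳ _))) (sym (+-identityʳ _)))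
  ∑-wk-snoc E (suc m) c x F = begin
    ∑ (wk E (suc (suc m)) c x) F
      ≡⟨ ∑-wk-suc E (suc m) c x F ⟩
    ∑ᶠ (λ y → ⟦ E c x y ⟧ * ∑ (wk E (suc m) (suc c) y) (λ zs → F (y ∷ zs)))
      ≡⟨ ∑-cong (allFin n) (λ y → cong (⟦ E c x y ⟧ *_) (∑-wk-snoc E m (suc c) y (λ zs → F (y ∷ zs)))) ⟩
    ∑ᶠ (λ y → ⟦ E c x y ⟧ * ∑ (wk E m (suc c) y) (λ zs → ∑ᶠ (λ w → ⟦ E (m + suc c) (end y zs) w ⟧ * F (y ∷ (zs ∷ʳ w)))))
      ≡⟨ ∑-cong (allFin n) (λ y → cong (⟦ E c x y ⟧ *_) (∑-cong (wk E m (suc c) y) (λ zs → ∑-cong (allFin n) (λ w →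
            cong (λ i → ⟦ E i (end y zs) w ⟧ * F (y ∷ (zs ∷ʳ w))) (+-suc m c))))) ⟩
    ∑ᶠ (λ y → ⟦ E c x y ⟧ * ∑ (wk E m (suc c) y) (λ zs → ∑ᶠ (λ w → ⟦ E (suc m + c) (end y zs) w ⟧ * F (y ∷ (zs ∷ʳ w)))))
      ≡⟨ sym (∑-wk-suc E m c x _) ⟩
    ∑ (wk E (suc m) c x) (λ zs → ∑ᶠ (λ y → ⟦ E (suc m + c) (end x zs) y ⟧ * F (zs ∷ʳ y))) ∎
    where open ≡-Reasoning

  wk-count : ∀ E ρ → (∀ c x → ∑ᶠ (λ y → ⟦ E c x y ⟧) ≤ ρ) → ∀ m c x → ∑ (wk E m c x) (λ _ → 1) ≤ ρ ^ m
  wk-count E ρ E≤ zero c x = ≤-refl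
  wk-count E ρ E≤ (suc m) c x = begin
    ∑ (wk E (suc m) c x) (λ _ → 1) ≡⟨ ∑-wk-suc E m c x (λ _ → 1) ⟩
    ∑ᶠ (λ y → ⟦ E c x y ⟧ * ∑ (wk E m (suc c) y) (λ _ → 1)) ≤⟨ ∑-mono (allFin n) (λ y → *-monoʳ-≤ ⟦ E c x y ⟧ (wk-count E ρ E≤ m (suc c) y)) ⟩
    ∑ᶠ (λ y → ⟦ E c x y ⟧ * ρ ^ m) ≡⟨ ∑-*ʳ (allFin n) _ (ρ ^ m) ⟩
    ∑ᶠ (λ y → ⟦ E c x y ⟧) * ρ ^ m ≤⟨ *-monoˡ-≤ (ρ ^ m) (E≤ c x) ⟩
    ρ * ρ ^ m ∎
    where open ≤-Reasoning

-- The recursion of `heavy-walks`: γ for walks whose first step is already heavy, and a factor γ on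
-- the later loss for the multiplicity of a light step.
heavyConst : ℕ → ℕ → ℕ
heavyConst γ zero = 0
heavyConst γ (suc m) = γ + γ * heavyConst γ m

module Colored {n : ℕ} (G : Graph n) (k : ℕ) (free : ¬ HasCycle G (2 * k))
  (out : Fin n → Fin n → Bool) (out-adj : ∀ x y → out x y ≡ true → Adj G x y)
  (ρ : ℕ) (out≤ : ∀ x → ∑ᶠ (λ y → ⟦ out x y ⟧) ≤ ρ)
  (κ : Fin n → ℕ) where

  -- Twice the constant of `sparse`, which is the in-degree that `heavy-edges` requires of a heavy
  -- vertex.
  Γ : ℕ
  Γ = 2 * (2 * k + 2)

  St : ℕ → Fin n → Fin n → Bool
  St c x y = out x y ∧ (κ y ≡ᵇ c)

  St≤ : ∀ c x → ∑ᶠ (λ y → ⟦ St c x y ⟧) ≤ ρ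
  St≤ c x = ≤-trans (∑-mono (allFin n) (λ y → ⟦⟧-mono ∧-l)) (out≤ x)

  -- The root has colour g, the backward levels have colours g-1, ..., 0, and the forward levels
  -- have colours cs, cs+1, .... Since g < cs no colour repeats, so the levels are disjoint.
  module Levels (g cs : ℕ) (g<cs : g < cs) where

    private
      inStep : ℕ → (Fin n → Bool) → Fin n → Bool
      inStep j S y = (κ y ≡ᵇ (g ∸ suc j)) ∧ ∃ᵇ (λ x → S x ∧ out y x)

      dg : ℕ → (Fin n → Bool) → Fin n → ℕ
      dg t S y = ∑ᶠ (λ x → ⟦ S x ∧ St (t + cs) x y ⟧)

      lightStep : ℕ → (Fin n → Bool) → Fin n → Bool
      lightStep t S y = (1 ≤ᵇ dg t S y) ∧ (dg t S y ≤ᵇ Γ)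

      step : ℕ → (Fin n → Bool) → Fin n → Bool
      step j S y = if j <ᵇ g then inStep j S y else lightStep (j ∸ g) S y

    -- Level 0 is the root; up to depth g the levels follow arcs backwards, beyond it they follow light arcs forwards.
    lev : Fin n → ℕ → Fin n → Bool
    lev r zero    y = (y == r) ∧ (κ y ≡ᵇ g)
    lev r (suc j) y = step j (lev r j) y

    private
      step-light : ∀ t S y → step (t + g) S y ≡ lightStep t S y
      step-light t S y rewrite <ᵇ-false {t + g} {g} (m≤n+m g t) | m+n∸n≡m t g = refl

      step-in : ∀ j S y → j < g → step j S y ≡ inStep j S y
      step-in j S y j<g rewrite true-<ᵇ j<g = refl

      col : ℕ → ℕ
      col zero = g
      col (suc j) = if j <ᵇ g then g ∸ suc j else (j ∸ g) + cs

      col-in : ∀ j → j ≤ g → col j ≡ g ∸ j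
      col-in zero _ = refl
      col-in (suc j) j<g rewrite true-<ᵇ j<g = refl

      col-out : ∀ t → col (suc (t + g)) ≡ t + cs
      col-out t rewrite <ᵇ-false {t + g} {g} (m≤n+m g t) | m+n∸n≡m t g = refl

      beyond : ∀ {j} → ¬ j ≤ g → j ≡ suc ((j ∸ suc g) + g)
      beyond {j} j≰g = trans (sym (m∸n+n≡m (≰⇒> j≰g))) (+-suc _ g)

      col-inj : ∀ i j → col i ≡ col j → i ≡ j
      col-inj i j e with i ≤? g | j ≤? g
      ... | yes p | yes q = ∸-cancelˡ-≡ p q (trans (sym (col-in i p)) (trans e (col-in j q)))
      ... | yes p | no q = ⊥-elim (<⇒≱ g<cs (≤-trans (m≤n+m cs _) (≤-trans (≤-reflexive (sym (trans (sym (col-in i p)) (trans e (trans (cong col (beyond q)) (col-out _)))))) (m∸n≤m g i))))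
      ... | no p | yes q = ⊥-elim (<⇒≱ g<cs (≤-trans (m≤n+m cs _) (≤-trans (≤-reflexive (trans (sym (col-out _)) (trans (sym (cong col (beyond p))) (trans e (col-in j q))))) (m∸n≤m g j))))
      ... | no p | no q = trans (beyond p) (trans (cong (λ t → suc (t + g)) (+-cancelʳ-≡ cs _ _
              (trans (sym (col-out _)) (trans (sym (cong col (beyond p))) (trans e (trans (cong col (beyond q)) (col-out _))))))) (sym (beyond q)))

      dg-pos : ∀ t S y → 0 < dg t S y → ∃ λ x → S x ≡ true × St (t + cs) x y ≡ true
      dg-pos t S y p with ∑ᶠ-pos⇒∃ _ p
      ... | x , q = x , ∧-l q , ∧-r {S x} q

      St-col : ∀ {c x y} → St c x y ≡ true → κ y ≡ c
      St-col {c} {x} {y} e = ≡ᵇ-true (∧-r {out x y} e)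

      lev-col : ∀ r j y → lev r j y ≡ true → κ y ≡ col j
      lev-col r zero y e = ≡ᵇ-true (∧-r {y == r} e)
      lev-col r (suc j) y e with j <ᵇ g
      ... | true = ≡ᵇ-true (∧-l e)
      ... | false with dg-pos (j ∸ g) (lev r j) y (≤ᵇ-true (∧-l e))
      ...   | x , _ , q = St-col {_} {x} {y} q

      lev-par : ∀ r j y → lev r (suc j) y ≡ true → ∃ λ x → lev r j x ≡ true × Adj G y x
      lev-par r j y e with j <ᵇ g
      ... | true with ∃ᵇ-elim {p = λ x → lev r j x ∧ out y x} (∧-r {κ y ≡ᵇ (g ∸ suc j)} e)
      ...   | x , q = x , ∧-l q , out-adj y x (∧-r {lev r j x} q)
      lev-par r j y e | false with dg-pos (j ∸ g) (lev r j) y (≤ᵇ-true (∧-l e))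
      ...   | x , p , q = x , p , trans (Graph.sym G y x) (out-adj x y (∧-l q))

      lev-root : ∀ r u v → lev r 0 u ≡ true → lev r 0 v ≡ true → u ≡ v
      lev-root r u v e e' = trans (==⇒≡ (∧-l e)) (sym (==⇒≡ (∧-l e')))

      lev-disj : ∀ r i j v → lev r i v ≡ true → lev r j v ≡ true → i ≡ j
      lev-disj r i j v e e' = col-inj i j (trans (sym (lev-col r i v e)) (lev-col r j v e'))

    module _ (r : Fin n) (t : ℕ) where
      private
        S = lev r (t + g)
        S' = lev r (suc (t + g))
        W : Fin n → Bool
        W y = Γ <ᵇ dg t S y
        E = St (t + cs)

        -- A heavy vertex is entered by a step, so it has the colour `t + cs` of the next level,
        -- which none of the levels up to `t + g` has.
        W-off : ∀ j v → j ≤ t + g → W v ≡ true → lev r j v ≡ true → ⊥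
        W-off j v j≤ w e with dg-pos t S v (≤-trans (s≤s z≤n) (<ᵇ-true w))
        ... | x , _ , q = <⇒≢ (s≤s j≤) (col-inj j (suc (t + g)) (trans (sym (lev-col r j v e)) (trans (St-col {_} {x} {v} q) (sym (col-out t)))))

        S'-deg : ∀ y → S' y ≡ true → dg t S y ≤ Γ
        S'-deg y e = ≤ᵇ-true (∧-r {1 ≤ᵇ dg t S y} (trans (sym (step-light t S y)) e))

        ¬S'-heavy : ∀ x y → S x ≡ true → E x y ≡ true → S' y ≡ false → W y ≡ true
        ¬S'-heavy x y Sx e ¬S' with dg t S y ≤? Γ
        ... | no gt = true-<ᵇ (≰⇒> gt)
        ... | yes le = contradiction (trans (sym ¬S') (trans (step-light t S y)
              (∧-intro (true-≤ᵇ (≤-trans (≤-reflexive (cong ⟦_⟧ (sym (∧-intro Sx e)))) (∑ᶠ-≥ (λ x → ⟦ S x ∧ E x y ⟧) x))) (true-≤ᵇ le)))) λ ()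

        swap-eq : ∀ (H : Fin n → ℕ) → ∑ᶠ (λ x → ⟦ S x ⟧ * ∑ᶠ (λ y → ⟦ E x y ⟧ * H y)) ≡ ∑ᶠ (λ y → dg t S y * H y)
        swap-eq H = begin
          ∑ᶠ (λ x → ⟦ S x ⟧ * ∑ᶠ (λ y → ⟦ E x y ⟧ * H y))
            ≡⟨ ∑-cong (allFin n) (λ x → sym (∑-*ˡ (allFin n) ⟦ S x ⟧ _)) ⟩
          ∑ᶠ (λ x → ∑ᶠ (λ y → ⟦ S x ⟧ * (⟦ E x y ⟧ * H y)))
            ≡⟨ ∑-swap (allFin n) (allFin n) _ ⟩
          ∑ᶠ (λ y → ∑ᶠ (λ x → ⟦ S x ⟧ * (⟦ E x y ⟧ * H y)))
            ≡⟨ ∑-cong (allFin n) (λ y → trans (∑-cong (allFin n) (λ x → trans (sym (*-assoc ⟦ S x ⟧ ⟦ E x y ⟧ (H y))) (cong (_* H y) (sym (⟦∧⟧ (S x) (E x y)))))) (∑-*ʳ (allFin n) _ (H y))) ⟩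
          ∑ᶠ (λ y → dg t S y * H y) ∎
          where open ≡-Reasoning

      light-mult : ∀ (F : Fin n → ℕ) →
        ∑ᶠ (λ x → ⟦ lev r (t + g) x ⟧ * ∑ᶠ (λ y → ⟦ St (t + cs) x y ⟧ * (⟦ lev r (suc (t + g)) y ⟧ * F y)))
          ≤ Γ * ∑ᶠ (λ y → ⟦ lev r (suc (t + g)) y ⟧ * F y)
      light-mult F = begin
        ∑ᶠ (λ x → ⟦ S x ⟧ * ∑ᶠ (λ y → ⟦ E x y ⟧ * (⟦ S' y ⟧ * F y))) ≡⟨ swap-eq _ ⟩
        ∑ᶠ (λ y → dg t S y * (⟦ S' y ⟧ * F y)) ≤⟨ ∑-mono (allFin n) pt ⟩
        ∑ᶠ (λ y → Γ * (⟦ S' y ⟧ * F y)) ≡⟨ ∑-*ˡ (allFin n) Γ _ ⟩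
        Γ * ∑ᶠ (λ y → ⟦ S' y ⟧ * F y) ∎
        where
        open ≤-Reasoning
        pt : ∀ y → dg t S y * (⟦ S' y ⟧ * F y) ≤ Γ * (⟦ S' y ⟧ * F y)
        pt y with S' y in eq
        ... | true = *-monoˡ-≤ (1 * F y) (S'-deg y eq)
        ... | false = ≤-reflexive (trans (*-zeroʳ (dg t S y)) (sym (*-zeroʳ Γ)))

      -- This is where the factor 1/ρ is gained: a step that leaves the light levels enters a heavy
      -- vertex, and `heavy-edges` allows only Γ|S| such arcs, whereas up to ρ|S| arcs leave the
      -- level.
      heavy-loss : t + g < k → ∀ (F : Fin n → ℕ) B → (∀ y → F y ≤ B) →
        ∑ᶠ (λ x → ⟦ lev r (t + g) x ⟧ * ∑ᶠ (λ y → ⟦ St (t + cs) x y ⟧ * (⟦ not (lev r (suc (t + g)) y) ⟧ * F y)))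
          ≤ Γ * card (lev r (t + g)) * B
      heavy-loss t<k F B F≤ = begin
        ∑ᶠ (λ x → ⟦ S x ⟧ * ∑ᶠ (λ y → ⟦ E x y ⟧ * (⟦ not (S' y) ⟧ * F y)))
          ≡⟨ ∑-cong (allFin n) (λ x → sym (∑-*ˡ (allFin n) ⟦ S x ⟧ _)) ⟩
        ∑ᶠ (λ x → ∑ᶠ (λ y → ⟦ S x ⟧ * (⟦ E x y ⟧ * (⟦ not (S' y) ⟧ * F y))))
          ≤⟨ ∑-mono (allFin n) (λ x → ∑-mono (allFin n) (λ y → pt x y)) ⟩
        ∑ᶠ (λ x → ∑ᶠ (λ y → ⟦ S x ∧ (W y ∧ E x y) ⟧ * B))
          ≡⟨ trans (∑-cong (allFin n) (λ x → ∑-*ʳ (allFin n) _ B)) (∑-*ʳ (allFin n) _ B) ⟩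
        edges * B
          ≤⟨ *-monoˡ-≤ B (heavy-edges (λ y w → <⇒≤ (<ᵇ-true w))) ⟩
        Γ * card S * B ∎
        where
        open ≤-Reasoning
        open Sparse G k (t + g) t<k (lev r) (lev-root r) (lev-par r) (lev-disj r) W W-off E (λ x y e → out-adj x y (∧-l e)) free
        pt : ∀ x y → ⟦ S x ⟧ * (⟦ E x y ⟧ * (⟦ not (S' y) ⟧ * F y)) ≤ ⟦ S x ∧ (W y ∧ E x y) ⟧ * B
        pt x y with S x in eS | E x y in eE | S' y in eS'
        ... | false | _ | _ = z≤n
        ... | true | false | _ = z≤n
        ... | true | true | true = z≤n
        ... | true | true | false rewrite ¬S'-heavy x y eS eE eS' = ≤-trans (≤-reflexive (trans (*-identityˡ _) (trans (*-identityˡ _) (*-identityˡ _)))) (≤-trans (F≤ y) (≤-reflexive (sym (*-identityˡ B))))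

      growth : card (lev r (suc (t + g))) ≤ ρ * card (lev r (t + g))
      growth = begin
        card S' ≤⟨ ∑-mono (allFin n) pt ⟩
        ∑ᶠ (λ y → dg t S y * 1) ≡⟨ sym (swap-eq (λ _ → 1)) ⟩
        ∑ᶠ (λ x → ⟦ S x ⟧ * ∑ᶠ (λ y → ⟦ E x y ⟧ * 1)) ≤⟨ ∑-mono (allFin n) (λ x → *-monoʳ-≤ ⟦ S x ⟧ (≤-trans (≤-reflexive (∑-cong (allFin n) (λ y → *-identityʳ _))) (St≤ (t + cs) x))) ⟩
        ∑ᶠ (λ x → ⟦ S x ⟧ * ρ) ≡⟨ trans (∑-*ʳ (allFin n) _ ρ) (*-comm _ ρ) ⟩
        ρ * card S ∎
        where
        open ≤-Reasoning
        pt : ∀ y → ⟦ S' y ⟧ ≤ dg t S y * 1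
        pt y with S' y in eq
        ... | true = ≤-trans (≤ᵇ-true {1} {dg t S y} (∧-l {1 ≤ᵇ dg t S y} (trans (sym (step-light t S y)) eq))) (≤-reflexive (sym (*-identityʳ (dg t S y))))
        ... | false = z≤n

    lightW : Fin n → ℕ → List (Fin n) → Bool
    lightW r t [] = true
    lightW r t (z ∷ zs) = lev r (suc (t + g)) z ∧ lightW r (suc t) zs

    lightW-init : ∀ r t zs y → lightW r t (zs ∷ʳ y) ≡ true → lightW r t zs ≡ true
    lightW-init r t [] y e = refl
    lightW-init r t (z ∷ zs) y e = ∧-intro (∧-l e) (lightW-init r (suc t) zs y (∧-r {lev r (suc (t + g)) z} e))

    -- A light vertex is entered at most Γ times from the level before it, so multiplicities
    -- multiply by at most Γ in each step.
    light-walks : ∀ m r t y →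
      ∑ᶠ (λ x → ⟦ lev r (t + g) x ⟧ * ∑ (wk St m (t + cs) x) (λ zs → ⟦ lightW r t zs ⟧ * ⟦ end x zs == y ⟧)) ≤ Γ ^ m
    light-walks zero r t y = begin
      ∑ᶠ (λ x → ⟦ lev r (t + g) x ⟧ * (1 * ⟦ x == y ⟧ + 0)) ≤⟨ ∑-mono (allFin n) (λ x → ≤-trans (⟦⟧*-≤ (lev r (t + g) x) _) (≤-reflexive (trans (+-identityʳ _) (*-identityˡ _)))) ⟩
      ∑ᶠ (λ x → ⟦ x == y ⟧) ≡⟨ ∑ᶠ-δ₁ y ⟩
      1 ∎
      where open ≤-Reasoning
    light-walks (suc m) r t y = begin
      ∑ᶠ (λ x → ⟦ lev r (t + g) x ⟧ * ∑ (wk St (suc m) (t + cs) x) (λ zs → ⟦ lightW r t zs ⟧ * ⟦ end x zs == y ⟧))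
        ≡⟨ ∑-cong (allFin n) (λ x → cong (⟦ lev r (t + g) x ⟧ *_) (trans (∑-wk-suc St m (t + cs) x _)
             (∑-cong (allFin n) (λ z → cong (⟦ St (t + cs) x z ⟧ *_) (trans (∑-cong (wk St m (suc t + cs) z) (λ zs →
                trans (cong (_* ⟦ end z zs == y ⟧) (⟦∧⟧ (lev r (suc (t + g)) z) (lightW r (suc t) zs))) (*-assoc ⟦ lev r (suc (t + g)) z ⟧ _ _)))
                (∑-*ˡ (wk St m (suc t + cs) z) ⟦ lev r (suc (t + g)) z ⟧ _)))))) ⟩
      ∑ᶠ (λ x → ⟦ lev r (t + g) x ⟧ * ∑ᶠ (λ z → ⟦ St (t + cs) x z ⟧ * (⟦ lev r (suc (t + g)) z ⟧ * N z)))
        ≤⟨ light-mult r t N ⟩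
      Γ * ∑ᶠ (λ z → ⟦ lev r (suc (t + g)) z ⟧ * N z)
        ≤⟨ *-monoʳ-≤ Γ (light-walks m r (suc t) y) ⟩
      Γ * Γ ^ m ∎
      where
      open ≤-Reasoning
      N : Fin n → ℕ
      N z = ∑ (wk St m (suc t + cs) z) (λ zs → ⟦ lightW r (suc t) zs ⟧ * ⟦ end z zs == y ⟧)

    private
      arith : ∀ q s p c h → q * (c * s * p) + c * (h * (q * s) * p) ≡ (c + c * h) * s * (q * p)
      arith = solve-∀

      not-∧ : ∀ a b → ⟦ not (a ∧ b) ⟧ ≡ ⟦ not a ⟧ * 1 + ⟦ a ⟧ * ⟦ not b ⟧
      not-∧ true true = refl
      not-∧ true false = refl
      not-∧ false b = refl

    -- The first step is either heavy, and `heavy-loss` applies with at most ρ^m continuations, or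
    -- light, and induction applies to the next level, which is at most ρ times larger. The factor ρ
    -- on the left expresses a loss of relative order 1/ρ.
    heavy-walks : ∀ m r t → (m + t) + g ≤ k →
      ρ * ∑ᶠ (λ x → ⟦ lev r (t + g) x ⟧ * ∑ (wk St m (t + cs) x) (λ zs → ⟦ not (lightW r t zs) ⟧))
        ≤ heavyConst Γ m * card (lev r (t + g)) * ρ ^ m
    heavy-walks zero r t _ = ≤-trans (≤-reflexive (trans (cong (ρ *_) (trans (∑-cong (allFin n) (λ x → *-zeroʳ ⟦ lev r (t + g) x ⟧)) (∑-zero (allFin n)))) (*-zeroʳ ρ))) z≤n
    heavy-walks (suc m) r t le = begin
      ρ * ∑ᶠ (λ x → ⟦ S x ⟧ * ∑ (wk St (suc m) (t + cs) x) (λ zs → ⟦ not (lightW r t zs) ⟧))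
        ≡⟨ cong (ρ *_) (∑-cong (allFin n) (λ x → cong (⟦ S x ⟧ *_) (trans (∑-wk-suc St m (t + cs) x _)
             (trans (∑-cong (allFin n) (λ z → trans (cong (⟦ St (t + cs) x z ⟧ *_) (inner z)) (*-distribˡ-+ ⟦ St (t + cs) x z ⟧ _ _)))
                    (∑-+ (allFin n) _ _))))) ⟩
      ρ * ∑ᶠ (λ x → ⟦ S x ⟧ * (∑ᶠ (λ z → ⟦ St (t + cs) x z ⟧ * (⟦ not (S' z) ⟧ * K z)) + ∑ᶠ (λ z → ⟦ St (t + cs) x z ⟧ * (⟦ S' z ⟧ * N z))))
        ≡⟨ cong (ρ *_) (trans (∑-cong (allFin n) (λ x → *-distribˡ-+ ⟦ S x ⟧ _ _)) (∑-+ (allFin n) _ _)) ⟩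
      ρ * (∑ᶠ (λ x → ⟦ S x ⟧ * ∑ᶠ (λ z → ⟦ St (t + cs) x z ⟧ * (⟦ not (S' z) ⟧ * K z))) + ∑ᶠ (λ x → ⟦ S x ⟧ * ∑ᶠ (λ z → ⟦ St (t + cs) x z ⟧ * (⟦ S' z ⟧ * N z))))
        ≤⟨ *-monoʳ-≤ ρ (+-mono-≤ (heavy-loss r t t<k K (ρ ^ m) (wk-count St ρ St≤ m (suc t + cs))) (light-mult r t N)) ⟩
      ρ * (Γ * card S * ρ ^ m + Γ * Q)
        ≡⟨ trans (*-distribˡ-+ ρ _ _) (cong (ρ * (Γ * card S * ρ ^ m) +_) (trans (sym (*-assoc ρ Γ Q)) (trans (cong (_* Q) (*-comm ρ Γ)) (*-assoc Γ ρ Q)))) ⟩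
      ρ * (Γ * card S * ρ ^ m) + Γ * (ρ * Q)
        ≤⟨ +-monoʳ-≤ (ρ * (Γ * card S * ρ ^ m)) (*-monoʳ-≤ Γ (heavy-walks m r (suc t) le')) ⟩
      ρ * (Γ * card S * ρ ^ m) + Γ * (heavyConst Γ m * card S' * ρ ^ m)
        ≤⟨ +-monoʳ-≤ (ρ * (Γ * card S * ρ ^ m)) (*-monoʳ-≤ Γ (*-monoˡ-≤ (ρ ^ m) (*-monoʳ-≤ (heavyConst Γ m) (growth r t)))) ⟩
      ρ * (Γ * card S * ρ ^ m) + Γ * (heavyConst Γ m * (ρ * card S) * ρ ^ m)
        ≡⟨ arith ρ (card S) (ρ ^ m) Γ (heavyConst Γ m) ⟩
      (Γ + Γ * heavyConst Γ m) * card S * (ρ * ρ ^ m) ∎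
      where
      open ≤-Reasoning
      S = lev r (t + g)
      S' = lev r (suc (t + g))
      K N : Fin n → ℕ
      K z = ∑ (wk St m (suc t + cs) z) (λ _ → 1)
      N z = ∑ (wk St m (suc t + cs) z) (λ zs → ⟦ not (lightW r (suc t) zs) ⟧)
      Q = ∑ᶠ (λ z → ⟦ S' z ⟧ * N z)
      inner : ∀ z → ∑ (wk St m (suc t + cs) z) (λ zs → ⟦ not (S' z ∧ lightW r (suc t) zs) ⟧) ≡ ⟦ not (S' z) ⟧ * K z + ⟦ S' z ⟧ * N z
      inner z = trans (∑-cong (wk St m (suc t + cs) z) (λ zs → not-∧ (S' z) (lightW r (suc t) zs)))
        (trans (∑-+ (wk St m (suc t + cs) z) _ _) (cong₂ _+_ (∑-*ˡ (wk St m (suc t + cs) z) ⟦ not (S' z) ⟧ _) (∑-*ˡ (wk St m (suc t + cs) z) ⟦ S' z ⟧ _)))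
      t<k : t + g < k
      t<k = ≤-trans (s≤s (+-monoˡ-≤ g (m≤n+m t m))) le
      le' : (m + suc t) + g ≤ k
      le' = ≤-trans (≤-reflexive (cong (_+ g) (+-suc m t))) le

    walk⇒lev : ∀ r j y zs → j ≤ g → κ y ≡ g ∸ j → Walk St (suc (g ∸ j)) y zs → length zs ≡ j → end y zs ≡ r → lev r j y ≡ true
    walk⇒lev r zero y [] _ ky _ _ refl = ∧-intro (==-refl y) (true-≡ᵇ ky)
    walk⇒lev r (suc j) y (z ∷ zs) j<g ky (e ∷ w) l en =
      trans (step-in j (lev r j) y j<g) (∧-intro (true-≡ᵇ ky) (∃ᵇ-intro z (∧-intro
        (walk⇒lev r j z zs (<⇒≤ j<g) (trans (St-col {_} {y} {z} e) (sym ej)) (subst (λ c → Walk St (suc c) z zs) (sym ej) w) (suc-injective l) en)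
        (∧-l e))))
      where
      ej : g ∸ j ≡ suc (g ∸ suc j)
      ej = +-∸-assoc 1 j<g

    lev-root≡ : ∀ r y → lev r 0 y ≡ true → y ≡ r
    lev-root≡ r y e = ==⇒≡ (∧-l e)

    lev-out : ∀ r j y → j < g → lev r (suc j) y ≡ true → ∃ λ x → out y x ≡ true
    lev-out r j y j<g e with ∃ᵇ-elim {p = λ x → lev r j x ∧ out y x} (∧-r {κ y ≡ᵇ (g ∸ suc j)} (trans (sym (step-in j (lev r j) y j<g)) e))
    ... | x , q = x , ∧-r {lev r j x} q

    root∈ : ∀ r → κ r ≡ g → lev r 0 r ≡ true
    root∈ r e = ∧-intro (==-refl r) (true-≡ᵇ e)

    -- Read forwards: the roots are ends of walks of j arcs from `y`. Only out-degrees enter.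
    roots≤ : ∀ j → j ≤ g → ∀ y → ∑ᶠ (λ r → ⟦ lev r j y ⟧) ≤ ρ ^ j
    roots≤ zero _ y = ≤-trans (∑-mono (allFin n) (λ r → ⟦⟧-mono {b = r == y} (λ e → subst (λ z → (z == y) ≡ true) (==⇒≡ {x = y} {r} (∧-l e)) (==-refl y)))) (≤-reflexive (∑ᶠ-δ₁ y))
    roots≤ (suc j) j<g y = begin
      ∑ᶠ (λ r → ⟦ lev r (suc j) y ⟧)
        ≤⟨ ∑-mono (allFin n) (λ r → ≤-trans (≤-reflexive (cong ⟦_⟧ (step-in j (lev r j) y j<g)))
             (≤-trans (⟦⟧-mono {(κ y ≡ᵇ (g ∸ suc j)) ∧ ∃ᵇ (λ x → lev r j x ∧ out y x)} (∧-r {κ y ≡ᵇ (g ∸ suc j)})) (any≤∑ (λ x → lev r j x ∧ out y x) (allFin n)))) ⟩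
      ∑ᶠ (λ r → ∑ᶠ (λ x → ⟦ lev r j x ∧ out y x ⟧))
        ≡⟨ ∑-swap (allFin n) (allFin n) _ ⟩
      ∑ᶠ (λ x → ∑ᶠ (λ r → ⟦ lev r j x ∧ out y x ⟧))
        ≡⟨ ∑-cong (allFin n) (λ x → trans (∑-cong (allFin n) (λ r → ⟦∧⟧ (lev r j x) (out y x))) (∑-*ʳ (allFin n) _ ⟦ out y x ⟧)) ⟩
      ∑ᶠ (λ x → ∑ᶠ (λ r → ⟦ lev r j x ⟧) * ⟦ out y x ⟧)
        ≤⟨ ∑-mono (allFin n) (λ x → *-monoˡ-≤ ⟦ out y x ⟧ (roots≤ j (<⇒≤ j<g) x)) ⟩
      ∑ᶠ (λ x → ρ ^ j * ⟦ out y x ⟧)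
        ≡⟨ ∑-*ˡ (allFin n) (ρ ^ j) _ ⟩
      ρ ^ j * ∑ᶠ (λ x → ⟦ out y x ⟧)
        ≤⟨ *-monoʳ-≤ (ρ ^ j) (out≤ y) ⟩
      ρ ^ j * ρ ≡⟨ *-comm (ρ ^ j) ρ ⟩
      ρ * ρ ^ j ∎
      where open ≤-Reasoning

-- Minors

-- The surviving branch sets form a subset of all indices, whereas a minor needs an initial segment
-- of its own as vertex set.
record Enumeration {N : ℕ} (U : Fin N → Bool) : Set where
  field
    size  : ℕ
    emb   : Fin size → Fin N
    emb-U : ∀ i → U (emb i) ≡ true
    inj   : ∀ i j → emb i ≡ emb j → i ≡ j
    index : ∀ ω → U ω ≡ true → ∃ λ i → emb i ≡ ω
    ∑-emb : ∀ (F : Fin N → ℕ) → ∑ᶠ (λ i → F (emb i)) ≡ ∑ᶠ (λ ω → ⟦ U ω ⟧ * F ω)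

enumerate : ∀ {N} (U : Fin N → Bool) → Enumeration U
enumerate {zero} U = record { size = 0 ; emb = λ () ; emb-U = λ () ; inj = λ () ; index = λ () ; ∑-emb = λ _ → refl }
enumerate {suc N} U with U zero in eq
... | false = record
    { size = size ; emb = suc ∘ emb ; emb-U = emb-U ; inj = λ i j e → inj i j (suc-inj e)
    ; index = λ { zero e → contradiction (trans (sym eq) e) λ () ; (suc ω) e → let i , p = index ω e in i , cong suc p }
    ; ∑-emb = λ F → trans (∑-emb (F ∘ suc)) (sym (trans (∑ᶠ-suc (λ ω → ⟦ U ω ⟧ * F ω)) (cong (λ b → ⟦ b ⟧ * F zero + ∑ᶠ (λ ω → ⟦ U (suc ω) ⟧ * F (suc ω))) eq))) }
  where
  open Enumeration (enumerate (U ∘ suc))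
  suc-inj : ∀ {i j : Fin N} → Fin.suc i ≡ suc j → i ≡ j
  suc-inj refl = refl
... | true = record
    { size = suc size ; emb = cons zero (suc ∘ emb) ; emb-U = λ { zero → eq ; (suc i) → emb-U i }
    ; inj = λ { zero zero e → refl ; (suc i) (suc j) e → cong suc (inj i j (suc-inj e)) }
    ; index = λ { zero e → zero , refl ; (suc ω) e → let i , p = index ω e in suc i , cong suc p }
    ; ∑-emb = λ F → trans (∑ᶠ-suc (λ i → F (cons zero (suc ∘ emb) i))) (trans (cong (F zero +_) (∑-emb (F ∘ suc)))
        (sym (trans (∑ᶠ-suc (λ ω → ⟦ U ω ⟧ * F ω)) (trans (cong (λ b → ⟦ b ⟧ * F zero + ∑ᶠ (λ ω → ⟦ U (suc ω) ⟧ * F (suc ω))) eq)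
          (cong (_+ ∑ᶠ (λ ω → ⟦ U (suc ω) ⟧ * F (suc ω))) (*-identityˡ (F zero))))))) }
  where
  open Enumeration (enumerate (U ∘ suc))
  suc-inj : ∀ {i j : Fin N} → Fin.suc i ≡ suc j → i ≡ j
  suc-inj refl = refl

module _ {n : ℕ} (G : Graph n) where

  -- An inductive form of `WalkIn`, in which concatenation and reversal are structural.
  data Conn (P : Fin n → Set) : Fin n → Fin n → Set where
    stop : ∀ {x} → P x → Conn P x x
    move : ∀ {x y z} → P x → Adj G x y → Conn P y z → Conn P x z

  conn-++ : ∀ {P x y z} → Conn P x y → Conn P y z → Conn P x z
  conn-++ (stop _)        d = d
  conn-++ (move p e c) d = move p e (conn-++ c d)

  conn-start : ∀ {P x y} → Conn P x y → P x
  conn-start (stop p) = p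
  conn-start (move p _ _) = p

  conn-sym : ∀ {P x y} → Conn P x y → Conn P y x
  conn-sym (stop p) = (stop p)
  conn-sym (move p e c) = conn-++ (conn-sym c) (move (conn-start c) (Adj-sym G e) (stop p))

  conn-map : ∀ {P Q : Fin n → Set} → (∀ {v} → P v → Q v) → ∀ {x y} → Conn P x y → Conn Q x y
  conn-map f (stop p) = stop (f p)
  conn-map f (move p e c) = move (f p) e (conn-map f c)

  conn⇒walk : ∀ {P x y} → Conn P x y → WalkIn G P x y
  conn⇒walk {x = x} (stop p) = 0 , (λ _ → x) , refl , refl , (λ { zero → p }) , (λ ())
  conn⇒walk {P = P} {x = x} (move p e c) with conn⇒walk c
  ... | ℓ , w , refl , w-end , w-in , w-adj =
    suc ℓ , cons x w , refl , w-end , (λ { zero → p ; (suc i) → w-in i }) , λ { zero → e ; (suc i) → w-adj i }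

  trail⇒conn : ∀ {P : Fin n → Set} {r x xs} → Trail G r x xs → (∀ v → v ∈ xs → P v) → ∀ {v} → v ∈ xs → Conn P r v
  trail⇒conn one h (here refl) = stop (h _ (here refl))
  trail⇒conn (e ∷ t) h (here refl) = stop (h _ (here refl))
  trail⇒conn (e ∷ t) h (there v∈) = move (h _ (here refl)) e (trail⇒conn t (λ v v∈ → h v (there v∈)) v∈)

  module BuildMinor {N : ℕ} (φ : Fin n → Maybe (Fin N)) (root : Fin N → Fin n) (U : Fin N → Bool)
    (φ-root : ∀ ω → U ω ≡ true → φ (root ω) ≡ just ω)
    (φ-conn : ∀ ω x → φ x ≡ just ω → Conn (λ z → φ z ≡ just ω) (root ω) x)
    (Eg : Fin N → Fin N → Bool)
    (Eg-U : ∀ ω ω' → Eg ω ω' ≡ true → U ω ≡ true × U ω' ≡ true × ω ≢ ω')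
    (Eg-adj : ∀ ω ω' → Eg ω ω' ≡ true → ∃ λ x → ∃ λ y → φ x ≡ just ω × φ y ≡ just ω' × Adj G x y)
    where

    open Enumeration (enumerate U) public

    private
      idx : Fin N → Maybe (Fin size)
      idx ω with U ω ≟ᵇ true
      ... | yes p = just (proj₁ (index ω p))
      ... | no _ = nothing

      idx-emb : ∀ i → idx (emb i) ≡ just i
      idx-emb i with U (emb i) ≟ᵇ true
      ... | yes p = cong just (inj _ _ (proj₂ (index (emb i) p)))
      ... | no ¬p = contradiction (emb-U i) ¬p

      emb-idx : ∀ ω i → idx ω ≡ just i → emb i ≡ ω
      emb-idx ω i e with U ω ≟ᵇ true
      emb-idx ω i refl | yes p = proj₂ (index ω p)

      bind : Maybe (Fin N) → Maybe (Fin size)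
      bind (just ω) = idx ω
      bind nothing = nothing

      φ' : Fin n → Maybe (Fin size)
      φ' x = bind (φ x)

      to : ∀ x i → φ' x ≡ just i → φ x ≡ just (emb i)
      to x i e with φ x
      ... | just ω = cong just (sym (emb-idx ω i e))

      from : ∀ x i → φ x ≡ just (emb i) → φ' x ≡ just i
      from x i e rewrite e = idx-emb i

    minor : Graph size
    minor = record
      { adj = λ i j → Eg (emb i) (emb j) ∨ Eg (emb j) (emb i)
      ; sym = λ i j → ∨-comm (Eg (emb i) (emb j)) (Eg (emb j) (emb i))
      ; irrefl = λ i → ≢true⇒≡false (λ e → irr i (∨-elim {Eg (emb i) (emb i)} e)) }
      where
      irr : ∀ i → Eg (emb i) (emb i) ≡ true ⊎ Eg (emb i) (emb i) ≡ true → ⊥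
      irr i (inj₁ e) = proj₂ (proj₂ (Eg-U _ _ e)) refl
      irr i (inj₂ e) = proj₂ (proj₂ (Eg-U _ _ e)) refl

    isMinor : IsMinor minor G
    isMinor = φ'
      , (λ i → root (emb i) , from _ i (φ-root _ (emb-U i)))
      , (λ i x y ex ey → conn⇒walk (conn-map (from _ i)
           (conn-++ (conn-sym (φ-conn _ x (to x i ex))) (φ-conn _ y (to y i ey)))))
      , (λ i j e → edge i j (∨-elim {Eg (emb i) (emb j)} e))
      where
      edge : ∀ i j → Eg (emb i) (emb j) ≡ true ⊎ Eg (emb j) (emb i) ≡ true →
             Σ (Fin n) λ x → Σ (Fin n) λ y → φ' x ≡ just i × φ' y ≡ just j × Adj G x y
      edge i j (inj₁ e) with Eg-adj _ _ e
      ... | x , y , ex , ey , a = x , y , from x i ex , from y j ey , a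
      edge i j (inj₂ e) with Eg-adj _ _ e
      ... | x , y , ex , ey , a = y , x , from y i ey , from x j ex , Adj-sym G a

    size≡card : size ≡ card U
    size≡card = begin
      size ≡⟨ sym (*-identityʳ size) ⟩
      size * 1 ≡⟨ sym (∑ᶠ-const size 1) ⟩
      ∑ᶠ {size} (λ _ → 1) ≡⟨ ∑-emb (λ _ → 1) ⟩
      ∑ᶠ (λ ω → ⟦ U ω ⟧ * 1) ≡⟨ ∑-cong (allFin N) (λ ω → *-identityʳ ⟦ U ω ⟧) ⟩
      card U ∎
      where open ≡-Reasoning

    edges≤degSum : ∑ᶠ (λ ω → ∑ᶠ (λ ω' → ⟦ Eg ω ω' ⟧)) ≤ degSum minor
    edges≤degSum = begin
      ∑ᶠ (λ ω → ∑ᶠ (λ ω' → ⟦ Eg ω ω' ⟧))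
        ≤⟨ ∑-mono (allFin N) (λ ω → ∑-mono (allFin N) (λ ω' → pt ω ω')) ⟩
      ∑ᶠ (λ ω → ∑ᶠ (λ ω' → ⟦ U ω ⟧ * (⟦ U ω' ⟧ * ⟦ Eg ω ω' ⟧)))
        ≡⟨ ∑-cong (allFin N) (λ ω → trans (∑-*ˡ (allFin N) ⟦ U ω ⟧ _) (cong (⟦ U ω ⟧ *_) (sym (∑-emb (λ ω' → ⟦ Eg ω ω' ⟧))))) ⟩
      ∑ᶠ (λ ω → ⟦ U ω ⟧ * ∑ᶠ (λ j → ⟦ Eg ω (emb j) ⟧))
        ≡⟨ sym (∑-emb (λ ω → ∑ᶠ (λ j → ⟦ Eg ω (emb j) ⟧))) ⟩
      ∑ᶠ (λ i → ∑ᶠ (λ j → ⟦ Eg (emb i) (emb j) ⟧))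
        ≤⟨ ∑-mono (allFin size) (λ i → ∑-mono (allFin size) (λ j → ⟦⟧-mono ∨-introˡ)) ⟩
      degSum minor ∎
      where
      open ≤-Reasoning
      pt : ∀ ω ω' → ⟦ Eg ω ω' ⟧ ≤ ⟦ U ω ⟧ * (⟦ U ω' ⟧ * ⟦ Eg ω ω' ⟧)
      pt ω ω' with Eg ω ω' in e
      ... | false = z≤n
      ... | true rewrite proj₁ (Eg-U ω ω' e) | proj₁ (proj₂ (Eg-U ω ω' e)) = ≤-refl

-- Random branch sets

-- `Rch v ω` means that `v` could be claimed by the branch set `ω`. The conditions `own` and `other`
-- say that the two ends of the link never compete for a vertex of the arms, so only a third chosen
-- index can disturb it.
record Link {n N : ℕ} (G : Graph n) (root : Fin N → Fin n) (Rch : Fin n → Fin N → Bool) (K : ℕ) (ω ω' : Fin N) : Set where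
  field
    armˡ armʳ : List (Fin n)
    x x'      : Fin n
    trailˡ    : Trail G (root ω) x armˡ
    trailʳ    : Trail G (root ω') x' armʳ
    bridge    : Adj G x x'
    short     : length armˡ + length armʳ ≤ K
    ownˡ      : ∀ v → v ∈ armˡ → Rch v ω ≡ true
    otherˡ    : ∀ v → v ∈ armˡ → Rch v ω' ≡ false
    ownʳ      : ∀ v → v ∈ armʳ → Rch v ω' ≡ true
    otherʳ    : ∀ v → v ∈ armʳ → Rch v ω ≡ false
    distinct  : ω ≢ ω'

trail-start∈ : ∀ {n} {G : Graph n} {x y xs} → Trail G x y xs → x ∈ xs
trail-start∈ one = here refl
trail-start∈ (_ ∷ _) = here refl

trail-end∈ : ∀ {n} {G : Graph n} {x y xs} → Trail G x y xs → y ∈ xs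
trail-end∈ one = here refl
trail-end∈ (_ ∷ t) = there (trail-end∈ t)

_∈ᵇ_ : ∀ {n} → Fin n → List (Fin n) → Bool
v ∈ᵇ xs = any (v ==_) xs

∈ᵇ-true : ∀ {n} {v : Fin n} {xs} → (v ∈ᵇ xs) ≡ true → v ∈ xs
∈ᵇ-true {v = v} {xs} e with any⇒∃ (v ==_) xs e
... | x , x∈ , p = subst (_∈ xs) (sym (==⇒≡ {x = v} p)) x∈

true-∈ᵇ : ∀ {n} {v : Fin n} {xs} → v ∈ xs → (v ∈ᵇ xs) ≡ true
true-∈ᵇ {v = v} {xs} v∈ = ∃⇒any (v ==_) xs v∈ (==-refl v)

-- Choosing every branch set independently with probability 1/q, a link survives if no other chosen branch set can reach its two arms.
module Sampling {n N : ℕ} (G : Graph n) (root : Fin N → Fin n)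
  (Rch : Fin n → Fin N → Bool) (D : ℕ) (cover : ∀ v → card (Rch v) ≤ D) (K : ℕ)
  (Lk : Fin N → Fin N → Bool) (link : ∀ ω ω' → Lk ω ω' ≡ true → Link G root Rch K ω ω')
  (Us : Fin N → Bool) (Lk-Us : ∀ ω ω' → Lk ω ω' ≡ true → Us ω ≡ true × Us ω' ≡ true)
  (q : ℕ) (pick : Fin q) (q-big : 2 * (K * D) ≤ q)
  where

  private
    instance
      q≢0 : NonZero q
      q≢0 = >-nonZero (≤-<-trans z≤n (toℕ<n pick))

    -- One link is fixed for every linked pair; the empty lists are a default for the other pairs.
    arms : Fin N → Fin N → List (Fin n) × List (Fin n)
    arms ω ω' with Lk ω ω' ≟ᵇ true
    ... | yes p = Link.armˡ (link ω ω' p) , Link.armʳ (link ω ω' p)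
    ... | no _ = [] , []

    aˡ aʳ : Fin N → Fin N → List (Fin n)
    aˡ ω ω' = proj₁ (arms ω ω')
    aʳ ω ω' = proj₂ (arms ω ω')

    getLink : ∀ ω ω' → Lk ω ω' ≡ true → Σ (Link G root Rch K ω ω') λ l → aˡ ω ω' ≡ Link.armˡ l × aʳ ω ω' ≡ Link.armʳ l
    getLink ω ω' e with Lk ω ω' ≟ᵇ true
    ... | yes p = link ω ω' p , refl , refl
    ... | no ¬p = contradiction e ¬p

    Choice : Set
    Choice = Fin N → Fin q

    sel : Choice → Fin N → Bool
    sel f ω = f ω == pick

    clash : Choice → Fin N → List (Fin n) → Bool
    clash f ω xs = any (λ v → ∃ᵇ (λ ω'' → Rch v ω'' ∧ (not (ω'' == ω) ∧ sel f ω''))) xs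

    surv : Choice → Fin N → Fin N → Bool
    surv f ω ω' = Lk ω ω' ∧ ((sel f ω ∧ sel f ω') ∧ (not (clash f ω (aˡ ω ω')) ∧ not (clash f ω' (aʳ ω ω'))))

    triple : Choice → Fin N → Fin N → Fin N → ℕ
    triple f ω ω' ω'' = ⟦ sel f ω ⟧ * (⟦ sel f ω' ⟧ * ⟦ sel f ω'' ⟧)

    -- The union bound for a clash: it counts the vertices of the arm with the chosen indices other
    -- than `o` that they reach, on the event that both ends are chosen.
    weight : Choice → Fin N → Fin N → Fin N → List (Fin n) → ℕ
    weight f o ω ω' xs = ∑ xs (λ v → ∑ᶠ (λ ω'' → ⟦ Rch v ω'' ∧ not (ω'' == o) ⟧ * triple f ω ω' ω''))

    clash-weight : ∀ f o ω ω' xs → sel f ω ≡ true → sel f ω' ≡ true → clash f o xs ≡ true → 1 ≤ weight f o ω ω' xs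
    clash-weight f o ω ω' xs e e' cl with any⇒∃ _ xs cl
    ... | v , v∈ , p with ∃ᵇ-elim {p = λ ω'' → Rch v ω'' ∧ (not (ω'' == o) ∧ sel f ω'')} p
    ...   | ω'' , r = ≤-trans (pt (Rch v ω'') (not (ω'' == o)) r e e')
                        (≤-trans (∑ᶠ-≥ (λ ω'' → ⟦ Rch v ω'' ∧ not (ω'' == o) ⟧ * triple f ω ω' ω'') ω'') (∑-∈ xs _ v∈))
      where
      pt : ∀ a b {c d d'} → a ∧ (b ∧ c) ≡ true → d ≡ true → d' ≡ true → 1 ≤ ⟦ a ∧ b ⟧ * (⟦ d ⟧ * (⟦ d' ⟧ * ⟦ c ⟧))
      pt true true refl refl refl = ≤-refl

    pointwise : ∀ f ω ω' → Lk ω ω' ≡ true → ⟦ sel f ω ⟧ * ⟦ sel f ω' ⟧ ≤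
                ⟦ surv f ω ω' ⟧ + (weight f ω ω ω' (aˡ ω ω') + weight f ω' ω ω' (aʳ ω ω'))
    pointwise f ω ω' lk = pt lk (clash-weight f ω ω ω' (aˡ ω ω')) (clash-weight f ω' ω ω' (aʳ ω ω'))
      where
      pt : ∀ {l a b c c' w w'} → l ≡ true → (a ≡ true → b ≡ true → c ≡ true → 1 ≤ w) → (a ≡ true → b ≡ true → c' ≡ true → 1 ≤ w') →
           ⟦ a ⟧ * ⟦ b ⟧ ≤ ⟦ l ∧ ((a ∧ b) ∧ (not c ∧ not c')) ⟧ + (w + w')
      pt {a = false} refl _ _ = z≤n
      pt {a = true} {false} refl _ _ = z≤n
      pt {a = true} {true} {false} {false} refl _ _ = s≤s z≤n
      pt {a = true} {true} {true} {c'} {w} {w'} refl h _ = ≤-trans (h refl refl refl) (m≤m+n w w')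
      pt {a = true} {true} {false} {true} {w} {w'} refl _ h = ≤-trans (h refl refl refl) (m≤n+m w' w)

    Fs = funs N q
    Q = q ^ N

    cube : ℕ → ℕ
    cube m = q * (q * (q * m))

    cube-∑ : ∀ {A : Set} (xs : List A) (F : A → ℕ) → cube (∑ xs F) ≡ ∑ xs (λ x → cube (F x))
    cube-∑ xs F = sym (trans (∑-*ˡ xs q _) (cong (q *_) (trans (∑-*ˡ xs q _) (cong (q *_) (∑-*ˡ xs q F)))))

    cube-*ˡ : ∀ a b → cube (a * b) ≡ a * cube b
    cube-*ˡ a b = lem q a b
      where lem : ∀ q a b → q * (q * (q * (a * b))) ≡ a * (q * (q * (q * b)))
            lem = solve-∀

    cube-mono : ∀ {a b} → a ≤ b → cube a ≤ cube b
    cube-mono le = *-monoʳ-≤ q (*-monoʳ-≤ q (*-monoʳ-≤ q le))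

    cube-+ : ∀ a b → cube (a + b) ≡ cube a + cube b
    cube-+ a b = lem q a b
      where lem : ∀ q a b → q * (q * (q * (a + b))) ≡ q * (q * (q * a)) + q * (q * (q * b))
            lem = solve-∀

    -- By `sep` the disturbing index differs from both ends, so the three choices are independent
    -- and have joint probability 1/q³. There are at most `D` such indices for each vertex of the
    -- arm.
    weight≤ : ∀ o ω ω' xs → ω ≢ ω' → (∀ v ω'' → v ∈ xs → Rch v ω'' ≡ true → ω'' ≢ o → ω'' ≢ ω × ω'' ≢ ω') →
              cube (∑ Fs (λ f → weight f o ω ω' xs)) ≤ length xs * D * Q
    weight≤ o ω ω' xs ω≢ω' sep = begin
      cube (∑ Fs (λ f → weight f o ω ω' xs))
        ≡⟨ cong cube (trans (∑-swap Fs xs _) (∑-cong xs (λ v → trans (∑-swap Fs (allFin N) _) (∑-cong (allFin N) (λ ω'' → ∑-*ˡ Fs ⟦ Rch v ω'' ∧ not (ω'' == o) ⟧ (λ f → triple f ω ω' ω'')))))) ⟩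
      cube (∑ xs (λ v → ∑ᶠ (λ ω'' → ⟦ Rch v ω'' ∧ not (ω'' == o) ⟧ * ∑ Fs (λ f → triple f ω ω' ω''))))
        ≡⟨ trans (cube-∑ xs _) (∑-cong xs (λ v → trans (cube-∑ (allFin N) _) (∑-cong (allFin N) (λ ω'' → cube-*ˡ ⟦ Rch v ω'' ∧ not (ω'' == o) ⟧ (∑ Fs (λ f → triple f ω ω' ω'')))))) ⟩
      ∑ xs (λ v → ∑ᶠ (λ ω'' → ⟦ Rch v ω'' ∧ not (ω'' == o) ⟧ * cube (∑ Fs (λ f → triple f ω ω' ω''))))
        ≤⟨ ∑-mono-∈ xs (λ v v∈ → ∑-mono (allFin N) (λ ω'' → pt v v∈ ω'')) ⟩
      ∑ xs (λ v → ∑ᶠ (λ ω'' → ⟦ Rch v ω'' ⟧ * Q))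
        ≤⟨ ∑-mono xs (λ v → ≤-trans (≤-reflexive (∑-*ʳ (allFin N) _ Q)) (*-monoˡ-≤ Q (cover v))) ⟩
      ∑ xs (λ v → D * Q)
        ≡⟨ trans (∑-const xs (D * Q)) (sym (*-assoc (length xs) D Q)) ⟩
      length xs * D * Q ∎
      where
      open ≤-Reasoning
      pt : ∀ v → v ∈ xs → ∀ ω'' → ⟦ Rch v ω'' ∧ not (ω'' == o) ⟧ * cube (∑ Fs (λ f → triple f ω ω' ω'')) ≤ ⟦ Rch v ω'' ⟧ * Q
      pt v v∈ ω'' with Rch v ω'' in r | ω'' ≟ o
      ... | false | _ = z≤n
      ... | true | yes _ = z≤n
      ... | true | no ne with sep v ω'' v∈ r ne
      ...   | n1 , n2 = *-monoʳ-≤ 1 (≤-reflexive (∑-funs-3 N q pick pick pick ω≢ω' (n1 ∘ sym) (n2 ∘ sym)))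

    S : Fin N → Fin N → ℕ
    S ω ω' = ∑ Fs (λ f → ⟦ surv f ω ω' ⟧)

    -- In units of 1/q³, both ends being chosen contributes q and the union bound takes away at most
    -- KD ≤ q/2. So a link survives with probability at least 1/(2q²).
    link-survives : ∀ ω ω' → Lk ω ω' ≡ true → q * Q ≤ 2 * cube (S ω ω')
    link-survives ω ω' lk with getLink ω ω' lk
    ... | l , el , er = final
      where
      open Link l
      open ≤-Reasoning
      wˡ = ∑ Fs (λ f → weight f ω ω ω' (aˡ ω ω'))
      wʳ = ∑ Fs (λ f → weight f ω' ω ω' (aʳ ω ω'))
      base : q * Q ≤ cube (S ω ω') + K * D * Q
      base = begin
        q * Q
          ≡⟨ cong (q *_) (sym (∑-funs-2 N q pick pick distinct)) ⟩
        cube (∑ Fs (λ f → ⟦ sel f ω ⟧ * ⟦ sel f ω' ⟧))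
          ≤⟨ cube-mono (∑-mono Fs (λ f → pointwise f ω ω' lk)) ⟩
        cube (∑ Fs (λ f → ⟦ surv f ω ω' ⟧ + (weight f ω ω ω' (aˡ ω ω') + weight f ω' ω ω' (aʳ ω ω'))))
          ≡⟨ cong cube (trans (∑-+ Fs _ _) (cong (S ω ω' +_) (∑-+ Fs _ _))) ⟩
        cube (S ω ω' + (wˡ + wʳ))
          ≡⟨ trans (cube-+ (S ω ω') _) (cong (cube (S ω ω') +_) (cube-+ wˡ wʳ)) ⟩
        cube (S ω ω') + (cube wˡ + cube wʳ)
          ≤⟨ +-monoʳ-≤ (cube (S ω ω')) (+-mono-≤ (weight≤ ω ω ω' (aˡ ω ω') distinct sepˡ) (weight≤ ω' ω ω' (aʳ ω ω') distinct sepʳ)) ⟩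
        cube (S ω ω') + (length (aˡ ω ω') * D * Q + length (aʳ ω ω') * D * Q)
          ≡⟨ cong (cube (S ω ω') +_) (trans (sym (*-distribʳ-+ Q (length (aˡ ω ω') * D) _)) (cong (_* Q) (sym (*-distribʳ-+ D (length (aˡ ω ω')) _)))) ⟩
        cube (S ω ω') + (length (aˡ ω ω') + length (aʳ ω ω')) * D * Q
          ≤⟨ +-monoʳ-≤ (cube (S ω ω')) (*-monoˡ-≤ Q (*-monoˡ-≤ D (subst₂ (λ a b → length a + length b ≤ K) (sym el) (sym er) short))) ⟩
        cube (S ω ω') + K * D * Q ∎
        where
        sepˡ : ∀ v ω'' → v ∈ aˡ ω ω' → Rch v ω'' ≡ true → ω'' ≢ ω → ω'' ≢ ω × ω'' ≢ ω'
        sepˡ v ω'' v∈ r ne = ne , λ { refl → contradiction (trans (sym r) (otherˡ v (subst (v ∈_) el v∈))) λ () }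
        sepʳ : ∀ v ω'' → v ∈ aʳ ω ω' → Rch v ω'' ≡ true → ω'' ≢ ω' → ω'' ≢ ω × ω'' ≢ ω'
        sepʳ v ω'' v∈ r ne = (λ { refl → contradiction (trans (sym r) (otherʳ v (subst (v ∈_) er v∈))) λ () }) , ne
      final : q * Q ≤ 2 * cube (S ω ω')
      final = +-cancelʳ-≤ (q * Q) _ _ (begin
        q * Q + q * Q ≤⟨ +-mono-≤ base base ⟩
        (cube (S ω ω') + K * D * Q) + (cube (S ω ω') + K * D * Q) ≡⟨ rearr (cube (S ω ω')) (K * D) Q ⟩
        2 * cube (S ω ω') + 2 * (K * D) * Q ≤⟨ +-monoʳ-≤ (2 * cube (S ω ω')) (*-monoˡ-≤ Q q-big) ⟩
        2 * cube (S ω ω') + q * Q ∎)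
        where rearr : ∀ a b c → (a + b * c) + (a + b * c) ≡ 2 * a + 2 * b * c
              rearr = solve-∀

    M : ℕ
    M = ∑ᶠ (λ ω → ∑ᶠ (λ ω' → ⟦ Lk ω ω' ⟧))

    total : Choice → ℕ
    total f = ∑ᶠ (λ ω → ∑ᶠ (λ ω' → ⟦ surv f ω ω' ⟧))

    used : Choice → ℕ
    used f = ∑ᶠ (λ ω → ⟦ Us ω ⟧ * ⟦ sel f ω ⟧)

    total-sum : M * (q * Q) ≤ 2 * cube (∑ Fs total)
    total-sum = begin
      M * (q * Q)
        ≡⟨ trans (sym (∑-*ʳ (allFin N) _ (q * Q))) (∑-cong (allFin N) (λ ω → sym (∑-*ʳ (allFin N) _ (q * Q)))) ⟩
      ∑ᶠ (λ ω → ∑ᶠ (λ ω' → ⟦ Lk ω ω' ⟧ * (q * Q)))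
        ≤⟨ ∑-mono (allFin N) (λ ω → ∑-mono (allFin N) (λ ω' → pt ω ω')) ⟩
      ∑ᶠ (λ ω → ∑ᶠ (λ ω' → 2 * cube (S ω ω')))
        ≡⟨ trans (∑-cong (allFin N) (λ ω → ∑-*ˡ (allFin N) 2 _)) (∑-*ˡ (allFin N) 2 _) ⟩
      2 * ∑ᶠ (λ ω → ∑ᶠ (λ ω' → cube (S ω ω')))
        ≡⟨ cong (2 *_) (sym (trans (cong cube (trans (∑-swap Fs (allFin N) _) (∑-cong (allFin N) (λ ω → ∑-swap Fs (allFin N) _))))
             (trans (cube-∑ (allFin N) _) (∑-cong (allFin N) (λ ω → cube-∑ (allFin N) _))))) ⟩
      2 * cube (∑ Fs total) ∎
      where
      open ≤-Reasoning
      pt : ∀ ω ω' → ⟦ Lk ω ω' ⟧ * (q * Q) ≤ 2 * cube (S ω ω')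
      pt ω ω' = ⟦⟧*-bound (Lk ω ω') (link-survives ω ω')

    used-sum : q * ∑ Fs used ≡ card Us * Q
    used-sum = begin
      q * ∑ Fs used
        ≡⟨ cong (q *_) (trans (∑-swap Fs (allFin N) _) (∑-cong (allFin N) (λ ω → ∑-*ˡ Fs ⟦ Us ω ⟧ _))) ⟩
      q * ∑ᶠ (λ ω → ⟦ Us ω ⟧ * ∑ Fs (λ f → ⟦ sel f ω ⟧))
        ≡⟨ sym (∑-*ˡ (allFin N) q _) ⟩
      ∑ᶠ (λ ω → q * (⟦ Us ω ⟧ * ∑ Fs (λ f → ⟦ sel f ω ⟧)))
        ≡⟨ ∑-cong (allFin N) (λ ω → trans (lem q ⟦ Us ω ⟧ _) (cong (⟦ Us ω ⟧ *_) (∑-funs-1 N q ω pick))) ⟩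
      ∑ᶠ (λ ω → ⟦ Us ω ⟧ * Q)
        ≡⟨ ∑-*ʳ (allFin N) _ Q ⟩
      card Us * Q ∎
      where
      open ≡-Reasoning
      lem : ∀ a b c → a * (b * c) ≡ b * (a * c)
      lem = solve-∀

    -- `used` has mean |Us|/q and `total` has mean at least M/(2q²). The constant 4 instead of 2
    -- makes the comparison strict, which later excludes an empty minor.
    choice : 0 < M → ∃ λ f → M * used f < 4 * q * card Us * total f
    choice M>0 = ∑-<⇒∃ Fs (λ f → M * used f) (λ f → 4 * q * card Us * total f)
        (*-cancelˡ-< (q * q) (∑ Fs (λ f → M * used f)) (∑ Fs (λ f → 4 * q * card Us * total f)) (begin-strict
          q * q * ∑ Fs (λ f → M * used f)   ≡⟨ cong (q * q *_) (∑-*ˡ Fs M used) ⟩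
          q * q * (M * ∑ Fs used)           ≡⟨ e1 q M (∑ Fs used) ⟩
          q * M * (q * ∑ Fs used)           ≡⟨ cong (q * M *_) used-sum ⟩
          q * M * (card Us * Q)             <⟨ doubled ⟩
          2 * card Us * (M * (q * Q))       ≤⟨ *-monoʳ-≤ (2 * card Us) total-sum ⟩
          2 * card Us * (2 * cube (∑ Fs total)) ≡⟨ e2 q (card Us) (∑ Fs total) ⟩
          q * q * (4 * q * card Us * ∑ Fs total) ≡⟨ cong (q * q *_) (sym (∑-*ˡ Fs (4 * q * card Us) total)) ⟩
          q * q * ∑ Fs (λ f → 4 * q * card Us * total f) ∎))
      where
      open ≤-Reasoning
      e1 : ∀ q m s → q * q * (m * s) ≡ q * m * (q * s)
      e1 = solve-∀
      e2 : ∀ q u s → 2 * u * (2 * (q * (q * (q * s)))) ≡ q * q * (4 * q * u * s)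
      e2 = solve-∀
      e3 : ∀ q m u c → 2 * u * (m * (q * c)) ≡ q * m * (u * c) + q * m * (u * c)
      e3 = solve-∀
      Us>0 : 0 < card Us
      Us>0 with ∑-<⇒∃ (allFin N) (λ _ → 0) (λ ω → ∑ᶠ (λ ω' → ⟦ Lk ω ω' ⟧)) (subst (_< M) (sym (∑-zero (allFin N))) M>0)
      ... | ω , p with ∑ᶠ-pos⇒∃ (Lk ω) p
      ...   | ω' , lk = ≤-trans (≤-reflexive (cong ⟦_⟧ (sym (proj₁ (Lk-Us ω ω' lk))))) (∑ᶠ-≥ (λ ω → ⟦ Us ω ⟧) ω)
      pos : 0 < q * M * (card Us * Q)
      pos = *-mono-≤ (*-mono-≤ (>-nonZero⁻¹ q) M>0) (*-mono-≤ Us>0 (m^n>0 q N))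
      doubled : q * M * (card Us * Q) < 2 * card Us * (M * (q * Q))
      doubled = subst (q * M * (card Us * Q) <_) (sym (e3 q M (card Us) Q)) (m<m+n _ pos)

    module Chosen (f : Choice) where

      s : Fin N → Fin N → Bool
      s = surv f

      s-lk : ∀ ω ω' → s ω ω' ≡ true → Lk ω ω' ≡ true
      s-lk ω ω' e = ∧-l e

      s-sel : ∀ ω ω' → s ω ω' ≡ true → sel f ω ≡ true × sel f ω' ≡ true
      s-sel ω ω' e = ∧-l {sel f ω} p , ∧-r {sel f ω} p
        where p = ∧-l {sel f ω ∧ sel f ω'} (∧-r {Lk ω ω'} e)

      not-true : ∀ {b} → not b ≡ true → b ≡ true → ⊥
      not-true {true} () _

      private
        noclash : ∀ o xs → not (clash f o xs) ≡ true → ∀ v ω'' → v ∈ xs → Rch v ω'' ≡ true → sel f ω'' ≡ true → ω'' ≡ o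
        noclash o xs nc v ω'' v∈ r se with ω'' ≟ o in eq
        ... | yes p = p
        ... | no ne = ⊥-elim (not-true nc (∃⇒any _ xs v∈ (∃ᵇ-intro ω'' (∧-intro r (∧-intro (cong not (≢⇒== ne)) se)))))

      s-clashˡ : ∀ ω ω' → s ω ω' ≡ true → ∀ v ω'' → v ∈ aˡ ω ω' → Rch v ω'' ≡ true → sel f ω'' ≡ true → ω'' ≡ ω
      s-clashˡ ω ω' e = noclash ω (aˡ ω ω') (∧-l (∧-r {sel f ω ∧ sel f ω'} (∧-r {Lk ω ω'} e)))

      s-clashʳ : ∀ ω ω' → s ω ω' ≡ true → ∀ v ω'' → v ∈ aʳ ω ω' → Rch v ω'' ≡ true → sel f ω'' ≡ true → ω'' ≡ ω'
      s-clashʳ ω ω' e = noclash ω' (aʳ ω ω') (∧-r {not (clash f ω (aˡ ω ω'))} (∧-r {sel f ω ∧ sel f ω'} (∧-r {Lk ω ω'} e)))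

      In : Fin N → Fin n → Set
      In ω v = (∃ λ ω' → s ω ω' ≡ true × v ∈ aˡ ω ω') ⊎ (∃ λ ω' → s ω' ω ≡ true × v ∈ aʳ ω' ω)

      inᵇ : Fin N → Fin n → Bool
      inᵇ ω v = ∃ᵇ (λ ω' → (s ω ω' ∧ (v ∈ᵇ aˡ ω ω')) ∨ (s ω' ω ∧ (v ∈ᵇ aʳ ω' ω)))

      inᵇ-true : ∀ ω v → inᵇ ω v ≡ true → In ω v
      inᵇ-true ω v e with ∃ᵇ-elim {p = λ ω' → (s ω ω' ∧ (v ∈ᵇ aˡ ω ω')) ∨ (s ω' ω ∧ (v ∈ᵇ aʳ ω' ω))} e
      ... | ω' , p with ∨-elim {s ω ω' ∧ (v ∈ᵇ aˡ ω ω')} p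
      ...   | inj₁ l = inj₁ (ω' , ∧-l l , ∈ᵇ-true (∧-r {s ω ω'} l))
      ...   | inj₂ r = inj₂ (ω' , ∧-l r , ∈ᵇ-true (∧-r {s ω' ω} r))

      true-inᵇ : ∀ ω v → In ω v → inᵇ ω v ≡ true
      true-inᵇ ω v (inj₁ (ω' , p , v∈)) = ∃ᵇ-intro ω' (∨-introˡ (∧-intro p (true-∈ᵇ v∈)))
      true-inᵇ ω v (inj₂ (ω' , p , v∈)) = ∃ᵇ-intro ω' (∨-introʳ {s ω ω' ∧ (v ∈ᵇ aˡ ω ω')} (∧-intro p (true-∈ᵇ v∈)))

      In-reach : ∀ ω v → In ω v → Rch v ω ≡ true × sel f ω ≡ true
      In-reach ω v (inj₁ (ω' , p , v∈)) with getLink ω ω' (s-lk ω ω' p)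
      ... | l , el , er = Link.ownˡ l v (subst (v ∈_) el v∈) , proj₁ (s-sel ω ω' p)
      In-reach ω v (inj₂ (ω' , p , v∈)) with getLink ω' ω (s-lk ω' ω p)
      ... | l , el , er = Link.ownʳ l v (subst (v ∈_) er v∈) , proj₂ (s-sel ω' ω p)

      -- Disjointness of the branch sets: membership in `ω₂` means that `v` reaches the chosen index
      -- `ω₂`, but on a surviving arm of `ω` no chosen index other than `ω` is reached.
      In-unique : ∀ ω ω₂ v → In ω v → In ω₂ v → ω₂ ≡ ω
      In-unique ω ω₂ v (inj₁ (ω' , p , v∈)) i₂ = s-clashˡ ω ω' p v ω₂ v∈ (proj₁ (In-reach ω₂ v i₂)) (proj₂ (In-reach ω₂ v i₂))
      In-unique ω ω₂ v (inj₂ (ω' , p , v∈)) i₂ = s-clashʳ ω' ω p v ω₂ v∈ (proj₁ (In-reach ω₂ v i₂)) (proj₂ (In-reach ω₂ v i₂))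

      φ : Fin n → Maybe (Fin N)
      φ v with ∃ᵇ (λ ω → inᵇ ω v) ≟ᵇ true
      ... | yes e = just (proj₁ (∃ᵇ-elim {p = λ ω → inᵇ ω v} e))
      ... | no _ = nothing

      φ-In : ∀ ω v → φ v ≡ just ω → In ω v
      φ-In ω v e with ∃ᵇ (λ ω → inᵇ ω v) ≟ᵇ true
      φ-In ω v refl | yes e = inᵇ-true _ v (proj₂ (∃ᵇ-elim {p = λ ω → inᵇ ω v} e))

      In-φ : ∀ ω v → In ω v → φ v ≡ just ω
      In-φ ω v i with ∃ᵇ (λ ω → inᵇ ω v) ≟ᵇ true
      ... | yes e = cong just (In-unique ω _ v i (inᵇ-true _ v (proj₂ (∃ᵇ-elim {p = λ ω → inᵇ ω v} e))))
      ... | no ¬e = contradiction (∃ᵇ-intro ω (true-inᵇ ω v i)) ¬e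

      U : Fin N → Bool
      U ω = inᵇ ω (root ω)

      rootˡ : ∀ ω ω' → s ω ω' ≡ true → root ω ∈ aˡ ω ω'
      rootˡ ω ω' p with getLink ω ω' (s-lk ω ω' p)
      ... | l , el , er = subst (root ω ∈_) (sym el) (trail-start∈ (Link.trailˡ l))

      rootʳ : ∀ ω ω' → s ω ω' ≡ true → root ω' ∈ aʳ ω ω'
      rootʳ ω ω' p with getLink ω ω' (s-lk ω ω' p)
      ... | l , el , er = subst (root ω' ∈_) (sym er) (trail-start∈ (Link.trailʳ l))

      φ-conn : ∀ ω x → φ x ≡ just ω → Conn G (λ z → φ z ≡ just ω) (root ω) x
      φ-conn ω x e with φ-In ω x e
      ... | inj₁ (ω' , p , x∈) with getLink ω ω' (s-lk ω ω' p)
      ...   | l , el , er = trail⇒conn G (subst (Trail G (root ω) (Link.x l)) (sym el) (Link.trailˡ l)) (λ v v∈ → In-φ ω v (inj₁ (ω' , p , v∈))) x∈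
      φ-conn ω x e | inj₂ (ω' , p , x∈) with getLink ω' ω (s-lk ω' ω p)
      ...   | l , el , er = trail⇒conn G (subst (Trail G (root ω) (Link.x' l)) (sym er) (Link.trailʳ l)) (λ v v∈ → In-φ ω v (inj₂ (ω' , p , v∈))) x∈

      s-U : ∀ ω ω' → s ω ω' ≡ true → U ω ≡ true × U ω' ≡ true × ω ≢ ω'
      s-U ω ω' p = true-inᵇ ω _ (inj₁ (ω' , p , rootˡ ω ω' p)) , true-inᵇ ω' _ (inj₂ (ω , p , rootʳ ω ω' p))
                 , Link.distinct (proj₁ (getLink ω ω' (s-lk ω ω' p)))

      s-adj : ∀ ω ω' → s ω ω' ≡ true → ∃ λ x → ∃ λ y → φ x ≡ just ω × φ y ≡ just ω' × Adj G x y
      s-adj ω ω' p with getLink ω ω' (s-lk ω ω' p)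
      ... | l , el , er = Link.x l , Link.x' l
        , In-φ ω _ (inj₁ (ω' , p , subst (Link.x l ∈_) (sym el) (trail-end∈ (Link.trailˡ l))))
        , In-φ ω' _ (inj₂ (ω , p , subst (Link.x' l ∈_) (sym er) (trail-end∈ (Link.trailʳ l))))
        , Link.bridge l

      open BuildMinor G φ root U (λ ω u → In-φ ω _ (inᵇ-true ω _ u)) φ-conn s s-U s-adj public

      U-used : card U ≤ used f
      U-used = ∑-mono (allFin N) pt
        where
        usd : ∀ ω → In ω (root ω) → Us ω ≡ true
        usd ω (inj₁ (ω' , p , _)) = proj₁ (Lk-Us ω ω' (s-lk ω ω' p))
        usd ω (inj₂ (ω' , p , _)) = proj₂ (Lk-Us ω' ω (s-lk ω' ω p))
        pt : ∀ ω → ⟦ U ω ⟧ ≤ ⟦ Us ω ⟧ * ⟦ sel f ω ⟧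
        pt ω = ≤-trans (⟦⟧-mono {U ω} {Us ω ∧ sel f ω} (λ u → ∧-intro (usd ω (inᵇ-true ω (root ω) u)) (proj₂ (In-reach ω (root ω) (inᵇ-true ω (root ω) u)))))
                       (≤-reflexive (⟦∧⟧ (Us ω) (sel f ω)))

    conclude : ∀ f → M * used f < 4 * q * card Us * total f → Σ ℕ λ m → Σ (Graph (suc m)) λ H → IsMinor H G ×
      M * suc m ≤ 4 * q * card Us * degSum H
    conclude f lt = pack C.size C.minor C.isMinor (≤-trans (≤-reflexive C.size≡card) C.U-used) C.edges≤degSum
      where
      module C = Chosen f
      pack : ∀ m (H : Graph m) → IsMinor H G → m ≤ used f → total f ≤ degSum H → Σ ℕ λ m → Σ (Graph (suc m)) λ H → IsMinor H G ×
        M * suc m ≤ 4 * q * card Us * degSum H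
      -- A graph without vertices has degree sum 0, against the strict inequality.
      pack zero H _ _ t≤ = ⊥-elim (n≮0 (≤-trans lt (≤-trans (*-monoʳ-≤ (4 * q * card Us) t≤) (≤-reflexive (*-zeroʳ (4 * q * card Us))))))
      pack (suc m) H isM m≤ t≤ = m , H , isM , ≤-trans (*-monoʳ-≤ M m≤) (≤-trans (<⇒≤ lt) (*-monoʳ-≤ (4 * q * card Us) t≤))

  dense-minor : 0 < ∑ᶠ (λ ω → ∑ᶠ (λ ω' → ⟦ Lk ω ω' ⟧)) → Σ ℕ λ m → Σ (Graph (suc m)) λ H → IsMinor H G ×
    ∑ᶠ (λ ω → ∑ᶠ (λ ω' → ⟦ Lk ω ω' ⟧)) * suc m ≤ 4 * q * card Us * degSum H
  dense-minor M>0 = conclude (proj₁ (choice M>0)) (proj₂ (choice M>0))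

-- Digraphs of constant out-degree and colourings

trim : ∀ {n} (p : Fin n → Bool) ρ → ρ ≤ card p → ∃ λ p' → (∀ v → p' v ≡ true → p v ≡ true) × card p' ≡ ρ
trim {zero} p zero _ = (λ ()) , (λ ()) , refl
trim {suc n} p zero _ = (λ _ → false) , (λ _ ()) , ∑-zero (allFin (suc n))
trim {suc n} p (suc ρ) le = go (p zero) refl (≤-trans le (≤-reflexive (∑ᶠ-suc (λ v → ⟦ p v ⟧))))
  where
  go : ∀ b → p zero ≡ b → suc ρ ≤ ⟦ b ⟧ + card (p ∘ suc) → ∃ λ p' → (∀ v → p' v ≡ true → p v ≡ true) × card p' ≡ suc ρ
  go true eq le' with trim (p ∘ suc) ρ (s≤s⁻¹ le')
  ... | p' , sub , c = cons true p' , (λ { zero _ → eq ; (suc v) e → sub v e }) , trans (∑ᶠ-suc (λ v → ⟦ cons true p' v ⟧)) (cong suc c)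
  go false eq le' with trim (p ∘ suc) (suc ρ) le'
  ... | p' , sub , c = cons false p' , (λ { zero () ; (suc v) e → sub v e }) , trans (∑ᶠ-suc (λ v → ⟦ cons false p' v ⟧)) c

record Digraph {n : ℕ} (E : Fin n → Fin n → Bool) (ρ : ℕ) : Set where
  field
    U       : Fin n → Bool
    point   : Fin n
    inside  : U point ≡ true
    out     : Fin n → Fin n → Bool
    out-E   : ∀ x y → out x y ≡ true → E x y ≡ true
    out-U   : ∀ x y → out x y ≡ true → U x ≡ true × U y ≡ true
    out-deg : ∀ x → U x ≡ true → card (out x) ≡ ρ

  out≤ : ∀ x → card (out x) ≤ ρ
  out≤ x with U x ≟ᵇ true
  ... | yes u = ≤-reflexive (out-deg x u)
  ... | no ¬u = ≤-trans (∑-mono (allFin n) (λ y → ⟦⟧-mono {out x y} {false} (λ e → ⊥-elim (¬u (proj₁ (out-U x y e)))))) (≤-trans (≤-reflexive (∑-zero (allFin n))) z≤n)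

-- Every core vertex keeps exactly ρ of its core edges as out-arcs. An edge may be kept from both
-- ends, and the choice does not control in-degrees.
core⇒digraph : ∀ {n} (E : Fin n → Fin n → Bool) (E-sym : ∀ v w → E v w ≡ E w v) {ρ C U₀} → ρ ≤ C → Core E E-sym C U₀ → Digraph E ρ
core⇒digraph {n} E E-sym {ρ} ρ≤C c = record
    { U = V ; point = point ; inside = inside ; out = out'
    ; out-E = λ x y e → ∧-r {V y} (sub' x y e)
    ; out-U = λ x y e → ∧-l e , ∧-l (sub' x y e)
    ; out-deg = λ x u → trans (∑-cong (allFin n) (λ y → cong (λ b → ⟦ b ∧ ch x (V x ≟ᵇ true) y ⟧) u)) (ch-card x u) }
  where
  open Core c
  ch : ∀ x → Dec (V x ≡ true) → Fin n → Bool
  ch x (yes u) = proj₁ (trim (λ y → V y ∧ E x y) ρ (≤-trans ρ≤C (<⇒≤ (degree> x u))))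
  ch x (no _) = λ _ → false
  ch-card : ∀ x u → card (ch x (V x ≟ᵇ true)) ≡ ρ
  ch-card x u with V x ≟ᵇ true
  ... | yes u' = proj₂ (proj₂ (trim (λ y → V y ∧ E x y) ρ (≤-trans ρ≤C (<⇒≤ (degree> x u')))))
  ... | no ¬u = contradiction u ¬u
  out' : Fin n → Fin n → Bool
  out' x y = V x ∧ ch x (V x ≟ᵇ true) y
  sub' : ∀ x y → out' x y ≡ true → V y ∧ E x y ≡ true
  sub' x y e with V x ≟ᵇ true
  ... | yes u' = proj₁ (proj₂ (trim (λ y → V y ∧ E x y) ρ (≤-trans ρ≤C (<⇒≤ (degree> x u'))))) y (∧-r {V x} e)
  ... | no ¬u = ⊥-elim (¬u (∧-l e))

rep : ∀ {n} → List (Fin n) → List (Fin n) → Bool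
rep av [] = false
rep av (z ∷ zs) = (z ∈ᵇ av) ∨ rep (z ∷ av) zs

rep-false : ∀ {n} (av zs : List (Fin n)) → rep av zs ≡ false → (∀ {z} → z ∈ zs → z ∉ av) × Unique zs
rep-false av [] e = (λ ()) , []
rep-false av (z ∷ zs) e with z ∈ᵇ av in ea
... | false with rep-false (z ∷ av) zs e
...   | off , u = (λ { (here refl) z∈ → contradiction (trans (sym ea) (true-∈ᵇ z∈)) λ () ; (there x∈) x∈av → off x∈ (there x∈av) })
                , ¬Any⇒All¬ zs (λ z∈ → off z∈ (here refl)) ∷ u

∈ᵇ-count : ∀ {n} (av : List (Fin n)) → ∑ᶠ (λ y → ⟦ y ∈ᵇ av ⟧) ≤ length av
∈ᵇ-count av = ≤-trans (∑-mono (allFin _) (λ y → any≤∑ (y ==_) av))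
  (≤-reflexive (trans (∑-swap (allFin _) av (λ y x → ⟦ y == x ⟧)) (trans (∑-cong av (λ x → ∑ᶠ-δ₁ x)) (trans (∑-const av 1) (*-identityʳ _)))))

okFrom : ∀ {n} → (Fin n → ℕ) → ℕ → List (Fin n) → Bool
okFrom κ c [] = true
okFrom κ c (z ∷ zs) = (κ z ≡ᵇ c) ∧ okFrom κ (suc c) zs

okFrom-++ : ∀ {n} (κ : Fin n → ℕ) c xs ys → okFrom κ c (xs ++ ys) ≡ okFrom κ c xs ∧ okFrom κ (length xs + c) ys
okFrom-++ κ c [] ys = refl
okFrom-++ κ c (x ∷ xs) ys with κ x ≡ᵇ c
... | false = refl
... | true = trans (okFrom-++ κ (suc c) xs ys) (cong (λ i → okFrom κ (suc c) xs ∧ okFrom κ i ys) (+-suc (length xs) c))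

module _ {n q : ℕ} where

  private
    ok : (Fin n → Fin q) → ℕ → List (Fin n) → Bool
    ok f = okFrom (toℕ ∘ f)

    color-eq : ∀ c (c<q : c < q) (x : Fin q) → (toℕ x ≡ᵇ c) ≡ (x == fromℕ< c<q)
    color-eq c c<q x with x ≟ fromℕ< c<q
    ... | yes refl = true-≡ᵇ (toℕ-fromℕ< c<q)
    ... | no ne = ≢true⇒≡false (λ e → ne (toℕ-injective (trans (≡ᵇ-true e) (sym (toℕ-fromℕ< c<q)))))

    ok-indep : ∀ z c zs → All (z ≢_) zs → Indep {n} {q} z (λ f → ⟦ ok f c zs ⟧)
    ok-indep z c zs z∉ f g h = cong ⟦_⟧ (go c zs z∉)
      where
      go : ∀ c zs → All (z ≢_) zs → ok f c zs ≡ ok g c zs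
      go c [] [] = refl
      go c (w ∷ zs) (z≢w ∷ z∉) = cong₂ _∧_ (cong (λ v → toℕ v ≡ᵇ c) (h w (z≢w ∘ sym))) (go (suc c) zs z∉)

  -- Distinct vertices have independent colours, so the prescribed sequence has probability
  -- q^(-length).
  colorings : ∀ c zs → Unique zs → c + length zs ≤ q → q ^ length zs * ∑ (funs n q) (λ f → ⟦ okFrom (toℕ ∘ f) c zs ⟧) ≡ q ^ n
  colorings c [] _ _ = trans (*-identityˡ _) (trans (∑-funs-const n q 1) (*-identityʳ _))
  colorings c (z ∷ zs) (z∉ ∷ u) le = begin
    q * q ^ length zs * ∑ (funs n q) (λ f → ⟦ ok f c (z ∷ zs) ⟧)
      ≡⟨ cong (q * q ^ length zs *_) (∑-cong (funs n q) (λ f → trans (⟦∧⟧ (toℕ (f z) ≡ᵇ c) (ok f (suc c) zs)) (cong (λ b → ⟦ b ⟧ * ⟦ ok f (suc c) zs ⟧) (color-eq c c<q (f z))))) ⟩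
    q * q ^ length zs * ∑ (funs n q) (λ f → ⟦ f z == fromℕ< c<q ⟧ * ⟦ ok f (suc c) zs ⟧)
      ≡⟨ lem q (q ^ length zs) _ ⟩
    q ^ length zs * (q * ∑ (funs n q) (λ f → ⟦ f z == fromℕ< c<q ⟧ * ⟦ ok f (suc c) zs ⟧))
      ≡⟨ cong (q ^ length zs *_) (∑-funs-fix n q z (fromℕ< c<q) _ (ok-indep z (suc c) zs z∉)) ⟩
    q ^ length zs * ∑ (funs n q) (λ f → ⟦ ok f (suc c) zs ⟧)
      ≡⟨ colorings (suc c) zs u (≤-trans (≤-reflexive (sym (+-suc c (length zs)))) le) ⟩
    q ^ n ∎
    where
    open ≡-Reasoning
    c<q : c < q
    c<q = ≤-trans (≤-trans (s≤s (m≤m+n c (length zs))) (≤-reflexive (sym (+-suc c (length zs))))) le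
    lem : ∀ a b c → a * b * c ≡ b * (a * c)
    lem = solve-∀

-- Since 2c ≤ ρ, the error term is at most half of `p` and moves to the left side.
absorb : ∀ ρ p d c Q x → 0 < ρ → ρ * p ≤ ρ * d + c * p → 2 * c ≤ ρ → d ≤ Q * x → p ≤ 2 * Q * x
absorb ρ p d c Q x ρ>0 le big d≤ = *-cancelˡ-≤ ρ {{>-nonZero ρ>0}} (+-cancelʳ-≤ (ρ * p) _ _ (begin
    ρ * p + ρ * p ≤⟨ +-mono-≤ le le ⟩
    (ρ * d + c * p) + (ρ * d + c * p) ≡⟨ lem ρ d c p ⟩
    ρ * (2 * d) + 2 * c * p ≤⟨ +-mono-≤ (*-monoʳ-≤ ρ (≤-trans (*-monoʳ-≤ 2 d≤) (≤-reflexive (sym (*-assoc 2 Q x))))) (*-monoˡ-≤ p big) ⟩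
    ρ * (2 * Q * x) + ρ * p ∎))
  where
  open ≤-Reasoning
  lem : ∀ r d c p → (r * d + c * p) + (r * d + c * p) ≡ r * (2 * d) + 2 * c * p
  lem = solve-∀

-- The two summands are `rep-count` for the left walk, h steps avoiding `u`, and for the right walk,
-- h+1 steps avoiding the h+1 vertices before it.
repConst : ℕ → ℕ
repConst h = h * (1 + h) + suc h * (suc h + suc h)

-- A configuration has 2h+2 vertices and there are 2h+2 colours; the factor 2 pays for walks with
-- repeated vertices.
outerConst : ℕ → ℕ
outerConst h = 2 * ((suc h + suc h) ^ (suc h + suc h))

module Coloring {n : ℕ} {E : Fin n → Fin n → Bool} {ρ : ℕ} (D : Digraph E ρ) (h : ℕ) where
  open Digraph D

  private
    P : ℕ → Fin n → Fin n → Bool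
    P _ = out

  colored : (Fin n → ℕ) → ℕ → Fin n → Fin n → Bool
  colored κ c x y = out x y ∧ (κ y ≡ᵇ c)

  private
    wk-end-U : ∀ m c x → U x ≡ true → ∑ (wk P m c x) (λ _ → 1) ≡ ρ ^ m
    wk-end-U zero c x u = refl
    wk-end-U (suc m) c x u = begin
      ∑ (wk P (suc m) c x) (λ _ → 1) ≡⟨ ∑-wk-suc P m c x (λ _ → 1) ⟩
      ∑ᶠ (λ y → ⟦ out x y ⟧ * ∑ (wk P m (suc c) y) (λ _ → 1)) ≡⟨ ∑-cong (allFin n) pt ⟩
      ∑ᶠ (λ y → ⟦ out x y ⟧ * ρ ^ m) ≡⟨ ∑-*ʳ (allFin n) _ (ρ ^ m) ⟩
      card (out x) * ρ ^ m ≡⟨ cong (_* ρ ^ m) (out-deg x u) ⟩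
      ρ * ρ ^ m ∎
      where
      open ≡-Reasoning
      pt : ∀ y → ⟦ out x y ⟧ * ∑ (wk P m (suc c) y) (λ _ → 1) ≡ ⟦ out x y ⟧ * ρ ^ m
      pt y with out x y in e
      ... | true = cong (1 *_) (wk-end-U m (suc c) y (proj₂ (out-U x y e)))
      ... | false = refl

    wk-colored : ∀ κ m c x (F : List (Fin n) → ℕ) → ∑ (wk (colored κ) m c x) F ≡ ∑ (wk P m c x) (λ zs → ⟦ okFrom κ c zs ⟧ * F zs)
    wk-colored κ zero c x F = cong (_+ 0) (sym (*-identityˡ (F [])))
    wk-colored κ (suc m) c x F = trans (∑-wk-suc (colored κ) m c x F) (trans (∑-cong (allFin n) pt) (sym (∑-wk-suc P m c x _)))
      where
      pt : ∀ y → ⟦ out x y ∧ (κ y ≡ᵇ c) ⟧ * ∑ (wk (colored κ) m (suc c) y) (λ zs → F (y ∷ zs))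
               ≡ ⟦ out x y ⟧ * ∑ (wk P m (suc c) y) (λ zs → ⟦ (κ y ≡ᵇ c) ∧ okFrom κ (suc c) zs ⟧ * F (y ∷ zs))
      pt y with out x y | κ y ≡ᵇ c
      ... | false | _ = refl
      ... | true | true = cong (1 *_) (wk-colored κ m (suc c) y (λ zs → F (y ∷ zs)))
      ... | true | false = sym (cong (1 *_) (∑-zero (wk P m (suc c) y)))

    arith : ∀ r a m p → r * (a * p) + r * (m * (suc a + m) * p) ≤ suc m * (a + suc m) * (r * p)
    arith r a m p = subst (r * (a * p) + r * (m * (suc a + m) * p) ≤_) (lem r a m p) (m≤m+n _ ((m + 1) * (r * p)))
      where
      lem : ∀ r a m p → r * (a * p) + r * (m * (suc a + m) * p) + (m + 1) * (r * p) ≡ suc m * (a + suc m) * (r * p)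
      lem = solve-∀

    -- In each of the m steps at most |av|+m vertices are forbidden and each is the head of at most
    -- one of the available arcs, so a repetition costs a factor ρ.
    rep-count : ∀ m c x av → ρ * ∑ (wk P m c x) (λ zs → ⟦ rep av zs ⟧) ≤ m * (length av + m) * ρ ^ m
    rep-count zero c x av = ≤-reflexive (*-zeroʳ ρ)
    rep-count (suc m) c x av = begin
      ρ * ∑ (wk P (suc m) c x) (λ zs → ⟦ rep av zs ⟧)
        ≡⟨ cong (ρ *_) (∑-wk-suc P m c x _) ⟩
      ρ * ∑ᶠ (λ y → ⟦ out x y ⟧ * ∑ (wk P m (suc c) y) (λ zs → ⟦ (y ∈ᵇ av) ∨ rep (y ∷ av) zs ⟧))
        ≤⟨ *-monoʳ-≤ ρ (∑-mono (allFin n) (λ y → *-monoʳ-≤ ⟦ out x y ⟧ (inner y))) ⟩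
      ρ * ∑ᶠ (λ y → ⟦ out x y ⟧ * (⟦ y ∈ᵇ av ⟧ * ρ ^ m + R y))
        ≡⟨ cong (ρ *_) (trans (∑-cong (allFin n) (λ y → *-distribˡ-+ ⟦ out x y ⟧ _ _)) (∑-+ (allFin n) _ _)) ⟩
      ρ * (∑ᶠ (λ y → ⟦ out x y ⟧ * (⟦ y ∈ᵇ av ⟧ * ρ ^ m)) + ∑ᶠ (λ y → ⟦ out x y ⟧ * R y))
        ≡⟨ trans (*-distribˡ-+ ρ _ _) (cong (ρ * ∑ᶠ (λ y → ⟦ out x y ⟧ * (⟦ y ∈ᵇ av ⟧ * ρ ^ m)) +_) (sym (∑-*ˡ (allFin n) ρ _))) ⟩
      ρ * ∑ᶠ (λ y → ⟦ out x y ⟧ * (⟦ y ∈ᵇ av ⟧ * ρ ^ m)) + ∑ᶠ (λ y → ρ * (⟦ out x y ⟧ * R y))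
        ≤⟨ +-mono-≤ (*-monoʳ-≤ ρ first) (∑-mono (allFin n) second) ⟩
      ρ * (length av * ρ ^ m) + ∑ᶠ (λ y → ⟦ out x y ⟧ * (m * (suc (length av) + m) * ρ ^ m))
        ≡⟨ cong (ρ * (length av * ρ ^ m) +_) (∑-*ʳ (allFin n) _ _) ⟩
      ρ * (length av * ρ ^ m) + card (out x) * (m * (suc (length av) + m) * ρ ^ m)
        ≤⟨ +-monoʳ-≤ (ρ * (length av * ρ ^ m)) (*-monoˡ-≤ (m * (suc (length av) + m) * ρ ^ m) (out≤ x)) ⟩
      ρ * (length av * ρ ^ m) + ρ * (m * (suc (length av) + m) * ρ ^ m)
        ≤⟨ arith ρ (length av) m (ρ ^ m) ⟩
      suc m * (length av + suc m) * (ρ * ρ ^ m) ∎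
      where
      open ≤-Reasoning
      R : Fin n → ℕ
      R y = ∑ (wk P m (suc c) y) (λ zs → ⟦ rep (y ∷ av) zs ⟧)
      inner : ∀ y → ∑ (wk P m (suc c) y) (λ zs → ⟦ (y ∈ᵇ av) ∨ rep (y ∷ av) zs ⟧) ≤ ⟦ y ∈ᵇ av ⟧ * ρ ^ m + R y
      inner y = begin
        ∑ (wk P m (suc c) y) (λ zs → ⟦ (y ∈ᵇ av) ∨ rep (y ∷ av) zs ⟧)
          ≤⟨ ∑-mono (wk P m (suc c) y) (λ zs → ≤-trans (⟦∨⟧≤ (y ∈ᵇ av) _) (+-monoˡ-≤ _ (≤-reflexive (sym (*-identityʳ ⟦ y ∈ᵇ av ⟧))))) ⟩
        ∑ (wk P m (suc c) y) (λ zs → ⟦ y ∈ᵇ av ⟧ * 1 + ⟦ rep (y ∷ av) zs ⟧)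
          ≡⟨ trans (∑-+ (wk P m (suc c) y) _ _) (cong (_+ R y) (∑-*ˡ (wk P m (suc c) y) ⟦ y ∈ᵇ av ⟧ (λ _ → 1))) ⟩
        ⟦ y ∈ᵇ av ⟧ * ∑ (wk P m (suc c) y) (λ _ → 1) + R y
          ≤⟨ +-monoˡ-≤ (R y) (*-monoʳ-≤ ⟦ y ∈ᵇ av ⟧ (wk-count P ρ (λ _ → out≤) m (suc c) y)) ⟩
        ⟦ y ∈ᵇ av ⟧ * ρ ^ m + R y ∎
      first : ∑ᶠ (λ y → ⟦ out x y ⟧ * (⟦ y ∈ᵇ av ⟧ * ρ ^ m)) ≤ length av * ρ ^ m
      first = ≤-trans (∑-mono (allFin n) (λ y → ⟦⟧*-≤ (out x y) _)) (≤-trans (≤-reflexive (∑-*ʳ (allFin n) _ (ρ ^ m))) (*-monoˡ-≤ (ρ ^ m) (∈ᵇ-count av)))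
      second : ∀ y → ρ * (⟦ out x y ⟧ * R y) ≤ ⟦ out x y ⟧ * (m * (suc (length av) + m) * ρ ^ m)
      second y = ≤-trans (≤-reflexive (trans (sym (*-assoc ρ ⟦ out x y ⟧ (R y))) (trans (cong (_* R y) (*-comm ρ ⟦ out x y ⟧)) (*-assoc ⟦ out x y ⟧ ρ (R y)))))
                   (*-monoʳ-≤ ⟦ out x y ⟧ (rep-count m (suc c) y (y ∷ av)))

    all-walks : (Fin n → List (Fin n) → List (Fin n) → ℕ) → ℕ
    all-walks F = ∑ᶠ (λ u → ⟦ U u ⟧ * ∑ (wk P h 1 u) (λ xs → ∑ (wk P (suc h) (suc h) u) (λ ys → F u xs ys)))

  colored-walks : (Fin n → ℕ) → (Fin n → List (Fin n) → List (Fin n) → ℕ) → ℕ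
  colored-walks κ F = ∑ᶠ (λ u → ⟦ U u ∧ (κ u ≡ᵇ 0) ⟧ *
    ∑ (wk (colored κ) h 1 u) (λ xs → ∑ (wk (colored κ) (suc h) (suc h) u) (λ ys → F u xs ys)))

  private
    aw-mono : ∀ {F H} → (∀ u xs ys → xs ∈ wk P h 1 u → ys ∈ wk P (suc h) (suc h) u → F u xs ys ≤ H u xs ys) → all-walks F ≤ all-walks H
    aw-mono le = ∑-mono (allFin n) (λ u → *-monoʳ-≤ ⟦ U u ⟧ (∑-mono-∈ (wk P h 1 u) (λ xs xs∈ → ∑-mono-∈ (wk P (suc h) (suc h) u) (λ ys ys∈ → le u xs ys xs∈ ys∈))))

    aw-+ : ∀ F H → all-walks (λ u xs ys → F u xs ys + H u xs ys) ≡ all-walks F + all-walks H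
    aw-+ F H = trans (∑-cong (allFin n) (λ u → trans (cong (⟦ U u ⟧ *_) (trans (∑-cong (wk P h 1 u) (λ xs → ∑-+ (wk P (suc h) (suc h) u) _ _)) (∑-+ (wk P h 1 u) _ _))) (*-distribˡ-+ ⟦ U u ⟧ _ _))) (∑-+ (allFin n) _ _)

    lenses : ∀ c a b → c * (a * b) ≡ a * (c * b)
    lenses = solve-∀

    aw-*ˡ : ∀ c F → all-walks (λ u xs ys → c * F u xs ys) ≡ c * all-walks F
    aw-*ˡ c F = trans (∑-cong (allFin n) (λ u → trans (cong (⟦ U u ⟧ *_) (trans (∑-cong (wk P h 1 u) (λ xs → ∑-*ˡ (wk P (suc h) (suc h) u) c _)) (∑-*ˡ (wk P h 1 u) c _))) (sym (lenses c ⟦ U u ⟧ _)))) (∑-*ˡ (allFin n) c _)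

    aw-swap : ∀ {A : Set} (zs : List A) (F : A → Fin n → List (Fin n) → List (Fin n) → ℕ) →
      ∑ zs (λ z → all-walks (F z)) ≡ all-walks (λ u xs ys → ∑ zs (λ z → F z u xs ys))
    aw-swap zs F = trans (∑-swap zs (allFin n) _) (∑-cong (allFin n) (λ u → trans (∑-*ˡ zs ⟦ U u ⟧ _) (cong (⟦ U u ⟧ *_)
      (trans (∑-swap zs (wk P h 1 u) _) (∑-cong (wk P h 1 u) (λ xs → ∑-swap zs (wk P (suc h) (suc h) u) _))))))

    aw-const : all-walks (λ _ _ _ → 1) ≡ card U * (ρ ^ h * ρ ^ suc h)
    aw-const = trans (∑-cong (allFin n) pt) (∑-*ʳ (allFin n) _ (ρ ^ h * ρ ^ suc h))
      where
      pt : ∀ u → ⟦ U u ⟧ * ∑ (wk P h 1 u) (λ xs → ∑ (wk P (suc h) (suc h) u) (λ _ → 1)) ≡ ⟦ U u ⟧ * (ρ ^ h * ρ ^ suc h)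
      pt u with U u in e
      ... | false = refl
      ... | true = cong (1 *_) (trans (∑-cong (wk P h 1 u) (λ xs → trans (wk-end-U (suc h) (suc h) u e) (sym (*-identityˡ (ρ ^ suc h)))))
                     (trans (∑-*ʳ (wk P h 1 u) (λ _ → 1) (ρ ^ suc h)) (cong (_* ρ ^ suc h) (wk-end-U h 1 u e))))

    cw-aw : ∀ κ F → colored-walks κ F ≡ all-walks (λ u xs ys → ⟦ okFrom κ 0 (u ∷ (xs ++ ys)) ⟧ * F u xs ys)
    cw-aw κ F = ∑-cong (allFin n) pt
      where
      pt : ∀ u → ⟦ U u ∧ (κ u ≡ᵇ 0) ⟧ * ∑ (wk (colored κ) h 1 u) (λ xs → ∑ (wk (colored κ) (suc h) (suc h) u) (λ ys → F u xs ys))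
               ≡ ⟦ U u ⟧ * ∑ (wk P h 1 u) (λ xs → ∑ (wk P (suc h) (suc h) u) (λ ys → ⟦ okFrom κ 0 (u ∷ (xs ++ ys)) ⟧ * F u xs ys))
      pt u with U u | κ u ≡ᵇ 0
      ... | false | _ = refl
      ... | true | false = sym (cong (1 *_) (trans (∑-cong (wk P h 1 u) (λ xs → ∑-zero (wk P (suc h) (suc h) u))) (∑-zero (wk P h 1 u))))
      ... | true | true = cong (1 *_) (trans (wk-colored κ h 1 u _) (∑-cong∈ (wk P h 1 u) inner))
        where
        ∑-cong∈ : ∀ {A : Set} (zs : List A) {f g : A → ℕ} → (∀ z → z ∈ zs → f z ≡ g z) → ∑ zs f ≡ ∑ zs g
        ∑-cong∈ [] e = refl
        ∑-cong∈ (z ∷ zs) e = cong₂ _+_ (e z (here refl)) (∑-cong∈ zs (λ w w∈ → e w (there w∈)))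
        inner : ∀ xs → xs ∈ wk P h 1 u → ⟦ okFrom κ 1 xs ⟧ * ∑ (wk (colored κ) (suc h) (suc h) u) (λ ys → F u xs ys)
              ≡ ∑ (wk P (suc h) (suc h) u) (λ ys → ⟦ okFrom κ 1 (xs ++ ys) ⟧ * F u xs ys)
        inner xs xs∈ = trans (cong (⟦ okFrom κ 1 xs ⟧ *_) (wk-colored κ (suc h) (suc h) u _)) (trans (sym (∑-*ˡ (wk P (suc h) (suc h) u) ⟦ okFrom κ 1 xs ⟧ _))
          (∑-cong (wk P (suc h) (suc h) u) (λ ys → trans (sym (*-assoc ⟦ okFrom κ 1 xs ⟧ _ (F u xs ys))) (cong (_* F u xs ys)
             (trans (sym (⟦∧⟧ (okFrom κ 1 xs) _)) (cong ⟦_⟧ (sym (trans (okFrom-++ κ 1 xs ys) (cong (λ i → okFrom κ 1 xs ∧ okFrom κ i ys) len)))))))))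
          where
          len : length xs + 1 ≡ suc h
          len = trans (+-comm (length xs) 1) (cong suc (proj₂ (wk-sound P h 1 u xs∈)))

    dist : Fin n → List (Fin n) → List (Fin n) → Bool
    dist u xs ys = not (rep (u ∷ []) xs) ∧ not (rep (u ∷ xs) ys)

    dist-unique : ∀ u xs ys → dist u xs ys ≡ true → Unique (u ∷ (xs ++ ys))
    dist-unique u xs ys e with rep (u ∷ []) xs in e1 | rep (u ∷ xs) ys in e2
    dist-unique u xs ys e | false | false with rep-false (u ∷ []) xs e1 | rep-false (u ∷ xs) ys e2
    ... | off1 , u1 | off2 , u2 = ¬Any⇒All¬ (xs ++ ys) u∉ ∷ Unique-++ u1 u2 (λ (x∈ , y∈) → off2 y∈ (there x∈))
      where
      u∉ : u ∉ (xs ++ ys)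
      u∉ u∈ with ∈-++⁻ xs u∈
      ... | inj₁ p = off1 p (here refl)
      ... | inj₂ p = off2 p (here refl)

  private
    q = suc h + suc h

    distinct-many : ρ * (card U * (ρ ^ h * ρ ^ suc h)) ≤ ρ * all-walks (λ u xs ys → ⟦ dist u xs ys ⟧) + repConst h * (card U * (ρ ^ h * ρ ^ suc h))
    distinct-many = begin
      ρ * (card U * (ρ ^ h * ρ ^ suc h)) ≡⟨ cong (ρ *_) (sym aw-const) ⟩
      ρ * all-walks (λ _ _ _ → 1) ≤⟨ *-monoʳ-≤ ρ (aw-mono (λ u xs ys _ _ → pt (rep (u ∷ []) xs) (rep (u ∷ xs) ys))) ⟩
      ρ * all-walks (λ u xs ys → ⟦ dist u xs ys ⟧ + (⟦ rep (u ∷ []) xs ⟧ + ⟦ rep (u ∷ xs) ys ⟧))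
        ≡⟨ cong (ρ *_) (trans (aw-+ _ _) (cong (d +_) (aw-+ _ _))) ⟩
      ρ * (d + (r₁ + r₂)) ≡⟨ trans (*-distribˡ-+ ρ d _) (cong (ρ * d +_) (*-distribˡ-+ ρ r₁ r₂)) ⟩
      ρ * d + (ρ * r₁ + ρ * r₂) ≤⟨ +-monoʳ-≤ (ρ * d) (+-mono-≤ b₁ b₂) ⟩
      ρ * d + (card U * (h * (1 + h) * ρ ^ h * ρ ^ suc h) + card U * (ρ ^ h * (suc h * (suc h + suc h) * ρ ^ suc h)))
        ≡⟨ cong (ρ * d +_) (lem (card U) (h * (1 + h)) (suc h * (suc h + suc h)) (ρ ^ h) (ρ ^ suc h)) ⟩
      ρ * d + repConst h * (card U * (ρ ^ h * ρ ^ suc h)) ∎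
      where
      open ≤-Reasoning
      d = all-walks (λ u xs ys → ⟦ dist u xs ys ⟧)
      r₁ = all-walks (λ u xs ys → ⟦ rep (u ∷ []) xs ⟧)
      r₂ = all-walks (λ u xs ys → ⟦ rep (u ∷ xs) ys ⟧)
      lem : ∀ c a b p s → c * (a * p * s) + c * (p * (b * s)) ≡ (a + b) * (c * (p * s))
      lem = solve-∀
      pt : ∀ a b → 1 ≤ ⟦ not a ∧ not b ⟧ + (⟦ a ⟧ + ⟦ b ⟧)
      pt true b = s≤s z≤n
      pt false true = s≤s z≤n
      pt false false = s≤s z≤n
      b₁ : ρ * r₁ ≤ card U * (h * (1 + h) * ρ ^ h * ρ ^ suc h)
      b₁ = begin
        ρ * r₁ ≡⟨ trans (sym (∑-*ˡ (allFin n) ρ _)) (∑-cong (allFin n) (λ u → lenses ρ ⟦ U u ⟧ _)) ⟩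
        ∑ᶠ (λ u → ⟦ U u ⟧ * (ρ * ∑ (wk P h 1 u) (λ xs → ∑ (wk P (suc h) (suc h) u) (λ ys → ⟦ rep (u ∷ []) xs ⟧))))
          ≤⟨ ∑-mono (allFin n) (λ u → *-monoʳ-≤ ⟦ U u ⟧ (inner u)) ⟩
        ∑ᶠ (λ u → ⟦ U u ⟧ * (h * (1 + h) * ρ ^ h * ρ ^ suc h)) ≡⟨ ∑-*ʳ (allFin n) _ _ ⟩
        card U * (h * (1 + h) * ρ ^ h * ρ ^ suc h) ∎
        where
        inner : ∀ u → ρ * ∑ (wk P h 1 u) (λ xs → ∑ (wk P (suc h) (suc h) u) (λ ys → ⟦ rep (u ∷ []) xs ⟧)) ≤ h * (1 + h) * ρ ^ h * ρ ^ suc h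
        inner u = begin
          ρ * ∑ (wk P h 1 u) (λ xs → ∑ (wk P (suc h) (suc h) u) (λ ys → ⟦ rep (u ∷ []) xs ⟧))
            ≤⟨ *-monoʳ-≤ ρ (∑-mono (wk P h 1 u) (λ xs → ≤-trans (≤-reflexive (trans (∑-cong (wk P (suc h) (suc h) u) (λ _ → sym (*-identityʳ ⟦ rep (u ∷ []) xs ⟧))) (∑-*ˡ (wk P (suc h) (suc h) u) ⟦ rep (u ∷ []) xs ⟧ (λ _ → 1)))) (*-monoʳ-≤ ⟦ rep (u ∷ []) xs ⟧ (wk-count P ρ (λ _ → out≤) (suc h) (suc h) u)))) ⟩
          ρ * ∑ (wk P h 1 u) (λ xs → ⟦ rep (u ∷ []) xs ⟧ * ρ ^ suc h)
            ≡⟨ trans (cong (ρ *_) (∑-*ʳ (wk P h 1 u) _ (ρ ^ suc h))) (sym (*-assoc ρ _ (ρ ^ suc h))) ⟩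
          ρ * ∑ (wk P h 1 u) (λ xs → ⟦ rep (u ∷ []) xs ⟧) * ρ ^ suc h
            ≤⟨ *-monoˡ-≤ (ρ ^ suc h) (rep-count h 1 u (u ∷ [])) ⟩
          h * (1 + h) * ρ ^ h * ρ ^ suc h ∎
      b₂ : ρ * r₂ ≤ card U * (ρ ^ h * (suc h * (suc h + suc h) * ρ ^ suc h))
      b₂ = begin
        ρ * r₂ ≡⟨ trans (sym (∑-*ˡ (allFin n) ρ _)) (∑-cong (allFin n) (λ u → lenses ρ ⟦ U u ⟧ _)) ⟩
        ∑ᶠ (λ u → ⟦ U u ⟧ * (ρ * ∑ (wk P h 1 u) (λ xs → ∑ (wk P (suc h) (suc h) u) (λ ys → ⟦ rep (u ∷ xs) ys ⟧))))
          ≤⟨ ∑-mono (allFin n) (λ u → *-monoʳ-≤ ⟦ U u ⟧ (inner u)) ⟩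
        ∑ᶠ (λ u → ⟦ U u ⟧ * (ρ ^ h * (suc h * (suc h + suc h) * ρ ^ suc h))) ≡⟨ ∑-*ʳ (allFin n) _ _ ⟩
        card U * (ρ ^ h * (suc h * (suc h + suc h) * ρ ^ suc h)) ∎
        where
        inner : ∀ u → ρ * ∑ (wk P h 1 u) (λ xs → ∑ (wk P (suc h) (suc h) u) (λ ys → ⟦ rep (u ∷ xs) ys ⟧)) ≤ ρ ^ h * (suc h * (suc h + suc h) * ρ ^ suc h)
        inner u = begin
          ρ * ∑ (wk P h 1 u) (λ xs → ∑ (wk P (suc h) (suc h) u) (λ ys → ⟦ rep (u ∷ xs) ys ⟧))
            ≡⟨ sym (∑-*ˡ (wk P h 1 u) ρ _) ⟩
          ∑ (wk P h 1 u) (λ xs → ρ * ∑ (wk P (suc h) (suc h) u) (λ ys → ⟦ rep (u ∷ xs) ys ⟧))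
            ≤⟨ ∑-mono-∈ (wk P h 1 u) (λ xs xs∈ → ≤-trans (rep-count (suc h) (suc h) u (u ∷ xs)) (≤-reflexive (trans (cong (λ l → suc h * (suc l + suc h) * ρ ^ suc h) (proj₂ (wk-sound P h 1 u xs∈))) (sym (*-identityˡ _))))) ⟩
          ∑ (wk P h 1 u) (λ _ → 1 * (suc h * (suc h + suc h) * ρ ^ suc h))
            ≡⟨ ∑-*ʳ (wk P h 1 u) (λ _ → 1) _ ⟩
          ∑ (wk P h 1 u) (λ _ → 1) * (suc h * (suc h + suc h) * ρ ^ suc h)
            ≤⟨ *-monoˡ-≤ (suc h * (suc h + suc h) * ρ ^ suc h) (wk-count P ρ (λ _ → out≤) h 1 u) ⟩
          ρ ^ h * (suc h * (suc h + suc h) * ρ ^ suc h) ∎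

    average : ∃ λ (f : Fin n → Fin q) → all-walks (λ u xs ys → ⟦ dist u xs ys ⟧) ≤ q ^ q * colored-walks (toℕ ∘ f) (λ _ _ _ → 1)
    average = proj₁ found , s≤s⁻¹ (proj₂ found)
      where
      d = all-walks (λ u xs ys → ⟦ dist u xs ys ⟧)
      c : (Fin n → Fin q) → ℕ
      c f = colored-walks (toℕ ∘ f) (λ _ _ _ → 1)
      open ≤-Reasoning
      core≤ : q ^ n * d ≤ ∑ (funs n q) (λ f → q ^ q * c f)
      core≤ = begin
        q ^ n * d ≡⟨ sym (aw-*ˡ (q ^ n) _) ⟩
        all-walks (λ u xs ys → q ^ n * ⟦ dist u xs ys ⟧)
          ≤⟨ aw-mono (λ u xs ys xs∈ ys∈ → pt u xs ys (proj₂ (wk-sound P h 1 u xs∈)) (proj₂ (wk-sound P (suc h) (suc h) u ys∈))) ⟩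
        all-walks (λ u xs ys → q ^ q * ∑ (funs n q) (λ f → ⟦ okFrom (toℕ ∘ f) 0 (u ∷ (xs ++ ys)) ⟧ * 1))
          ≡⟨ aw-*ˡ (q ^ q) _ ⟩
        q ^ q * all-walks (λ u xs ys → ∑ (funs n q) (λ f → ⟦ okFrom (toℕ ∘ f) 0 (u ∷ (xs ++ ys)) ⟧ * 1))
          ≡⟨ cong (q ^ q *_) (trans (sym (aw-swap (funs n q) _)) (∑-cong (funs n q) (λ f → sym (cw-aw (toℕ ∘ f) (λ _ _ _ → 1))))) ⟩
        q ^ q * ∑ (funs n q) c
          ≡⟨ sym (∑-*ˡ (funs n q) (q ^ q) c) ⟩
        ∑ (funs n q) (λ f → q ^ q * c f) ∎
        where
        pt : ∀ u xs ys → length xs ≡ h → length ys ≡ suc h → q ^ n * ⟦ dist u xs ys ⟧ ≤ q ^ q * ∑ (funs n q) (λ f → ⟦ okFrom (toℕ ∘ f) 0 (u ∷ (xs ++ ys)) ⟧ * 1)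
        pt u xs ys lx ly with dist u xs ys in e
        ... | false = ≤-trans (≤-reflexive (*-zeroʳ (q ^ n))) z≤n
        ... | true = ≤-reflexive (trans (*-identityʳ (q ^ n)) (sym (trans (cong₂ (λ l s → q ^ l * s) (sym len) (∑-cong (funs n q) (λ f → *-identityʳ _)))
               (colorings 0 (u ∷ (xs ++ ys)) (dist-unique u xs ys e) (≤-reflexive len)))))
          where
          len : length (u ∷ (xs ++ ys)) ≡ q
          len = cong suc (trans (length-++ xs) (cong₂ _+_ lx ly))
      -- Adding 1 to every term makes the comparison strict; it is removed again from the witness.
      lt : ∑ (funs n q) (λ _ → d) < ∑ (funs n q) (λ f → suc (q ^ q * c f))
      lt = begin-strict
        ∑ (funs n q) (λ _ → d) ≡⟨ ∑-funs-const n q d ⟩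
        q ^ n * d ≤⟨ core≤ ⟩
        ∑ (funs n q) (λ f → q ^ q * c f) <⟨ m<n+m _ (≤-trans (m^n>0 q n) (≤-reflexive (sym (trans (∑-funs-const n q 1) (*-identityʳ (q ^ n)))))) ⟩
        ∑ (funs n q) (λ _ → 1) + ∑ (funs n q) (λ f → q ^ q * c f) ≡⟨ sym (∑-+ (funs n q) (λ _ → 1) _) ⟩
        ∑ (funs n q) (λ f → suc (q ^ q * c f)) ∎
      found = ∑-<⇒∃ (funs n q) (λ _ → d) (λ f → suc (q ^ q * c f)) lt

  -- For large ρ at least half of the pairs of walks have no repeated vertex, and each of these is
  -- coloured correctly with probability (2h+2)^(-(2h+2)).
  good-coloring : 0 < ρ → 2 * repConst h ≤ ρ → ∃ λ (κ : Fin n → ℕ) →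
    card U * (ρ ^ h * ρ ^ suc h) ≤ outerConst h * colored-walks κ (λ _ _ _ → 1)
  good-coloring ρ>0 big = toℕ ∘ proj₁ average , absorb ρ (card U * (ρ ^ h * ρ ^ suc h)) (all-walks (λ u xs ys → ⟦ dist u xs ys ⟧)) (repConst h) (q ^ q)
    (colored-walks (toℕ ∘ proj₁ average) (λ _ _ _ → 1)) ρ>0 distinct-many big (proj₂ average)

-- Configurations

x∙yz≡y∙xz : ∀ a b c → a * (b * c) ≡ b * (a * c)
x∙yz≡y∙xz = solve-∀

front : {A : Set} → List A → List A
front [] = []
front (z ∷ []) = []
front (z ∷ z' ∷ zs) = z ∷ front (z' ∷ zs)

front-∷ʳ : {A : Set} (zs : List A) (y : A) → front (zs ∷ʳ y) ≡ zs
front-∷ʳ [] y = refl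
front-∷ʳ (z ∷ []) y = refl
front-∷ʳ (z ∷ z' ∷ zs) y = cong (z ∷_) (front-∷ʳ (z' ∷ zs) y)

module Items {n : ℕ} (G : Graph n) (k : ℕ) (free : ¬ HasCycle G (2 * k))
  {E : Fin n → Fin n → Bool} {ρ : ℕ} (D : Digraph E ρ) (E-adj : ∀ x y → E x y ≡ true → Adj G x y)
  (h : ℕ) (κ : Fin n → ℕ) where

  open Digraph D public
  open Colored G k free out (λ x y e → E-adj x y (out-E x y e)) ρ out≤ κ public

  -- The tree rooted at the start `u` of a configuration, of colour 0, with forward levels of
  -- colours 1, 2, ... along the left walk.
  module Lu = Levels 0 1 (s≤s z≤n)

  I : Fin n → Bool
  I u = U u ∧ (κ u ≡ᵇ 0)

  lightU : Fin n → List (Fin n) → Bool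
  lightU u xs = Lu.lightW u 0 xs

  walk-U : ∀ {c u zs} → U u ≡ true → Walk St c u zs → U (end u zs) ≡ true
  walk-U Uu [] = Uu
  walk-U {u = u} Uu (_∷_ {y = y} e w) = walk-U (proj₂ (out-U u y (∧-l e))) w

  -- The tree rooted at the vertex of colour g on the left walk: g levels back to the start `u`,
  -- then forward along the right walk, whose colours begin at h+1.
  module Rooted (g : ℕ) (g≤h : g ≤ h) where
    open Levels g (suc h) (s≤s g≤h) public

    private
      lev-U : ∀ r u → U r ≡ true → lev r g u ≡ true → U u ≡ true
      lev-U r u Ur e = go g ≤-refl e
        where
        go : ∀ j → j ≤ g → lev r j u ≡ true → U u ≡ true
        go zero _ e = subst (λ v → U v ≡ true) (sym (lev-root≡ r u e)) Ur
        go (suc j) j<g e = proj₁ (out-U u _ (proj₂ (lev-out r j u j<g e)))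

    -- The factor Γ^g is lightness as seen from `u`. If there is any such walk at all, then read
    -- from its end it places `u` on level g of the tree rooted at `r`.
    left-walks : ∀ u r → I u ≡ true →
      ∑ (wk St g 1 u) (λ xs → ⟦ lightU u xs ⟧ * ⟦ end u xs == r ⟧) ≤ Γ ^ g * (⟦ U r ⟧ * ⟦ lev r g u ⟧)
    left-walks u r Iu = subst (λ s → L ≤ Γ ^ g * s) (⟦∧⟧ (U r) (lev r g u)) (cases (U r ∧ lev r g u) refl)
      where
      L = ∑ (wk St g 1 u) (λ xs → ⟦ lightU u xs ⟧ * ⟦ end u xs == r ⟧)
      κu : κ u ≡ 0
      κu = ≡ᵇ-true (∧-r {U u} Iu)
      ends : ∀ xs → xs ∈ wk St g 1 u → end u xs ≡ r → U r ∧ lev r g u ≡ true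
      ends xs xs∈ refl with wk-sound St g 1 u xs∈
      ... | w , l = ∧-intro (walk-U (∧-l Iu) w)
              (walk⇒lev (end u xs) g u xs ≤-refl (trans κu (sym (n∸n≡0 g))) (subst (λ c → Walk St (suc c) u xs) (sym (n∸n≡0 g)) w) l refl)
      cases : ∀ b → U r ∧ lev r g u ≡ b → L ≤ Γ ^ g * ⟦ b ⟧
      cases true e = begin
        L ≡⟨ sym (*-identityˡ L) ⟩
        1 * L ≡⟨ cong (λ b → ⟦ b ⟧ * L) (sym (Lu.root∈ u κu)) ⟩
        ⟦ Lu.lev u 0 u ⟧ * L ≤⟨ ∑ᶠ-≥ (λ x → ⟦ Lu.lev u 0 x ⟧ * ∑ (wk St g 1 x) (λ zs → ⟦ Lu.lightW u 0 zs ⟧ * ⟦ end x zs == r ⟧)) u ⟩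
        ∑ᶠ (λ x → ⟦ Lu.lev u 0 x ⟧ * ∑ (wk St g 1 x) (λ zs → ⟦ Lu.lightW u 0 zs ⟧ * ⟦ end x zs == r ⟧)) ≤⟨ Lu.light-walks g u 0 r ⟩
        Γ ^ g ≡⟨ sym (*-identityʳ (Γ ^ g)) ⟩
        Γ ^ g * 1 ∎
        where open ≤-Reasoning
      cases false e = ≤-trans (∑-mono-∈ (wk St g 1 u) pt) (≤-trans (≤-reflexive (∑-zero (wk St g 1 u))) z≤n)
        where
        pt : ∀ xs → xs ∈ wk St g 1 u → ⟦ lightU u xs ⟧ * ⟦ end u xs == r ⟧ ≤ 0
        pt xs xs∈ with end u xs ≟ r
        ... | yes p = contradiction (trans (sym e) (ends xs xs∈ p)) λ ()
        ... | no _ = ≤-reflexive (*-zeroʳ ⟦ lightU u xs ⟧)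

    -- Exchanges left walks for pairs of a root `r` and a vertex `u` on level g of its tree, so that
    -- the bounds for the tree of `r` become applicable.
    gather : ∀ (N : Fin n → Fin n → ℕ) →
      ∑ᶠ (λ u → ⟦ I u ⟧ * ∑ (wk St g 1 u) (λ xs → ⟦ lightU u xs ⟧ * N (end u xs) u))
        ≤ Γ ^ g * ∑ᶠ (λ r → ⟦ U r ⟧ * ∑ᶠ (λ u → ⟦ lev r g u ⟧ * N r u))
    gather N = begin
      ∑ᶠ (λ u → ⟦ I u ⟧ * ∑ (wk St g 1 u) (λ xs → ⟦ lightU u xs ⟧ * N (end u xs) u))
        ≤⟨ ∑-mono (allFin n) (λ u → ⟦⟧*-bound (I u) (inner u)) ⟩
      ∑ᶠ (λ u → ∑ᶠ (λ r → N r u * (Γ ^ g * (⟦ U r ⟧ * ⟦ lev r g u ⟧))))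
        ≡⟨ ∑-swap (allFin n) (allFin n) _ ⟩
      ∑ᶠ (λ r → ∑ᶠ (λ u → N r u * (Γ ^ g * (⟦ U r ⟧ * ⟦ lev r g u ⟧))))
        ≡⟨ ∑-cong (allFin n) (λ r → trans (∑-cong (allFin n) (λ u → lem (N r u) (Γ ^ g) ⟦ U r ⟧ ⟦ lev r g u ⟧)) (trans (∑-*ˡ (allFin n) (Γ ^ g) _) (cong (Γ ^ g *_) (∑-*ˡ (allFin n) ⟦ U r ⟧ _)))) ⟩
      ∑ᶠ (λ r → Γ ^ g * (⟦ U r ⟧ * ∑ᶠ (λ u → ⟦ lev r g u ⟧ * N r u)))
        ≡⟨ ∑-*ˡ (allFin n) (Γ ^ g) _ ⟩
      Γ ^ g * ∑ᶠ (λ r → ⟦ U r ⟧ * ∑ᶠ (λ u → ⟦ lev r g u ⟧ * N r u)) ∎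
      where
      open ≤-Reasoning
      lem : ∀ a b c d → a * (b * (c * d)) ≡ b * (c * (d * a))
      lem = solve-∀
      inner : ∀ u → I u ≡ true → ∑ (wk St g 1 u) (λ xs → ⟦ lightU u xs ⟧ * N (end u xs) u) ≤ ∑ᶠ (λ r → N r u * (Γ ^ g * (⟦ U r ⟧ * ⟦ lev r g u ⟧)))
      inner u Iu = begin
        ∑ (wk St g 1 u) (λ xs → ⟦ lightU u xs ⟧ * N (end u xs) u)
          ≡⟨ ∑-cong (wk St g 1 u) (λ xs → trans (cong (⟦ lightU u xs ⟧ *_) (sym (∑ᶠ-δ (end u xs) (λ r → N r u)))) (trans (sym (∑-*ˡ (allFin n) ⟦ lightU u xs ⟧ _))
               (∑-cong (allFin n) (λ r → trans (cong (λ b → ⟦ lightU u xs ⟧ * (⟦ b ⟧ * N r u)) (==-sym r (end u xs))) (lem2 ⟦ lightU u xs ⟧ _ (N r u)))))) ⟩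
        ∑ (wk St g 1 u) (λ xs → ∑ᶠ (λ r → N r u * (⟦ lightU u xs ⟧ * ⟦ end u xs == r ⟧)))
          ≡⟨ trans (∑-swap (wk St g 1 u) (allFin n) _) (∑-cong (allFin n) (λ r → ∑-*ˡ (wk St g 1 u) (N r u) _)) ⟩
        ∑ᶠ (λ r → N r u * ∑ (wk St g 1 u) (λ xs → ⟦ lightU u xs ⟧ * ⟦ end u xs == r ⟧))
          ≤⟨ ∑-mono (allFin n) (λ r → *-monoʳ-≤ (N r u) (left-walks u r Iu)) ⟩
        ∑ᶠ (λ r → N r u * (Γ ^ g * (⟦ U r ⟧ * ⟦ lev r g u ⟧))) ∎
        where
        lem2 : ∀ a b c → a * (b * c) ≡ c * (a * b)
        lem2 = solve-∀

    bad : ∀ m → m + g ≤ k →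
      ρ * ∑ᶠ (λ u → ⟦ I u ⟧ * ∑ (wk St g 1 u) (λ xs → ⟦ lightU u xs ⟧ * ∑ (wk St m (suc h) u) (λ zs → ⟦ not (lightW (end u xs) 0 zs) ⟧)))
        ≤ Γ ^ g * heavyConst Γ m * (card U * (ρ ^ g * ρ ^ m))
    bad m le = begin
      ρ * ∑ᶠ (λ u → ⟦ I u ⟧ * ∑ (wk St g 1 u) (λ xs → ⟦ lightU u xs ⟧ * N (end u xs) u))
        ≤⟨ *-monoʳ-≤ ρ (gather N) ⟩
      ρ * (Γ ^ g * ∑ᶠ (λ r → ⟦ U r ⟧ * ∑ᶠ (λ u → ⟦ lev r g u ⟧ * N r u)))
        ≡⟨ trans (x∙yz≡y∙xz ρ (Γ ^ g) _) (cong (Γ ^ g *_) (trans (sym (∑-*ˡ (allFin n) ρ _)) (∑-cong (allFin n) (λ r → x∙yz≡y∙xz ρ ⟦ U r ⟧ _)))) ⟩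
      Γ ^ g * ∑ᶠ (λ r → ⟦ U r ⟧ * (ρ * ∑ᶠ (λ u → ⟦ lev r g u ⟧ * N r u)))
        ≤⟨ *-monoʳ-≤ (Γ ^ g) (∑-mono (allFin n) (λ r → *-monoʳ-≤ ⟦ U r ⟧ (heavy-walks m r 0 (≤-trans (≤-reflexive (cong (_+ g) (+-identityʳ m))) le)))) ⟩
      Γ ^ g * ∑ᶠ (λ r → ⟦ U r ⟧ * (heavyConst Γ m * card (lev r g) * ρ ^ m))
        ≡⟨ cong (Γ ^ g *_) (trans (∑-cong (allFin n) (λ r → lem ⟦ U r ⟧ (heavyConst Γ m) (card (lev r g)) (ρ ^ m))) (∑-*ˡ (allFin n) (heavyConst Γ m * ρ ^ m) _)) ⟩
      Γ ^ g * (heavyConst Γ m * ρ ^ m * ∑ᶠ (λ r → ⟦ U r ⟧ * card (lev r g)))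
        ≤⟨ *-monoʳ-≤ (Γ ^ g) (*-monoʳ-≤ (heavyConst Γ m * ρ ^ m) starts) ⟩
      Γ ^ g * (heavyConst Γ m * ρ ^ m * (card U * ρ ^ g))
        ≡⟨ lem3 (Γ ^ g) (heavyConst Γ m) (ρ ^ m) (card U) (ρ ^ g) ⟩
      Γ ^ g * heavyConst Γ m * (card U * (ρ ^ g * ρ ^ m)) ∎
      where
      open ≤-Reasoning
      N : Fin n → Fin n → ℕ
      N r u = ∑ (wk St m (suc h) u) (λ zs → ⟦ not (lightW r 0 zs) ⟧)
      lem : ∀ a b c d → a * (b * c * d) ≡ b * d * (a * c)
      lem = solve-∀
      lem3 : ∀ a b c d e → a * (b * c * (d * e)) ≡ a * b * (d * (e * c))
      lem3 = solve-∀
      -- A single level may be arbitrarily large, but summed over all roots the levels count the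
      -- roots that each `u` reaches, at most ρ^g.
      starts : ∑ᶠ (λ r → ⟦ U r ⟧ * card (lev r g)) ≤ card U * ρ ^ g
      starts = begin
        ∑ᶠ (λ r → ⟦ U r ⟧ * card (lev r g)) ≡⟨ ∑-cong (allFin n) (λ r → sym (∑-*ˡ (allFin n) ⟦ U r ⟧ _)) ⟩
        ∑ᶠ (λ r → ∑ᶠ (λ u → ⟦ U r ⟧ * ⟦ lev r g u ⟧)) ≤⟨ ∑-mono (allFin n) (λ r → ∑-mono (allFin n) (λ u → pt r u)) ⟩
        ∑ᶠ (λ r → ∑ᶠ (λ u → ⟦ U u ⟧ * ⟦ lev r g u ⟧)) ≡⟨ trans (∑-swap (allFin n) (allFin n) _) (∑-cong (allFin n) (λ u → ∑-*ˡ (allFin n) ⟦ U u ⟧ _)) ⟩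
        ∑ᶠ (λ u → ⟦ U u ⟧ * ∑ᶠ (λ r → ⟦ lev r g u ⟧)) ≤⟨ ∑-mono (allFin n) (λ u → *-monoʳ-≤ ⟦ U u ⟧ (roots≤ g ≤-refl u)) ⟩
        ∑ᶠ (λ u → ⟦ U u ⟧ * ρ ^ g) ≡⟨ ∑-*ʳ (allFin n) _ (ρ ^ g) ⟩
        card U * ρ ^ g ∎
        where
        pt : ∀ r u → ⟦ U r ⟧ * ⟦ lev r g u ⟧ ≤ ⟦ U u ⟧ * ⟦ lev r g u ⟧
        pt r u = subst₂ _≤_ (⟦∧⟧ (U r) (lev r g u)) (⟦∧⟧ (U u) (lev r g u))
          (⟦⟧-mono {U r ∧ lev r g u} (λ e → ∧-intro (lev-U r u (∧-l e) (∧-r {U r} e)) (∧-r {U r} e)))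

    mult : ∀ m r y →
      ∑ᶠ (λ u → ⟦ I u ⟧ * ∑ (wk St g 1 u) (λ xs → ⟦ lightU u xs ⟧ * (⟦ end u xs == r ⟧ * ∑ (wk St m (suc h) u) (λ zs → ⟦ lightW r 0 zs ⟧ * ⟦ end u zs == y ⟧))))
        ≤ Γ ^ g * Γ ^ m
    mult m r y = begin
      ∑ᶠ (λ u → ⟦ I u ⟧ * ∑ (wk St g 1 u) (λ xs → ⟦ lightU u xs ⟧ * N (end u xs) u))
        ≤⟨ gather N ⟩
      Γ ^ g * ∑ᶠ (λ r' → ⟦ U r' ⟧ * ∑ᶠ (λ u → ⟦ lev r' g u ⟧ * N r' u))
        ≤⟨ *-monoʳ-≤ (Γ ^ g) (∑-mono (allFin n) (λ r' → ⟦⟧*-≤ (U r') _)) ⟩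
      Γ ^ g * ∑ᶠ (λ r' → ∑ᶠ (λ u → ⟦ lev r' g u ⟧ * (⟦ r' == r ⟧ * M u)))
        ≡⟨ cong (Γ ^ g *_) (∑-cong (allFin n) (λ r' → trans (∑-cong (allFin n) (λ u → x∙yz≡y∙xz ⟦ lev r' g u ⟧ ⟦ r' == r ⟧ (M u))) (∑-*ˡ (allFin n) ⟦ r' == r ⟧ _))) ⟩
      Γ ^ g * ∑ᶠ (λ r' → ⟦ r' == r ⟧ * ∑ᶠ (λ u → ⟦ lev r' g u ⟧ * M u))
        ≡⟨ cong (Γ ^ g *_) (∑ᶠ-δ r (λ r' → ∑ᶠ (λ u → ⟦ lev r' g u ⟧ * M u))) ⟩
      Γ ^ g * ∑ᶠ (λ u → ⟦ lev r g u ⟧ * M u)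
        ≤⟨ *-monoʳ-≤ (Γ ^ g) (light-walks m r 0 y) ⟩
      Γ ^ g * Γ ^ m ∎
      where
      open ≤-Reasoning
      M : Fin n → ℕ
      M u = ∑ (wk St m (suc h) u) (λ zs → ⟦ lightW r 0 zs ⟧ * ⟦ end u zs == y ⟧)
      N : Fin n → Fin n → ℕ
      N r' u = ⟦ r' == r ⟧ * M u

∑-filter : {A : Set} (p : A → Bool) (xs : List A) (F : A → ℕ) → ∑ (filterᵇ p xs) F ≡ ∑ xs (λ x → ⟦ p x ⟧ * F x)
∑-filter p [] F = refl
∑-filter p (x ∷ xs) F with p x
... | true = cong₂ _+_ (sym (*-identityˡ (F x))) (∑-filter p xs F)
... | false = ∑-filter p xs F

filter-true : {A : Set} (p : A → Bool) (xs : List A) {x : A} → x ∈ filterᵇ p xs → x ∈ xs × p x ≡ true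
filter-true p (y ∷ xs) x∈ with p y in e
filter-true p (y ∷ xs) (here refl) | true = here refl , e
filter-true p (y ∷ xs) (there x∈) | true = let a , b = filter-true p xs x∈ in there a , b
filter-true p (y ∷ xs) x∈ | false = let a , b = filter-true p xs x∈ in there a , b

module Configurations {n : ℕ} (G : Graph n) (k : ℕ) (free : ¬ HasCycle G (2 * k))
  {E : Fin n → Fin n → Bool} {ρ : ℕ} (D : Digraph E ρ) (E-adj : ∀ x y → E x y ≡ true → Adj G x y)
  (h' : ℕ) (κ : Fin n → ℕ) where

  h = suc h'
  open Items G k free D E-adj h κ public

  Item : Set
  Item = Fin n × List (Fin n) × List (Fin n)

  items : List Item
  items = concatMap (λ u → if I u then concatMap (λ xs → map (λ ys → u , xs , ys) (wk St (suc h) (suc h) u)) (wk St h 1 u) else []) (allFin n)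

  nested : (Fin n → List (Fin n) → List (Fin n) → ℕ) → ℕ
  nested F = ∑ᶠ (λ u → ⟦ I u ⟧ * ∑ (wk St h 1 u) (λ xs → ∑ (wk St (suc h) (suc h) u) (λ ys → F u xs ys)))

  ∑-items : (F : Fin n → List (Fin n) → List (Fin n) → ℕ) → ∑ items (λ (u , xs , ys) → F u xs ys) ≡ nested F
  ∑-items F = trans (∑-concatMap _ (allFin n) _) (∑-cong (allFin n) pt)
    where
    pt : ∀ u → ∑ (if I u then concatMap (λ xs → map (λ ys → u , xs , ys) (wk St (suc h) (suc h) u)) (wk St h 1 u) else []) (λ (u , xs , ys) → F u xs ys)
             ≡ ⟦ I u ⟧ * ∑ (wk St h 1 u) (λ xs → ∑ (wk St (suc h) (suc h) u) (λ ys → F u xs ys))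
    pt u with I u
    ... | false = refl
    ... | true = trans (∑-concatMap _ (wk St h 1 u) _) (trans (∑-cong (wk St h 1 u) (λ xs → ∑-map _ (wk St (suc h) (suc h) u) _)) (sym (*-identityˡ _)))

  record Valid (τ : Item) : Set where
    u = proj₁ τ
    xs = proj₁ (proj₂ τ)
    ys = proj₂ (proj₂ τ)
    field
      Iu  : I u ≡ true
      wxs : Walk St 1 u xs
      lxs : length xs ≡ h
      wys : Walk St (suc h) u ys
      lys : length ys ≡ suc h

  items-valid : ∀ {τ} → τ ∈ items → Valid τ
  items-valid {τ} τ∈ with find (∈-concatMap⁻ (λ u → if I u then concatMap (λ xs → map (λ ys → u , xs , ys) (wk St (suc h) (suc h) u)) (wk St h 1 u) else []) {xs = allFin n} τ∈)
  ... | u , _ , p with I u in eq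
  ...   | true with find (∈-concatMap⁻ (λ xs → map (λ ys → u , xs , ys) (wk St (suc h) (suc h) u)) {xs = wk St h 1 u} p)
  ...     | xs , xs∈ , q with ∈-map⁻ (λ ys → u , xs , ys) q
  ...       | ys , ys∈ , refl = record { Iu = eq ; wxs = proj₁ wx ; lxs = proj₂ wx ; wys = proj₁ wy ; lys = proj₂ wy }
    where
    wx = wk-sound St h 1 u xs∈
    wy = wk-sound St (suc h) (suc h) u ys∈

  nested-mono : ∀ {F H} → (∀ u xs ys → F u xs ys ≤ H u xs ys) → nested F ≤ nested H
  nested-mono le = ∑-mono (allFin n) (λ u → *-monoʳ-≤ ⟦ I u ⟧ (∑-mono (wk St h 1 u) (λ xs → ∑-mono (wk St (suc h) (suc h) u) (λ ys → le u xs ys))))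

  nested-+ : ∀ F H → nested (λ u xs ys → F u xs ys + H u xs ys) ≡ nested F + nested H
  nested-+ F H = trans (∑-cong (allFin n) (λ u → trans (cong (⟦ I u ⟧ *_) (trans (∑-cong (wk St h 1 u) (λ xs → ∑-+ (wk St (suc h) (suc h) u) _ _)) (∑-+ (wk St h 1 u) _ _))) (*-distribˡ-+ ⟦ I u ⟧ _ _))) (∑-+ (allFin n) _ _)

  total : ℕ
  total = card U * (ρ ^ h * ρ ^ suc h)

  private
    I≤U : ∑ᶠ (λ u → ⟦ I u ⟧) ≤ card U
    I≤U = ∑-mono (allFin n) (λ u → ⟦⟧-mono {I u} ∧-l)

    ∑-const≤ : ∀ m c u X → ∑ (wk St m c u) (λ _ → X) ≤ X * ρ ^ m
    ∑-const≤ m c u X = ≤-trans (≤-reflexive (trans (∑-cong (wk St m c u) (λ _ → sym (*-identityʳ X))) (∑-*ˡ (wk St m c u) X (λ _ → 1)))) (*-monoʳ-≤ X (wk-count St ρ St≤ m c u))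

  bad-left : h ≤ k → ρ * nested (λ u xs ys → ⟦ not (lightU u xs) ⟧) ≤ heavyConst Γ h * total
  bad-left h≤k = begin
    ρ * nested (λ u xs ys → ⟦ not (lightU u xs) ⟧)
      ≡⟨ trans (sym (∑-*ˡ (allFin n) ρ _)) (∑-cong (allFin n) (λ u → x∙yz≡y∙xz ρ ⟦ I u ⟧ _)) ⟩
    ∑ᶠ (λ u → ⟦ I u ⟧ * (ρ * ∑ (wk St h 1 u) (λ xs → ∑ (wk St (suc h) (suc h) u) (λ ys → ⟦ not (lightU u xs) ⟧))))
      ≤⟨ ∑-mono (allFin n) (λ u → ⟦⟧*-mono (I u) (inner u)) ⟩
    ∑ᶠ (λ u → ⟦ I u ⟧ * (heavyConst Γ h * 1 * ρ ^ h * ρ ^ suc h))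
      ≡⟨ ∑-*ʳ (allFin n) _ _ ⟩
    ∑ᶠ (λ u → ⟦ I u ⟧) * (heavyConst Γ h * 1 * ρ ^ h * ρ ^ suc h)
      ≤⟨ *-monoˡ-≤ _ I≤U ⟩
    card U * (heavyConst Γ h * 1 * ρ ^ h * ρ ^ suc h)
      ≡⟨ lem (card U) (heavyConst Γ h) (ρ ^ h) (ρ ^ suc h) ⟩
    heavyConst Γ h * total ∎
    where
    open ≤-Reasoning
    lem : ∀ a b c d → a * (b * 1 * c * d) ≡ b * (a * (c * d))
    lem = solve-∀
    inner : ∀ u → I u ≡ true → ρ * ∑ (wk St h 1 u) (λ xs → ∑ (wk St (suc h) (suc h) u) (λ ys → ⟦ not (lightU u xs) ⟧)) ≤ heavyConst Γ h * 1 * ρ ^ h * ρ ^ suc h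
    inner u Iu = begin
      ρ * ∑ (wk St h 1 u) (λ xs → ∑ (wk St (suc h) (suc h) u) (λ ys → ⟦ not (lightU u xs) ⟧))
        ≤⟨ *-monoʳ-≤ ρ (∑-mono (wk St h 1 u) (λ xs → ∑-const≤ (suc h) (suc h) u _)) ⟩
      ρ * ∑ (wk St h 1 u) (λ xs → ⟦ not (lightU u xs) ⟧ * ρ ^ suc h)
        ≡⟨ trans (cong (ρ *_) (∑-*ʳ (wk St h 1 u) _ (ρ ^ suc h))) (sym (*-assoc ρ _ (ρ ^ suc h))) ⟩
      ρ * L * ρ ^ suc h
        ≤⟨ *-monoˡ-≤ (ρ ^ suc h) (*-monoʳ-≤ ρ single) ⟩
      ρ * ∑ᶠ (λ x → ⟦ Lu.lev u 0 x ⟧ * ∑ (wk St h 1 x) (λ zs → ⟦ not (Lu.lightW u 0 zs) ⟧)) * ρ ^ suc h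
        ≤⟨ *-monoˡ-≤ (ρ ^ suc h) (Lu.heavy-walks h u 0 (≤-trans (≤-reflexive (trans (+-identityʳ _) (+-identityʳ h))) h≤k)) ⟩
      heavyConst Γ h * card (Lu.lev u 0) * ρ ^ h * ρ ^ suc h
        ≤⟨ *-monoˡ-≤ (ρ ^ suc h) (*-monoˡ-≤ (ρ ^ h) (*-monoʳ-≤ (heavyConst Γ h) (≤-trans (∑-mono (allFin n) (λ x → ⟦⟧-mono {Lu.lev u 0 x} {x == u} ∧-l)) (≤-reflexive (∑ᶠ-δ₁ u))))) ⟩
      heavyConst Γ h * 1 * ρ ^ h * ρ ^ suc h ∎
      where
      L = ∑ (wk St h 1 u) (λ xs → ⟦ not (lightU u xs) ⟧)
      single : L ≤ ∑ᶠ (λ x → ⟦ Lu.lev u 0 x ⟧ * ∑ (wk St h 1 x) (λ zs → ⟦ not (Lu.lightW u 0 zs) ⟧))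
      single = ≤-trans (≤-reflexive (trans (sym (*-identityˡ L)) (cong (λ b → ⟦ b ⟧ * L) (sym (Lu.root∈ u (≡ᵇ-true (∧-r {U u} Iu)))))))
                 (∑ᶠ-≥ (λ x → ⟦ Lu.lev u 0 x ⟧ * ∑ (wk St h 1 x) (λ zs → ⟦ not (Lu.lightW u 0 zs) ⟧)) u)

  module La = Rooted h ≤-refl
  module Lc = Rooted h' (n≤1+n h')

  factor : ∀ (f : Fin n → List (Fin n) → ℕ) (g : Fin n → List (Fin n) → List (Fin n) → ℕ) →
    nested (λ u xs ys → f u xs * g u xs ys) ≡ ∑ᶠ (λ u → ⟦ I u ⟧ * ∑ (wk St h 1 u) (λ xs → f u xs * ∑ (wk St (suc h) (suc h) u) (g u xs)))
  factor f g = ∑-cong (allFin n) (λ u → cong (⟦ I u ⟧ *_) (∑-cong (wk St h 1 u) (λ xs → ∑-*ˡ (wk St (suc h) (suc h) u) (f u xs) _)))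

  -- In a configuration (u , xs , ys) the roots are a = end u xs and a' = end u ys; their neighbours on the walk are
  -- c = end u (front xs) and c' = end u (front ys).
  bad-a : suc h + h ≤ k → ρ * nested (λ u xs ys → ⟦ lightU u xs ⟧ * ⟦ not (La.lightW (end u xs) 0 ys) ⟧) ≤ Γ ^ h * heavyConst Γ (suc h) * total
  bad-a le = ≤-trans (≤-reflexive (cong (ρ *_) (factor (λ u xs → ⟦ lightU u xs ⟧) (λ u xs ys → ⟦ not (La.lightW (end u xs) 0 ys) ⟧)))) (La.bad (suc h) le)

  mult-a : ∀ α α' → nested (λ u xs ys → (⟦ lightU u xs ⟧ * ⟦ end u xs == α ⟧) * (⟦ La.lightW α 0 ys ⟧ * ⟦ end u ys == α' ⟧)) ≤ Γ ^ h * Γ ^ suc h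
  mult-a α α' = ≤-trans (≤-reflexive (trans (factor (λ u xs → ⟦ lightU u xs ⟧ * ⟦ end u xs == α ⟧) (λ u xs ys → ⟦ La.lightW α 0 ys ⟧ * ⟦ end u ys == α' ⟧)) (∑-cong (allFin n) (λ u → cong (⟦ I u ⟧ *_) (∑-cong (wk St h 1 u) (λ xs → *-assoc ⟦ lightU u xs ⟧ _ _)))))) (La.mult (suc h) α α')

  private
    snocʳ : ∀ u (F : List (Fin n) → ℕ) → ∑ (wk St (suc h) (suc h) u) F ≡ ∑ (wk St h (suc h) u) (λ qs → ∑ᶠ (λ a' → ⟦ St (h + suc h) (end u qs) a' ⟧ * F (qs ∷ʳ a')))
    snocʳ u F = ∑-wk-snoc St h (suc h) u F

    snocˡ : ∀ u (F : List (Fin n) → ℕ) → ∑ (wk St h 1 u) F ≡ ∑ (wk St h' 1 u) (λ ps → ∑ᶠ (λ a → ⟦ St (h' + 1) (end u ps) a ⟧ * F (ps ∷ʳ a)))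
    snocˡ u F = ∑-wk-snoc St h' 1 u F

    step≤ : ∀ c x (X : ℕ) → ∑ᶠ (λ y → ⟦ St c x y ⟧ * X) ≤ X * ρ
    step≤ c x X = ≤-trans (≤-reflexive (trans (∑-*ʳ (allFin n) _ X) (*-comm _ X))) (*-monoʳ-≤ X (St≤ c x))

  -- The last right arc is left untested and contributes a factor ρ on both sides, so that depth 2h
  -- suffices.
  bad-a⁻ : h + h ≤ k → ρ * nested (λ u xs ys → ⟦ lightU u xs ⟧ * ⟦ not (La.lightW (end u xs) 0 (front ys)) ⟧) ≤ Γ ^ h * heavyConst Γ h * total
  bad-a⁻ le = begin
    ρ * nested (λ u xs ys → ⟦ lightU u xs ⟧ * ⟦ not (La.lightW (end u xs) 0 (front ys)) ⟧)
      ≡⟨ cong (ρ *_) (factor (λ u xs → ⟦ lightU u xs ⟧) (λ u xs ys → ⟦ not (La.lightW (end u xs) 0 (front ys)) ⟧)) ⟩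
    ρ * ∑ᶠ (λ u → ⟦ I u ⟧ * ∑ (wk St h 1 u) (λ xs → ⟦ lightU u xs ⟧ * ∑ (wk St (suc h) (suc h) u) (λ ys → ⟦ not (La.lightW (end u xs) 0 (front ys)) ⟧)))
      ≤⟨ *-monoʳ-≤ ρ (∑-mono (allFin n) (λ u → *-monoʳ-≤ ⟦ I u ⟧ (∑-mono (wk St h 1 u) (λ xs → *-monoʳ-≤ ⟦ lightU u xs ⟧ (inner u (end u xs)))))) ⟩
    ρ * ∑ᶠ (λ u → ⟦ I u ⟧ * ∑ (wk St h 1 u) (λ xs → ⟦ lightU u xs ⟧ * (N (end u xs) u * ρ)))
      ≡⟨ cong (ρ *_) (trans (∑-cong (allFin n) (λ u → trans (cong (⟦ I u ⟧ *_) (trans (∑-cong (wk St h 1 u) (λ xs → sym (*-assoc ⟦ lightU u xs ⟧ _ ρ))) (∑-*ʳ (wk St h 1 u) _ ρ))) (sym (*-assoc ⟦ I u ⟧ _ ρ)))) (∑-*ʳ (allFin n) _ ρ)) ⟩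
    ρ * (B * ρ) ≡⟨ sym (*-assoc ρ B ρ) ⟩
    ρ * B * ρ ≤⟨ *-monoˡ-≤ ρ (La.bad h le) ⟩
    Γ ^ h * heavyConst Γ h * (card U * (ρ ^ h * ρ ^ h)) * ρ ≡⟨ lem (Γ ^ h * heavyConst Γ h) (card U) (ρ ^ h) ρ ⟩
    Γ ^ h * heavyConst Γ h * total ∎
    where
    open ≤-Reasoning
    N : Fin n → Fin n → ℕ
    N r u = ∑ (wk St h (suc h) u) (λ qs → ⟦ not (La.lightW r 0 qs) ⟧)
    B = ∑ᶠ (λ u → ⟦ I u ⟧ * ∑ (wk St h 1 u) (λ xs → ⟦ lightU u xs ⟧ * N (end u xs) u))
    lem : ∀ a b c r → a * (b * (c * c)) * r ≡ a * (b * (c * (r * c)))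
    lem = solve-∀
    inner : ∀ u r → ∑ (wk St (suc h) (suc h) u) (λ ys → ⟦ not (La.lightW r 0 (front ys)) ⟧) ≤ N r u * ρ
    inner u r = ≤-trans (≤-reflexive (snocʳ u _)) (≤-trans (∑-mono (wk St h (suc h) u) (λ qs →
        ≤-trans (≤-reflexive (∑-cong (allFin n) (λ a' → cong (λ zs → ⟦ St (h + suc h) (end u qs) a' ⟧ * ⟦ not (La.lightW r 0 zs) ⟧) (front-∷ʳ qs a')))) (step≤ (h + suc h) (end u qs) _)))
      (≤-reflexive (∑-*ʳ (wk St h (suc h) u) _ ρ)))

  -- The tree starts one vertex before the end of the left walk. The last left arc is free, and the
  -- depth is again 2h.
  bad-c : suc h + h' ≤ k → ρ * nested (λ u xs ys → ⟦ lightU u xs ⟧ * ⟦ not (Lc.lightW (end u (front xs)) 0 ys) ⟧) ≤ Γ ^ h' * heavyConst Γ (suc h) * total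
  bad-c le = begin
    ρ * nested (λ u xs ys → ⟦ lightU u xs ⟧ * ⟦ not (Lc.lightW (end u (front xs)) 0 ys) ⟧)
      ≡⟨ cong (ρ *_) (factor (λ u xs → ⟦ lightU u xs ⟧) (λ u xs ys → ⟦ not (Lc.lightW (end u (front xs)) 0 ys) ⟧)) ⟩
    ρ * ∑ᶠ (λ u → ⟦ I u ⟧ * ∑ (wk St h 1 u) (λ xs → ⟦ lightU u xs ⟧ * N (end u (front xs)) u))
      ≤⟨ *-monoʳ-≤ ρ (∑-mono (allFin n) (λ u → *-monoʳ-≤ ⟦ I u ⟧ (inner u))) ⟩
    ρ * ∑ᶠ (λ u → ⟦ I u ⟧ * (∑ (wk St h' 1 u) (λ ps → ⟦ lightU u ps ⟧ * N (end u ps) u) * ρ))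
      ≡⟨ cong (ρ *_) (trans (∑-cong (allFin n) (λ u → sym (*-assoc ⟦ I u ⟧ _ ρ))) (∑-*ʳ (allFin n) _ ρ)) ⟩
    ρ * (B * ρ) ≡⟨ sym (*-assoc ρ B ρ) ⟩
    ρ * B * ρ ≤⟨ *-monoˡ-≤ ρ (Lc.bad (suc h) le) ⟩
    Γ ^ h' * heavyConst Γ (suc h) * (card U * (ρ ^ h' * ρ ^ suc h)) * ρ ≡⟨ lem (Γ ^ h' * heavyConst Γ (suc h)) (card U) (ρ ^ h') (ρ ^ suc h) ρ ⟩
    Γ ^ h' * heavyConst Γ (suc h) * total ∎
    where
    open ≤-Reasoning
    N : Fin n → Fin n → ℕ
    N r u = ∑ (wk St (suc h) (suc h) u) (λ ys → ⟦ not (Lc.lightW r 0 ys) ⟧)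
    B = ∑ᶠ (λ u → ⟦ I u ⟧ * ∑ (wk St h' 1 u) (λ ps → ⟦ lightU u ps ⟧ * N (end u ps) u))
    lem : ∀ a b c d r → a * (b * (c * d)) * r ≡ a * (b * (r * c * d))
    lem = solve-∀
    inner : ∀ u → ∑ (wk St h 1 u) (λ xs → ⟦ lightU u xs ⟧ * N (end u (front xs)) u) ≤ ∑ (wk St h' 1 u) (λ ps → ⟦ lightU u ps ⟧ * N (end u ps) u) * ρ
    inner u = ≤-trans (≤-reflexive (snocˡ u _)) (≤-trans (∑-mono (wk St h' 1 u) (λ ps →
        ≤-trans (∑-mono (allFin n) (λ a → *-monoʳ-≤ ⟦ St (h' + 1) (end u ps) a ⟧ (*-mono-≤ (⟦⟧-mono (Lu.lightW-init u 0 ps a)) (≤-reflexive (cong (λ zs → N (end u zs) u) (front-∷ʳ ps a))))))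
          (step≤ (h' + 1) (end u ps) _)))
      (≤-reflexive (∑-*ʳ (wk St h' 1 u) _ ρ)))

  -- Once `γ` and `α'` are fixed the last right arc is determined, so lightness up to `γ` is enough.
  -- In `mult-ca'` the same happens to the last left arc.
  mult-ac' : ∀ α γ α' → nested (λ u xs ys → (⟦ lightU u xs ⟧ * ⟦ end u xs == α ⟧) * ((⟦ La.lightW α 0 (front ys) ⟧ * ⟦ end u (front ys) == γ ⟧) * ⟦ end u ys == α' ⟧)) ≤ Γ ^ h * Γ ^ h
  mult-ac' α γ α' = ≤-trans (≤-reflexive (factor (λ u xs → ⟦ lightU u xs ⟧ * ⟦ end u xs == α ⟧) (λ u xs ys → (⟦ La.lightW α 0 (front ys) ⟧ * ⟦ end u (front ys) == γ ⟧) * ⟦ end u ys == α' ⟧))) (≤-trans (∑-mono (allFin n) (λ u → *-monoʳ-≤ ⟦ I u ⟧ (∑-mono (wk St h 1 u) (λ xs →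
      ≤-trans (*-monoʳ-≤ (⟦ lightU u xs ⟧ * ⟦ end u xs == α ⟧) (inner u)) (≤-reflexive (*-assoc ⟦ lightU u xs ⟧ _ _)))))) (La.mult h α γ))
    where
    inner : ∀ u → ∑ (wk St (suc h) (suc h) u) (λ ys → (⟦ La.lightW α 0 (front ys) ⟧ * ⟦ end u (front ys) == γ ⟧) * ⟦ end u ys == α' ⟧)
              ≤ ∑ (wk St h (suc h) u) (λ qs → ⟦ La.lightW α 0 qs ⟧ * ⟦ end u qs == γ ⟧)
    inner u = ≤-trans (≤-reflexive (snocʳ u _)) (∑-mono (wk St h (suc h) u) (λ qs → begin
      ∑ᶠ (λ a' → ⟦ St (h + suc h) (end u qs) a' ⟧ * ((⟦ La.lightW α 0 (front (qs ∷ʳ a')) ⟧ * ⟦ end u (front (qs ∷ʳ a')) == γ ⟧) * ⟦ end u (qs ∷ʳ a') == α' ⟧))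
        ≤⟨ ∑-mono (allFin n) (λ a' → ⟦⟧*-≤ (St (h + suc h) (end u qs) a') _) ⟩
      ∑ᶠ (λ a' → (⟦ La.lightW α 0 (front (qs ∷ʳ a')) ⟧ * ⟦ end u (front (qs ∷ʳ a')) == γ ⟧) * ⟦ end u (qs ∷ʳ a') == α' ⟧)
        ≡⟨ ∑-cong (allFin n) (λ a' → cong₂ (λ zs e → (⟦ La.lightW α 0 zs ⟧ * ⟦ end u zs == γ ⟧) * ⟦ e == α' ⟧) (front-∷ʳ qs a') (end-∷ʳ u qs a')) ⟩
      ∑ᶠ (λ a' → (⟦ La.lightW α 0 qs ⟧ * ⟦ end u qs == γ ⟧) * ⟦ a' == α' ⟧)
        ≡⟨ trans (∑-*ˡ (allFin n) (⟦ La.lightW α 0 qs ⟧ * ⟦ end u qs == γ ⟧) _) (trans (cong (⟦ La.lightW α 0 qs ⟧ * ⟦ end u qs == γ ⟧ *_) (∑ᶠ-δ₁ α')) (*-identityʳ _)) ⟩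
      ⟦ La.lightW α 0 qs ⟧ * ⟦ end u qs == γ ⟧ ∎))
      where open ≤-Reasoning

  mult-ca' : ∀ α γ α' → nested (λ u xs ys → (⟦ lightU u xs ⟧ * (⟦ end u xs == α ⟧ * ⟦ end u (front xs) == γ ⟧)) * (⟦ Lc.lightW γ 0 ys ⟧ * ⟦ end u ys == α' ⟧)) ≤ Γ ^ h' * Γ ^ suc h
  mult-ca' α γ α' = ≤-trans (≤-reflexive (factor (λ u xs → ⟦ lightU u xs ⟧ * (⟦ end u xs == α ⟧ * ⟦ end u (front xs) == γ ⟧)) (λ u xs ys → ⟦ Lc.lightW γ 0 ys ⟧ * ⟦ end u ys == α' ⟧))) (≤-trans (∑-mono (allFin n) (λ u → *-monoʳ-≤ ⟦ I u ⟧ (inner u _))) (Lc.mult (suc h) γ α'))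
    where
    lem : ∀ s l e c q → s * ((l * (e * c)) * q) ≡ (l * (c * q)) * (s * e)
    lem = solve-∀
    inner : ∀ u Q → ∑ (wk St h 1 u) (λ xs → (⟦ lightU u xs ⟧ * (⟦ end u xs == α ⟧ * ⟦ end u (front xs) == γ ⟧)) * Q)
              ≤ ∑ (wk St h' 1 u) (λ ps → ⟦ lightU u ps ⟧ * (⟦ end u ps == γ ⟧ * Q))
    inner u Q = ≤-trans (≤-reflexive (snocˡ u _)) (∑-mono (wk St h' 1 u) (λ ps → begin
      ∑ᶠ (λ a → ⟦ St (h' + 1) (end u ps) a ⟧ * ((⟦ lightU u (ps ∷ʳ a) ⟧ * (⟦ end u (ps ∷ʳ a) == α ⟧ * ⟦ end u (front (ps ∷ʳ a)) == γ ⟧)) * Q))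
        ≤⟨ ∑-mono (allFin n) (λ a → *-monoʳ-≤ ⟦ St (h' + 1) (end u ps) a ⟧ (*-monoˡ-≤ Q (*-mono-≤ (⟦⟧-mono (Lu.lightW-init u 0 ps a))
             (≤-reflexive (cong₂ (λ e zs → ⟦ e == α ⟧ * ⟦ end u zs == γ ⟧) (end-∷ʳ u ps a) (front-∷ʳ ps a)))))) ⟩
      ∑ᶠ (λ a → ⟦ St (h' + 1) (end u ps) a ⟧ * ((⟦ lightU u ps ⟧ * (⟦ a == α ⟧ * ⟦ end u ps == γ ⟧)) * Q))
        ≡⟨ ∑-cong (allFin n) (λ a → lem ⟦ St (h' + 1) (end u ps) a ⟧ ⟦ lightU u ps ⟧ ⟦ a == α ⟧ ⟦ end u ps == γ ⟧ Q) ⟩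
      ∑ᶠ (λ a → (⟦ lightU u ps ⟧ * (⟦ end u ps == γ ⟧ * Q)) * (⟦ St (h' + 1) (end u ps) a ⟧ * ⟦ a == α ⟧))
        ≡⟨ ∑-*ˡ (allFin n) (⟦ lightU u ps ⟧ * (⟦ end u ps == γ ⟧ * Q)) _ ⟩
      (⟦ lightU u ps ⟧ * (⟦ end u ps == γ ⟧ * Q)) * ∑ᶠ (λ a → ⟦ St (h' + 1) (end u ps) a ⟧ * ⟦ a == α ⟧)
        ≤⟨ *-monoʳ-≤ (⟦ lightU u ps ⟧ * (⟦ end u ps == γ ⟧ * Q)) (≤-trans (∑-mono (allFin n) (λ a → ⟦⟧*-≤ (St (h' + 1) (end u ps) a) _)) (≤-reflexive (∑ᶠ-δ₁ α))) ⟩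
      (⟦ lightU u ps ⟧ * (⟦ end u ps == γ ⟧ * Q)) * 1 ≡⟨ *-identityʳ _ ⟩
      ⟦ lightU u ps ⟧ * (⟦ end u ps == γ ⟧ * Q) ∎))
      where open ≤-Reasoning

-- Distinct pairs of branch sets

wk-complete : ∀ {n} {E : ℕ → Fin n → Fin n → Bool} {c x zs} → Walk E c x zs → zs ∈ wk E (length zs) c x
wk-complete [] = here refl
wk-complete {n} {E} {c} {x} {y ∷ zs} (e ∷ w) =
  ∈-concatMap⁺ (λ y → if E c x y then map (y ∷_) (wk E (length zs) (suc c) y) else []) (lose (∈-allFin y)
    (subst (λ b → (y ∷ zs) ∈ (if b then map (y ∷_) (wk E (length zs) (suc c) y) else [])) (sym e) (∈-map⁺ (y ∷_) (wk-complete w))))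

2ab≤aa+bb : ∀ a b → 2 * (a * b) ≤ a * a + b * b
2ab≤aa+bb a b with ≤-total a b
... | inj₁ a≤b = subst (λ b → 2 * (a * b) ≤ a * a + b * b) (m+[n∸m]≡n a≤b) (subst (2 * (a * (a + (b ∸ a))) ≤_) (lem a (b ∸ a)) (m≤m+n _ _))
  where lem : ∀ a d → 2 * (a * (a + d)) + d * d ≡ a * a + (a + d) * (a + d)
        lem = solve-∀
... | inj₂ b≤a = subst (λ a → 2 * (a * b) ≤ a * a + b * b) (m+[n∸m]≡n b≤a) (subst (2 * ((b + (a ∸ b)) * b) ≤_) (lem b (a ∸ b)) (m≤m+n _ _))
  where lem : ∀ b d → 2 * ((b + d) * b) + d * d ≡ (b + d) * (b + d) + b * b
        lem = solve-∀

-- A second-moment argument. If m is the multiplicity of a pair, then 2Cm ≤ C² + m² on every pair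
-- that occurs. Summing and inserting the bound on the sum of m² leaves at least 1/C as many pairs
-- as items; no Cauchy-Schwarz quotient is needed.
module DistinctPairs {A : Set} {N : ℕ} (ts : List A) (f g : A → Fin N) (C : ℕ) (C>0 : 0 < C)
  (collisions : ∑ ts (λ s → ∑ ts (λ t → ⟦ f t == f s ⟧ * ⟦ g t == g s ⟧)) ≤ C * length ts) where

  Hit : Fin N → Fin N → Bool
  Hit ω ω' = any (λ t → (f t == ω) ∧ (g t == ω')) ts

  private
    m : Fin N → Fin N → ℕ
    m ω ω' = ∑ ts (λ t → ⟦ f t == ω ⟧ * ⟦ g t == ω' ⟧)

    dbl : (Fin N → Fin N → ℕ) → ℕ
    dbl F = ∑ᶠ (λ ω → ∑ᶠ (λ ω' → F ω ω'))

    spread : ∀ (F : Fin N → Fin N → ℕ) → dbl (λ ω ω' → m ω ω' * F ω ω') ≡ ∑ ts (λ t → F (f t) (g t))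
    spread F = begin
      dbl (λ ω ω' → m ω ω' * F ω ω')
        ≡⟨ ∑-cong (allFin N) (λ ω → ∑-cong (allFin N) (λ ω' → sym (∑-*ʳ ts _ (F ω ω')))) ⟩
      dbl (λ ω ω' → ∑ ts (λ t → ⟦ f t == ω ⟧ * ⟦ g t == ω' ⟧ * F ω ω'))
        ≡⟨ trans (∑-cong (allFin N) (λ ω → ∑-swap (allFin N) ts _)) (∑-swap (allFin N) ts _) ⟩
      ∑ ts (λ t → dbl (λ ω ω' → ⟦ f t == ω ⟧ * ⟦ g t == ω' ⟧ * F ω ω'))
        ≡⟨ ∑-cong ts (λ t → trans (∑-cong (allFin N) (λ ω → inner t ω)) (∑ᶠ-δ (f t) (λ ω → F ω (g t)))) ⟩
      ∑ ts (λ t → F (f t) (g t)) ∎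
      where
      open ≡-Reasoning
      inner : ∀ t ω → ∑ᶠ (λ ω' → ⟦ f t == ω ⟧ * ⟦ g t == ω' ⟧ * F ω ω') ≡ ⟦ ω == f t ⟧ * F ω (g t)
      inner t ω = trans (∑-cong (allFin N) (λ ω' → trans (*-assoc ⟦ f t == ω ⟧ _ _) (cong₂ (λ b d → ⟦ b ⟧ * (⟦ d ⟧ * F ω ω')) (==-sym (f t) ω) (==-sym (g t) ω'))))
        (trans (∑-*ˡ (allFin N) ⟦ ω == f t ⟧ _) (cong (⟦ ω == f t ⟧ *_) (∑ᶠ-δ (g t) (F ω))))

    total-m : dbl m ≡ length ts
    total-m = trans (∑-cong (allFin N) (λ ω → ∑-cong (allFin N) (λ ω' → sym (*-identityʳ (m ω ω')))))
      (trans (spread (λ _ _ → 1)) (trans (∑-const ts 1) (*-identityʳ _)))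

    pt : ∀ ω ω' → 2 * (C * m ω ω') ≤ C * C * ⟦ Hit ω ω' ⟧ + m ω ω' * m ω ω'
    pt ω ω' = cases (Hit ω ω') refl
      where
      cases : ∀ b → Hit ω ω' ≡ b → 2 * (C * m ω ω') ≤ C * C * ⟦ b ⟧ + m ω ω' * m ω ω'
      cases true _ = ≤-trans (2ab≤aa+bb C (m ω ω')) (≤-reflexive (cong (_+ m ω ω' * m ω ω') (sym (*-identityʳ (C * C)))))
      cases false e = ≤-trans (≤-reflexive (trans (cong (λ x → 2 * (C * x)) zero-m) (trans (cong (2 *_) (*-zeroʳ C)) refl))) z≤n
        where
        zero-m : m ω ω' ≡ 0
        zero-m = n≤0⇒n≡0 (≤-trans (∑-mono-∈ ts (λ t t∈ → ≤-trans (≤-reflexive (sym (⟦∧⟧ (f t == ω) (g t == ω'))))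
          (⟦⟧-mono {_} {false} (λ p → trans (sym e) (∃⇒any _ ts t∈ p))))) (≤-reflexive (∑-zero ts)))

  many : length ts ≤ C * ∑ᶠ (λ ω → ∑ᶠ (λ ω' → ⟦ Hit ω ω' ⟧))
  many = *-cancelˡ-≤ C {{>-nonZero C>0}} (+-cancelʳ-≤ (C * length ts) _ _ (begin
      C * length ts + C * length ts
        ≡⟨ trans (cong (C * length ts +_) (sym (+-identityʳ _))) (cong (λ x → 2 * (C * x)) (sym total-m)) ⟩
      2 * (C * dbl m)
        ≡⟨ sym (trans (trans (∑-cong (allFin N) (λ ω → ∑-*ˡ (allFin N) 2 _)) (∑-*ˡ (allFin N) 2 _)) (cong (2 *_) (trans (∑-cong (allFin N) (λ ω → ∑-*ˡ (allFin N) C _)) (∑-*ˡ (allFin N) C _)))) ⟩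
      dbl (λ ω ω' → 2 * (C * m ω ω'))
        ≤⟨ ∑-mono (allFin N) (λ ω → ∑-mono (allFin N) (λ ω' → pt ω ω')) ⟩
      dbl (λ ω ω' → C * C * ⟦ Hit ω ω' ⟧ + m ω ω' * m ω ω')
        ≡⟨ trans (∑-cong (allFin N) (λ ω → ∑-+ (allFin N) _ _)) (∑-+ (allFin N) _ _) ⟩
      dbl (λ ω ω' → C * C * ⟦ Hit ω ω' ⟧) + dbl (λ ω ω' → m ω ω' * m ω ω')
        ≡⟨ cong₂ _+_ (trans (∑-cong (allFin N) (λ ω → ∑-*ˡ (allFin N) (C * C) _)) (∑-*ˡ (allFin N) (C * C) _)) (spread m) ⟩
      C * C * dbl (λ ω ω' → ⟦ Hit ω ω' ⟧) + ∑ ts (λ s → m (f s) (g s))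
        ≤⟨ +-mono-≤ (≤-reflexive (*-assoc C C _)) collisions ⟩
      C * (C * dbl (λ ω ω' → ⟦ Hit ω ω' ⟧)) + C * length ts ∎))
    where open ≤-Reasoning

-- Linked branch sets from configurations

module Assembly {n : ℕ} (G : Graph n) (k : ℕ) (free : ¬ HasCycle G (2 * k))
  {E : Fin n → Fin n → Bool} {ρ : ℕ} (D : Digraph E ρ) (E-adj : ∀ x y → E x y ≡ true → Adj G x y)
  (h' : ℕ) (κ : Fin n → ℕ) (ρ>0 : 0 < ρ) (B : ℕ) (lab : Fin n → Fin n → Fin B) where

  open Configurations G k free D E-adj h' κ

  -- Branch sets are indexed by a root and the label of the arc through which the walk enters it.
  tip : Fin n → List (Fin n) → Fin (n * B)
  tip v zs = combine (end v zs) (lab (end v (front zs)) (end v zs))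

  keyˡ keyʳ : Item → Fin (n * B)
  keyˡ (u , xs , ys) = tip u xs
  keyʳ (u , xs , ys) = tip u ys

  root : Fin (n * B) → Fin n
  root ω = proj₁ (remQuot B ω)

  private
    root-combine : ∀ a i → root (combine a i) ≡ a
    root-combine a i = cong proj₁ (remQuot-combine {n} {B} a i)

    -- Left roots have colour h and right roots colour h + (h + 1); the colour of a vertex decides which kind it reaches.
    tgt : Fin n → ℕ
    tgt v = if κ v ≤ᵇ h then h else h + suc h

    tgtˡ : ∀ v → κ v ≤ h → tgt v ≡ h
    tgtˡ v le = cong (λ b → if b then h else h + suc h) (true-≤ᵇ le)

    tgtʳ : ∀ v → h < κ v → tgt v ≡ h + suc h
    tgtʳ v lt = cong (λ b → if b then h else h + suc h) (≢true⇒≡false (λ e → <⇒≱ lt (≤ᵇ-true e)))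

    -- A root reaches all `B` branch sets that share it; this is the summand `B` in the sampling
    -- rate and the reason why `B` must not exceed O(ρ^h).
    reachN : ℕ → Fin n → List (Fin (n * B))
    reachN zero    v = map (combine v) (allFin B)
    reachN (suc s) v = map (tip v) (wk St (suc s) (suc (κ v)) v)

    reach : Fin n → List (Fin (n * B))
    reach v = reachN (tgt v ∸ κ v) v

    Rch : Fin n → Fin (n * B) → Bool
    Rch v ω = ω ∈ᵇ reach v

    reachN-length : ∀ s v → s ≤ h → length (reachN s v) ≤ B + ρ ^ h
    reachN-length zero v _ = ≤-trans (≤-reflexive (trans (length-map (combine v) (allFin B)) (length-tabulate {n = B} id))) (m≤m+n B _)
    reachN-length (suc s) v s≤h = ≤-trans (≤-reflexive (trans (length-map (tip v) (wk St (suc s) (suc (κ v)) v)) (sym (trans (∑-const (wk St (suc s) (suc (κ v)) v) 1) (*-identityʳ _)))))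
      (≤-trans (wk-count St ρ St≤ (suc s) (suc (κ v)) v) (≤-trans (^-monoʳ-≤ ρ {{>-nonZero ρ>0}} s≤h) (m≤n+m _ B)))

    cover : ∀ v → card (Rch v) ≤ B + ρ ^ h
    cover v = ≤-trans (∈ᵇ-count (reach v)) (reachN-length (tgt v ∸ κ v) v steps)
      where
      steps : tgt v ∸ κ v ≤ h
      steps with κ v ≤? h
      ... | yes le = ≤-trans (≤-reflexive (cong (_∸ κ v) (tgtˡ v le))) (m∸n≤m h (κ v))
      ... | no gt = ≤-trans (≤-reflexive (cong (_∸ κ v) (tgtʳ v (≰⇒> gt)))) (≤-trans (∸-monoʳ-≤ (h + suc h) (≰⇒> gt)) (≤-reflexive (m+n∸n≡m h (suc h))))

    rv : Fin n → List (Fin n) → List (Fin n)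
    rv x [] = x ∷ []
    rv x (z ∷ zs) = rv z zs ++ (x ∷ [])

    rv-trail : ∀ {c x zs} → Walk St c x zs → Trail G (end x zs) x (rv x zs)
    rv-trail [] = one
    rv-trail {x = x} (_∷_ {y = y} e w) = join G (rv-trail w) (Adj-sym G (E-adj x y (out-E x y (∧-l e)))) one

    rv-length : ∀ x zs → length (rv x zs) ≡ suc (length zs)
    rv-length x [] = refl
    rv-length x (z ∷ zs) = trans (length-++ (rv z zs)) (trans (+-comm _ 1) (cong suc (rv-length z zs)))

    St-color : ∀ {c} x y → St c x y ≡ true → κ y ≡ c
    St-color x y e = ≡ᵇ-true (∧-r {out x y} e)

    -- The label is fixed by the last arc. At the root itself no arc is left and every label is
    -- reached, so the condition on `l` is needed for nonempty `zs` only.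
    own : ∀ zs v l t → κ v + length zs ≡ t → Walk St (suc (κ v)) v zs → (∀ w → κ v ≤ κ w → κ w ≤ t → tgt w ≡ t) →
          (zs ≢ [] → l ≡ lab (end v (front zs)) (end v zs)) → ∀ w → w ∈ rv v zs → combine (end v zs) l ∈ reach w
    own [] v l t e _ T _ w (here refl) = subst (λ s → combine v l ∈ reachN s v) (sym arrived) (∈-map⁺ (combine v) (∈-allFin l))
      where
      κv : κ v ≡ t
      κv = trans (sym (+-identityʳ (κ v))) e
      arrived : tgt v ∸ κ v ≡ 0
      arrived = trans (cong₂ _∸_ (T v ≤-refl (≤-reflexive κv)) κv) (n∸n≡0 t)
    own (z ∷ zs) v l t e (p ∷ wlk) T L w w∈ with ∈-++⁻ (rv z zs) w∈
    ... | inj₁ w∈' = own zs z l t (trans (cong (_+ length zs) κz) (trans (sym (+-suc (κ v) (length zs))) e)) (subst (λ c → Walk St (suc c) z zs) (sym κz) wlk)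
                       (λ w' z≤ ≤t → T w' (≤-trans (n≤1+n _) (≤-trans (≤-reflexive (sym κz)) z≤)) ≤t) (L' zs L) w w∈'
      where
      κz : κ z ≡ suc (κ v)
      κz = St-color v z p
      L' : ∀ zs → ((z ∷ zs) ≢ [] → l ≡ lab (end v (front (z ∷ zs))) (end z zs)) → zs ≢ [] → l ≡ lab (end z (front zs)) (end z zs)
      L' [] L ne = contradiction refl ne
      L' (z' ∷ zs) L ne = L (λ ())
    ... | inj₂ (here refl) = subst (λ s → combine (end z zs) l ∈ reachN s v) (sym len)
                               (subst (λ i → combine (end z zs) i ∈ reachN (suc (length zs)) v) (sym (L (λ ()))) (∈-map⁺ (tip v) (wk-complete (p ∷ wlk))))
      where
      v≤t : κ v ≤ t
      v≤t = ≤-trans (m≤m+n (κ v) _) (≤-reflexive e)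
      len : tgt v ∸ κ v ≡ suc (length zs)
      len = trans (cong (_∸ κ v) (trans (T v ≤-refl v≤t) (sym e))) (m+n∸m≡n (κ v) (suc (length zs)))

    walk-color : ∀ v zs → Walk St (suc (κ v)) v zs → κ (end v zs) ≡ κ v + length zs
    walk-color v [] [] = sym (+-identityʳ (κ v))
    walk-color v (z ∷ zs) (p ∷ w) = trans (walk-color z zs (subst (λ c → Walk St (suc c) z zs) (sym κz) w)) (trans (cong (_+ length zs) κz) (sym (+-suc (κ v) (length zs))))
      where
      κz : κ z ≡ suc (κ v)
      κz = St-color v z p

    root-color : ∀ v ω → κ v ≤ tgt v → ω ∈ reach v → κ (root ω) ≡ tgt v
    root-color v ω v≤ ω∈ = go (tgt v ∸ κ v) refl ω∈
      where
      go : ∀ s → tgt v ∸ κ v ≡ s → ω ∈ reachN s v → κ (root ω) ≡ tgt v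
      go zero e ω∈ with ∈-map⁻ (combine v) ω∈
      ... | i , _ , refl = trans (cong κ (root-combine v i)) (≤-antisym v≤ (m∸n≡0⇒m≤n e))
      go (suc s) e ω∈ with ∈-map⁻ (tip v) ω∈
      ... | zs , zs∈ , refl with wk-sound St (suc s) (suc (κ v)) v zs∈
      ...   | w , l = trans (cong κ (root-combine (end v zs) _)) (trans (walk-color v zs w) (trans (cong (κ v +_) (trans l (sym e))) (m+[n∸m]≡n v≤)))

    rv-colors : ∀ v zs → Walk St (suc (κ v)) v zs → ∀ w → w ∈ rv v zs → κ v ≤ κ w × κ w ≤ κ v + length zs
    rv-colors v [] [] w (here refl) = ≤-refl , m≤m+n (κ v) 0
    rv-colors v (z ∷ zs) (p ∷ wlk) w w∈ with ∈-++⁻ (rv z zs) w∈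
    ... | inj₂ (here refl) = ≤-refl , m≤m+n (κ v) _
    ... | inj₁ w∈' with rv-colors z zs (subst (λ c → Walk St (suc c) z zs) (sym (St-color v z p)) wlk) w w∈'
    ...   | lo , hi = ≤-trans (≤-trans (n≤1+n _) (≤-reflexive (sym (St-color v z p)))) lo
                    , ≤-trans hi (≤-reflexive (trans (cong (_+ length zs) (St-color v z p)) (sym (+-suc (κ v) (length zs)))))

  module _ (τ : Item) (val : Valid τ) where
    open Valid val

    -- The first right arc is the bridge. A vertex of the left arm reaches only roots of colour h
    -- and one of the right arm only roots of colour 2h+1, which gives `otherˡ`, `otherʳ` and
    -- `distinct`.
    τ-link : Link G root Rch (suc h + suc h) (keyˡ τ) (keyʳ τ)
    τ-link = build ys wys lys
      where
      κu : κ u ≡ 0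
      κu = ≡ᵇ-true (∧-r {U u} Iu)
      wxs' : Walk St (suc (κ u)) u xs
      wxs' = subst (λ c → Walk St (suc c) u xs) (sym κu) wxs
      tot : κ u + length xs ≡ h
      tot = trans (cong (_+ length xs) κu) lxs
      colorˡ : κ (root (tip u xs)) ≡ h
      colorˡ = trans (cong κ (root-combine _ _)) (trans (walk-color u xs wxs') tot)
      build : ∀ ys → Walk St (suc h) u ys → length ys ≡ suc h → Link G root Rch (suc h + suc h) (tip u xs) (tip u ys)
      build (y ∷ zs) (e ∷ wzs) lys = record
        { armˡ = rv u xs ; armʳ = rv y zs ; x = u ; x' = y
        ; trailˡ = subst (λ r → Trail G r u (rv u xs)) (sym (root-combine _ _)) (rv-trail wxs)
        ; trailʳ = subst (λ r → Trail G r y (rv y zs)) (sym (root-combine _ _)) (rv-trail wzs)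
        ; bridge = E-adj u y (out-E u y (∧-l e))
        ; short = ≤-reflexive (cong₂ _+_ (trans (rv-length u xs) (cong suc lxs)) (trans (rv-length y zs) lys))
        ; ownˡ = λ v v∈ → true-∈ᵇ (own xs u _ h tot wxs' (λ w _ le → tgtˡ w le) (λ _ → refl) v v∈)
        ; otherˡ = λ v v∈ → ≢true⇒≡false (λ r → <⇒≢ h<2h (trans (sym (tgtˡ v (inˡ v v∈))) (trans (sym (root-color v _ (≤-trans (inˡ v v∈) (≤-reflexive (sym (tgtˡ v (inˡ v v∈))))) (∈ᵇ-true r))) colorʳ)))
        ; ownʳ = λ v v∈ → true-∈ᵇ (own zs y _ (h + suc h) tot' wzs' (λ w lo _ → tgtʳ w (≤-trans (≤-reflexive (sym κy)) lo)) (lbl zs lz) v v∈)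
        ; otherʳ = λ v v∈ → ≢true⇒≡false (λ r → <⇒≢ h<2h (sym (trans (sym (tgtʳ v (lo v v∈))) (trans (sym (root-color v _ (≤-trans (hi v v∈) (≤-reflexive (sym (tgtʳ v (lo v v∈))))) (∈ᵇ-true r))) colorˡ))))
        ; distinct = λ eq → <⇒≢ h<2h (trans (sym colorˡ) (trans (cong (κ ∘ root) eq) colorʳ)) }
        where
        h<2h : h < h + suc h
        h<2h = m<m+n h (s≤s z≤n)
        κy : κ y ≡ suc h
        κy = St-color u y e
        lz : length zs ≡ h
        lz = suc-injective lys
        wzs' : Walk St (suc (κ y)) y zs
        wzs' = subst (λ c → Walk St (suc c) y zs) (sym κy) wzs
        tot' : κ y + length zs ≡ h + suc h
        tot' = trans (cong₂ _+_ κy lz) (+-comm (suc h) h)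
        colorʳ : κ (root (tip u (y ∷ zs))) ≡ h + suc h
        colorʳ = trans (cong κ (root-combine _ _)) (trans (walk-color y zs wzs') tot')
        inˡ : ∀ v → v ∈ rv u xs → κ v ≤ h
        inˡ v v∈ = ≤-trans (proj₂ (rv-colors u xs wxs' v v∈)) (≤-reflexive tot)
        lo : ∀ v → v ∈ rv y zs → h < κ v
        lo v v∈ = ≤-trans (≤-reflexive (sym κy)) (proj₁ (rv-colors y zs wzs' v v∈))
        hi : ∀ v → v ∈ rv y zs → κ v ≤ h + suc h
        hi v v∈ = ≤-trans (proj₂ (rv-colors y zs wzs' v v∈)) (≤-reflexive tot')
        lbl : ∀ zs → length zs ≡ h → zs ≢ [] → lab (end u (front (y ∷ zs))) (end y zs) ≡ lab (end y (front zs)) (end y zs)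
        lbl (z ∷ zs) _ _ = refl

  assemble : (𝒯 : List Item) → (∀ τ → τ ∈ 𝒯 → Valid τ) → 0 < length 𝒯 →
    ∀ C → 0 < C → ∑ 𝒯 (λ s → ∑ 𝒯 (λ t → ⟦ keyˡ t == keyˡ s ⟧ * ⟦ keyʳ t == keyʳ s ⟧)) ≤ C * length 𝒯 →
    (used : Fin n → Fin B → Bool) →
    (∀ τ → τ ∈ 𝒯 → let (u , xs , ys) = τ in used (end u xs) (lab (end u (front xs)) (end u xs)) ≡ true × used (end u ys) (lab (end u (front ys)) (end u ys)) ≡ true) →
    Σ ℕ λ m → Σ (Graph (suc m)) λ H → IsMinor H G ×
      length 𝒯 * suc m ≤ C * (4 * suc (2 * ((suc h + suc h) * (B + ρ ^ h))) * ∑ᶠ (λ a → ∑ᶠ (λ i → ⟦ used a i ⟧))) * degSum H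
  assemble 𝒯 valid 𝒯>0 C C>0 collisions used used-ok = finish (dense-minor M>0)
    where
    open DistinctPairs 𝒯 keyˡ keyʳ C C>0 collisions
    hit : ∀ ω ω' → Hit ω ω' ≡ true → ∃ λ τ → τ ∈ 𝒯 × keyˡ τ ≡ ω × keyʳ τ ≡ ω'
    hit ω ω' e with any⇒∃ (λ t → (keyˡ t == ω) ∧ (keyʳ t == ω')) 𝒯 e
    ... | τ , τ∈ , p = τ , τ∈ , ==⇒≡ (∧-l p) , ==⇒≡ {x = keyʳ τ} (∧-r {keyˡ τ == ω} p)
    Us : Fin (n * B) → Bool
    Us ω = used (proj₁ (remQuot {n} B ω)) (proj₂ (remQuot {n} B ω))
    Us-combine : ∀ a i → used a i ≡ true → Us (combine a i) ≡ true
    Us-combine a i e = trans (cong (λ p → used (proj₁ p) (proj₂ p)) (remQuot-combine {n} {B} a i)) e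
    link : ∀ ω ω' → Hit ω ω' ≡ true → Link G root Rch (suc h + suc h) ω ω'
    link ω ω' e with hit ω ω' e
    ... | τ , τ∈ , refl , refl = τ-link τ (valid τ τ∈)
    Lk-Us : ∀ ω ω' → Hit ω ω' ≡ true → Us ω ≡ true × Us ω' ≡ true
    Lk-Us ω ω' e with hit ω ω' e
    ... | τ , τ∈ , refl , refl = Us-combine _ _ (proj₁ (used-ok τ τ∈)) , Us-combine _ _ (proj₂ (used-ok τ τ∈))
    -- Twice the number 2h+2 of arm vertices times the number of branch sets that a vertex can
    -- reach; `suc` provides the element that stands for being chosen.
    q = suc (2 * ((suc h + suc h) * (B + ρ ^ h)))
    open Sampling G root Rch (B + ρ ^ h) cover (suc h + suc h) Hit link Us Lk-Us q zero (n≤1+n _)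
    M = ∑ᶠ (λ ω → ∑ᶠ (λ ω' → ⟦ Hit ω ω' ⟧))
    M>0 : 0 < M
    M>0 = n≢0⇒n>0 (λ e → <⇒≱ 𝒯>0 (≤-trans many (≤-reflexive (trans (cong (C *_) e) (*-zeroʳ C)))))
    Nu = ∑ᶠ (λ a → ∑ᶠ (λ i → ⟦ used a i ⟧))
    Us≤ : card Us ≤ Nu
    Us≤ = begin
      card Us ≤⟨ ∑-mono (allFin (n * B)) pt ⟩
      ∑ᶠ (λ ω → ∑ᶠ (λ a → ∑ᶠ (λ i → ⟦ ω == combine a i ⟧ * ⟦ used a i ⟧)))
        ≡⟨ trans (∑-swap (allFin (n * B)) (allFin n) _) (∑-cong (allFin n) (λ a → trans (∑-swap (allFin (n * B)) (allFin B) _)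
             (∑-cong (allFin B) (λ i → trans (∑-*ʳ (allFin (n * B)) _ ⟦ used a i ⟧) (trans (cong (_* ⟦ used a i ⟧) (∑ᶠ-δ₁ (combine a i))) (*-identityˡ _)))))) ⟩
      Nu ∎
      where
      open ≤-Reasoning
      pt : ∀ ω → ⟦ Us ω ⟧ ≤ ∑ᶠ (λ a → ∑ᶠ (λ i → ⟦ ω == combine a i ⟧ * ⟦ used a i ⟧))
      pt ω = begin
        ⟦ Us ω ⟧ ≡⟨ trans (sym (*-identityˡ _)) (cong (λ b → ⟦ b ⟧ * ⟦ Us ω ⟧) (sym (trans (cong (ω ==_) (combine-remQuot {n} B ω)) (==-refl ω)))) ⟩
        ⟦ ω == combine a₀ i₀ ⟧ * ⟦ used a₀ i₀ ⟧ ≤⟨ ∑ᶠ-≥ (λ i → ⟦ ω == combine a₀ i ⟧ * ⟦ used a₀ i ⟧) i₀ ⟩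
        ∑ᶠ (λ i → ⟦ ω == combine a₀ i ⟧ * ⟦ used a₀ i ⟧) ≤⟨ ∑ᶠ-≥ (λ a → ∑ᶠ (λ i → ⟦ ω == combine a i ⟧ * ⟦ used a i ⟧)) a₀ ⟩
        ∑ᶠ (λ a → ∑ᶠ (λ i → ⟦ ω == combine a i ⟧ * ⟦ used a i ⟧)) ∎
        where
        a₀ = proj₁ (remQuot {n} B ω)
        i₀ = proj₂ (remQuot {n} B ω)
    finish : (Σ ℕ λ m → Σ (Graph (suc m)) λ H → IsMinor H G × M * suc m ≤ 4 * q * card Us * degSum H) →
      Σ ℕ λ m → Σ (Graph (suc m)) λ H → IsMinor H G × length 𝒯 * suc m ≤ C * (4 * q * Nu) * degSum H
    finish (m , H , isM , le) = m , H , isM , (begin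
      length 𝒯 * suc m ≤⟨ *-monoˡ-≤ (suc m) many ⟩
      C * M * suc m ≡⟨ *-assoc C M (suc m) ⟩
      C * (M * suc m) ≤⟨ *-monoʳ-≤ C (≤-trans le (*-monoˡ-≤ (degSum H) (*-monoʳ-≤ (4 * q) Us≤))) ⟩
      C * (4 * q * Nu * degSum H) ≡⟨ sym (*-assoc C (4 * q * Nu) (degSum H)) ⟩
      C * (4 * q * Nu) * degSum H ∎)
      where open ≤-Reasoning

-- Odd k

imp-product : ∀ {a b c d e f g} → (a ≡ true → b ≡ true → c ≡ true → (d ≡ true × e ≡ true) × (f ≡ true × g ≡ true)) →
  ⟦ a ⟧ * (⟦ b ⟧ * ⟦ c ⟧) ≤ (⟦ d ⟧ * ⟦ e ⟧) * (⟦ f ⟧ * ⟦ g ⟧)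
imp-product {false} h = z≤n
imp-product {true} {false} h = z≤n
imp-product {true} {true} {false} h = z≤n
imp-product {true} {true} {true} h with h refl refl refl
... | (refl , refl) , (refl , refl) = ≤-refl

-- The factor `ρh` in the number of configurations pays for the sampling rate q ≤ β ρh, and `cu`
-- pays for the number of possible branch sets. What remains is a density of order `ρh1`/ν.
density : ∀ {cu ρh ρh1 len sm deg q Nu Q C ν β K} → 0 < cu → 0 < ρh →
  cu * (ρh * ρh1) ≤ 2 * Q * len → len * sm ≤ C * (4 * suc (2 * (K * q)) * Nu) * deg →
  q ≤ β * ρh → Nu ≤ ν * cu → ρh1 * sm ≤ 2 * Q * (C * (4 * (1 + 2 * (K * β)))) * ν * deg
density {cu} {ρh} {ρh1} {len} {sm} {deg} {q} {Nu} {Q} {C} {ν} {β} {K} cu>0 ρh>0 le1 le2 q≤ Nu≤ =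
  *-cancelˡ-≤ (cu * ρh) {{>-nonZero (*-mono-≤ cu>0 ρh>0)}} (begin
    cu * ρh * (ρh1 * sm) ≡⟨ e1 cu ρh ρh1 sm ⟩
    cu * (ρh * ρh1) * sm ≤⟨ *-monoˡ-≤ sm le1 ⟩
    2 * Q * len * sm ≡⟨ *-assoc (2 * Q) len sm ⟩
    2 * Q * (len * sm) ≤⟨ *-monoʳ-≤ (2 * Q) le2 ⟩
    2 * Q * (C * (4 * suc (2 * (K * q)) * Nu) * deg)
      ≤⟨ *-monoʳ-≤ (2 * Q) (*-monoˡ-≤ deg (*-monoʳ-≤ C (*-mono-≤ (*-monoʳ-≤ 4 (+-mono-≤ ρh>0 (*-monoʳ-≤ 2 (*-monoʳ-≤ K q≤)))) Nu≤))) ⟩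
    2 * Q * (C * (4 * (ρh + 2 * (K * (β * ρh))) * (ν * cu)) * deg) ≡⟨ e2 Q C K β ρh ν cu deg ⟩
    cu * ρh * (2 * Q * (C * (4 * (1 + 2 * (K * β)))) * ν * deg) ∎)
  where
  open ≤-Reasoning
  e1 : ∀ a b c d → a * b * (c * d) ≡ a * (b * c) * d
  e1 = solve-∀
  e2 : ∀ Q C K β r ν u g → 2 * Q * (C * (4 * (r + 2 * (K * (β * r))) * (ν * u)) * g) ≡ u * r * (2 * Q * (C * (4 * (1 + 2 * (K * β)))) * ν * g)
  e2 = solve-∀

many-good : ∀ ρ total Q all good K → 0 < ρ → total ≤ Q * all → ρ * all ≤ ρ * good + K * total → 2 * (Q * K) ≤ ρ → total ≤ 2 * Q * good
many-good ρ total Q all good K ρ>0 le1 le2 big = absorb ρ total (Q * good) (Q * K) Q good ρ>0 (begin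
    ρ * total ≤⟨ *-monoʳ-≤ ρ le1 ⟩
    ρ * (Q * all) ≡⟨ x∙yz≡y∙xz ρ Q all ⟩
    Q * (ρ * all) ≤⟨ *-monoʳ-≤ Q le2 ⟩
    Q * (ρ * good + K * total) ≡⟨ lem Q ρ good K total ⟩
    ρ * (Q * good) + Q * K * total ∎) big ≤-refl
  where
  open ≤-Reasoning
  lem : ∀ Q r g K t → Q * (r * g + K * t) ≡ r * (Q * g) + Q * K * t
  lem = solve-∀

length-∑ : {A : Set} (xs : List A) → length xs ≡ ∑ xs (λ _ → 1)
length-∑ xs = sym (trans (∑-const xs 1) (*-identityʳ _))

cap : ℕ → ℕ
cap k = 2 * (2 * k + 2)

cap^>0 : ∀ k m → 0 < cap k ^ m
cap^>0 k m = m^n>0 (cap k) {{>-nonZero (*-mono-≤ {1} {2} (s≤s z≤n) (≤-trans (s≤s z≤n) (m≤n+m 2 (2 * k))))}} m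

-- The constants of `bad-left` and `bad-a`, and the multiplicity from `mult-a`.
oddLoss oddMult : ℕ → ℕ → ℕ
oddLoss k h = heavyConst (cap k) h + cap k ^ h * heavyConst (cap k) (suc h)
oddMult k h = cap k ^ h * cap k ^ suc h

module Odd {n : ℕ} (G : Graph n) (k h' : ℕ) (window : suc (suc h') + suc h' ≤ k) (free : ¬ HasCycle G (2 * k))
  {E : Fin n → Fin n → Bool} {ρ : ℕ} (D : Digraph E ρ) (E-adj : ∀ x y → E x y ≡ true → Adj G x y) where

  module _ (κ : Fin n → ℕ) (ρ>0 : 0 < ρ) (big : 2 * (outerConst (suc h') * oddLoss k (suc h')) ≤ ρ) where
    open Configurations G k free D E-adj h' κ
    open Assembly G k free D E-adj h' κ ρ>0 1 (λ _ _ → zero)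

    private
      good : Item → Bool
      good (u , xs , ys) = lightU u xs ∧ La.lightW (end u xs) 0 ys

      gw = nested (λ u xs ys → ⟦ good (u , xs , ys) ⟧)

      loss : ρ * nested (λ _ _ _ → 1) ≤ ρ * gw + oddLoss k h * total
      loss = begin
        ρ * nested (λ _ _ _ → 1) ≤⟨ *-monoʳ-≤ ρ (nested-mono (λ u xs ys → pt (lightU u xs) (La.lightW (end u xs) 0 ys))) ⟩
        ρ * nested (λ u xs ys → ⟦ good (u , xs , ys) ⟧ + (⟦ not (lightU u xs) ⟧ + ⟦ lightU u xs ⟧ * ⟦ not (La.lightW (end u xs) 0 ys) ⟧))
          ≡⟨ cong (ρ *_) (trans (nested-+ (λ u xs ys → ⟦ good (u , xs , ys) ⟧) _) (cong (gw +_) (nested-+ (λ u xs ys → ⟦ not (lightU u xs) ⟧) _))) ⟩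
        ρ * (gw + (b₁ + b₂)) ≡⟨ trans (*-distribˡ-+ ρ gw _) (cong (ρ * gw +_) (*-distribˡ-+ ρ b₁ b₂)) ⟩
        ρ * gw + (ρ * b₁ + ρ * b₂) ≤⟨ +-monoʳ-≤ (ρ * gw) (+-mono-≤ (bad-left (≤-trans (≤-trans (n≤1+n h) (m≤m+n (suc h) h)) window)) (bad-a window)) ⟩
        ρ * gw + (heavyConst Γ h * total + Γ ^ h * heavyConst Γ (suc h) * total) ≡⟨ cong (ρ * gw +_) (sym (*-distribʳ-+ total (heavyConst Γ h) _)) ⟩
        ρ * gw + oddLoss k h * total ∎
        where
        open ≤-Reasoning
        b₁ = nested (λ u xs ys → ⟦ not (lightU u xs) ⟧)
        b₂ = nested (λ u xs ys → ⟦ lightU u xs ⟧ * ⟦ not (La.lightW (end u xs) 0 ys) ⟧)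
        pt : ∀ a b → 1 ≤ ⟦ a ∧ b ⟧ + (⟦ not a ⟧ + ⟦ a ⟧ * ⟦ not b ⟧)
        pt true true = s≤s z≤n
        pt true false = s≤s z≤n
        pt false b = s≤s z≤n

      𝒯 : List Item
      𝒯 = filterᵇ good items

      length-𝒯 : length 𝒯 ≡ gw
      length-𝒯 = trans (length-∑ 𝒯) (trans (∑-filter good items (λ _ → 1)) (trans (∑-items (λ u xs ys → ⟦ good (u , xs , ys) ⟧ * 1))
        (∑-cong (allFin n) (λ u → cong (⟦ I u ⟧ *_) (∑-cong (wk St h 1 u) (λ xs → ∑-cong (wk St (suc h) (suc h) u) (λ ys → *-identityʳ _)))))))

      tip-end : ∀ u xs v zs → (tip u xs == tip v zs) ≡ true → end u xs ≡ end v zs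
      tip-end u xs v zs e = combine-injectiveˡ (end u xs) zero (end v zs) zero (==⇒≡ e)

      collisions : ∑ 𝒯 (λ s → ∑ 𝒯 (λ t → ⟦ keyˡ t == keyˡ s ⟧ * ⟦ keyʳ t == keyʳ s ⟧)) ≤ oddMult k h * length 𝒯
      collisions = ≤-trans (∑-mono 𝒯 per) (≤-reflexive (trans (∑-const 𝒯 (oddMult k h)) (*-comm (length 𝒯) (oddMult k h))))
        where
        open ≤-Reasoning
        per : ∀ s → ∑ 𝒯 (λ t → ⟦ keyˡ t == keyˡ s ⟧ * ⟦ keyʳ t == keyʳ s ⟧) ≤ oddMult k h
        per s@(u₀ , xs₀ , ys₀) = begin
          ∑ 𝒯 (λ t → ⟦ keyˡ t == keyˡ s ⟧ * ⟦ keyʳ t == keyʳ s ⟧)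
            ≡⟨ trans (∑-filter good items _) (∑-items (λ u xs ys → ⟦ good (u , xs , ys) ⟧ * (⟦ tip u xs == keyˡ s ⟧ * ⟦ tip u ys == keyʳ s ⟧))) ⟩
          nested (λ u xs ys → ⟦ good (u , xs , ys) ⟧ * (⟦ tip u xs == keyˡ s ⟧ * ⟦ tip u ys == keyʳ s ⟧))
            ≤⟨ nested-mono (λ u xs ys → imp-product {good (u , xs , ys)} {tip u xs == keyˡ s} {tip u ys == keyʳ s} (imp u xs ys)) ⟩
          nested (λ u xs ys → (⟦ lightU u xs ⟧ * ⟦ end u xs == end u₀ xs₀ ⟧) * (⟦ La.lightW (end u₀ xs₀) 0 ys ⟧ * ⟦ end u ys == end u₀ ys₀ ⟧))
            ≤⟨ mult-a (end u₀ xs₀) (end u₀ ys₀) ⟩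
          oddMult k h ∎
          where
          imp : ∀ u xs ys → good (u , xs , ys) ≡ true → (tip u xs == keyˡ s) ≡ true → (tip u ys == keyʳ s) ≡ true →
            (lightU u xs ≡ true × (end u xs == end u₀ xs₀) ≡ true) × (La.lightW (end u₀ xs₀) 0 ys ≡ true × (end u ys == end u₀ ys₀) ≡ true)
          imp u xs ys g kl kr with tip-end u xs u₀ xs₀ kl | tip-end u ys u₀ ys₀ kr
          ... | el | er = (∧-l g , trans (cong (_== end u₀ xs₀) el) (==-refl (end u₀ xs₀)))
                        , (subst (λ a → La.lightW a 0 ys ≡ true) el (∧-r {lightU u xs} g) , trans (cong (_== end u₀ ys₀) er) (==-refl (end u₀ ys₀)))

      used : Fin n → Fin 1 → Bool
      used a _ = U a

    conclude : total ≤ outerConst h * nested (λ _ _ _ → 1) → Σ ℕ λ m → Σ (Graph (suc m)) λ H → IsMinor H G ×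
      ρ ^ suc h * suc m ≤ 2 * outerConst h * (oddMult k h * (4 * (1 + 2 * ((suc h + suc h) * 2)))) * 1 * degSum H
    conclude colored = finish (assemble 𝒯 (λ τ τ∈ → items-valid (proj₁ (filter-true good items τ∈))) 𝒯>0 (oddMult k h) mult>0 collisions used used-ok)
      where
      cu>0 : 0 < card U
      cu>0 = ≤-trans (≤-reflexive (cong ⟦_⟧ (sym inside))) (∑ᶠ-≥ (λ v → ⟦ U v ⟧) point)
      ρ^>0 : ∀ m → 0 < ρ ^ m
      ρ^>0 m = m^n>0 ρ {{>-nonZero ρ>0}} m
      mult>0 : 0 < oddMult k h
      mult>0 = *-mono-≤ (cap^>0 k h) (cap^>0 k (suc h))
      enough : total ≤ 2 * outerConst h * length 𝒯
      enough = subst (λ l → total ≤ 2 * outerConst h * l) (sym length-𝒯) (many-good ρ total (outerConst h) _ gw (oddLoss k h) ρ>0 colored loss big)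
      𝒯>0 : 0 < length 𝒯
      𝒯>0 = n≢0⇒n>0 (λ e → <⇒≱ (*-mono-≤ cu>0 (*-mono-≤ (ρ^>0 h) (ρ^>0 (suc h)))) (≤-trans enough (≤-reflexive (trans (cong (2 * outerConst h *_) e) (*-zeroʳ (2 * outerConst h))))))
      used-ok : ∀ τ → τ ∈ 𝒯 → let (u , xs , ys) = τ in U (end u xs) ≡ true × U (end u ys) ≡ true
      used-ok τ τ∈ = walk-U (∧-l Iu) wxs , walk-U (∧-l Iu) wys
        where open Valid (items-valid (proj₁ (filter-true good items τ∈)))
      Nu≤ : ∑ᶠ (λ a → ∑ᶠ {1} (λ i → ⟦ U a ⟧)) ≤ 1 * card U
      Nu≤ = ≤-reflexive (trans (∑-cong (allFin n) (λ a → +-identityʳ ⟦ U a ⟧)) (sym (+-identityʳ (card U))))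
      finish : (Σ ℕ λ m → Σ (Graph (suc m)) λ H → IsMinor H G ×
                 length 𝒯 * suc m ≤ oddMult k h * (4 * suc (2 * ((suc h + suc h) * (1 + ρ ^ h))) * ∑ᶠ (λ a → ∑ᶠ {1} (λ i → ⟦ U a ⟧))) * degSum H) →
               Σ ℕ λ m → Σ (Graph (suc m)) λ H → IsMinor H G × ρ ^ suc h * suc m ≤ 2 * outerConst h * (oddMult k h * (4 * (1 + 2 * ((suc h + suc h) * 2)))) * 1 * degSum H
      -- With the single label B = 1, the reach B + ρ^h is at most 2ρ^h.
      finish (m , H , isM , le) = m , H , isM , density {card U} {ρ ^ h} {ρ ^ suc h} {length 𝒯} {suc m} {degSum H} {1 + ρ ^ h} {_} {outerConst h} {oddMult k h} {1} {2} {suc h + suc h}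
        cu>0 (ρ^>0 h) enough le (+-mono-≤ (ρ^>0 h) (≤-reflexive (sym (+-identityʳ (ρ ^ h))))) Nu≤

-- Even k

rank : ∀ {n} → (Fin n → Bool) → Fin n → ℕ
rank p zero = 0
rank p (suc c) = ⟦ p zero ⟧ + rank (p ∘ suc) c

rank≤card : ∀ {n} (p : Fin n → Bool) c → rank p c ≤ card p
rank≤card p zero = z≤n
rank≤card p (suc c) = ≤-trans (+-monoʳ-≤ ⟦ p zero ⟧ (rank≤card (p ∘ suc) c)) (≤-reflexive (sym (∑ᶠ-suc (λ v → ⟦ p v ⟧))))

window-count : ∀ {n} (p : Fin n → Bool) lo w → ∑ᶠ (λ c → ⟦ p c ∧ ((lo ≤ᵇ rank p c) ∧ (rank p c <ᵇ lo + w)) ⟧) ≤ w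
window-count {zero} p lo w = z≤n
window-count {suc n} p lo w = ≤-trans (≤-reflexive (∑ᶠ-suc (λ c → ⟦ p c ∧ ((lo ≤ᵇ rank p c) ∧ (rank p c <ᵇ lo + w)) ⟧))) (go (p zero) lo w)
  where
  shifted : Bool → ℕ → ℕ → ℕ
  shifted b lo w = ∑ᶠ (λ c → ⟦ p (suc c) ∧ ((lo ≤ᵇ (⟦ b ⟧ + rank (p ∘ suc) c)) ∧ ((⟦ b ⟧ + rank (p ∘ suc) c) <ᵇ lo + w)) ⟧)
  ≤ᵇ-suc : ∀ a b → (suc a ≤ᵇ suc b) ≡ (a ≤ᵇ b)
  ≤ᵇ-suc zero b = refl
  ≤ᵇ-suc (suc a) b = refl
  go : ∀ b lo w → ⟦ b ∧ ((lo ≤ᵇ 0) ∧ (0 <ᵇ lo + w)) ⟧ + shifted b lo w ≤ w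
  go false lo w = window-count (p ∘ suc) lo w
  go true (suc lo) w = ≤-trans (≤-reflexive (∑-cong (allFin n) (λ c → cong (λ d → ⟦ p (suc c) ∧ (d ∧ (rank (p ∘ suc) c <ᵇ lo + w)) ⟧) (≤ᵇ-suc lo (rank (p ∘ suc) c))))) (window-count (p ∘ suc) lo w)
  go true zero zero = ≤-reflexive (trans (∑-cong (allFin n) (λ c → cong ⟦_⟧ (∧-false (p (suc c))))) (∑-zero (allFin n)))
    where ∧-false : ∀ b → b ∧ false ≡ false
          ∧-false true = refl
          ∧-false false = refl
  go true zero (suc w) = s≤s (window-count (p ∘ suc) 0 w)

group-count : ∀ {n} (p : Fin n → Bool) σ .{{_ : NonZero σ}} i → ∑ᶠ (λ c → ⟦ p c ∧ (rank p c / σ ≡ᵇ i) ⟧) ≤ σ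
group-count {n} p σ i = ≤-trans (∑-mono (allFin n) (λ c → ⟦⟧-mono {p c ∧ (rank p c / σ ≡ᵇ i)} (λ e → ∧-intro {p c} (∧-l e) (inside c (≡ᵇ-true (∧-r {p c} e)))))) (window-count p (i * σ) σ)
  where
  inside : ∀ c → rank p c / σ ≡ i → (i * σ ≤ᵇ rank p c) ∧ (rank p c <ᵇ i * σ + σ) ≡ true
  inside c refl = ∧-intro (true-≤ᵇ (m/n*n≤m (rank p c) σ)) (true-<ᵇ (begin-strict
      rank p c ≡⟨ m≡m%n+[m/n]*n (rank p c) σ ⟩
      rank p c % σ + rank p c / σ * σ <⟨ +-monoˡ-< _ (m%n<n (rank p c) σ) ⟩
      σ + rank p c / σ * σ ≡⟨ +-comm σ _ ⟩
      rank p c / σ * σ + σ ∎))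
    where open ≤-Reasoning

below-count : ∀ B x → ∑ᶠ {B} (λ i → ⟦ toℕ i <ᵇ x ⟧) ≤ x
below-count zero x = z≤n
below-count (suc B) zero = ≤-reflexive (∑-zero (allFin (suc B)))
below-count (suc B) (suc x) = ≤-trans (≤-reflexive (∑ᶠ-suc {B} (λ i → ⟦ toℕ i <ᵇ suc x ⟧))) (s≤s (below-count B x))

below-average : ∀ n q .{{_ : NonZero q}} (F : (Fin n → Fin q) → ℕ) K → ∑ (funs n q) F ≤ q ^ n * K → ∃ λ f → F f ≤ K
below-average n q F K le = proj₁ found , s≤s⁻¹ (proj₂ found)
  where
  open ≤-Reasoning
  found = ∑-<⇒∃ (funs n q) F (λ _ → suc K) (begin-strict
    ∑ (funs n q) F ≤⟨ le ⟩
    q ^ n * K <⟨ m<n+m (q ^ n * K) (m^n>0 q n) ⟩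
    q ^ n + q ^ n * K ≡⟨ sym (*-suc (q ^ n) K) ⟩
    q ^ n * suc K ≡⟨ sym (∑-funs-const n q (suc K)) ⟩
    ∑ (funs n q) (λ _ → suc K) ∎)

-- The losses of `bad-left`, `bad-a⁻` and `bad-c`; the multiplicities of `mult-ac'` for near
-- collisions and of `mult-ca'` for far ones.
evenLoss evenMult : ℕ → ℕ → ℕ
evenLoss k h' = heavyConst (cap k) (suc h') + (cap k ^ suc h' * heavyConst (cap k) (suc h') + cap k ^ h' * heavyConst (cap k) (suc (suc h')))
evenMult k h' = cap k ^ suc h' * cap k ^ suc h' + cap k ^ h' * cap k ^ suc (suc h')

-- The hypothesis `indeg≤` bounds the number of blocks of in-neighbours at a root, so that block
-- numbers are labels in `Fin (suc b)`.
module Even {n : ℕ} (G : Graph n) (k h' : ℕ) (window : suc h' + suc h' ≤ k) (free : ¬ HasCycle G (2 * k))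
  {E : Fin n → Fin n → Bool} {ρ : ℕ} (D : Digraph E ρ) (E-adj : ∀ x y → E x y ≡ true → Adj G x y)
  (σ : ℕ) .{{_ : NonZero σ}} (ρ≡σσ : ρ ≡ σ * σ) (b : ℕ) (σ≤b : σ ≤ b)
  (indeg≤ : ∀ a → card (λ c → Digraph.out D c a) / σ ≤ b)
  (κ : Fin n → ℕ) (ρ>0 : 0 < ρ) (big : 2 * (outerConst (suc h') * evenLoss k h') ≤ ρ) where

  open Configurations G k free D E-adj h' κ

  private
    good : Item → Bool
    good (u , xs , ys) = lightU u xs ∧ (La.lightW (end u xs) 0 (front ys) ∧ Lc.lightW (end u (front xs)) 0 ys)

    gw = nested (λ u xs ys → ⟦ good (u , xs , ys) ⟧)

    loss : ρ * nested (λ _ _ _ → 1) ≤ ρ * gw + evenLoss k h' * total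
    loss = begin
      ρ * nested (λ _ _ _ → 1) ≤⟨ *-monoʳ-≤ ρ (nested-mono (λ u xs ys → pt (lightU u xs) (La.lightW (end u xs) 0 (front ys)) (Lc.lightW (end u (front xs)) 0 ys))) ⟩
      ρ * nested (λ u xs ys → ⟦ good (u , xs , ys) ⟧ + (⟦ not (lightU u xs) ⟧ + (⟦ lightU u xs ⟧ * ⟦ not (La.lightW (end u xs) 0 (front ys)) ⟧ + ⟦ lightU u xs ⟧ * ⟦ not (Lc.lightW (end u (front xs)) 0 ys) ⟧)))
        ≡⟨ cong (ρ *_) (trans (nested-+ (λ u xs ys → ⟦ good (u , xs , ys) ⟧) _) (cong (gw +_) (trans (nested-+ (λ u xs ys → ⟦ not (lightU u xs) ⟧) _) (cong (b₁ +_) (nested-+ (λ u xs ys → ⟦ lightU u xs ⟧ * ⟦ not (La.lightW (end u xs) 0 (front ys)) ⟧) _))))) ⟩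
      ρ * (gw + (b₁ + (b₂ + b₃))) ≡⟨ dist ρ gw b₁ b₂ b₃ ⟩
      ρ * gw + (ρ * b₁ + (ρ * b₂ + ρ * b₃)) ≤⟨ +-monoʳ-≤ (ρ * gw) (+-mono-≤ (bad-left (≤-trans (m≤m+n h h) window)) (+-mono-≤ (bad-a⁻ window) (bad-c (≤-trans (≤-reflexive (sym (+-suc h h'))) window)))) ⟩
      ρ * gw + (heavyConst Γ h * total + (Γ ^ h * heavyConst Γ h * total + Γ ^ h' * heavyConst Γ (suc h) * total))
        ≡⟨ cong (ρ * gw +_) (undist (heavyConst Γ h) (Γ ^ h * heavyConst Γ h) (Γ ^ h' * heavyConst Γ (suc h)) total) ⟩
      ρ * gw + evenLoss k h' * total ∎
      where
      open ≤-Reasoning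
      b₁ = nested (λ u xs ys → ⟦ not (lightU u xs) ⟧)
      b₂ = nested (λ u xs ys → ⟦ lightU u xs ⟧ * ⟦ not (La.lightW (end u xs) 0 (front ys)) ⟧)
      b₃ = nested (λ u xs ys → ⟦ lightU u xs ⟧ * ⟦ not (Lc.lightW (end u (front xs)) 0 ys) ⟧)
      dist : ∀ r a b c d → r * (a + (b + (c + d))) ≡ r * a + (r * b + (r * c + r * d))
      dist = solve-∀
      undist : ∀ a b c t → a * t + (b * t + c * t) ≡ (a + (b + c)) * t
      undist = solve-∀
      pt : ∀ a b c → 1 ≤ ⟦ a ∧ (b ∧ c) ⟧ + (⟦ not a ⟧ + (⟦ a ⟧ * ⟦ not b ⟧ + ⟦ a ⟧ * ⟦ not c ⟧))
      pt true true true = s≤s z≤n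
      pt true true false = s≤s z≤n
      pt true false c = s≤s z≤n
      pt false b c = s≤s z≤n

    𝒯 : List Item
    𝒯 = filterᵇ good items

    ∑𝒯 : ∀ (F : Fin n → List (Fin n) → List (Fin n) → ℕ) → ∑ 𝒯 (λ (u , xs , ys) → F u xs ys) ≡ nested (λ u xs ys → ⟦ good (u , xs , ys) ⟧ * F u xs ys)
    ∑𝒯 F = trans (∑-filter good items _) (∑-items (λ u xs ys → ⟦ good (u , xs , ys) ⟧ * F u xs ys))

    length-𝒯 : length 𝒯 ≡ gw
    length-𝒯 = trans (length-∑ 𝒯) (trans (∑𝒯 (λ _ _ _ → 1))
      (∑-cong (allFin n) (λ u → cong (⟦ I u ⟧ *_) (∑-cong (wk St h 1 u) (λ xs → ∑-cong (wk St (suc h) (suc h) u) (λ ys → *-identityʳ _))))))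

    valid : ∀ τ → τ ∈ 𝒯 → Valid τ
    valid τ τ∈ = items-valid (proj₁ (filter-true good items τ∈))

    headˡ penˡ headʳ penʳ : Item → Fin n
    headˡ (u , xs , ys) = end u xs
    penˡ (u , xs , ys) = end u (front xs)
    headʳ (u , xs , ys) = end u ys
    penʳ (u , xs , ys) = end u (front ys)

    indeg : Fin n → ℕ
    indeg a = card (λ c → out c a)

    grp : Fin n → Fin n → ℕ
    grp c a = rank (λ c → out c a) c / σ

    grp≤ : ∀ c a → grp c a ≤ indeg a / σ
    grp≤ c a = /-monoˡ-≤ σ (rank≤card (λ c → out c a) c)

    last-step : ∀ {c x zs} → Walk St c x zs → zs ≢ [] → out (end x (front zs)) (end x zs) ≡ true × κ (end x zs) ≡ c + (length zs ∸ 1)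
    last-step [] ne = contradiction refl ne
    last-step {c} {x} (_∷_ {y = y} e []) _ = ∧-l e , trans (≡ᵇ-true (∧-r {out x y} e)) (sym (+-identityʳ c))
    last-step {c} (e ∷ (e' ∷ w)) _ with last-step (e' ∷ w) (λ ())
    ... | o , κe = o , trans κe (sym (+-suc c _))

    nonempty : ∀ {m} {zs : List (Fin n)} → length zs ≡ suc m → zs ≢ []
    nonempty () refl

    outˡ : ∀ τ → τ ∈ 𝒯 → out (penˡ τ) (headˡ τ) ≡ true × κ (headˡ τ) ≡ h
    outˡ τ τ∈ = proj₁ s , trans (proj₂ s) (cong (λ l → 1 + (l ∸ 1)) lxs)
      where
      open Valid (valid τ τ∈)
      s = last-step wxs (nonempty lxs)

    outʳ : ∀ τ → τ ∈ 𝒯 → out (penʳ τ) (headʳ τ) ≡ true × κ (headʳ τ) ≡ suc h + h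
    outʳ τ τ∈ = proj₁ s , trans (proj₂ s) (cong (λ l → suc h + (l ∸ 1)) lys)
      where
      open Valid (valid τ τ∈)
      s = last-step wys (nonempty lys)

    -- In-neighbours of a left root are grouped in blocks of σ by rank, those of a right root by a random colour χ.
    num : (Fin n → Fin σ) → Fin n → Fin n → ℕ
    num χ c a = if κ a ≡ᵇ h then grp c a else toℕ (χ c)

    -- Only makes the label total; on items of `𝒯` the number is at most `b` and nothing is cut off.
    clamp : ℕ → Fin (suc b)
    clamp x = fromℕ< (s≤s (m⊓n≤n x b))

    toℕ-clamp : ∀ x → x ≤ b → toℕ (clamp x) ≡ x
    toℕ-clamp x x≤b = trans (toℕ-fromℕ< (s≤s (m⊓n≤n x b))) (m≤n⇒m⊓n≡m x≤b)

    lab : (Fin n → Fin σ) → Fin n → Fin n → Fin (suc b)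
    lab χ c a = clamp (num χ c a)

    numˡ : ∀ χ τ → τ ∈ 𝒯 → num χ (penˡ τ) (headˡ τ) ≡ grp (penˡ τ) (headˡ τ)
    numˡ χ τ τ∈ = cong (λ b → if b then grp (penˡ τ) (headˡ τ) else toℕ (χ (penˡ τ))) (true-≡ᵇ (proj₂ (outˡ τ τ∈)))

    h≢ : ∀ {x} → x ≡ suc h + h → (x ≡ᵇ h) ≡ false
    h≢ refl = ≢true⇒≡false (λ e → <⇒≢ (s≤s (m≤n+m h h)) (sym (≡ᵇ-true e)))

    numʳ : ∀ χ τ → τ ∈ 𝒯 → num χ (penʳ τ) (headʳ τ) ≡ toℕ (χ (penʳ τ))
    numʳ χ τ τ∈ = cong (λ b → if b then grp (penʳ τ) (headʳ τ) else toℕ (χ (penʳ τ))) (h≢ (proj₂ (outʳ τ τ∈)))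

    labˡ : ∀ χ τ → τ ∈ 𝒯 → toℕ (lab χ (penˡ τ) (headˡ τ)) ≡ grp (penˡ τ) (headˡ τ)
    labˡ χ τ τ∈ = trans (toℕ-clamp _ (≤-trans (≤-reflexive (numˡ χ τ τ∈)) (≤-trans (grp≤ (penˡ τ) (headˡ τ)) (indeg≤ (headˡ τ))))) (numˡ χ τ τ∈)

    labʳ : ∀ χ τ → τ ∈ 𝒯 → toℕ (lab χ (penʳ τ) (headʳ τ)) ≡ toℕ (χ (penʳ τ))
    labʳ χ τ τ∈ = trans (toℕ-clamp _ (≤-trans (≤-reflexive (numʳ χ τ τ∈)) (≤-trans (<⇒≤ (toℕ<n (χ (penʳ τ)))) σ≤b))) (numʳ χ τ τ∈)

    module Asm (χ : Fin n → Fin σ) = Assembly G k free D E-adj h' κ ρ>0 (suc b) (lab χ)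

    -- A collision at the same right neighbour is bounded by a-lightness; the others lie in a left block of size σ, where
    -- c-lightness applies, and survive the colouring with probability 1/σ.
    near far : Item → Item → Bool
    near s t = (headˡ t == headˡ s) ∧ ((penʳ t == penʳ s) ∧ (headʳ t == headʳ s))
    far s t = (headˡ t == headˡ s) ∧ ((grp (penˡ t) (headˡ t) ≡ᵇ grp (penˡ s) (headˡ s)) ∧ (headʳ t == headʳ s))

    clash : (Fin n → Fin σ) → Item → Item → ℕ
    clash χ s t = ⟦ not (penʳ t == penʳ s) ∧ (χ (penʳ t) == χ (penʳ s)) ⟧

    collide : ∀ χ s t → s ∈ 𝒯 → t ∈ 𝒯 → ⟦ Asm.keyˡ χ t == Asm.keyˡ χ s ⟧ * ⟦ Asm.keyʳ χ t == Asm.keyʳ χ s ⟧ ≤ ⟦ near s t ⟧ + ⟦ far s t ⟧ * clash χ s t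
    collide χ s t s∈ t∈ = ≤-trans (≤-reflexive (sym (⟦∧⟧ (Asm.keyˡ χ t == Asm.keyˡ χ s) (Asm.keyʳ χ t == Asm.keyʳ χ s)))) (cases (Asm.keyˡ χ t == Asm.keyˡ χ s) (Asm.keyʳ χ t == Asm.keyʳ χ s) refl refl)
      where
      cases : ∀ x y → (Asm.keyˡ χ t == Asm.keyˡ χ s) ≡ x → (Asm.keyʳ χ t == Asm.keyʳ χ s) ≡ y → ⟦ x ∧ y ⟧ ≤ ⟦ near s t ⟧ + ⟦ far s t ⟧ * clash χ s t
      cases false y _ _ = z≤n
      cases true false _ _ = z≤n
      cases true true el er with combine-injective (headˡ t) (lab χ (penˡ t) (headˡ t)) (headˡ s) (lab χ (penˡ s) (headˡ s)) (==⇒≡ el)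
                               | combine-injective (headʳ t) (lab χ (penʳ t) (headʳ t)) (headʳ s) (lab χ (penʳ s) (headʳ s)) (==⇒≡ er)
      ... | al , ll | ar , lr = final (penʳ t == penʳ s) refl
        where
        tl : (headˡ t == headˡ s) ≡ true
        tl = trans (cong (_== headˡ s) al) (==-refl (headˡ s))
        tr : (headʳ t == headʳ s) ≡ true
        tr = trans (cong (_== headʳ s) ar) (==-refl (headʳ s))
        tg : (grp (penˡ t) (headˡ t) ≡ᵇ grp (penˡ s) (headˡ s)) ≡ true
        tg = true-≡ᵇ (trans (sym (labˡ χ t t∈)) (trans (cong toℕ ll) (labˡ χ s s∈)))
        tχ : (χ (penʳ t) == χ (penʳ s)) ≡ true
        tχ = trans (cong (_== χ (penʳ s)) (toℕ-injective (trans (sym (labʳ χ t t∈)) (trans (cong toℕ lr) (labʳ χ s s∈))))) (==-refl (χ (penʳ s)))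
        final : ∀ p → (penʳ t == penʳ s) ≡ p → 1 ≤ ⟦ near s t ⟧ + ⟦ far s t ⟧ * clash χ s t
        final true ep = ≤-trans (≤-reflexive (cong ⟦_⟧ (sym (∧-intro tl (∧-intro ep tr))))) (m≤m+n _ _)
        final false ep = ≤-trans (≤-reflexive (sym (cong₂ (λ x y → ⟦ x ⟧ * ⟦ y ⟧) (∧-intro tl (∧-intro tg tr)) (∧-intro (cong not ep) tχ)))) (m≤n+m _ _)

    near-count : ∀ s → ∑ 𝒯 (λ t → ⟦ near s t ⟧) ≤ Γ ^ h * Γ ^ h
    near-count s = ≤-trans (≤-reflexive (∑𝒯 (λ u xs ys → ⟦ near s (u , xs , ys) ⟧)))
      (≤-trans (nested-mono pt) (mult-ac' (headˡ s) (penʳ s) (headʳ s)))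
      where
      pt : ∀ u xs ys → ⟦ good (u , xs , ys) ⟧ * ⟦ near s (u , xs , ys) ⟧ ≤
           (⟦ lightU u xs ⟧ * ⟦ end u xs == headˡ s ⟧) * ((⟦ La.lightW (headˡ s) 0 (front ys) ⟧ * ⟦ end u (front ys) == penʳ s ⟧) * ⟦ end u ys == headʳ s ⟧)
      pt u xs ys = ⟦⟧*-bound (good (u , xs , ys)) (λ g → go g (near s (u , xs , ys)) refl)
        where
        go : good (u , xs , ys) ≡ true → ∀ x → near s (u , xs , ys) ≡ x → ⟦ x ⟧ ≤
             (⟦ lightU u xs ⟧ * ⟦ end u xs == headˡ s ⟧) * ((⟦ La.lightW (headˡ s) 0 (front ys) ⟧ * ⟦ end u (front ys) == penʳ s ⟧) * ⟦ end u ys == headʳ s ⟧)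
        go g false _ = z≤n
        go g true e = ≤-reflexive (sym (cong₂ _*_ (cong₂ (λ x y → ⟦ x ⟧ * ⟦ y ⟧) (∧-l {lightU u xs} g) (∧-l {end u xs == headˡ s} e))
            (cong₂ _*_ (cong₂ (λ x y → ⟦ x ⟧ * ⟦ y ⟧) la (∧-l {end u (front ys) == penʳ s} (∧-r {end u xs == headˡ s} e))) (cong ⟦_⟧ (∧-r {end u (front ys) == penʳ s} (∧-r {end u xs == headˡ s} e))))))
          where
          la : La.lightW (headˡ s) 0 (front ys) ≡ true
          la = subst (λ a → La.lightW a 0 (front ys) ≡ true) (==⇒≡ {x = end u xs} (∧-l e)) (∧-l (∧-r {lightU u xs} g))

    -- The block of `s` contains at most σ candidates for the penultimate left vertex, and
    -- `mult-ca'` applies to each of them.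
    far-count : ∀ s → ∑ 𝒯 (λ t → ⟦ far s t ⟧) ≤ σ * (Γ ^ h' * Γ ^ suc h)
    far-count s = begin
      ∑ 𝒯 (λ t → ⟦ far s t ⟧)
        ≤⟨ ∑-mono-∈ 𝒯 split ⟩
      ∑ 𝒯 (λ t → ∑ᶠ (λ c → ⟦ mem c ⟧ * ⟦ via c t ⟧))
        ≡⟨ trans (∑-swap 𝒯 (allFin n) _) (∑-cong (allFin n) (λ c → ∑-*ˡ 𝒯 ⟦ mem c ⟧ _)) ⟩
      ∑ᶠ (λ c → ⟦ mem c ⟧ * ∑ 𝒯 (λ t → ⟦ via c t ⟧))
        ≤⟨ ∑-mono (allFin n) (λ c → *-monoʳ-≤ ⟦ mem c ⟧ (via-count c)) ⟩
      ∑ᶠ (λ c → ⟦ mem c ⟧ * (Γ ^ h' * Γ ^ suc h))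
        ≡⟨ ∑-*ʳ (allFin n) _ _ ⟩
      ∑ᶠ (λ c → ⟦ mem c ⟧) * (Γ ^ h' * Γ ^ suc h)
        ≤⟨ *-monoˡ-≤ (Γ ^ h' * Γ ^ suc h) (group-count (λ c → out c (headˡ s)) σ (grp (penˡ s) (headˡ s))) ⟩
      σ * (Γ ^ h' * Γ ^ suc h) ∎
      where
      open ≤-Reasoning
      mem : Fin n → Bool
      mem c = out c (headˡ s) ∧ (grp c (headˡ s) ≡ᵇ grp (penˡ s) (headˡ s))
      via : Fin n → Item → Bool
      via c t = ((headˡ t == headˡ s) ∧ (penˡ t == c)) ∧ (headʳ t == headʳ s)
      split : ∀ t → t ∈ 𝒯 → ⟦ far s t ⟧ ≤ ∑ᶠ (λ c → ⟦ mem c ⟧ * ⟦ via c t ⟧)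
      split t t∈ = ≤-trans (go (far s t) refl) (∑ᶠ-≥ (λ c → ⟦ mem c ⟧ * ⟦ via c t ⟧) (penˡ t))
        where
        go : ∀ x → far s t ≡ x → ⟦ x ⟧ ≤ ⟦ mem (penˡ t) ⟧ * ⟦ via (penˡ t) t ⟧
        go false _ = z≤n
        go true e = ≤-reflexive (sym (cong₂ (λ x y → ⟦ x ⟧ * ⟦ y ⟧)
            (∧-intro (subst (λ a → out (penˡ t) a ≡ true) ea (proj₁ (outˡ t t∈))) (subst (λ a → (grp (penˡ t) a ≡ᵇ grp (penˡ s) (headˡ s)) ≡ true) ea (∧-l (∧-r {headˡ t == headˡ s} e))))
            (∧-intro (∧-intro (∧-l e) (==-refl (penˡ t))) (∧-r {grp (penˡ t) (headˡ t) ≡ᵇ grp (penˡ s) (headˡ s)} (∧-r {headˡ t == headˡ s} e)))))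
          where
          ea : headˡ t ≡ headˡ s
          ea = ==⇒≡ (∧-l e)
      via-count : ∀ c → ∑ 𝒯 (λ t → ⟦ via c t ⟧) ≤ Γ ^ h' * Γ ^ suc h
      via-count c = ≤-trans (≤-reflexive (∑𝒯 (λ u xs ys → ⟦ via c (u , xs , ys) ⟧))) (≤-trans (nested-mono pt) (mult-ca' (headˡ s) c (headʳ s)))
        where
        pt : ∀ u xs ys → ⟦ good (u , xs , ys) ⟧ * ⟦ via c (u , xs , ys) ⟧ ≤
             (⟦ lightU u xs ⟧ * (⟦ end u xs == headˡ s ⟧ * ⟦ end u (front xs) == c ⟧)) * (⟦ Lc.lightW c 0 ys ⟧ * ⟦ end u ys == headʳ s ⟧)
        pt u xs ys = ⟦⟧*-bound (good (u , xs , ys)) (λ g → go g (via c (u , xs , ys)) refl)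
          where
          go : good (u , xs , ys) ≡ true → ∀ x → via c (u , xs , ys) ≡ x → ⟦ x ⟧ ≤
               (⟦ lightU u xs ⟧ * (⟦ end u xs == headˡ s ⟧ * ⟦ end u (front xs) == c ⟧)) * (⟦ Lc.lightW c 0 ys ⟧ * ⟦ end u ys == headʳ s ⟧)
          go g false _ = z≤n
          go g true e = ≤-reflexive (sym (cong₂ _*_ (cong₂ _*_ (cong ⟦_⟧ (∧-l {lightU u xs} g)) (cong₂ (λ x y → ⟦ x ⟧ * ⟦ y ⟧) (∧-l {end u xs == headˡ s} (∧-l {(end u xs == headˡ s) ∧ (end u (front xs) == c)} e)) ec))
              (cong₂ (λ x y → ⟦ x ⟧ * ⟦ y ⟧) lc (∧-r {(end u xs == headˡ s) ∧ (end u (front xs) == c)} e))))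
            where
            ec : (end u (front xs) == c) ≡ true
            ec = ∧-r {end u xs == headˡ s} (∧-l {(end u xs == headˡ s) ∧ (end u (front xs) == c)} e)
            lc : Lc.lightW c 0 ys ≡ true
            lc = subst (λ a → Lc.lightW a 0 ys ≡ true) (==⇒≡ {x = end u (front xs)} ec) (∧-r {La.lightW (end u xs) 0 (front ys)} (∧-r {lightU u xs} g))

    clash-sum : ∀ s t → σ * ∑ (funs n σ) (λ χ → clash χ s t) ≤ σ ^ n
    clash-sum s t with penʳ t ≟ penʳ s
    ... | yes _ = ≤-trans (≤-reflexive (trans (cong (σ *_) (∑-zero (funs n σ))) (*-zeroʳ σ))) z≤n
    ... | no ne = ≤-reflexive (∑-funs-≡ n σ ne)

    X : (Fin n → Fin σ) → ℕ
    X χ = ∑ 𝒯 (λ s → ∑ 𝒯 (λ t → ⟦ Asm.keyˡ χ t == Asm.keyˡ χ s ⟧ * ⟦ Asm.keyʳ χ t == Asm.keyʳ χ s ⟧))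

    -- The factor σ in `far-count` cancels against the probability 1/σ that two different
    -- penultimate right vertices receive the same colour.
    X-sum : ∑ (funs n σ) X ≤ σ ^ n * (evenMult k h' * length 𝒯)
    X-sum = *-cancelˡ-≤ σ (begin
      σ * ∑ (funs n σ) X
        ≤⟨ *-monoʳ-≤ σ (∑-mono (funs n σ) (λ χ → ∑-mono-∈ 𝒯 (λ s s∈ → ∑-mono-∈ 𝒯 (λ t t∈ → collide χ s t s∈ t∈)))) ⟩
      σ * ∑ (funs n σ) (λ χ → ∑ 𝒯 (λ s → ∑ 𝒯 (λ t → ⟦ near s t ⟧ + ⟦ far s t ⟧ * clash χ s t)))
        ≡⟨ cong (σ *_) (trans (∑-swap (funs n σ) 𝒯 _) (∑-cong 𝒯 (λ s → ∑-swap (funs n σ) 𝒯 _))) ⟩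
      σ * ∑ 𝒯 (λ s → ∑ 𝒯 (λ t → ∑ (funs n σ) (λ χ → ⟦ near s t ⟧ + ⟦ far s t ⟧ * clash χ s t)))
        ≡⟨ trans (sym (∑-*ˡ 𝒯 σ _)) (∑-cong 𝒯 (λ s → sym (∑-*ˡ 𝒯 σ _))) ⟩
      ∑ 𝒯 (λ s → ∑ 𝒯 (λ t → σ * ∑ (funs n σ) (λ χ → ⟦ near s t ⟧ + ⟦ far s t ⟧ * clash χ s t)))
        ≤⟨ ∑-mono 𝒯 (λ s → ∑-mono 𝒯 (λ t → pair s t)) ⟩
      ∑ 𝒯 (λ s → ∑ 𝒯 (λ t → ⟦ near s t ⟧ * (σ * σ ^ n) + ⟦ far s t ⟧ * σ ^ n))
        ≡⟨ ∑-cong 𝒯 (λ s → trans (∑-+ 𝒯 _ _) (cong₂ _+_ (∑-*ʳ 𝒯 _ (σ * σ ^ n)) (∑-*ʳ 𝒯 _ (σ ^ n)))) ⟩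
      ∑ 𝒯 (λ s → ∑ 𝒯 (λ t → ⟦ near s t ⟧) * (σ * σ ^ n) + ∑ 𝒯 (λ t → ⟦ far s t ⟧) * σ ^ n)
        ≤⟨ ∑-mono 𝒯 (λ s → +-mono-≤ (*-monoˡ-≤ (σ * σ ^ n) (near-count s)) (*-monoˡ-≤ (σ ^ n) (far-count s))) ⟩
      ∑ 𝒯 (λ s → Γ ^ h * Γ ^ h * (σ * σ ^ n) + σ * (Γ ^ h' * Γ ^ suc h) * σ ^ n)
        ≡⟨ trans (∑-const 𝒯 _) (lem (length 𝒯) (Γ ^ h * Γ ^ h) σ (σ ^ n) (Γ ^ h' * Γ ^ suc h)) ⟩
      σ * (σ ^ n * (evenMult k h' * length 𝒯)) ∎)
      where
      open ≤-Reasoning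
      lem : ∀ l a s p c → l * (a * (s * p) + s * c * p) ≡ s * (p * ((a + c) * l))
      lem = solve-∀
      pair : ∀ s t → σ * ∑ (funs n σ) (λ χ → ⟦ near s t ⟧ + ⟦ far s t ⟧ * clash χ s t) ≤ ⟦ near s t ⟧ * (σ * σ ^ n) + ⟦ far s t ⟧ * σ ^ n
      pair s t = begin
        σ * ∑ (funs n σ) (λ χ → ⟦ near s t ⟧ + ⟦ far s t ⟧ * clash χ s t)
          ≡⟨ cong (σ *_) (trans (∑-+ (funs n σ) (λ _ → ⟦ near s t ⟧) _) (cong₂ _+_ (∑-funs-const n σ ⟦ near s t ⟧) (∑-*ˡ (funs n σ) ⟦ far s t ⟧ _))) ⟩
        σ * (σ ^ n * ⟦ near s t ⟧ + ⟦ far s t ⟧ * ∑ (funs n σ) (λ χ → clash χ s t))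
          ≡⟨ lem2 σ (σ ^ n) ⟦ near s t ⟧ ⟦ far s t ⟧ _ ⟩
        ⟦ near s t ⟧ * (σ * σ ^ n) + ⟦ far s t ⟧ * (σ * ∑ (funs n σ) (λ χ → clash χ s t))
          ≤⟨ +-monoʳ-≤ (⟦ near s t ⟧ * (σ * σ ^ n)) (*-monoʳ-≤ ⟦ far s t ⟧ (clash-sum s t)) ⟩
        ⟦ near s t ⟧ * (σ * σ ^ n) + ⟦ far s t ⟧ * σ ^ n ∎
        where
        lem2 : ∀ s p a f c → s * (p * a + f * c) ≡ a * (s * p) + f * (s * c)
        lem2 = solve-∀

    best : ∃ λ χ → X χ ≤ evenMult k h' * length 𝒯
    best = below-average n σ X _ X-sum

    χ₀ = proj₁ best
    open Asm χ₀ using (assemble)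

    used : Fin n → Fin (suc b) → Bool
    used a i = U a ∧ (if κ a ≡ᵇ h then toℕ i <ᵇ suc (indeg a / σ) else toℕ i <ᵇ σ)

    used-ok : ∀ τ → τ ∈ 𝒯 → used (headˡ τ) (lab χ₀ (penˡ τ) (headˡ τ)) ≡ true × used (headʳ τ) (lab χ₀ (penʳ τ) (headʳ τ)) ≡ true
    used-ok τ τ∈ =
        ∧-intro (walk-U (∧-l Iu) wxs) (trans (cong (λ b → if b then (toℕ (lab χ₀ (penˡ τ) (headˡ τ)) <ᵇ suc (indeg (headˡ τ) / σ)) else (toℕ (lab χ₀ (penˡ τ) (headˡ τ)) <ᵇ σ)) (true-≡ᵇ (proj₂ (outˡ τ τ∈))))
          (true-<ᵇ (s≤s (≤-trans (≤-reflexive (labˡ χ₀ τ τ∈)) (grp≤ (penˡ τ) (headˡ τ))))))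
      , ∧-intro (walk-U (∧-l Iu) wys) (trans (cong (λ b → if b then (toℕ (lab χ₀ (penʳ τ) (headʳ τ)) <ᵇ suc (indeg (headʳ τ) / σ)) else (toℕ (lab χ₀ (penʳ τ) (headʳ τ)) <ᵇ σ)) (h≢ (proj₂ (outʳ τ τ∈))))
          (true-<ᵇ (≤-trans (s≤s (≤-reflexive (labʳ χ₀ τ τ∈))) (toℕ<n (χ₀ (penʳ τ))))))
      where open Valid (valid τ τ∈)

    out-total : ∑ᶠ (λ a → ⟦ U a ⟧ * indeg a) ≤ card U * ρ
    out-total = begin
      ∑ᶠ (λ a → ⟦ U a ⟧ * indeg a) ≤⟨ ∑-mono (allFin n) (λ a → ⟦⟧*-≤ (U a) (indeg a)) ⟩
      ∑ᶠ (λ a → indeg a) ≡⟨ ∑-swap (allFin n) (allFin n) (λ a c → ⟦ out c a ⟧) ⟩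
      ∑ᶠ (λ c → card (out c)) ≤⟨ ∑-mono (allFin n) pt ⟩
      ∑ᶠ (λ c → ⟦ U c ⟧ * ρ) ≡⟨ ∑-*ʳ (allFin n) _ ρ ⟩
      card U * ρ ∎
      where
      open ≤-Reasoning
      pt : ∀ c → card (out c) ≤ ⟦ U c ⟧ * ρ
      pt c = go (U c) refl
        where
        go : ∀ x → U c ≡ x → card (out c) ≤ ⟦ x ⟧ * ρ
        go true _ = ≤-trans (out≤ c) (≤-reflexive (sym (*-identityˡ ρ)))
        go false e = ≤-trans (∑-mono (allFin n) (λ y → ⟦⟧-mono {out c y} {false} (λ o → trans (sym e) (proj₁ (out-U c y o))))) (≤-reflexive (∑-zero (allFin n)))

    -- After multiplication by σ each vertex has three shares of at most σ² on average: rounding up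
    -- the number of blocks, the σ right labels, and the in-degrees, whose sum is at most σ²|U|.
    Nu≤ : ∑ᶠ (λ a → ∑ᶠ (λ i → ⟦ used a i ⟧)) ≤ 3 * σ * card U
    Nu≤ = *-cancelˡ-≤ σ (begin
      σ * ∑ᶠ (λ a → ∑ᶠ (λ i → ⟦ used a i ⟧))
        ≡⟨ sym (∑-*ˡ (allFin n) σ _) ⟩
      ∑ᶠ (λ a → σ * ∑ᶠ (λ i → ⟦ used a i ⟧))
        ≤⟨ ∑-mono (allFin n) each ⟩
      ∑ᶠ (λ a → ⟦ U a ⟧ * (σ + σ * σ) + ⟦ U a ⟧ * indeg a)
        ≡⟨ trans (∑-+ (allFin n) _ _) (cong (_+ ∑ᶠ (λ a → ⟦ U a ⟧ * indeg a)) (∑-*ʳ (allFin n) _ (σ + σ * σ))) ⟩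
      card U * (σ + σ * σ) + ∑ᶠ (λ a → ⟦ U a ⟧ * indeg a)
        ≤⟨ +-mono-≤ (*-monoʳ-≤ (card U) (+-monoˡ-≤ (σ * σ) (m≤m*n σ σ))) (≤-trans out-total (≤-reflexive (cong (card U *_) ρ≡σσ))) ⟩
      card U * (σ * σ + σ * σ) + card U * (σ * σ)
        ≡⟨ lem (card U) σ ⟩
      σ * (3 * σ * card U) ∎)
      where
      open ≤-Reasoning
      lem : ∀ c s → c * (s * s + s * s) + c * (s * s) ≡ s * (3 * s * c)
      lem = solve-∀
      ite : ∀ x a b → ⟦ if x then a else b ⟧ ≤ ⟦ a ⟧ + ⟦ b ⟧
      ite true a b = m≤m+n _ _
      ite false a b = m≤n+m _ _
      each : ∀ a → σ * ∑ᶠ (λ i → ⟦ used a i ⟧) ≤ ⟦ U a ⟧ * (σ + σ * σ) + ⟦ U a ⟧ * indeg a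
      each a = begin
        σ * ∑ᶠ (λ i → ⟦ used a i ⟧)
          ≤⟨ *-monoʳ-≤ σ (∑-mono (allFin (suc b)) (λ i → ≤-trans (≤-reflexive (⟦∧⟧ (U a) _)) (*-monoʳ-≤ ⟦ U a ⟧ (ite (κ a ≡ᵇ h) _ _)))) ⟩
        σ * ∑ᶠ {suc b} (λ i → ⟦ U a ⟧ * (⟦ toℕ i <ᵇ suc (indeg a / σ) ⟧ + ⟦ toℕ i <ᵇ σ ⟧))
          ≡⟨ cong (σ *_) (trans (∑-*ˡ (allFin (suc b)) ⟦ U a ⟧ _) (cong (⟦ U a ⟧ *_) (∑-+ (allFin (suc b)) (λ i → ⟦ toℕ i <ᵇ suc (indeg a / σ) ⟧) (λ i → ⟦ toℕ i <ᵇ σ ⟧)))) ⟩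
        σ * (⟦ U a ⟧ * (∑ᶠ {suc b} (λ i → ⟦ toℕ i <ᵇ suc (indeg a / σ) ⟧) + ∑ᶠ {suc b} (λ i → ⟦ toℕ i <ᵇ σ ⟧)))
          ≤⟨ *-monoʳ-≤ σ (*-monoʳ-≤ ⟦ U a ⟧ (+-mono-≤ (below-count (suc b) (suc (indeg a / σ))) (below-count (suc b) σ))) ⟩
        σ * (⟦ U a ⟧ * (suc (indeg a / σ) + σ))
          ≡⟨ lem2 σ ⟦ U a ⟧ (indeg a / σ) ⟩
        ⟦ U a ⟧ * (σ + σ * σ) + ⟦ U a ⟧ * (indeg a / σ * σ)
          ≤⟨ +-monoʳ-≤ (⟦ U a ⟧ * (σ + σ * σ)) (*-monoʳ-≤ ⟦ U a ⟧ (m/n*n≤m (indeg a) σ)) ⟩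
        ⟦ U a ⟧ * (σ + σ * σ) + ⟦ U a ⟧ * indeg a ∎
        where
        lem2 : ∀ s u d → s * (u * (suc d + s)) ≡ u * (s + s * s) + u * (d * s)
        lem2 = solve-∀

  conclude : ∀ β → suc b + ρ ^ h ≤ β * ρ ^ h → total ≤ outerConst h * nested (λ _ _ _ → 1) → Σ ℕ λ m → Σ (Graph (suc m)) λ H → IsMinor H G ×
    ρ ^ suc h * suc m ≤ 2 * outerConst h * (evenMult k h' * (4 * (1 + 2 * ((suc h + suc h) * β)))) * (3 * σ) * degSum H
  conclude β q≤ colored = finish (assemble 𝒯 valid 𝒯>0 (evenMult k h') mult>0 (proj₂ best) used used-ok)
    where
    cu>0 : 0 < card U
    cu>0 = ≤-trans (≤-reflexive (cong ⟦_⟧ (sym inside))) (∑ᶠ-≥ (λ v → ⟦ U v ⟧) point)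
    ρ^>0 : ∀ m → 0 < ρ ^ m
    ρ^>0 m = m^n>0 ρ {{>-nonZero ρ>0}} m
    mult>0 : 0 < evenMult k h'
    mult>0 = ≤-trans (*-mono-≤ (cap^>0 k h) (cap^>0 k h)) (m≤m+n _ _)
    enough : total ≤ 2 * outerConst h * length 𝒯
    enough = subst (λ l → total ≤ 2 * outerConst h * l) (sym length-𝒯) (many-good ρ total (outerConst h) _ gw (evenLoss k h') ρ>0 colored loss big)
    𝒯>0 : 0 < length 𝒯
    𝒯>0 = n≢0⇒n>0 (λ e → <⇒≱ (*-mono-≤ cu>0 (*-mono-≤ (ρ^>0 h) (ρ^>0 (suc h)))) (≤-trans enough (≤-reflexive (trans (cong (2 * outerConst h *_) e) (*-zeroʳ (2 * outerConst h))))))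
    finish : (Σ ℕ λ m → Σ (Graph (suc m)) λ H → IsMinor H G ×
               length 𝒯 * suc m ≤ evenMult k h' * (4 * suc (2 * ((suc h + suc h) * (suc b + ρ ^ h))) * ∑ᶠ (λ a → ∑ᶠ (λ i → ⟦ used a i ⟧))) * degSum H) →
             Σ ℕ λ m → Σ (Graph (suc m)) λ H → IsMinor H G × ρ ^ suc h * suc m ≤ 2 * outerConst h * (evenMult k h' * (4 * (1 + 2 * ((suc h + suc h) * β)))) * (3 * σ) * degSum H
    finish (m , H , isM , le) = m , H , isM , density {card U} {ρ ^ h} {ρ ^ suc h} {length 𝒯} {suc m} {degSum H} {suc b + ρ ^ h} {_} {outerConst h} {evenMult k h'} {3 * σ} {β} {suc h + suc h}
      cu>0 (ρ^>0 h) enough le q≤ Nu≤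

-- Arcs concentrated on vertices of large in-degree

module Concentrated {n : ℕ} (G : Graph n) (k : ℕ) (1<k : 1 < k) (free : ¬ HasCycle G (2 * k))
  {E : Fin n → Fin n → Bool} {ρ : ℕ} (D : Digraph E ρ) (E-adj : ∀ x y → E x y ≡ true → Adj G x y) (Δ : ℕ) where

  open Digraph D

  indeg : Fin n → ℕ
  indeg a = card (λ c → out c a)

  S : Fin n → Bool
  S a = Δ <ᵇ indeg a

  arcs-into-S : ℕ
  arcs-into-S = ∑ᶠ (λ x → ∑ᶠ (λ s → ⟦ out x s ∧ S s ⟧))

  private
    Γ = cap k

    out-count : ∑ᶠ (λ x → card (out x)) ≤ card U * ρ
    out-count = ≤-trans (∑-mono (allFin n) pt) (≤-reflexive (∑-*ʳ (allFin n) _ ρ))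
      where
      pt : ∀ c → card (out c) ≤ ⟦ U c ⟧ * ρ
      pt c = go (U c) refl
        where
        go : ∀ x → U c ≡ x → card (out c) ≤ ⟦ x ⟧ * ρ
        go true _ = ≤-trans (out≤ c) (≤-reflexive (sym (*-identityˡ ρ)))
        go false e = ≤-trans (∑-mono (allFin n) (λ y → ⟦⟧-mono {out c y} {false} (λ o → trans (sym e) (proj₁ (out-U c y o))))) (≤-reflexive (∑-zero (allFin n)))

  S-small : Δ * card S ≤ card U * ρ
  S-small = begin
    Δ * card S ≡⟨ trans (*-comm Δ _) (sym (∑-*ʳ (allFin n) _ Δ)) ⟩
    ∑ᶠ (λ a → ⟦ S a ⟧ * Δ) ≤⟨ ∑-mono (allFin n) (λ a → ⟦⟧*-bound (S a) (λ e → <⇒≤ (<ᵇ-true e))) ⟩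
    ∑ᶠ (λ a → indeg a) ≡⟨ ∑-swap (allFin n) (allFin n) (λ a c → ⟦ out c a ⟧) ⟩
    ∑ᶠ (λ x → card (out x)) ≤⟨ out-count ⟩
    card U * ρ ∎
    where open ≤-Reasoning

  module _ (many : card U * ρ ≤ 2 * arcs-into-S) (ρ≤Δ : 4 * ρ ≤ Δ) (big : 64 * (cap k + 1) ≤ ρ) where

    private
      -- Arcs from outside `S` into `S`: each tail can be contracted into one of its heads, and the
      -- other heads then become neighbours of that head.
      t : Fin n → Fin n → Bool
      t x s = not (S x) ∧ (out x s ∧ S s)

      t-out : ∀ {x s} → t x s ≡ true → out x s ≡ true
      t-out {x} e = ∧-l (∧-r {not (S x)} e)

      t-S : ∀ {x s} → t x s ≡ true → S s ≡ true
      t-S {x} {s} e = ∧-r {out x s} (∧-r {not (S x)} e)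

      t-¬S : ∀ {x s} → t x s ≡ true → S x ≡ true → ⊥
      t-¬S {x} e Sx = contradiction (trans (sym (∧-l {not (S x)} e)) (cong not Sx)) λ ()

      d : Fin n → ℕ
      d x = ∑ᶠ (λ s → ⟦ t x s ⟧)

      d≤ρ : ∀ x → d x ≤ ρ
      d≤ρ x = ≤-trans (∑-mono (allFin n) (λ s → ⟦⟧-mono {t x s} {out x s} t-out)) (out≤ x)

      d-U : ∀ x → U x ≡ false → d x ≡ 0
      d-U x e = n≤0⇒n≡0 (≤-trans (∑-mono (allFin n) (λ s → ⟦⟧-mono {t x s} {false} (λ o → trans (sym e) (proj₁ (out-U x s (t-out o)))))) (≤-reflexive (∑-zero (allFin n))))

      ∑d : ℕ
      ∑d = ∑ᶠ d

      ∑d≤ : ∑d ≤ card U * ρ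
      ∑d≤ = ≤-trans (∑-mono (allFin n) (λ x → ∑-mono (allFin n) (λ s → ⟦⟧-mono {t x s} {out x s} t-out))) out-count

      -- By `S-small` and 4ρ ≤ Δ the arcs that start in `S` number at most a quarter of |U|ρ, while
      -- at least half of |U|ρ arcs enter `S`.
      ∑d≥ : card U * ρ ≤ 4 * ∑d
      ∑d≥ = +-cancelʳ-≤ (card U * ρ) _ _ (begin
        card U * ρ + card U * ρ ≤⟨ +-mono-≤ many many ⟩
        2 * arcs-into-S + 2 * arcs-into-S ≡⟨ lem arcs-into-S ⟩
        4 * arcs-into-S ≤⟨ *-monoʳ-≤ 4 split ⟩
        4 * (∑d + card S * ρ) ≡⟨ lem2 ∑d (card S) ρ ⟩
        4 * ∑d + 4 * ρ * card S ≤⟨ +-monoʳ-≤ (4 * ∑d) (≤-trans (*-monoˡ-≤ (card S) ρ≤Δ) S-small) ⟩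
        4 * ∑d + card U * ρ ∎)
        where
        open ≤-Reasoning
        lem : ∀ a → 2 * a + 2 * a ≡ 4 * a
        lem = solve-∀
        lem2 : ∀ a b c → 4 * (a + b * c) ≡ 4 * a + 4 * c * b
        lem2 = solve-∀
        split : arcs-into-S ≤ ∑d + card S * ρ
        split = begin
          arcs-into-S ≤⟨ ∑-mono (allFin n) (λ x → row x (S x) refl) ⟩
          ∑ᶠ (λ x → d x + ⟦ S x ⟧ * ρ) ≡⟨ trans (∑-+ (allFin n) d _) (cong (∑d +_) (∑-*ʳ (allFin n) _ ρ)) ⟩
          ∑d + card S * ρ ∎
          where
          row : ∀ x b → S x ≡ b → ∑ᶠ (λ s → ⟦ out x s ∧ S s ⟧) ≤ d x + ⟦ b ⟧ * ρ
          row x true _ = ≤-trans (∑-mono (allFin n) (λ s → ⟦⟧-mono {out x s ∧ S s} {out x s} ∧-l)) (≤-trans (out≤ x) (≤-trans (≤-reflexive (sym (*-identityˡ ρ))) (m≤n+m _ (d x))))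
          row x false e = ≤-trans (∑-mono (allFin n) (λ s → ⟦⟧-mono {out x s ∧ S s} {t x s} (λ p → ∧-intro (cong not e) p))) (m≤m+n (d x) 0)

      dg : Fin n → Fin n → ℕ
      dg s z = ∑ᶠ (λ x → ⟦ t x s ∧ t x z ⟧)

      light : Fin n → Fin n → Bool
      light s z = not (z == s) ∧ (dg s z ≤ᵇ Γ)

      heavy : Fin n → Fin n → Bool
      heavy s z = not (z == s) ∧ (Γ <ᵇ dg s z)

      -- The tree is a star with centre `s` whose leaves are the tails of its `t`-arcs, so the depth
      -- is 1 < k. The heavy vertices lie in `S`, the leaves outside, as `Sparse` requires.
      heavy-at : ∀ s → S s ≡ true → ∑ᶠ (λ x → ∑ᶠ (λ z → ⟦ t x s ∧ (heavy s z ∧ t x z) ⟧)) ≤ Γ * ∑ᶠ (λ x → ⟦ t x s ⟧)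
      heavy-at s Ss = heavy-edges (λ z w → <⇒≤ (<ᵇ-true (∧-r {not (z == s)} w)))
        where
        lev : ℕ → Fin n → Bool
        lev 0 v = v == s
        lev 1 v = t v s
        lev (suc (suc _)) v = false
        root : ∀ u v → lev 0 u ≡ true → lev 0 v ≡ true → u ≡ v
        root u v e e' = trans (==⇒≡ e) (sym (==⇒≡ {x = v} e'))
        par : ∀ j y → lev (suc j) y ≡ true → ∃ λ x → lev j x ≡ true × Adj G y x
        par zero y e = s , ==-refl s , E-adj y s (out-E y s (t-out e))
        notroot : ∀ v → (v == s) ≡ true → t v s ≡ true → ⊥
        notroot v e e' = t-¬S e' (subst (λ w → S w ≡ true) (sym (==⇒≡ {x = v} e)) Ss)
        disj : ∀ i j v → lev i v ≡ true → lev j v ≡ true → i ≡ j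
        disj 0 0 v _ _ = refl
        disj 0 1 v e e' = ⊥-elim (notroot v e e')
        disj 1 0 v e e' = ⊥-elim (notroot v e' e)
        disj 1 1 v _ _ = refl
        W : Fin n → Bool
        W z = heavy s z
        W-off : ∀ j v → j ≤ 1 → W v ≡ true → lev j v ≡ true → ⊥
        W-off 0 v _ w e = contradiction (trans (sym (∧-l {not (v == s)} w)) (cong not e)) λ ()
        W-off 1 v _ w e with ∑ᶠ-pos⇒∃ (λ x → t x s ∧ t x v) (≤-trans (s≤s z≤n) (<ᵇ-true (∧-r {not (v == s)} w)))
        ... | x , p = t-¬S e (t-S {x} {v} (∧-r {t x s} p))
        W-off (suc (suc j)) v (s≤s ()) _ _
        open Sparse G k 1 1<k lev root par disj W W-off t (λ x y e → E-adj x y (out-E x y (t-out e))) free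

      TOT : Fin n → ℕ
      TOT x = ∑ᶠ (λ s → ⟦ t x s ⟧ * ∑ᶠ (λ z → ⟦ t x z ∧ light s z ⟧))

      -- A pair of heads of `x` is light, or heavy, or consists of equal heads. The heavy pairs
      -- contribute Γ `∑d` by `heavy-at` and the equal ones `∑d`.
      squares : ∑ᶠ (λ x → d x * d x) ≤ ∑ᶠ TOT + (Γ + 1) * ∑d
      squares = begin
        ∑ᶠ (λ x → d x * d x)
          ≡⟨ ∑-cong (allFin n) (λ x → sym (∑-*ʳ (allFin n) _ (d x))) ⟩
        ∑ᶠ (λ x → ∑ᶠ (λ s → ⟦ t x s ⟧ * d x))
          ≤⟨ ∑-mono (allFin n) (λ x → ∑-mono (allFin n) (λ s → row x s)) ⟩
        ∑ᶠ (λ x → ∑ᶠ (λ s → ⟦ t x s ⟧ * lt x s + (⟦ t x s ⟧ + hv x s)))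
          ≡⟨ trans (∑-cong (allFin n) (λ x → trans (∑-+ (allFin n) _ _) (cong (TOT x +_) (∑-+ (allFin n) _ _)))) (trans (∑-+ (allFin n) TOT _) (cong (∑ᶠ TOT +_) (∑-+ (allFin n) d _))) ⟩
        ∑ᶠ TOT + (∑d + ∑ᶠ (λ x → ∑ᶠ (hv x)))
          ≤⟨ +-monoʳ-≤ (∑ᶠ TOT) (+-monoʳ-≤ ∑d hv-bound) ⟩
        ∑ᶠ TOT + (∑d + Γ * ∑d) ≡⟨ cong (∑ᶠ TOT +_) (trans (+-comm ∑d (Γ * ∑d)) (lem Γ ∑d)) ⟩
        ∑ᶠ TOT + (Γ + 1) * ∑d ∎
        where
        open ≤-Reasoning
        lem : ∀ a b → a * b + b ≡ (a + 1) * b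
        lem = solve-∀
        lt hv : Fin n → Fin n → ℕ
        lt x s = ∑ᶠ (λ z → ⟦ t x z ∧ light s z ⟧)
        hv x s = ∑ᶠ (λ z → ⟦ t x s ∧ (heavy s z ∧ t x z) ⟧)
        row : ∀ x s → ⟦ t x s ⟧ * d x ≤ ⟦ t x s ⟧ * lt x s + (⟦ t x s ⟧ + hv x s)
        row x s = begin
          ⟦ t x s ⟧ * d x ≡⟨ sym (∑-*ˡ (allFin n) ⟦ t x s ⟧ _) ⟩
          ∑ᶠ (λ z → ⟦ t x s ⟧ * ⟦ t x z ⟧) ≤⟨ ∑-mono (allFin n) (λ z → pt (t x s) (t x z) (z == s) (dg s z ≤ᵇ Γ) (Γ <ᵇ dg s z) (dichotomy (dg s z))) ⟩
          ∑ᶠ (λ z → ⟦ t x s ⟧ * ⟦ t x z ∧ light s z ⟧ + (⟦ z == s ⟧ * ⟦ t x s ⟧ + ⟦ t x s ∧ (heavy s z ∧ t x z) ⟧))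
            ≡⟨ trans (∑-+ (allFin n) _ _) (cong₂ _+_ (∑-*ˡ (allFin n) ⟦ t x s ⟧ _) (trans (∑-+ (allFin n) _ _) (cong (_+ hv x s) (∑ᶠ-δ s (λ _ → ⟦ t x s ⟧))))) ⟩
          ⟦ t x s ⟧ * lt x s + (⟦ t x s ⟧ + hv x s) ∎
          where
          dichotomy : ∀ m → (m ≤ᵇ Γ) ≡ true ⊎ (Γ <ᵇ m) ≡ true
          dichotomy m with m ≤? Γ
          ... | yes le = inj₁ (true-≤ᵇ le)
          ... | no gt = inj₂ (true-<ᵇ (≰⇒> gt))
          pt : ∀ a b e l g → l ≡ true ⊎ g ≡ true → ⟦ a ⟧ * ⟦ b ⟧ ≤ ⟦ a ⟧ * ⟦ b ∧ (not e ∧ l) ⟧ + (⟦ e ⟧ * ⟦ a ⟧ + ⟦ a ∧ ((not e ∧ g) ∧ b) ⟧)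
          pt false b e l g _ = z≤n
          pt true false e l g _ = z≤n
          pt true true true l g _ = s≤s z≤n
          pt true true false true g (inj₁ refl) = s≤s z≤n
          pt true true false true true (inj₂ refl) = s≤s z≤n
          pt true true false false true (inj₂ refl) = s≤s z≤n
        hv-bound : ∑ᶠ (λ x → ∑ᶠ (hv x)) ≤ Γ * ∑d
        hv-bound = begin
          ∑ᶠ (λ x → ∑ᶠ (hv x)) ≡⟨ ∑-swap (allFin n) (allFin n) hv ⟩
          ∑ᶠ (λ s → ∑ᶠ (λ x → hv x s)) ≤⟨ ∑-mono (allFin n) (λ s → col s (S s) refl) ⟩
          ∑ᶠ (λ s → Γ * ∑ᶠ (λ x → ⟦ t x s ⟧)) ≡⟨ trans (∑-*ˡ (allFin n) Γ _) (cong (Γ *_) (∑-swap (allFin n) (allFin n) (λ s x → ⟦ t x s ⟧))) ⟩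
          Γ * ∑d ∎
          where
          col : ∀ s b → S s ≡ b → ∑ᶠ (λ x → hv x s) ≤ Γ * ∑ᶠ (λ x → ⟦ t x s ⟧)
          col s true e = heavy-at s e
          col s false e = ≤-trans (∑-mono (allFin n) (λ x → ≤-trans (∑-mono (allFin n) (λ z → ⟦⟧-mono {t x s ∧ (heavy s z ∧ t x z)} {false} (λ p → trans (sym e) (t-S {x} {s} (∧-l p))))) (≤-reflexive (∑-zero (allFin n))))) (≤-trans (≤-reflexive (∑-zero (allFin n))) z≤n)

      λw : Fin n → Fin n → ℕ
      λw x s = ∑ᶠ (λ z → ⟦ t x z ∧ light s z ⟧)

      -- `x` can join only one head, and the best one carries at least the share 1/d(x) ≥ 1/ρ of its
      -- light pairs. The summand 1 makes the comparison strict, and the weight `t x s` forces the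
      -- witness to be a head.
      choose : ∀ x → 0 < d x → ∃ λ s → t x s ≡ true × TOT x ≤ ρ * λw x s
      choose x d>0 = proj₁ found , fst (t x (proj₁ found)) (proj₂ found) , snd (t x (proj₁ found)) (proj₂ found)
        where
        open ≤-Reasoning
        lem : ∀ a r l → a + r * (a * l) ≡ a * suc (r * l)
        lem = solve-∀
        fst : ∀ b {y z} → ⟦ b ⟧ * y < ⟦ b ⟧ * z → b ≡ true
        fst true _ = refl
        snd : ∀ b {y z} → ⟦ b ⟧ * y < ⟦ b ⟧ * suc z → y ≤ z
        snd true lt = s≤s⁻¹ (subst₂ _<_ (*-identityˡ _) (*-identityˡ _) lt)
        found = ∑-<⇒∃ (allFin n) (λ s → ⟦ t x s ⟧ * TOT x) (λ s → ⟦ t x s ⟧ * suc (ρ * λw x s)) (begin-strict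
          ∑ᶠ (λ s → ⟦ t x s ⟧ * TOT x) ≡⟨ ∑-*ʳ (allFin n) _ (TOT x) ⟩
          d x * TOT x ≤⟨ *-monoˡ-≤ (TOT x) (d≤ρ x) ⟩
          ρ * TOT x <⟨ m<n+m (ρ * TOT x) d>0 ⟩
          d x + ρ * TOT x ≡⟨ cong (d x +_) (sym (∑-*ˡ (allFin n) ρ _)) ⟩
          d x + ∑ᶠ (λ s → ρ * (⟦ t x s ⟧ * λw x s)) ≡⟨ sym (∑-+ (allFin n) (λ s → ⟦ t x s ⟧) _) ⟩
          ∑ᶠ (λ s → ⟦ t x s ⟧ + ρ * (⟦ t x s ⟧ * λw x s)) ≡⟨ ∑-cong (allFin n) (λ s → lem ⟦ t x s ⟧ ρ (λw x s)) ⟩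
          ∑ᶠ (λ s → ⟦ t x s ⟧ * suc (ρ * λw x s)) ∎)

      pickS : ∀ x → Dec (0 < d x) → Maybe (Fin n)
      pickS x (yes p) = just (proj₁ (choose x p))
      pickS x (no _) = nothing

      asg : Fin n → Maybe (Fin n)
      asg x = pickS x (0 <? d x)

      asg-t : ∀ x s → asg x ≡ just s → t x s ≡ true × TOT x ≤ ρ * λw x s
      asg-t x s e with 0 <? d x
      asg-t x s refl | yes p = proj₂ (choose x p)

      φ : Fin n → Maybe (Fin n)
      φ v = if S v then just v else asg v

      φ-S : ∀ v → S v ≡ true → φ v ≡ just v
      φ-S v e = cong (λ b → if b then just v else asg v) e

      φ-asg : ∀ x s → asg x ≡ just s → φ x ≡ just s
      φ-asg x s e = trans (cong (λ b → if b then just x else asg x) (≢true⇒≡false (t-¬S (proj₁ (asg-t x s e))))) e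

      φ-cases : ∀ s x → φ x ≡ just s → (x ≡ s × S s ≡ true) ⊎ asg x ≡ just s
      φ-cases s x e = go (S x) refl e
        where
        go : ∀ b → S x ≡ b → (if b then just x else asg x) ≡ just s → (x ≡ s × S s ≡ true) ⊎ asg x ≡ just s
        go true Sx refl = inj₁ (refl , Sx)
        go false _ e = inj₂ e

      asgᵇ : Fin n → Fin n → Bool
      asgᵇ x s = go (asg x)
        where
        go : Maybe (Fin n) → Bool
        go (just s') = s' == s
        go nothing = false

      asgᵇ-true : ∀ x s → asgᵇ x s ≡ true → asg x ≡ just s
      asgᵇ-true x s e with asg x
      ... | just s' = cong just (==⇒≡ {x = s'} e)

      φ-conn : ∀ s x → φ x ≡ just s → Conn G (λ z → φ z ≡ just s) s x
      φ-conn s x e with φ-cases s x e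
      ... | inj₁ (refl , Ss) = stop (φ-S x Ss)
      ... | inj₂ p = move (φ-S s (t-S {x} {s} tx)) (Adj-sym G (E-adj x s (out-E x s (t-out tx)))) (stop e)
        where tx = proj₁ (asg-t x s p)

      Eg : Fin n → Fin n → Bool
      Eg s z = ∃ᵇ (λ x → asgᵇ x s ∧ (t x z ∧ light s z))

      Eg-elim : ∀ s z → Eg s z ≡ true → ∃ λ x → asg x ≡ just s × t x z ≡ true × light s z ≡ true
      Eg-elim s z e with ∃ᵇ-elim {p = λ x → asgᵇ x s ∧ (t x z ∧ light s z)} e
      ... | x , p = x , asgᵇ-true x s (∧-l p) , ∧-l {t x z} (∧-r {asgᵇ x s} p) , ∧-r {t x z} (∧-r {asgᵇ x s} p)

      Eg-U : ∀ s z → Eg s z ≡ true → S s ≡ true × S z ≡ true × s ≢ z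
      Eg-U s z e with Eg-elim s z e
      ... | x , p , q , l = t-S {x} {s} (proj₁ (asg-t x s p)) , t-S {x} {z} q , λ { refl → contradiction (trans (sym (∧-l {not (z == s)} l)) (cong not (==-refl s))) λ () }

      Eg-adj : ∀ s z → Eg s z ≡ true → ∃ λ x → ∃ λ y → φ x ≡ just s × φ y ≡ just z × Adj G x y
      Eg-adj s z e with Eg-elim s z e
      ... | x , p , q , l = x , z , φ-asg x s p , φ-S z (t-S {x} {z} q) , E-adj x z (out-E x z (t-out q))

      module B = BuildMinor G φ id S φ-S φ-conn Eg Eg-U Eg-adj

      eF = ∑ᶠ (λ s → ∑ᶠ (λ z → ⟦ Eg s z ⟧))

      -- An edge `s z` of the minor is produced only by common tails of `s` and `z`, and lightness
      -- allows at most Γ of these.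
      λ-total : ∑ᶠ (λ x → ∑ᶠ (λ s → ⟦ asgᵇ x s ⟧ * λw x s)) ≤ Γ * eF
      λ-total = begin
        ∑ᶠ (λ x → ∑ᶠ (λ s → ⟦ asgᵇ x s ⟧ * λw x s))
          ≡⟨ ∑-cong (allFin n) (λ x → ∑-cong (allFin n) (λ s → sym (∑-*ˡ (allFin n) ⟦ asgᵇ x s ⟧ _))) ⟩
        ∑ᶠ (λ x → ∑ᶠ (λ s → ∑ᶠ (λ z → ⟦ asgᵇ x s ⟧ * ⟦ t x z ∧ light s z ⟧)))
          ≡⟨ trans (∑-swap (allFin n) (allFin n) _) (∑-cong (allFin n) (λ s → ∑-swap (allFin n) (allFin n) _)) ⟩
        ∑ᶠ (λ s → ∑ᶠ (λ z → ∑ᶠ (λ x → ⟦ asgᵇ x s ⟧ * ⟦ t x z ∧ light s z ⟧)))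
          ≤⟨ ∑-mono (allFin n) (λ s → ∑-mono (allFin n) (λ z → cell s z (Eg s z) refl)) ⟩
        ∑ᶠ (λ s → ∑ᶠ (λ z → Γ * ⟦ Eg s z ⟧))
          ≡⟨ trans (∑-cong (allFin n) (λ s → ∑-*ˡ (allFin n) Γ _)) (∑-*ˡ (allFin n) Γ _) ⟩
        Γ * eF ∎
        where
        open ≤-Reasoning
        cell : ∀ s z b → Eg s z ≡ b → ∑ᶠ (λ x → ⟦ asgᵇ x s ⟧ * ⟦ t x z ∧ light s z ⟧) ≤ Γ * ⟦ b ⟧
        cell s z false e = ≤-trans (∑-mono (allFin n) (λ x → ≤-trans (≤-reflexive (sym (⟦∧⟧ (asgᵇ x s) (t x z ∧ light s z)))) (⟦⟧-mono {_} {false} (λ p → trans (sym e) (∃ᵇ-intro x p))))) (≤-trans (≤-reflexive (∑-zero (allFin n))) z≤n)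
        cell s z true e = begin
          ∑ᶠ (λ x → ⟦ asgᵇ x s ⟧ * ⟦ t x z ∧ light s z ⟧) ≤⟨ ∑-mono (allFin n) (λ x → ≤-trans (≤-reflexive (sym (⟦∧⟧ (asgᵇ x s) (t x z ∧ light s z)))) (⟦⟧-mono {_} {t x s ∧ t x z} (λ p → ∧-intro (proj₁ (asg-t x s (asgᵇ-true x s (∧-l p)))) (∧-l {t x z} (∧-r {asgᵇ x s} p))))) ⟩
          dg s z ≤⟨ ≤ᵇ-true (∧-r {not (z == s)} (proj₂ (proj₂ (proj₂ (Eg-elim s z e))))) ⟩
          Γ ≡⟨ sym (*-identityʳ Γ) ⟩
          Γ * 1 ∎

      TOT≤ : ∑ᶠ TOT ≤ ρ * (Γ * eF)
      TOT≤ = begin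
        ∑ᶠ TOT ≤⟨ ∑-mono (allFin n) (λ x → each x (0 <? d x) refl) ⟩
        ∑ᶠ (λ x → ρ * ∑ᶠ (λ s → ⟦ asgᵇ x s ⟧ * λw x s)) ≡⟨ ∑-*ˡ (allFin n) ρ _ ⟩
        ρ * ∑ᶠ (λ x → ∑ᶠ (λ s → ⟦ asgᵇ x s ⟧ * λw x s)) ≤⟨ *-monoʳ-≤ ρ λ-total ⟩
        ρ * (Γ * eF) ∎
        where
        open ≤-Reasoning
        true-asgᵇ : ∀ x s → asg x ≡ just s → asgᵇ x s ≡ true
        true-asgᵇ x s e with asg x
        true-asgᵇ x s refl | just .s = ==-refl s
        each : ∀ x → (p : Dec (0 < d x)) → (0 <? d x) ≡ p → TOT x ≤ ρ * ∑ᶠ (λ s → ⟦ asgᵇ x s ⟧ * λw x s)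
        each x (yes p) e = begin
          TOT x ≤⟨ proj₂ (asg-t x s₀ as) ⟩
          ρ * λw x s₀ ≡⟨ cong (ρ *_) (trans (sym (*-identityˡ _)) (cong (λ b → ⟦ b ⟧ * λw x s₀) (sym (true-asgᵇ x s₀ as)))) ⟩
          ρ * (⟦ asgᵇ x s₀ ⟧ * λw x s₀) ≤⟨ *-monoʳ-≤ ρ (∑ᶠ-≥ (λ s → ⟦ asgᵇ x s ⟧ * λw x s) s₀) ⟩
          ρ * ∑ᶠ (λ s → ⟦ asgᵇ x s ⟧ * λw x s) ∎
          where
          s₀ = proj₁ (choose x p)
          as : asg x ≡ just s₀
          as = cong (pickS x) e
        each x (no ¬p) e = ≤-trans (∑-mono (allFin n) (λ s → ⟦⟧*-bound (t x s) {m' = 0} (λ p → ⊥-elim (¬p (≤-trans (≤-reflexive (cong ⟦_⟧ (sym p))) (∑ᶠ-≥ (λ s → ⟦ t x s ⟧) s)))))) (≤-trans (≤-reflexive (∑-zero (allFin n))) z≤n)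

      -- Convexity in pointwise form: 16ρd ≤ 64d² + ρ², that is (8d - ρ)² ≥ 0, summed over `U` and
      -- compared with `∑d≥`.
      squares≥ : 3 * (card U * (ρ * ρ)) ≤ 64 * ∑ᶠ (λ x → d x * d x)
      squares≥ = +-cancelʳ-≤ (card U * (ρ * ρ)) _ _ (begin
        3 * (card U * (ρ * ρ)) + card U * (ρ * ρ) ≡⟨ lem (card U) ρ ⟩
        4 * ρ * (card U * ρ) ≤⟨ *-monoʳ-≤ (4 * ρ) ∑d≥ ⟩
        4 * ρ * (4 * ∑d) ≡⟨ trans (lem2 ρ ∑d) (sym (∑-*ˡ (allFin n) (16 * ρ) d)) ⟩
        ∑ᶠ (λ x → 16 * ρ * d x) ≤⟨ ∑-mono (allFin n) (λ x → pt x (U x) refl) ⟩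
        ∑ᶠ (λ x → 64 * (d x * d x) + ⟦ U x ⟧ * (ρ * ρ)) ≡⟨ trans (∑-+ (allFin n) _ _) (cong₂ _+_ (∑-*ˡ (allFin n) 64 _) (∑-*ʳ (allFin n) _ (ρ * ρ))) ⟩
        64 * ∑ᶠ (λ x → d x * d x) + card U * (ρ * ρ) ∎)
        where
        open ≤-Reasoning
        lem : ∀ u r → 3 * (u * (r * r)) + u * (r * r) ≡ 4 * r * (u * r)
        lem = solve-∀
        lem2 : ∀ r d → 4 * r * (4 * d) ≡ 16 * r * d
        lem2 = solve-∀
        lem3 : ∀ r d → 16 * r * d ≡ 2 * (8 * d * r)
        lem3 = solve-∀
        lem4 : ∀ r d → 8 * d * (8 * d) + r * r ≡ 64 * (d * d) + 1 * (r * r)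
        lem4 = solve-∀
        pt : ∀ x b → U x ≡ b → 16 * ρ * d x ≤ 64 * (d x * d x) + ⟦ b ⟧ * (ρ * ρ)
        pt x true _ = ≤-trans (≤-reflexive (lem3 ρ (d x))) (≤-trans (2ab≤aa+bb (8 * d x) ρ) (≤-reflexive (lem4 ρ (d x))))
        pt x false e = ≤-trans (≤-reflexive (trans (cong (16 * ρ *_) (d-U x e)) (*-zeroʳ (16 * ρ)))) z≤n

      U>0 : 0 < card U
      U>0 = ≤-trans (≤-reflexive (cong ⟦_⟧ (sym inside))) (∑ᶠ-≥ (λ v → ⟦ U v ⟧) point)

      ρ>0 : 0 < ρ
      ρ>0 = ≤-trans (*-mono-≤ {1} {64} (s≤s z≤n) (m≤n+m 1 (cap k))) big

      -- The assumption `big` makes the heavy and equal pairs, 64(Γ+1) `∑d`, at most |U|ρ², one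
      -- third of the left side of `squares≥`; the light pairs account for the rest.
      edges≥ : card U * ρ ≤ 32 * Γ * eF
      edges≥ = *-cancelˡ-≤ 2 (*-cancelˡ-≤ ρ {{>-nonZero ρ>0}} (+-cancelʳ-≤ (card U * (ρ * ρ)) _ _ (begin
        ρ * (2 * (card U * ρ)) + card U * (ρ * ρ) ≡⟨ lem (card U) ρ ⟩
        3 * (card U * (ρ * ρ)) ≤⟨ squares≥ ⟩
        64 * ∑ᶠ (λ x → d x * d x) ≤⟨ *-monoʳ-≤ 64 squares ⟩
        64 * (∑ᶠ TOT + (Γ + 1) * ∑d) ≡⟨ lem2 (∑ᶠ TOT) (Γ + 1) ∑d ⟩
        64 * ∑ᶠ TOT + 64 * (Γ + 1) * ∑d ≤⟨ +-mono-≤ (*-monoʳ-≤ 64 TOT≤) (*-mono-≤ big ∑d≤) ⟩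
        64 * (ρ * (Γ * eF)) + ρ * (card U * ρ) ≡⟨ lem3 ρ Γ eF (card U) ⟩
        ρ * (2 * (32 * Γ * eF)) + card U * (ρ * ρ) ∎)))
        where
        open ≤-Reasoning
        lem : ∀ u r → r * (2 * (u * r)) + u * (r * r) ≡ 3 * (u * (r * r))
        lem = solve-∀
        lem2 : ∀ a b c → 64 * (a + b * c) ≡ 64 * a + 64 * b * c
        lem2 = solve-∀
        lem3 : ∀ r g e u → 64 * (r * (g * e)) + r * (u * r) ≡ r * (2 * (32 * g * e)) + u * (r * r)
        lem3 = solve-∀

    concentrated-minor : Σ ℕ λ m → Σ (Graph (suc m)) λ H → IsMinor H G × Δ * suc m ≤ 32 * cap k * degSum H
    concentrated-minor = pack B.size B.minor B.isMinor
        (≤-trans (*-monoʳ-≤ Δ (≤-reflexive B.size≡card)) (≤-trans S-small (≤-trans edges≥ (*-monoʳ-≤ (32 * Γ) B.edges≤degSum))))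
        (≤-trans (*-mono-≤ U>0 ρ>0) (≤-trans edges≥ (*-monoʳ-≤ (32 * Γ) B.edges≤degSum)))
      where
      pack : ∀ m (H : Graph m) → IsMinor H G → Δ * m ≤ 32 * cap k * degSum H → 0 < 32 * cap k * degSum H →
             Σ ℕ λ m → Σ (Graph (suc m)) λ H → IsMinor H G × Δ * suc m ≤ 32 * cap k * degSum H
      pack zero H _ _ pos = ⊥-elim (<⇒≢ pos (sym (*-zeroʳ (32 * cap k))))
      pack (suc m) H isM le _ = m , H , isM , le

-- Minors of large density

sq-pow : ∀ σ m → (σ * σ) ^ m ≡ σ ^ (m + m)
sq-pow σ zero = refl
sq-pow σ (suc m) = trans (cong (σ * σ *_) (sq-pow σ m)) (trans (*-assoc σ σ _) (cong (λ e → σ * σ ^ e) (sym (+-suc m m))))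

-- Average degree at least d/C, stated in natural numbers.
DenseMinor : ∀ {n} → Graph n → ℕ → ℕ → Set
DenseMinor G d C = Σ ℕ λ m → Σ (Graph (suc m)) λ H → IsMinor H G × d * suc m ≤ C * degSum H

widen : ∀ {n} (G : Graph n) d C C' → C ≤ C' → DenseMinor G d C → DenseMinor G d C'
widen G d C C' le (m , H , isM , bound) = m , H , isM , ≤-trans bound (*-monoˡ-≤ (degSum H) le)

all-card : ∀ n → card {n} (λ _ → true) ≡ n
all-card n = trans (∑ᶠ-const n 1) (*-identityʳ n)

adj-core : ∀ {n} (G : Graph n) ρ → 2 * ρ * n < degSum G → Digraph (adj G) ρ
adj-core {n} G ρ lt = core⇒digraph (adj G) (Graph.sym G) ≤-refl
  (core (adj G) (Graph.sym G) ρ (λ _ → true) (subst (λ c → 2 * ρ * c < degSum G) (sym (all-card n)) lt))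

σ≤σσ : ∀ {σ} → 0 < σ → σ ≤ σ * σ
σ≤σσ {suc σ} _ = m≤m*n (suc σ) (suc σ)

-- The first summand makes repeated vertices rare, the second makes heavy walks rare, and `suc`
-- makes the threshold positive.
oddThreshold oddConst : ℕ → ℕ → ℕ
oddThreshold k h = suc (2 * repConst h + 2 * (outerConst h * oddLoss k h))
oddConst k h = 2 * outerConst h * (oddMult k h * (4 * (1 + 2 * ((suc h + suc h) * 2)))) * 1

odd-digraph : ∀ k h' → k ≡ suc (suc h') + suc h' → ∀ {n} (G : Graph n) → ¬ HasCycle G (2 * k) →
  ∀ {E ρ} (D : Digraph E ρ) → (∀ x y → E x y ≡ true → Adj G x y) → oddThreshold k (suc h') ≤ ρ →
  DenseMinor G (ρ ^ suc (suc h')) (oddConst k (suc h'))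
odd-digraph k h' k≡ G free {ρ = ρ} D E-adj big = go (Coloring.good-coloring D (suc h') ρ>0 (≤-trans (m≤m+n _ _) ρ-big))
  where
  ρ>0 : 0 < ρ
  ρ>0 = ≤-trans (s≤s z≤n) big
  ρ-big : 2 * repConst (suc h') + 2 * (outerConst (suc h') * oddLoss k (suc h')) ≤ ρ
  ρ-big = ≤-trans (n≤1+n _) big
  go : (∃ λ κ → card (Digraph.U D) * (ρ ^ suc h' * ρ ^ suc (suc h')) ≤ outerConst (suc h') * Coloring.colored-walks D (suc h') κ (λ _ _ _ → 1)) →
       DenseMinor G (ρ ^ suc (suc h')) (oddConst k (suc h'))
  go (κ , colored) = Odd.conclude G k h' (≤-reflexive (sym k≡)) free D E-adj κ ρ>0 (≤-trans (m≤n+m _ (2 * repConst (suc h'))) ρ-big) colored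

odd-case : ∀ k h' → k ≡ suc (suc h') + suc h' → ∀ {n} (G : Graph n) → ¬ HasCycle G (2 * k) →
  ∀ σ → oddThreshold k (suc h') ≤ σ → 2 * (σ * σ) * n < degSum G → DenseMinor G (σ ^ (k + 1)) (oddConst k (suc h'))
odd-case k h' k≡ G free σ σ-big lt = subst (λ x → DenseMinor G x (oddConst k (suc h'))) pow
    (odd-digraph k h' k≡ G free (adj-core G (σ * σ) lt) (λ _ _ e → e) (≤-trans σ-big (σ≤σσ (≤-trans (s≤s z≤n) σ-big))))
  where
  h = suc h'
  pow : (σ * σ) ^ suc h ≡ σ ^ (k + 1)
  pow = trans (sq-pow σ (suc h)) (cong (σ ^_) (trans (+-suc (suc h) h) (trans (+-comm 1 _) (cong (_+ 1) (sym k≡)))))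

evenBase : ℕ → ℕ → ℕ
evenBase k h' = 2 * outerConst (suc h') * (evenMult k h' * (4 * (1 + 2 * ((suc (suc h') + suc (suc h')) * 11))))

evenReq : ℕ → ℕ → ℕ
evenReq k h' = 2 * repConst (suc h') + 2 * (outerConst (suc h') * evenLoss k h')

summands≤ : ∀ a b c {s} → a + (b + c) ≤ s → a ≤ s × b ≤ s × c ≤ s
summands≤ a b c le = ≤-trans (m≤m+n a (b + c)) le , ≤-trans (≤-trans (m≤m+n b c) (m≤n+m (b + c) a)) le , ≤-trans (≤-trans (m≤n+m c b) (m≤n+m (b + c) a)) le

even-digraph : ∀ k h' → k ≡ suc h' + suc h' → ∀ {n} (G : Graph n) → ¬ HasCycle G (2 * k) →
  ∀ {E} σ → 0 < σ → (D : Digraph E (σ * σ)) → (∀ x y → E x y ≡ true → Adj G x y) →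
  (∀ a → card (λ c → Digraph.out D c a) ≤ 9 * σ ^ k * σ) →
  evenReq k h' ≤ σ * σ →
  DenseMinor G ((σ * σ) ^ suc (suc h')) (evenBase k h' * (3 * σ))
even-digraph k h' k≡ G free σ σ>0 D E-adj indeg big = go (Coloring.good-coloring D h ρ>0 (≤-trans (m≤m+n _ _) big))
  where
  h = suc h'
  ρ = σ * σ
  b = 9 * σ ^ k
  instance
    σ≢0 : NonZero σ
    σ≢0 = >-nonZero σ>0
  ρ>0 : 0 < ρ
  ρ>0 = *-mono-≤ σ>0 σ>0
  k≥1 : 1 ≤ k
  k≥1 = ≤-trans (s≤s z≤n) (≤-reflexive (sym k≡))
  σ≤b : σ ≤ b
  σ≤b = ≤-trans (≤-trans (≤-reflexive (sym (^-identityʳ σ))) (^-monoʳ-≤ σ k≥1)) (m≤n*m (σ ^ k) 9)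
  ρ^h : ρ ^ h ≡ σ ^ k
  ρ^h = trans (sq-pow σ h) (cong (σ ^_) (sym k≡))
  -- 11 = 9 + 1 + 1: the block bound `b`, its `suc`, and ρ^h itself, each compared with σ^k.
  room : suc b + ρ ^ h ≤ 11 * ρ ^ h
  room = begin
    suc b + ρ ^ h ≡⟨ cong (suc b +_) ρ^h ⟩
    suc b + σ ^ k ≤⟨ +-monoˡ-≤ (σ ^ k) (+-monoˡ-≤ b (m^n>0 σ k)) ⟩
    (σ ^ k + b) + σ ^ k ≡⟨ lem (σ ^ k) ⟩
    11 * σ ^ k ≡⟨ cong (11 *_) (sym ρ^h) ⟩
    11 * ρ ^ h ∎
    where
    open ≤-Reasoning
    lem : ∀ x → (x + 9 * x) + x ≡ 11 * x
    lem = solve-∀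
  go : (∃ λ κ → card (Digraph.U D) * (ρ ^ h * ρ ^ suc h) ≤ outerConst h * Coloring.colored-walks D h κ (λ _ _ _ → 1)) →
       DenseMinor G (ρ ^ suc h) (evenBase k h' * (3 * σ))
  go (κ , colored) = Even.conclude G k h' (≤-reflexive (sym k≡)) free D E-adj σ refl b σ≤b
    (λ a → ≤-trans (/-monoˡ-≤ σ (indeg a)) (≤-reflexive (m*n/n≡m b σ)))
    κ ρ>0 (≤-trans (m≤n+m _ (2 * repConst h)) big) 11 room colored

-- If few arcs enter vertices of large in-degree, dropping those arcs bounds all degrees by O(Δ).
module Spread {n : ℕ} (G : Graph n) (k : ℕ) (k≥2 : 2 ≤ k) (free : ¬ HasCycle G (2 * k)) (ρ Δ : ℕ) (ρ≤Δ : 8 * ρ ≤ 8 * Δ)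
  (D₁ : Digraph (adj G) (8 * ρ)) where

  open Digraph D₁ renaming (U to U₁; out to out₁; out≤ to out₁≤; out-U to out₁-U; out-E to out₁-E; out-deg to out₁-deg)
  open Concentrated G k k≥2 free D₁ (λ _ _ e → e) Δ public

  E₂ : Fin n → Fin n → Bool
  E₂ x y = (out₁ x y ∧ not (S y)) ∨ (out₁ y x ∧ not (S x))

  private
    E₂-sym : ∀ x y → E₂ x y ≡ E₂ y x
    E₂-sym x y = ∨-comm (out₁ x y ∧ not (S y)) (out₁ y x ∧ not (S x))

  E₂-adj : ∀ x y → E₂ x y ≡ true → Adj G x y
  E₂-adj x y e with ∨-elim {out₁ x y ∧ not (S y)} e
  ... | inj₁ p = out₁-E x y (∧-l p)
  ... | inj₂ p = Adj-sym G (out₁-E y x (∧-l p))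

  module _ (few : ¬ (card U₁ * (8 * ρ) ≤ 2 * arcs-into-S)) where

    private
      kept = ∑ᶠ (λ x → ∑ᶠ (λ y → ⟦ out₁ x y ∧ not (S y) ⟧))

      arcs : card U₁ * (8 * ρ) ≤ arcs-into-S + kept
      arcs = begin
        card U₁ * (8 * ρ) ≡⟨ sym (∑-*ʳ (allFin n) _ (8 * ρ)) ⟩
        ∑ᶠ (λ x → ⟦ U₁ x ⟧ * (8 * ρ)) ≤⟨ ∑-mono (allFin n) (λ x → ⟦⟧*-bound (U₁ x) (λ u → ≤-reflexive (sym (out₁-deg x u)))) ⟩
        ∑ᶠ (λ x → card (out₁ x)) ≤⟨ ∑-mono (allFin n) (λ x → ∑-mono (allFin n) (λ y → pt (out₁ x y) (S y))) ⟩
        ∑ᶠ (λ x → ∑ᶠ (λ y → ⟦ out₁ x y ∧ S y ⟧ + ⟦ out₁ x y ∧ not (S y) ⟧))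
          ≡⟨ trans (∑-cong (allFin n) (λ x → ∑-+ (allFin n) _ _)) (∑-+ (allFin n) _ _) ⟩
        arcs-into-S + kept ∎
        where
        open ≤-Reasoning
        pt : ∀ a b → ⟦ a ⟧ ≤ ⟦ a ∧ b ⟧ + ⟦ a ∧ not b ⟧
        pt true true = s≤s z≤n
        pt true false = s≤s z≤n
        pt false b = z≤n

      -- Fewer than half of the 8ρ|U₁| arcs enter `S`, so more than 4ρ|U₁| are kept, enough for a
      -- core of degree above ρ.
      kept-many : 2 * ρ * card U₁ < kept
      kept-many = *-cancelˡ-< 2 _ _ (+-cancelˡ-< (card U₁ * (8 * ρ)) _ _ (begin-strict
        card U₁ * (8 * ρ) + 2 * (2 * ρ * card U₁) ≤⟨ +-monoʳ-≤ (card U₁ * (8 * ρ)) (≤-trans (≤-reflexive (lem ρ (card U₁))) (*-monoʳ-≤ (card U₁) (*-monoˡ-≤ ρ {4} {8} (s≤s (s≤s (s≤s (s≤s z≤n))))))) ⟩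
        card U₁ * (8 * ρ) + card U₁ * (8 * ρ) ≤⟨ +-mono-≤ arcs arcs ⟩
        (arcs-into-S + kept) + (arcs-into-S + kept) ≡⟨ lem2 arcs-into-S kept ⟩
        2 * arcs-into-S + 2 * kept <⟨ +-monoˡ-< (2 * kept) (≰⇒> few) ⟩
        card U₁ * (8 * ρ) + 2 * kept ∎))
        where
        open ≤-Reasoning
        lem : ∀ r u → 2 * (2 * r * u) ≡ u * (4 * r)
        lem = solve-∀
        lem2 : ∀ a b → (a + b) + (a + b) ≡ 2 * a + 2 * b
        lem2 = solve-∀

      vol≥ : kept ≤ volIn E₂ E₂-sym U₁
      vol≥ = ∑-mono (allFin n) (λ x → ∑-mono (allFin n) (λ y → ⟦⟧-mono {out₁ x y ∧ not (S y)} {U₁ x ∧ (U₁ y ∧ E₂ x y)}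
        (λ e → ∧-intro (proj₁ (out₁-U x y (∧-l e))) (∧-intro (proj₂ (out₁-U x y (∧-l e))) (∨-introˡ e)))))

    spread-digraph : Digraph E₂ ρ
    spread-digraph = core⇒digraph E₂ E₂-sym ≤-refl (core E₂ E₂-sym ρ U₁ (≤-trans kept-many vol≥))

  -- The new orientation is unrelated to the old one. An arc into `a` comes from an old arc into `a`
  -- outside `S`, at most Δ of them, or reverses an old arc out of `a`, at most 8ρ.
  spread-indeg : (D₂ : Digraph E₂ ρ) → ∀ a → card (λ c → Digraph.out D₂ c a) ≤ 9 * Δ
  spread-indeg D₂ a = begin
    card (λ c → Digraph.out D₂ c a) ≤⟨ ∑-mono (allFin n) (λ c → ≤-trans (⟦⟧-mono (Digraph.out-E D₂ c a)) (⟦∨⟧≤ (out₁ c a ∧ not (S a)) (out₁ a c ∧ not (S c)))) ⟩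
    ∑ᶠ (λ c → ⟦ out₁ c a ∧ not (S a) ⟧ + ⟦ out₁ a c ∧ not (S c) ⟧) ≡⟨ ∑-+ (allFin n) _ _ ⟩
    ∑ᶠ (λ c → ⟦ out₁ c a ∧ not (S a) ⟧) + ∑ᶠ (λ c → ⟦ out₁ a c ∧ not (S c) ⟧)
      ≤⟨ +-mono-≤ (col (S a) refl) (≤-trans (∑-mono (allFin n) (λ c → ⟦⟧-mono {out₁ a c ∧ not (S c)} {out₁ a c} ∧-l)) (out₁≤ a)) ⟩
    Δ + 8 * ρ ≤⟨ +-monoʳ-≤ Δ ρ≤Δ ⟩
    9 * Δ ∎
    where
    open ≤-Reasoning
    col : ∀ x → S a ≡ x → ∑ᶠ (λ c → ⟦ out₁ c a ∧ not x ⟧) ≤ Δ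
    col true _ = ≤-trans (∑-mono (allFin n) (λ c → ⟦⟧-mono {out₁ c a ∧ false} {false} (∧-r {out₁ c a}))) (≤-trans (≤-reflexive (∑-zero (allFin n))) z≤n)
    col false e = ≤-trans (∑-mono (allFin n) (λ c → ⟦⟧-mono {out₁ c a ∧ true} {out₁ c a} ∧-l)) (≮⇒≥ (λ gt → contradiction (trans (sym e) (true-<ᵇ gt)) λ ()))

even-split : ∀ k h' → k ≡ suc h' + suc h' → ∀ {n} (G : Graph n) → ¬ HasCycle G (2 * k) →
  ∀ σ → 32 ≤ σ → evenReq k h' ≤ σ → 64 * (cap k + 1) ≤ σ → Digraph (adj G) (8 * (σ * σ)) → DenseMinor G (σ ^ (k + 1)) (evenBase k h' * 3 + 32 * cap k)
even-split k h' k≡ {n} G free σ 32≤σ req≤σ cap≤σ D₁ = cases (card (Digraph.U D₁) * (8 * ρ) ≤? 2 * arcs-into-S)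
  where
  h = suc h'
  ρ = σ * σ
  Δ = σ ^ (k + 1)
  σ>0 : 0 < σ
  σ>0 = ≤-trans (s≤s z≤n) 32≤σ
  instance
    σ≢0 : NonZero σ
    σ≢0 = >-nonZero σ>0
  k≥2 : 2 ≤ k
  k≥2 = ≤-trans (s≤s (≤-trans (s≤s z≤n) (m≤n+m (suc h') h'))) (≤-reflexive (sym k≡))
  σ³≤Δ : σ * ρ ≤ Δ
  σ³≤Δ = ≤-trans (≤-reflexive (cong (λ x → σ * (σ * x)) (sym (*-identityʳ σ)))) (^-monoʳ-≤ σ {3} {k + 1} (+-monoˡ-≤ 1 k≥2))
  -- 32 = 4 · 8: the concentrated case is applied with out-degree 8ρ and needs four times that below
  -- Δ. As k ≥ 2, Δ is at least σ³.
  32ρ≤Δ : 32 * ρ ≤ Δ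
  32ρ≤Δ = ≤-trans (*-monoˡ-≤ ρ 32≤σ) σ³≤Δ
  open Spread G k k≥2 free ρ Δ (*-monoʳ-≤ 8 (≤-trans (m≤n*m ρ 32) 32ρ≤Δ)) D₁

  9Δ≡ : 9 * Δ ≡ 9 * σ ^ k * σ
  9Δ≡ = trans (cong (9 *_) (trans (cong (σ ^_) (+-comm k 1)) (*-comm σ (σ ^ k)))) (sym (*-assoc 9 (σ ^ k) σ))

  pow : ρ ^ suc h ≡ σ * Δ
  pow = trans (sq-pow σ (suc h)) (cong (σ ^_) (cong suc (trans (+-suc h h) (trans (+-comm 1 _) (cong (_+ 1) (sym k≡))))))

  cancel : DenseMinor G (ρ ^ suc h) (evenBase k h' * (3 * σ)) → DenseMinor G Δ (evenBase k h' * 3 + 32 * cap k)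
  cancel (m , H , isM , le) = m , H , isM , *-cancelˡ-≤ σ (begin
      σ * (Δ * suc m) ≡⟨ trans (sym (*-assoc σ Δ (suc m))) (cong (_* suc m) (sym pow)) ⟩
      ρ ^ suc h * suc m ≤⟨ le ⟩
      evenBase k h' * (3 * σ) * degSum H ≡⟨ lem (evenBase k h') σ (degSum H) ⟩
      σ * (evenBase k h' * 3 * degSum H) ≤⟨ *-monoʳ-≤ σ (*-monoˡ-≤ (degSum H) (m≤m+n (evenBase k h' * 3) (32 * cap k))) ⟩
      σ * ((evenBase k h' * 3 + 32 * cap k) * degSum H) ∎)
    where
    open ≤-Reasoning
    lem : ∀ K s d → K * (3 * s) * d ≡ s * (K * 3 * d)
    lem = solve-∀

  spread : Digraph E₂ ρ → DenseMinor G Δ (evenBase k h' * 3 + 32 * cap k)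
  spread D₂ = cancel (even-digraph k h' k≡ G free σ σ>0 D₂ E₂-adj (λ a → ≤-trans (spread-indeg D₂ a) (≤-reflexive 9Δ≡)) (≤-trans req≤σ (σ≤σσ σ>0)))

  cases : Dec (card (Digraph.U D₁) * (8 * ρ) ≤ 2 * arcs-into-S) → DenseMinor G Δ (evenBase k h' * 3 + 32 * cap k)
  cases (no few) = spread (spread-digraph few)
  cases (yes many) = widen G Δ (32 * cap k) (evenBase k h' * 3 + 32 * cap k) (m≤n+m (32 * cap k) (evenBase k h' * 3))
    (concentrated-minor many (≤-trans (≤-reflexive (sym (*-assoc 4 8 ρ))) 32ρ≤Δ) (≤-trans cap≤σ (≤-trans (σ≤σσ σ>0) (m≤n*m ρ 8))))

even-case : ∀ k h' → k ≡ suc h' + suc h' → ∀ {n} (G : Graph n) → ¬ HasCycle G (2 * k) →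
  ∀ σ → 32 + (evenReq k h' + 64 * (cap k + 1)) ≤ σ → 16 * (σ * σ) * n < degSum G → DenseMinor G (σ ^ (k + 1)) (evenBase k h' * 3 + 32 * cap k)
even-case k h' k≡ {n} G free σ σ-big lt = even-split k h' k≡ G free σ (proj₁ parts) (proj₁ (proj₂ parts)) (proj₂ (proj₂ parts))
    (adj-core G (8 * (σ * σ)) (subst (λ x → x * n < degSum G) (*-assoc 2 8 (σ * σ)) lt))
  where parts = summands≤ 32 (evenReq k h') (64 * (cap k + 1)) σ-big

odd⊎even : ∀ k → 2 ≤ k → (∃ λ h' → k ≡ suc (suc h') + suc h') ⊎ (∃ λ h' → k ≡ suc h' + suc h')
odd⊎even (suc zero) (s≤s ())
odd⊎even (suc (suc zero)) _ = inj₂ (0 , refl)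
odd⊎even (suc (suc (suc zero))) _ = inj₁ (0 , refl)
odd⊎even (suc (suc (suc (suc k)))) _ with odd⊎even (suc (suc k)) (s≤s (s≤s z≤n))
... | inj₁ (h' , e) = inj₁ (suc h' , trans (cong (λ x → suc (suc x)) e) (cong (λ x → suc (suc x)) (sym (+-suc (suc h') (suc h')))))
... | inj₂ (h' , e) = inj₂ (suc h' , trans (cong (λ x → suc (suc x)) e) (cong suc (sym (+-suc (suc h') (suc h')))))

-- The factor 16 comes from the even case: a core of degree above 8σ² needs volume above 2 · 8σ² for
-- each vertex. In the odd case 2 would do.
minor-density : ∀ k → 2 ≤ k → ∃ λ R → ∃ λ C → ∀ {n} (G : Graph n) → ¬ HasCycle G (2 * k) →
  ∀ σ → R ≤ σ → 16 * (σ * σ) * n < degSum G → DenseMinor G (σ ^ (k + 1)) C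
minor-density k k≥2 with odd⊎even k k≥2
... | inj₁ (h' , e) = oddThreshold k (suc h') , oddConst k (suc h') , λ {n} G free σ R≤σ lt →
        odd-case k h' e G free σ R≤σ (≤-<-trans (*-monoˡ-≤ n (*-monoˡ-≤ (σ * σ) {2} {16} (s≤s (s≤s z≤n)))) lt)
... | inj₂ (h' , e) = 32 + (evenReq k h' + 64 * (cap k + 1)) , evenBase k h' * 3 + 32 * cap k , even-case k h' e

-- Average degrees

open import Data.Integer using (+_; +≤+) renaming (_*_ to _*ℤ_; _≤_ to _≤ℤ_)
open import Data.Integer.Properties using (pos-*)
open import Data.Rational using (ℚ; 0ℚ; toℚᵘ; fromℚᵘ) renaming (_<_ to _<ℚ_; _*_ to _*ℚ_; _≤_ to _≤ℚ_; _/_ to _/ℚ_)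
open import Data.Rational.Properties using (toℚᵘ-fromℚᵘ; toℚᵘ-homo-*; toℚᵘ-cancel-≤; positive⁻¹; normalize-pos)
open import Data.Rational.Unnormalised using (ℚᵘ; mkℚᵘ; *≤*; ↥_; ↧_; ↧ₙ_; 1ℚᵘ) renaming (_*_ to _*ᵘ_; _≤_ to _≤ᵘ_; _≃_ to _≃ᵘ_)
open import Data.Rational.Unnormalised.Properties using (≃-refl; ≃-sym; ≃-trans; ≤-respˡ-≃; ≤-respʳ-≃) renaming (*-cong to *ᵘ-cong)

-- Settles graphs of bounded average degree r, where r^((k+1)/2) is at most a constant times r
-- because k ≥ 2.
self-minor : ∀ {n} (G : Graph n) → IsMinor G G
self-minor {n} G = just , (λ u → u , refl) , (λ u x y ex ey → conn⇒walk G (stay u x y ex ey)) , λ u u' e → u , u' , refl , refl , e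
  where
  stay : ∀ u x y → just x ≡ just u → just y ≡ just u → Conn G (λ z → just z ≡ just u) x y
  stay u x y refl refl = stop refl

-- An integer square root of S/(16N), found by counting upwards; `S` steps suffice since 16(σ+1)²N
-- exceeds σ.
bracket : ∀ S N → 0 < S → 0 < N → ∃ λ σ → 16 * (σ * σ) * N < S × S ≤ 16 * (suc σ * suc σ) * N
bracket S N S>0 N>0 = go S 0 ≤-refl S>0
  where
  go : ∀ fuel σ → S ≤ σ + fuel → 16 * (σ * σ) * N < S → ∃ λ σ → 16 * (σ * σ) * N < S × S ≤ 16 * (suc σ * suc σ) * N
  go fuel σ le lt with S ≤? 16 * (suc σ * suc σ) * N
  ... | yes p = σ , lt , p
  go zero σ le lt | no ¬p = contradiction (≤-trans le (begin
      σ + 0 ≡⟨ +-identityʳ σ ⟩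
      σ ≤⟨ n≤1+n σ ⟩
      suc σ ≤⟨ m≤m*n (suc σ) (suc σ) ⟩
      suc σ * suc σ ≤⟨ m≤n*m (suc σ * suc σ) 16 ⟩
      16 * (suc σ * suc σ) ≤⟨ m≤m*n (16 * (suc σ * suc σ)) N {{>-nonZero N>0}} ⟩
      16 * (suc σ * suc σ) * N ∎)) ¬p
    where open ≤-Reasoning
  go (suc fuel) σ le lt | no ¬p = go fuel (suc σ) (≤-trans le (≤-reflexive (+-suc σ fuel))) (≰⇒> ¬p)

^-distrib-* : ∀ a b m → (a * b) ^ m ≡ a ^ m * b ^ m
^-distrib-* a b zero = refl
^-distrib-* a b (suc m) = trans (cong (a * b *_) (^-distrib-* a b m)) (lem a b (a ^ m) (b ^ m))
  where lem : ∀ a b c d → a * b * (c * d) ≡ a * c * (b * d)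
        lem = solve-∀

powᵘ : ℚᵘ → ℕ → ℚᵘ
powᵘ p zero = 1ℚᵘ
powᵘ p (suc e) = p *ᵘ powᵘ p e

toℚᵘ-pow : ∀ p q e → toℚᵘ p ≃ᵘ q → toℚᵘ (p ^ℚ e) ≃ᵘ powᵘ q e
toℚᵘ-pow p q zero eq = ≃-refl
toℚᵘ-pow p q (suc e) eq = ≃-trans (toℚᵘ-homo-* p (p ^ℚ e)) (*ᵘ-cong eq (toℚᵘ-pow p q e eq))

↥-* : ∀ p q → ↥ (p *ᵘ q) ≡ ↥ p *ℤ ↥ q
↥-* (mkℚᵘ a b) (mkℚᵘ c d) = refl

↧-* : ∀ p q → ↧ₙ (p *ᵘ q) ≡ ↧ₙ p * ↧ₙ q
↧-* (mkℚᵘ a b) (mkℚᵘ c d) = refl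

↥-pow : ∀ S n e → ↥ (powᵘ (mkℚᵘ (+ S) n) e) ≡ + (S ^ e)
↥-pow S n zero = refl
↥-pow S n (suc e) = trans (↥-* (mkℚᵘ (+ S) n) (powᵘ (mkℚᵘ (+ S) n) e)) (trans (cong (+ S *ℤ_) (↥-pow S n e)) (sym (pos-* S (S ^ e))))

↧-pow : ∀ S n e → ↧ₙ (powᵘ (mkℚᵘ (+ S) n) e) ≡ suc n ^ e
↧-pow S n zero = refl
↧-pow S n (suc e) = trans (↧-* (mkℚᵘ (+ S) n) (powᵘ (mkℚᵘ (+ S) n) e)) (cong (suc n *_) (↧-pow S n e))

-- For unnormalised fractions numerators and denominators simply multiply, so the claim becomes the
-- cross-multiplied inequality of integers.
clear-denominators : ∀ q S n T m e → S ^ e * (suc m * suc m) ≤ T * T * (suc q * suc q * suc n ^ e) →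
  (((+ 1) /ℚ suc q) *ℚ ((+ 1) /ℚ suc q)) *ℚ (((+ S) /ℚ suc n) ^ℚ e) ≤ℚ ((+ T) /ℚ suc m) *ℚ ((+ T) /ℚ suc m)
clear-denominators q S n T m e le = toℚᵘ-cancel-≤ (≤-respˡ-≃ (≃-sym lhs) (≤-respʳ-≃ (≃-sym rhs) (*≤* integers)))
  where
  c s t : ℚᵘ
  c = mkℚᵘ (+ 1) q
  s = mkℚᵘ (+ S) n
  t = mkℚᵘ (+ T) m
  cℚ = fromℚᵘ c
  lhs : toℚᵘ ((cℚ *ℚ cℚ) *ℚ (fromℚᵘ s ^ℚ e)) ≃ᵘ (c *ᵘ c) *ᵘ powᵘ s e
  lhs = ≃-trans (toℚᵘ-homo-* (cℚ *ℚ cℚ) (fromℚᵘ s ^ℚ e))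
    (*ᵘ-cong (≃-trans (toℚᵘ-homo-* cℚ cℚ) (*ᵘ-cong (toℚᵘ-fromℚᵘ c) (toℚᵘ-fromℚᵘ c))) (toℚᵘ-pow (fromℚᵘ s) s e (toℚᵘ-fromℚᵘ s)))
  rhs : toℚᵘ (fromℚᵘ t *ℚ fromℚᵘ t) ≃ᵘ t *ᵘ t
  rhs = ≃-trans (toℚᵘ-homo-* (fromℚᵘ t) (fromℚᵘ t)) (*ᵘ-cong (toℚᵘ-fromℚᵘ t) (toℚᵘ-fromℚᵘ t))
  num : ↥ ((c *ᵘ c) *ᵘ powᵘ s e) ≡ + (S ^ e)
  num = trans (↥-* (c *ᵘ c) (powᵘ s e)) (trans (cong (+ 1 *ℤ_) (↥-pow S n e)) (trans (sym (pos-* 1 (S ^ e))) (cong +_ (*-identityˡ (S ^ e)))))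
  den : ↧ ((c *ᵘ c) *ᵘ powᵘ s e) ≡ + (suc q * suc q * suc n ^ e)
  den = cong +_ (trans (↧-* (c *ᵘ c) (powᵘ s e)) (cong (suc q * suc q *_) (↧-pow S n e)))
  integers : ↥ ((c *ᵘ c) *ᵘ powᵘ s e) *ℤ ↧ (t *ᵘ t) ≤ℤ ↥ (t *ᵘ t) *ℤ ↧ ((c *ᵘ c) *ᵘ powᵘ s e)
  integers = subst₂ _≤ℤ_
    (trans (pos-* (S ^ e) (suc m * suc m)) (cong (_*ℤ ↧ (t *ᵘ t)) (sym num)))
    (trans (pos-* (T * T) (suc q * suc q * suc n ^ e)) (cong₂ _*ℤ_ (pos-* T T) (sym den)))
    (+≤+ le)

k+1≡ : ∀ {k} → 2 ≤ k → k + 1 ≡ 2 + (k ∸ 1)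
k+1≡ {k} k≥2 = trans (+-comm k 1) (cong suc (sym (m+[n∸m]≡n (≤-trans (s≤s z≤n) k≥2))))

q≤sq : ∀ q → q ≤ suc q * suc q
q≤sq q = ≤-trans (n≤1+n q) (m≤m*n (suc q) (suc q))

sparse-bound : ∀ k → 2 ≤ k → ∀ L q S N → L ^ (k ∸ 1) ≤ q → S ≤ L * N → S ^ (k + 1) * (N * N) ≤ S * S * (suc q * suc q * N ^ (k + 1))
sparse-bound k k≥2 L q S N L≤q le = begin
  S ^ (k + 1) * (N * N) ≡⟨ cong (λ i → S ^ i * (N * N)) (k+1≡ k≥2) ⟩
  S * (S * S ^ (k ∸ 1)) * (N * N) ≤⟨ *-monoˡ-≤ (N * N) (*-monoʳ-≤ S (*-monoʳ-≤ S (≤-trans (^-monoˡ-≤ (k ∸ 1) le) (≤-reflexive (^-distrib-* L N (k ∸ 1)))))) ⟩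
  S * (S * (L ^ (k ∸ 1) * N ^ (k ∸ 1))) * (N * N) ≡⟨ lem S (L ^ (k ∸ 1)) (N ^ (k ∸ 1)) N ⟩
  S * S * (L ^ (k ∸ 1) * (N * (N * N ^ (k ∸ 1)))) ≡⟨ cong (λ i → S * S * (L ^ (k ∸ 1) * N ^ i)) (sym (k+1≡ k≥2)) ⟩
  S * S * (L ^ (k ∸ 1) * N ^ (k + 1)) ≤⟨ *-monoʳ-≤ (S * S) (*-monoˡ-≤ (N ^ (k + 1)) (≤-trans L≤q (q≤sq q))) ⟩
  S * S * (suc q * suc q * N ^ (k + 1)) ∎
  where
  open ≤-Reasoning
  lem : ∀ s l p n → s * (s * (l * p)) * (n * n) ≡ s * s * (l * (n * (n * p)))
  lem = solve-∀

-- As σ is positive, σ+1 ≤ 2σ and 16(σ+1)² ≤ 64σ²; rounding the square root thus costs the factor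
-- 64^e. The density bound is used twice because everything is squared.
dense-bound : ∀ e C q S N T M σ → 64 ^ e * (C * C) ≤ q → 0 < σ → S ≤ 16 * (suc σ * suc σ) * N → σ ^ e * M ≤ C * T →
  S ^ e * (M * M) ≤ T * T * (suc q * suc q * N ^ e)
dense-bound e C q S N T M σ C≤q σ>0 S≤ le = begin
  S ^ e * (M * M) ≤⟨ *-monoˡ-≤ (M * M) (^-monoˡ-≤ e S≤64) ⟩
  (64 * (σ * σ) * N) ^ e * (M * M) ≡⟨ cong (_* (M * M)) (trans (^-distrib-* (64 * (σ * σ)) N e) (cong (_* N ^ e) (trans (^-distrib-* 64 (σ * σ) e) (cong (64 ^ e *_) (^-distrib-* σ σ e))))) ⟩
  64 ^ e * (σ ^ e * σ ^ e) * N ^ e * (M * M) ≡⟨ lem (64 ^ e) (σ ^ e) (N ^ e) M ⟩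
  64 ^ e * N ^ e * (σ ^ e * M * (σ ^ e * M)) ≤⟨ *-monoʳ-≤ (64 ^ e * N ^ e) (*-mono-≤ le le) ⟩
  64 ^ e * N ^ e * (C * T * (C * T)) ≡⟨ lem2 (64 ^ e) (N ^ e) C T ⟩
  T * T * (64 ^ e * (C * C) * N ^ e) ≤⟨ *-monoʳ-≤ (T * T) (*-monoˡ-≤ (N ^ e) (≤-trans C≤q (q≤sq q))) ⟩
  T * T * (suc q * suc q * N ^ e) ∎
  where
  open ≤-Reasoning
  lem : ∀ a s p m → a * (s * s) * p * (m * m) ≡ a * p * (s * m * (s * m))
  lem = solve-∀
  lem2 : ∀ a p c t → a * p * (c * t * (c * t)) ≡ t * t * (a * (c * c) * p)
  lem2 = solve-∀
  lem3 : ∀ s → 16 * ((s + s) * (s + s)) ≡ 64 * (s * s)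
  lem3 = solve-∀
  S≤64 : S ≤ 64 * (σ * σ) * N
  S≤64 = ≤-trans S≤ (*-monoˡ-≤ N (≤-trans (*-monoʳ-≤ 16 (*-mono-≤ (+-monoˡ-≤ σ σ>0) (+-monoˡ-≤ σ σ>0))) (≤-reflexive (lem3 σ))))

module _ (k : ℕ) (k≥2 : 2 ≤ k) (R C q : ℕ)
  (density : ∀ {n} (G : Graph n) → ¬ HasCycle G (2 * k) → ∀ σ → R ≤ σ → 16 * (σ * σ) * n < degSum G → DenseMinor G (σ ^ (k + 1)) C)
  (L≤q : (16 * (suc R * suc R)) ^ (k ∸ 1) ≤ q) (C≤q : 64 ^ (k + 1) * (C * C) ≤ q) where

  private
    Found : ∀ {n} → Graph (suc n) → Set
    Found G = Σ ℕ λ m → Σ (Graph (suc m)) λ Γ → IsMinor Γ G ×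
      ((((+ 1) /ℚ suc q) *ℚ ((+ 1) /ℚ suc q)) *ℚ (avgDeg G ^ℚ (k + 1)) ≤ℚ avgDeg Γ *ℚ avgDeg Γ)

    itself : ∀ n (G : Graph (suc n)) → degSum G ≤ 16 * (suc R * suc R) * suc n → Found G
    itself n G le = n , G , self-minor G , clear-denominators q (degSum G) n (degSum G) n (k + 1)
      (sparse-bound k k≥2 (16 * (suc R * suc R)) q (degSum G) (suc n) L≤q le)

    denser : ∀ n (G : Graph (suc n)) σ → suc R ≤ σ → degSum G ≤ 16 * (suc σ * suc σ) * suc n → DenseMinor G (σ ^ (k + 1)) C → Found G
    denser n G σ R<σ S≤ (m , H , isM , le) = m , H , isM , clear-denominators q (degSum G) n (degSum H) m (k + 1)
      (dense-bound (k + 1) C q (degSum G) (suc n) (degSum H) (suc m) σ C≤q (≤-trans (s≤s z≤n) R<σ) S≤ le)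

  average-degree : ∀ n (G : Graph (suc n)) → ¬ HasCycle G (2 * k) →
    Σ ℕ λ m → Σ (Graph (suc m)) λ Γ → IsMinor Γ G ×
    ((((+ 1) /ℚ suc q) *ℚ ((+ 1) /ℚ suc q)) *ℚ (avgDeg G ^ℚ (k + 1)) ≤ℚ avgDeg Γ *ℚ avgDeg Γ)
  average-degree n G free = by-size (degSum G ≤? 16 * (suc R * suc R) * suc n)
    where
    by-bracket : ¬ (degSum G ≤ 16 * (suc R * suc R) * suc n) → (∃ λ σ → 16 * (σ * σ) * suc n < degSum G × degSum G ≤ 16 * (suc σ * suc σ) * suc n) → Found G
    by-bracket large (σ , lt , S≤) = go (suc R ≤? σ)
      where
      go : Dec (suc R ≤ σ) → Found G
      go (yes R<σ) = denser n G σ R<σ S≤ (density G free σ (<⇒≤ R<σ) lt)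
      go (no R≮σ) = contradiction (≤-trans S≤ (*-monoˡ-≤ (suc n) (*-monoʳ-≤ 16 (*-mono-≤ (≰⇒> R≮σ) (≰⇒> R≮σ))))) large
    by-size : Dec (degSum G ≤ 16 * (suc R * suc R) * suc n) → Found G
    by-size (yes small) = itself n G small
    by-size (no large) = by-bracket large (bracket (degSum G) (suc n) (≤-<-trans z≤n (≰⇒> large)) (s≤s z≤n))

-- The exponent (k+1)/2 need not be an integer. Both sides are nonnegative, so the inequality is
-- stated for the squares.
theorem4p7 : (k : ℕ) → 2 ≤ k →
    Σ ℚ λ c → 0ℚ <ℚ c ×
    ((n : ℕ) (G : Graph (suc n)) → ¬ HasCycle G (2 * k) →
    Σ ℕ λ m → Σ (Graph (suc m)) λ Γ → IsMinor Γ G ×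
    ((c *ℚ c) *ℚ (avgDeg G ^ℚ (k + 1)) ≤ℚ avgDeg Γ *ℚ avgDeg Γ))
theorem4p7 k k≥2 = choose (minor-density k k≥2)
  where
  choose : (∃ λ R → ∃ λ C → ∀ {n} (G : Graph n) → ¬ HasCycle G (2 * k) → ∀ σ → R ≤ σ → 16 * (σ * σ) * n < degSum G → DenseMinor G (σ ^ (k + 1)) C) →
    Σ ℚ λ c → 0ℚ <ℚ c ×
    ((n : ℕ) (G : Graph (suc n)) → ¬ HasCycle G (2 * k) →
    Σ ℕ λ m → Σ (Graph (suc m)) λ Γ → IsMinor Γ G ×
    ((c *ℚ c) *ℚ (avgDeg G ^ℚ (k + 1)) ≤ℚ avgDeg Γ *ℚ avgDeg Γ))
  choose (R , C , density) = (+ 1) /ℚ suc q , positive⁻¹ ((+ 1) /ℚ suc q) {{normalize-pos 1 (suc q)}}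
    , average-degree k k≥2 R C q density (m≤m+n ((16 * (suc R * suc R)) ^ (k ∸ 1)) (64 ^ (k + 1) * (C * C))) (m≤n+m (64 ^ (k + 1) * (C * C)) ((16 * (suc R * suc R)) ^ (k ∸ 1)))
    where
    -- One denominator for both regimes: the first summand serves bounded average degree, the second
    -- large average degree.
    q = (16 * (suc R * suc R)) ^ (k ∸ 1) + 64 ^ (k + 1) * (C * C)
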